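{- There are absolute constants $C_4 > 0$ and $c > 0$ with the following property. Let $m,n$ be positive integers, let $K > 0$ be a real number, and suppose that $f : \mathbf{F}_2^m \to \mathbf{F}_2^n$ is a function such that, if $x,y$ are selected independently and uniformly at random from $\mathbf{F}_2^m$, then $\mathbf{P}(f(x+y) = f(x)+f(y)) \geq 1/K$. Then there is a homomorphism $g : \mathbf{F}_2^m \to \mathbf{F}_2^n$ such that, for $x$ selected uniformly at random from $\mathbf{F}_2^m$, $\mathbf{P}(f(x) = g(x)) \geq c K^{ -C_4}$.
   Context: $\mathbf{F}_2$ is the field with two elements. The constants $c, C_4$ do not depend on $m,n,K,f$. -}

module Defs where

open import Algebra.Bundles using (AbelianGroup)
open import Algebra.Definitions.RawSemiring using () renaming (_^_ to pow)
open import Data.Integer as ℤ using (+_; ∣_∣)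
import Data.Integer.Properties as ℤ
open import Data.List.Base
  using (List; []; _∷_; length; filter; cartesianProduct; cartesianProductWith)
open import Data.List.Membership.Propositional using (_∈_)
open import Data.List.Membership.Propositional.Properties 
  using (∈-cartesianProduct⁺; ∈-cartesianProductWith⁺)
open import Data.List.Relation.Unary.All using ([]; _∷_)
open import Data.List.Relation.Unary.AllPairs using ([]; _∷_)
open import Data.List.Relation.Unary.Any using (here; there)
open import Data.List.Relation.Unary.Unique.Propositional using (Unique)
import Data.List.Relation.Unary.Unique.Propositional.Properties as Unique
open import Data.Nat.Base as ℕ using (ℕ; zero; suc; z≤n; s≤s)
import Data.Nat.Properties as ℕ
open import Data.Parity.Base as Parity using (Parity; 0ℙ; 1ℙ)
import Data.Parity.Properties as Parity
open import Data.Product using (_×_; _,_; ∃; ∃-syntax; proj₁)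
open import Data.Rational as ℚ using (ℚ; 0ℚ; 1ℚ; ↥_; ↧_; ↧ₙ_)
import Data.Rational.Properties as ℚ
open import Data.Sum using (_⊎_; inj₁; inj₂)
open import Data.Vec.Base as Vec using (Vec; []; _∷_; zipWith; replicate)
import Data.Vec.Properties as Vec
open import Function using (id)
open import Level using (0ℓ)
open import Relation.Binary.Definitions using (DecidableEquality)
open import Relation.Binary.PropositionalEquality
open import Relation.Nullary using (¬_; yes; no; contradiction)
open import Relation.Unary using (Pred; Decidable)

------------------------------------------------------------------------
-- Powers of rationals

infixr 8 _^ℚ_

_^ℚ_ : ℚ → ℕ → ℚ
_^ℚ_ = pow ℚ.+-*-rawSemiring

private
  0<1 : 0ℚ ℚ.< 1ℚ
  0<1 = ℚ.positive⁻¹ 1ℚ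

  *-pos : ∀ {p q} → 0ℚ ℚ.< p → 0ℚ ℚ.< q → 0ℚ ℚ.< p ℚ.* q
  *-pos {p} {q} 0<p 0<q =
    ℚ.positive⁻¹ _ {{ℚ.pos*pos⇒pos p {{ℚ.positive 0<p}} q {{ℚ.positive 0<q}}}}

  *-mono-≤ : ∀ {p q r s} → 0ℚ ℚ.≤ r → 0ℚ ℚ.≤ q →
             p ℚ.≤ q → r ℚ.≤ s → p ℚ.* r ℚ.≤ q ℚ.* s
  *-mono-≤ {p} {q} {r} {s} 0≤r 0≤q p≤q r≤s = ℚ.≤-trans
    (ℚ.*-monoʳ-≤-nonNeg r {{ℚ.nonNegative 0≤r}} p≤q)
    (ℚ.*-monoˡ-≤-nonNeg q {{ℚ.nonNegative 0≤q}} r≤s)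

  *-mono-< : ∀ {p q r s} → 0ℚ ℚ.< r → 0ℚ ℚ.< q →
             p ℚ.< q → r ℚ.≤ s → p ℚ.* r ℚ.< q ℚ.* s
  *-mono-< {p} {q} {r} {s} 0<r 0<q p<q r≤s = ℚ.<-≤-trans
    (ℚ.*-monoˡ-<-pos r {{ℚ.positive 0<r}} p<q)
    (ℚ.*-monoˡ-≤-nonNeg q {{ℚ.nonNegative (ℚ.<⇒≤ 0<q)}} r≤s)

  ^-pos : ∀ {p} n → 0ℚ ℚ.< p → 0ℚ ℚ.< p ^ℚ n
  ^-pos zero    0<p = 0<1
  ^-pos (suc n) 0<p = *-pos 0<p (^-pos n 0<p)

  ^-monoˡ-≤ : ∀ {p q} n → 0ℚ ℚ.< p → p ℚ.≤ q → p ^ℚ n ℚ.≤ q ^ℚ n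
  ^-monoˡ-≤ zero    0<p p≤q = ℚ.≤-refl
  ^-monoˡ-≤ (suc n) 0<p p≤q =
    *-mono-≤ (ℚ.<⇒≤ (^-pos n 0<p)) (ℚ.≤-trans (ℚ.<⇒≤ 0<p) p≤q) p≤q (^-monoˡ-≤ n 0<p p≤q)

  ^-monoˡ-< : ∀ {p q} n .{{_ : ℕ.NonZero n}} → 0ℚ ℚ.< p → p ℚ.< q → p ^ℚ n ℚ.< q ^ℚ n
  ^-monoˡ-< (suc n) 0<p p<q =
    *-mono-< (^-pos n 0<p) (ℚ.<-trans 0<p p<q) p<q (^-monoˡ-≤ n 0<p (ℚ.<⇒≤ p<q))

  1≤^ : ∀ {p} n → 1ℚ ℚ.≤ p → 1ℚ ℚ.≤ p ^ℚ n
  1≤^ zero    1≤p = ℚ.≤-refl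
  1≤^ (suc n) 1≤p =
    *-mono-≤ (ℚ.<⇒≤ 0<1) (ℚ.≤-trans (ℚ.<⇒≤ 0<1) 1≤p) 1≤p (1≤^ n 1≤p)

  ^≤1 : ∀ {p} n → 0ℚ ℚ.< p → p ℚ.≤ 1ℚ → p ^ℚ n ℚ.≤ 1ℚ
  ^≤1 zero    0<p p≤1 = ℚ.≤-refl
  ^≤1 (suc n) 0<p p≤1 =
    *-mono-≤ (ℚ.<⇒≤ (^-pos n 0<p)) (ℚ.<⇒≤ 0<1) p≤1 (^≤1 n 0<p p≤1)

  ^-monoʳ-≤ : ∀ {p m n} → 1ℚ ℚ.≤ p → m ℕ.≤ n → p ^ℚ m ℚ.≤ p ^ℚ n
  ^-monoʳ-≤ {n = n} 1≤p z≤n = 1≤^ n 1≤p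
  ^-monoʳ-≤ {p} {suc m} 1≤p (s≤s m≤n) =
    *-mono-≤ (ℚ.≤-trans (ℚ.<⇒≤ 0<1) (1≤^ m 1≤p)) 0≤p ℚ.≤-refl (^-monoʳ-≤ 1≤p m≤n)
    where 0≤p = ℚ.≤-trans (ℚ.<⇒≤ 0<1) 1≤p

  ^-+ : ∀ p m n → p ^ℚ (m ℕ.+ n) ≡ p ^ℚ m ℚ.* p ^ℚ n
  ^-+ p zero    n = sym (ℚ.*-identityˡ _)
  ^-+ p (suc m) n = trans (cong (p ℚ.*_) (^-+ p m n)) (sym (ℚ.*-assoc p _ _))

  ^-* : ∀ p m n → p ^ℚ (n ℕ.* m) ≡ (p ^ℚ m) ^ℚ n
  ^-* p m zero    = refl
  ^-* p m (suc n) = trans (^-+ p m (n ℕ.* m)) (cong (p ^ℚ m ℚ.*_) (^-* p m n))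

  pos-↥ : ∀ p → 0ℚ ℚ.< p → + ∣ ↥ p ∣ ≡ ↥ p
  pos-↥ (ℚ.mkℚ (+ n) _ _)      _   = refl
  pos-↥ p@(ℚ.mkℚ ℤ.-[1+ _ ] _ _) 0<p = contradiction 0<p (ℚ.<-asym (ℚ.negative⁻¹ p))

  ↥≤ : ∀ {r q} → 0ℚ ℚ.< r → r ℚ.≤ q → ∣ ↥ r ∣ ℕ.≤ ↧ₙ r ℕ.* ∣ ↥ q ∣
  ↥≤ {r} {q} 0<r r≤q = ℕ.≤-trans (ℕ.m≤m*n ∣ ↥ r ∣ (↧ₙ q)) (ℕ.≤-trans
    (ℤ.drop‿+≤+ (subst₂ ℤ._≤_ (eq r q 0<r) (eq q r (ℚ.<-≤-trans 0<r r≤q)) (ℚ.drop-*≤* r≤q)))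
    (ℕ.≤-reflexive (ℕ.*-comm ∣ ↥ q ∣ (↧ₙ r))))
    where
    eq : ∀ p q → 0ℚ ℚ.< p → ↥ p ℤ.* ↧ q ≡ + (∣ ↥ p ∣ ℕ.* ↧ₙ q)
    eq p q 0<p = trans (cong (ℤ._* ↧ q) (sym (pos-↥ p 0<p))) (sym (ℤ.pos-* ∣ ↥ p ∣ (↧ₙ q)))

------------------------------------------------------------------------
-- Positive real numbers

-- A positive real x is a Dedekind cut in the positive rationals: `lower`
-- is the set { p ∈ ℚ ∣ 0 < p < x }.  As in the classical construction the
-- cut is one-sided, and no constructive locatedness is demanded.
-- Classically this is the set of positive real numbers.

record ℝ⁺ : Set₁ where
  field
    lower    : Pred ℚ 0ℓ
    positive : ∀ {p} → lower p → 0ℚ ℚ.< p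
    nonempty : ∃ lower
    bounded  : ∃[ q ] 0ℚ ℚ.< q × ¬ lower q
    downward : ∀ {p q} → 0ℚ ℚ.< p → p ℚ.≤ q → lower q → lower p
    open-top : ∀ {p} → lower p → ∃[ q ] p ℚ.< q × lower q

open ℝ⁺

private
  below : ∀ (x : ℝ⁺) {p q} → lower x p → 0ℚ ℚ.< q → ¬ lower x q → p ℚ.< q
  below x {p} {q} p∈x 0<q q∉x with p ℚ.<? q
  ... | yes p<q = p<q
  ... | no  p≮q = contradiction (downward x 0<q (ℚ.≮⇒≥ p≮q) p∈x) q∉x

infix  4 _≤ʳ_
infixl 7 _*ʳ_
infix  9 1/ʳ_
infixr 8 _^ʳ_

-- x ≤ q, for a rational q: every positive rational below x is below q.
_≤ʳ_ : ℝ⁺ → ℚ → Set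
x ≤ʳ q = ∀ {p} → lower x p → p ℚ.< q

_*ʳ_ : ℝ⁺ → ℝ⁺ → ℝ⁺
lower (x *ʳ y) p = 0ℚ ℚ.< p × ∃[ s ] ∃[ t ] lower x s × lower y t × p ℚ.≤ s ℚ.* t
positive (x *ʳ y) = proj₁
nonempty (x *ʳ y) =
  let s , s∈x = nonempty x
      t , t∈y = nonempty y
  in  s ℚ.* t , *-pos (positive x s∈x) (positive y t∈y) , s , t , s∈x , t∈y , ℚ.≤-refl
bounded (x *ʳ y) =
  let S , 0<S , S∉x = bounded x
      T , 0<T , T∉y = bounded y
  in  S ℚ.* T , *-pos 0<S 0<T , λ (_ , s , t , s∈x , t∈y , ST≤st) →
        ℚ.<-irrefl refl (ℚ.≤-<-trans ST≤st
          (*-mono-< (positive y t∈y) 0<S (below x s∈x 0<S S∉x) (ℚ.<⇒≤ (below y t∈y 0<T T∉y))))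
downward (x *ʳ y) 0<p p≤q (_ , s , t , s∈x , t∈y , q≤st) =
  0<p , s , t , s∈x , t∈y , ℚ.≤-trans p≤q q≤st
open-top (x *ʳ y) (0<p , s , t , s∈x , t∈y , p≤st) =
  let s′ , s<s′ , s′∈x = open-top x s∈x
      0<t = positive y t∈y
      p<s′t = ℚ.≤-<-trans p≤st (ℚ.*-monoˡ-<-pos t {{ℚ.positive 0<t}} s<s′)
  in  s′ ℚ.* t , p<s′t , ℚ.<-trans 0<p p<s′t , s′ , t , s′∈x , t∈y , ℚ.≤-refl

-- 0 < p < 1/x  iff  p < q ≤ 1/r for some rationals q and r ≥ x.
1/ʳ_ : ℝ⁺ → ℝ⁺
lower (1/ʳ x) p =
  0ℚ ℚ.< p × ∃[ q ] ∃[ r ] p ℚ.< q × 0ℚ ℚ.< r × ¬ lower x r × q ℚ.* r ℚ.≤ 1ℚ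
positive (1/ʳ x) = proj₁
nonempty (1/ʳ x) =
  let r , 0<r , r∉x = bounded x
      instance
        r⁺ = ℚ.positive 0<r
        r≢0 = ℚ.pos⇒nonZero r
      0<1/r = ℚ.positive⁻¹ _ {{ℚ.1/pos⇒pos r}}
      p , 0<p , p<1/r = ℚ.<-dense 0<1/r
  in  p , 0<p , ℚ.1/ r , r , p<1/r , 0<r , r∉x , ℚ.≤-reflexive (ℚ.*-inverseˡ r)
bounded (1/ʳ x) =
  let s , s∈x = nonempty x
      0<s = positive x s∈x
      instance
        s⁺ = ℚ.positive 0<s
        s≢0 = ℚ.pos⇒nonZero s
      0<1/s = ℚ.positive⁻¹ _ {{ℚ.1/pos⇒pos s}}
  in  ℚ.1/ s , 0<1/s , λ (_ , q , r , 1/s<q , 0<r , r∉x , qr≤1) →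
        ℚ.<-irrefl (ℚ.*-inverseˡ s) (ℚ.<-≤-trans
          (*-mono-< 0<s (ℚ.<-trans 0<1/s 1/s<q) 1/s<q (ℚ.<⇒≤ (below x s∈x 0<r r∉x)))
          qr≤1)
downward (1/ʳ x) 0<p p≤p′ (_ , q , r , p′<q , rest) =
  0<p , q , r , ℚ.≤-<-trans p≤p′ p′<q , rest
open-top (1/ʳ x) (0<p , q , r , p<q , rest) =
  let p′ , p<p′ , p′<q = ℚ.<-dense p<q
  in  p′ , p<p′ , ℚ.<-trans 0<p p<p′ , q , r , p′<q , rest

-- x ^ y is the supremum of the numbers s ^ r with s < x and r rational,
-- where r < y if s ≥ 1 and r ≥ y if s ≤ 1 (so that s ^ r ≤ s ^ y ≤ x ^ y).
-- For positive rational r = a / b and t, t ^ b ≤ s ^ a expresses t ≤ s ^ r.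
_^ʳ_ : ℝ⁺ → ℝ⁺ → ℝ⁺
lower (x ^ʳ y) p =
  0ℚ ℚ.< p × ∃[ t ] ∃[ s ] ∃[ r ]
    p ℚ.< t × lower x s × 0ℚ ℚ.< r ×
    (1ℚ ℚ.≤ s × lower y r ⊎ s ℚ.≤ 1ℚ × ¬ lower y r) ×
    t ^ℚ ↧ₙ r ℚ.≤ s ^ℚ ∣ ↥ r ∣
positive (x ^ʳ y) = proj₁
nonempty (x ^ʳ y) =
  let s₀ , s₀∈x = nonempty x
      r , 0<r , r∉y = bounded y
      s , 0<s , s≤1 , s∈x = shrink s₀ s₀∈x
      t = s ^ℚ ∣ ↥ r ∣
      0<t = ^-pos ∣ ↥ r ∣ 0<s
      p , 0<p , p<t = ℚ.<-dense 0<t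
  in  p , 0<p , t , s , r , p<t , s∈x , 0<r , inj₂ (s≤1 , r∉y) ,
      power≤ (↧ₙ r) 0<t (^≤1 ∣ ↥ r ∣ 0<s s≤1)
  where
  shrink : ∀ s → lower x s → ∃[ s′ ] 0ℚ ℚ.< s′ × s′ ℚ.≤ 1ℚ × lower x s′
  shrink s s∈x with ℚ.≤-total s 1ℚ
  ... | inj₁ s≤1 = s , positive x s∈x , s≤1 , s∈x
  ... | inj₂ 1≤s = 1ℚ , 0<1 , ℚ.≤-refl , downward x 0<1 1≤s s∈x

  power≤ : ∀ {t} n .{{_ : ℕ.NonZero n}} → 0ℚ ℚ.< t → t ℚ.≤ 1ℚ → t ^ℚ n ℚ.≤ t
  power≤ {t} (suc n) 0<t t≤1 = subst (t ^ℚ suc n ℚ.≤_) (ℚ.*-identityʳ t)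
    (ℚ.*-monoˡ-≤-nonNeg t {{ℚ.nonNegative (ℚ.<⇒≤ 0<t)}} (^≤1 n 0<t t≤1))
bounded (x ^ʳ y) =
  let S₀ , 0<S₀ , S₀∉x = bounded x
      R , 0<R , R∉y = bounded y
      S = S₀ ℚ.⊔ 1ℚ
      1≤S = ℚ.p≤q⊔p S₀ 1ℚ
      0<S = ℚ.<-≤-trans 0<1 1≤S
      M = S ^ℚ ∣ ↥ R ∣
      0<M = ^-pos ∣ ↥ R ∣ 0<S
  in  M , 0<M , λ
        { (_ , t , s , r , M<t , s∈x , 0<r , inj₁ (1≤s , r∈y) , t≤s^r) →
            ℚ.<-irrefl refl (ℚ.<-≤-trans (^-monoˡ-< (↧ₙ r) 0<M M<t) (ℚ.≤-trans t≤s^r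
              (ℚ.≤-trans
                (^-monoˡ-≤ ∣ ↥ r ∣ (positive x s∈x)
                  (ℚ.≤-trans (ℚ.<⇒≤ (below x s∈x 0<S₀ S₀∉x)) (ℚ.p≤p⊔q S₀ 1ℚ)))
                (ℚ.≤-trans
                  (^-monoʳ-≤ 1≤S (↥≤ {r} {R} 0<r (ℚ.<⇒≤ (below y r∈y 0<R R∉y))))
                  (ℚ.≤-reflexive (^-* S ∣ ↥ R ∣ (↧ₙ r)))))))
        ; (_ , t , s , r , M<t , s∈x , 0<r , inj₂ (s≤1 , _) , t≤s^r) →
            ℚ.<-irrefl refl (ℚ.<-≤-trans (^-monoˡ-< (↧ₙ r) 0<M M<t) (ℚ.≤-trans t≤s^r
              (ℚ.≤-trans (^≤1 ∣ ↥ r ∣ (positive x s∈x) s≤1) (1≤^ (↧ₙ r) (1≤^ ∣ ↥ R ∣ 1≤S)))))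
        }
downward (x ^ʳ y) 0<p p≤q (_ , t , s , r , q<t , rest) =
  0<p , t , s , r , ℚ.≤-<-trans p≤q q<t , rest
open-top (x ^ʳ y) (0<p , t , s , r , p<t , rest) =
  let q , p<q , q<t = ℚ.<-dense p<t
  in  q , p<q , ℚ.<-trans 0<p p<q , t , s , r , q<t , rest

------------------------------------------------------------------------
-- The additive group of 𝐅₂ⁿ

𝔽₂ : Set
𝔽₂ = Parity

𝔽₂^ : ℕ → AbelianGroup 0ℓ 0ℓ
𝔽₂^ n = record
  { Carrier = Vec 𝔽₂ n
  ; _≈_     = _≡_
  ; _∙_     = zipWith Parity._+_
  ; ε       = replicate n 0ℙ
  ; _⁻¹     = id
  ; isAbelianGroup = record
    { isGroup = record
      { isMonoid = record
        { isSemigroup = record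
          { isMagma = record
            { isEquivalence = isEquivalence
            ; ∙-cong        = cong₂ (zipWith Parity._+_)
            }
          ; assoc = Vec.zipWith-assoc Parity.+-assoc
          }
        ; identity = Vec.zipWith-identityˡ Parity.+-identityˡ
                   , Vec.zipWith-identityʳ Parity.+-identityʳ
        }
      ; inverse = inv , inv
      ; ⁻¹-cong = id
      }
    ; comm = Vec.zipWith-comm Parity.+-comm
    }
  }
  where
  inv : ∀ {n} (v : Vec 𝔽₂ n) → zipWith Parity._+_ v v ≡ replicate n 0ℙ
  inv []      = refl
  inv (a ∷ v) = cong₂ _∷_ (Parity.p+p≡0ℙ a) (inv v)

infixl 6 _+ᵛ_
infix  4 _≟ᵛ_

_+ᵛ_ : ∀ {n} → Vec 𝔽₂ n → Vec 𝔽₂ n → Vec 𝔽₂ n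
_+ᵛ_ {n} = AbelianGroup._∙_ (𝔽₂^ n)

_≟ᵛ_ : ∀ {n} → DecidableEquality (Vec 𝔽₂ n)
_≟ᵛ_ = Vec.≡-dec Parity._≟_

------------------------------------------------------------------------
-- Uniform probability on a finite nonempty set

record SampleSpace (Ω : Set) : Set where
  field
    elements : List Ω
    complete : ∀ ω → ω ∈ elements
    unique   : Unique elements
    point    : Ω

  size : ℕ
  size = length elements

  instance
    size≢0 : ℕ.NonZero size
    size≢0 with elements | complete point
    ... | _ ∷ _ | _ = _

-- The probability that P holds for a uniformly random element.
ℙ[_] : ∀ {Ω : Set} → SampleSpace Ω → {P : Pred Ω 0ℓ} → Decidable P → ℚ
ℙ[ X ] P? = (+ length (filter P? elements)) ℚ./ size
  where open SampleSpace X

infixr 5 _⊗_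

-- A uniformly random pair consists of independent uniformly random elements.
_⊗_ : ∀ {A B : Set} → SampleSpace A → SampleSpace B → SampleSpace (A × B)
X ⊗ Y = record
  { elements = cartesianProduct (elements X) (elements Y)
  ; complete = λ (a , b) → ∈-cartesianProduct⁺ (complete X a) (complete Y b)
  ; unique   = Unique.cartesianProduct⁺ (unique X) (unique Y)
  ; point    = point X , point Y
  }
  where open SampleSpace

scalars : SampleSpace 𝔽₂
scalars = record
  { elements = 0ℙ ∷ 1ℙ ∷ []
  ; complete = λ { 0ℙ → here refl ; 1ℙ → there (here refl) }
  ; unique   = ((λ ()) ∷ []) ∷ [] ∷ []
  ; point    = 0ℙ
  }

vectors : ∀ n → SampleSpace (Vec 𝔽₂ n)
vectors zero    = record
  { elements = [] ∷ []
  ; complete = λ { [] → here refl }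
  ; unique   = [] ∷ []
  ; point    = []
  }
vectors (suc n) = record
  { elements = cartesianProductWith _∷_ (elements scalars) (elements (vectors n))
  ; complete = λ { (a ∷ v) →
      ∈-cartesianProductWith⁺ _∷_ (complete scalars a) (complete (vectors n) v) }
  ; unique   = Unique.cartesianProductWith⁺ _∷_ Vec.∷-injective
                 (unique scalars) (unique (vectors n))
  ; point    = replicate (suc n) 0ℙ
  }
  where open SampleSpace

-- This is the entropic proof of Gowers, Green, Manners and Tao.  By hypothesis many pairs of points on the graph Γ of f
-- have their sum on Γ, so an entropic Balog–Szemerédi–Gowers argument gives a law ξ on Γ whose doubled Ruzsa distance
-- D ξ ξ is small.  As long as D μ ν > 0, some pair of sums, or of conditioned sums, of independent copies of μ and ν
-- lowers 16 D μ ν + D ξ μ + D ξ ν by at least D μ ν; the descent ends at some μ with almost no doubling and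
-- D ξ μ ≤ 18 D ξ ξ.  Such a μ is almost uniform on a coset of a subgroup H of 𝔽₂ᵐ × 𝔽₂ⁿ, and some coset of H meets Γ
-- in many points.  Over its projection to 𝔽₂ᵐ, H contains the graph of a linear map φ, so by the pigeonhole principle
-- f agrees often with φ + v for some v, and a linear functional that is often 1 absorbs the constant v.
--
-- No real numbers are needed for the entropies: for integer weights they are formal quotients (log q) / d with q rational,
-- which form an ordered divisible abelian group with a decidable order.

module Submission where

open import Defs
open import Algebra.Bundles using (AbelianGroup; CommutativeMonoid; RawMonoid)
open import Algebra.Definitions.RawMonoid using () renaming (_×_ to times)
open import Algebra.Morphism.Structures using (IsGroupHomomorphism)
import Algebra.Properties.CommutativeMonoid.Mult as Mult
open import Data.Bool.Base using (if_then_else_)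
open import Data.Empty using (⊥; ⊥-elim)
open import Data.Fin.Base using (Fin; zero; suc)
import Data.Integer as ℤ
import Data.Integer.Properties as ℤ
open import Data.List.Base using (List; []; _∷_; length; filter; cartesianProduct; _++_; map)
open import Data.List.Membership.Propositional using (_∈_; lose)
open import Data.List.Membership.Propositional.Properties using (∈-cartesianProduct⁺)
open import Data.List.Properties using (length-filter)
open import Data.List.Relation.Unary.All as All using (All; []; _∷_)
import Data.List.Relation.Unary.AllPairs as AllPairs
open import Data.List.Relation.Unary.Any as Any using (here; there)
open import Data.List.Relation.Unary.Unique.Propositional using (Unique)
import Data.List.Relation.Unary.Unique.Propositional.Properties as Unique
open import Data.Nat.Base as ℕ using (ℕ; zero; suc; _+_; _*_; _^_; _∸_; _!; _≤_; _<_; z≤n; s≤s; NonZero)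
import Data.Nat.Coprimality as Coprime
open import Data.Nat.Divisibility using (_∣_; divides; ∣-trans; m∣m*n; m≤n⇒m!∣n!)
import Data.Nat.Properties as ℕ
open import Data.Nat.Tactic.RingSolver using (solve-∀)
open import Data.Parity.Base as Parity using (Parity; 0ℙ; 1ℙ)
import Data.Parity.Properties as Parity
open import Data.Product using (_×_; _,_; proj₁; proj₂; <_,_>; ∃; ∃-syntax; Σ-syntax) renaming (swap to ×-swap)
open import Data.Product.Properties using (≡-dec)
open import Data.Rational as ℚ using (ℚ; 0ℚ; 1ℚ)
import Data.Rational.Properties as ℚ
import Data.Rational.Unnormalised.Base as ℚᵘ
import Data.Rational.Unnormalised.Properties as ℚᵘ
open import Data.Sum as ⊎ using (_⊎_; inj₁; inj₂)
open import Data.Unit.Base using (⊤; tt)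
open import Data.Vec.Base as Vec using (Vec; []; _∷_; lookup; replicate; zipWith)
import Data.Vec.Properties as Vec
open import Function using (_∘_; id)
open import Level using (0ℓ)
open import Relation.Binary.Bundles using (Preorder)
open import Relation.Binary.Definitions using (DecidableEquality)
open import Relation.Binary.PropositionalEquality
open import Relation.Nullary using (¬_; Dec; yes; no; contradiction; does; _×-dec_)
import Relation.Nullary.Decidable as Dec

-- The arithmetic–geometric mean inequality

-- The usual argument takes a minimiser of the functional among real-valued laws, which exists by
-- compactness. Integer weights give no minimiser, so the descent stops as soon as D μ ν ≤ κ, and
-- the structure theorem has to cope with a small positive doubling. The threshold κ is fixed by the
-- single number `resolution`, not by the group or by K; the number of steps of the descent depends
-- on the group but does not enter the final bound. Relative entropy is turned into total variation
-- without Pinsker's inequality: the arithmetic-geometric mean inequality gains a fixed amount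
-- wherever one density exceeds another by a factor of at least 1 + 1/r. The exponent arises as 770
-- = 7 · 110. With p the probability in the hypothesis, finding ξ loses 7 log (1/p), and everything
-- after it loses 2 + 6 · 18 = 110 times as much. The definition of real powers by cuts then asks
-- for one more, so that C₄ = 771.

rearrange-≤ : ∀ {a b x y} → a ≤ b → x ≤ y → a * y + x * b ≤ a * x + b * y
rearrange-≤ {a} {b} {x} {y} a≤b x≤y with ℕ.m≤n⇒∃[o]m+o≡n a≤b | ℕ.m≤n⇒∃[o]m+o≡n x≤y
... | d , refl | e , refl = ℕ.≤-trans (ℕ.m≤m+n _ (d * e)) (ℕ.≤-reflexive (eq a d x e))
  where
  eq : ∀ a d x e → a * (x + e) + x * (a + d) + d * e ≡ a * x + (a + d) * (x + e)
  eq = solve-∀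

^-distribʳ-* : ∀ k m n → (m * n) ^ k ≡ m ^ k * n ^ k
^-distribʳ-* zero    m n = refl
^-distribʳ-* (suc k) m n = trans (cong (m * n *_) (^-distribʳ-* k m n)) (eq m n (m ^ k) (n ^ k))
  where
  eq : ∀ m n x y → m * n * (x * y) ≡ (m * x) * (n * y)
  eq = solve-∀

-- Bernoulli's inequality for B / A, made homogeneous so that nothing is divided. The induction
-- leaves A Bⁿ⁺¹ + Aⁿ⁺¹ B ≤ Aⁿ⁺² + Bⁿ⁺², the rearrangement inequality for A, B and their powers.
bernoulli : ∀ n A B → suc n * (A ^ n * B) ≤ B ^ suc n + n * A ^ suc n
bernoulli zero    A B = ℕ.≤-reflexive (eq B)
  where
  eq : ∀ B → 1 * (1 * B) ≡ B * 1 + 0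
  eq = solve-∀
bernoulli (suc n) A B = begin
  suc (suc n) * (A ^ suc n * B)                    ≡⟨ eq₁ n A B (A ^ n) ⟩
  A * (suc n * (A ^ n * B)) + A ^ suc n * B        ≤⟨ ℕ.+-monoˡ-≤ (A ^ suc n * B) (ℕ.*-monoʳ-≤ A (bernoulli n A B)) ⟩
  A * (B ^ suc n + n * A ^ suc n) + A ^ suc n * B  ≡⟨ eq₂ n A B (A ^ suc n) (B ^ suc n) ⟩
  (A * B ^ suc n + A ^ suc n * B) + n * A ^ suc (suc n) ≤⟨ ℕ.+-monoˡ-≤ (n * A ^ suc (suc n)) mixed ⟩
  (A * A ^ suc n + B * B ^ suc n) + n * A ^ suc (suc n) ≡⟨ eq₃ n (A ^ suc (suc n)) (B ^ suc (suc n)) ⟩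
  B ^ suc (suc n) + suc n * A ^ suc (suc n)        ∎
  where
  open ℕ.≤-Reasoning
  eq₁ : ∀ n A B X → suc (suc n) * (A * X * B) ≡ A * (suc n * (X * B)) + A * X * B
  eq₁ = solve-∀
  eq₂ : ∀ n A B X Y → A * (Y + n * X) + X * B ≡ (A * Y + X * B) + n * (A * X)
  eq₂ = solve-∀
  eq₃ : ∀ n X Y → (X + Y) + n * X ≡ Y + suc n * X
  eq₃ = solve-∀
  mixed : A * B ^ suc n + A ^ suc n * B ≤ A * A ^ suc n + B * B ^ suc n
  mixed with ℕ.≤-total A B
  ... | inj₁ A≤B = rearrange-≤ A≤B (ℕ.^-monoˡ-≤ (suc n) A≤B)
  ... | inj₂ B≤A = ℕ.≤-trans
    (ℕ.≤-reflexive (trans (ℕ.+-comm (A * B ^ suc n) (A ^ suc n * B)) (cong₂ _+_ (ℕ.*-comm (A ^ suc n) B) (ℕ.*-comm A (B ^ suc n)))))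
    (ℕ.≤-trans (rearrange-≤ B≤A (ℕ.^-monoˡ-≤ (suc n) B≤A)) (ℕ.≤-reflexive (ℕ.+-comm (B * B ^ suc n) (A * A ^ suc n))))

-- Bernoulli at A = (n+1)S, B = n(S+y): the mean of n+1 numbers against the mean of the first n.
mean-step : ∀ n S y → S ^ n * y * suc n ^ suc n ≤ n ^ n * (S + y) ^ suc n
mean-step zero    S y = ℕ.≤-trans (ℕ.≤-reflexive (eq y)) (ℕ.≤-trans (ℕ.m≤n+m y S) (ℕ.≤-reflexive (eq′ (S + y))))
  where
  eq : ∀ y → 1 * y * (1 * 1) ≡ y
  eq = solve-∀
  eq′ : ∀ z → z ≡ 1 * (z * 1)
  eq′ = solve-∀
mean-step n@(suc _) S y = ℕ.*-cancelˡ-≤ n (ℕ.+-cancelʳ-≤ (n * A ^ suc n) _ _ (begin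
  n * (S ^ n * y * suc n ^ suc n) + n * A ^ suc n  ≡⟨ cong₂ _+_ (eq₁ n (S ^ n) y (suc n ^ n)) refl ⟩
  (suc n ^ n * S ^ n) * (suc n * (n * y)) + n * (A * A ^ n) ≡⟨ cong (λ z → z * (suc n * (n * y)) + n * (A * A ^ n)) (sym (^-distribʳ-* n (suc n) S)) ⟩
  A ^ n * (suc n * (n * y)) + n * (suc n * S * A ^ n) ≡⟨ eq₂ n S y (A ^ n) ⟩
  suc n * (A ^ n * B)              ≤⟨ bernoulli n A B ⟩
  B ^ suc n + n * A ^ suc n        ≡⟨ cong (_+ n * A ^ suc n) (^-distribʳ-* (suc n) n (S + y)) ⟩
  n ^ suc n * (S + y) ^ suc n + n * A ^ suc n ≡⟨ cong (_+ n * A ^ suc n) (ℕ.*-assoc n (n ^ n) _) ⟩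
  n * (n ^ n * (S + y) ^ suc n) + n * A ^ suc n ∎))
  where
  open ℕ.≤-Reasoning
  A = suc n * S
  B = n * (S + y)
  eq₁ : ∀ n X y Z → n * (X * y * (suc n * Z)) ≡ (Z * X) * (suc n * (n * y))
  eq₁ = solve-∀
  eq₂ : ∀ n S y X → X * (suc n * (n * y)) + n * (suc n * S * X) ≡ suc n * (X * (n * (S + y)))
  eq₂ = solve-∀

n^n≢0 : ∀ n → NonZero (n ^ n)
n^n≢0 zero    = _
n^n≢0 (suc n) = ℕ.m^n≢0 (suc n) (suc n)

-- Induction on b puts in one more copy of y at a time; `mean-step` compares the mean of a + b + 1
-- numbers with that of the first a + b. The factor n ^ n that is cancelled is nonzero also for n =
-- 0, where it is 1.
weighted-AM-GM : ∀ a b x y → x ^ a * y ^ b * (a + b) ^ (a + b) ≤ (a * x + b * y) ^ (a + b)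
weighted-AM-GM a zero x y = ℕ.≤-reflexive (begin
  x ^ a * 1 * (a + 0) ^ (a + 0)  ≡⟨ cong₂ _*_ (ℕ.*-identityʳ (x ^ a)) (cong (λ n → n ^ n) (ℕ.+-identityʳ a)) ⟩
  x ^ a * a ^ a                  ≡⟨ ℕ.*-comm (x ^ a) (a ^ a) ⟩
  a ^ a * x ^ a                  ≡⟨ ^-distribʳ-* a a x ⟨
  (a * x) ^ a                    ≡⟨ cong₂ _^_ (ℕ.+-identityʳ (a * x)) (ℕ.+-identityʳ a) ⟨
  (a * x + 0) ^ (a + 0)          ∎)
  where open ≡-Reasoning
weighted-AM-GM a (suc b) x y rewrite ℕ.+-suc a b =
  ℕ.*-cancelˡ-≤ (n ^ n) {{n^n≢0 n}} (begin
  n ^ n * (x ^ a * (y * y ^ b) * suc n ^ suc n)  ≡⟨ eq₁ (n ^ n) (x ^ a) y (y ^ b) (suc n ^ suc n) ⟩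
  x ^ a * y ^ b * n ^ n * (y * suc n ^ suc n)    ≤⟨ ℕ.*-monoˡ-≤ (y * suc n ^ suc n) (weighted-AM-GM a b x y) ⟩
  S ^ n * (y * suc n ^ suc n)                    ≡⟨ ℕ.*-assoc (S ^ n) y _ ⟨
  S ^ n * y * suc n ^ suc n                      ≤⟨ mean-step n S y ⟩
  n ^ n * (S + y) ^ suc n                        ≡⟨ cong (λ z → n ^ n * z ^ suc n) (eq₂ a b x y) ⟩
  n ^ n * (a * x + suc b * y) ^ suc n            ∎)
  where
  open ℕ.≤-Reasoning
  n = a + b
  S = a * x + b * y
  eq₁ : ∀ N X y Y M → N * (X * (y * Y) * M) ≡ X * Y * N * (y * M)
  eq₁ = solve-∀
  eq₂ : ∀ a b x y → a * x + b * y + y ≡ a * x + suc b * y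
  eq₂ = solve-∀

-- Logarithms of rationals as an ordered divisible group

record ℚ⁺ : Set where
  constructor _,⁺_
  field
    value : ℚ
    value⁺   : ℚ.Positive value

open ℚ⁺

ℚ⁺-group : AbelianGroup 0ℓ 0ℓ
ℚ⁺-group = record
  { Carrier = ℚ⁺
  ; _≈_     = λ p q → value p ≡ value q
  ; _∙_     = λ p q → (value p ℚ.* value q) ,⁺ ℚ.pos*pos⇒pos (value p) {{value⁺ p}} (value q) {{value⁺ q}}
  ; ε       = 1ℚ ,⁺ _
  ; _⁻¹     = λ p → (ℚ.1/_ (value p) {{ℚ.pos⇒nonZero (value p) {{value⁺ p}}}}) ,⁺ ℚ.1/pos⇒pos (value p) {{value⁺ p}}
  ; isAbelianGroup = record
    { isGroup = record
      { isMonoid = record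
        { isSemigroup = record
          { isMagma = record
            { isEquivalence = record { refl = refl ; sym = sym ; trans = trans }
            ; ∙-cong = cong₂ ℚ._*_
            }
          ; assoc = λ p q r → ℚ.*-assoc (value p) (value q) (value r)
          }
        ; identity = (λ p → ℚ.*-identityˡ (value p)) , (λ p → ℚ.*-identityʳ (value p))
        }
      ; inverse = (λ p → ℚ.*-inverseˡ (value p) {{ℚ.pos⇒nonZero (value p) {{value⁺ p}}}})
                , (λ p → ℚ.*-inverseʳ (value p) {{ℚ.pos⇒nonZero (value p) {{value⁺ p}}}})
      ; ⁻¹-cong = λ { {p ,⁺ _} {.p ,⁺ _} refl → refl }
      }
    ; comm = λ p q → ℚ.*-comm (value p) (value q)
    }
  }

-- The multiplicative group is renamed additively because q stands for log q: `⊹` multiplies, `⋆`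
-- takes powers, and `≼` orders logarithms, which is the order of the rationals themselves.
module LogRational where

  open AbelianGroup ℚ⁺-group public using () renaming
    ( _≈_ to _≈⁺_; _∙_ to _⊹_; ε to 𝟎; _⁻¹ to neg; ∙-cong to ⊹-cong
    ; comm to ⊹-comm; inverseˡ to neg-inverseˡ; identityˡ to ⊹-identityˡ
    ; commutativeMonoid to ⊹-monoid)
  open import Algebra.Properties.CommutativeMonoid.Mult ⊹-monoid public using () renaming
    ( _×_ to _⋆_; ×-congʳ to ⋆-congʳ; ×-assocˡ to ⋆-assocˡ; ×-distrib-+ to ⋆-distrib-⊹; ×-homo-1 to ⋆-homo-1)

  infix 4 _≼_
  _≼_ : ℚ⁺ → ℚ⁺ → Set
  p ≼ q = value p ℚ.≤ value q

  ⊹-mono : ∀ {p q r s} → p ≼ q → r ≼ s → p ⊹ r ≼ q ⊹ s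
  ⊹-mono {p} {q} {r} {s} p≤q r≤s = ℚ.≤-trans
    (ℚ.*-monoʳ-≤-nonNeg (value r) {{ℚ.pos⇒nonNeg (value r) {{value⁺ r}}}} p≤q)
    (ℚ.*-monoˡ-≤-nonNeg (value q) {{ℚ.pos⇒nonNeg (value q) {{value⁺ q}}}} r≤s)

  ⊹-mono-< : ∀ {p q r s} → value p ℚ.< value q → r ≼ s → value (p ⊹ r) ℚ.< value (q ⊹ s)
  ⊹-mono-< {p} {q} {r} {s} p<q r≤s = ℚ.<-≤-trans
    (ℚ.*-monoˡ-<-pos (value r) {{value⁺ r}} p<q)
    (ℚ.*-monoˡ-≤-nonNeg (value q) {{ℚ.pos⇒nonNeg (value q) {{value⁺ q}}}} r≤s)

  ⋆-mono : ∀ n {p q} → p ≼ q → n ⋆ p ≼ n ⋆ q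
  ⋆-mono zero    p≤q = ℚ.≤-refl
  ⋆-mono (suc n) {p} {q} p≤q = ⊹-mono {p} {q} {n ⋆ p} {n ⋆ q} p≤q (⋆-mono n p≤q)

  ⋆-cancel : ∀ n {p q} → suc n ⋆ p ≼ suc n ⋆ q → p ≼ q
  ⋆-cancel n {p} {q} np≤nq with value p ℚ.≤? value q
  ... | yes p≤q = p≤q
  ... | no  p≰q = contradiction (ℚ.≤-<-trans np≤nq (⊹-mono-< {q} {p} {n ⋆ q} {n ⋆ p} q<p (⋆-mono n {q} {p} (ℚ.<⇒≤ q<p)))) (ℚ.<-irrefl refl)
    where q<p = ℚ.≰⇒> p≰q

  ⋆-comm : ∀ m n p → m ⋆ (n ⋆ p) ≈⁺ n ⋆ (m ⋆ p)
  ⋆-comm m n p = trans (⋆-assocˡ p m n) (trans (cong (λ k → value (k ⋆ p)) (ℕ.*-comm m n)) (sym (⋆-assocˡ p n m)))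

  ≼-subst : ∀ {p p′ q q′} → p ≈⁺ p′ → q ≈⁺ q′ → p ≼ q → p′ ≼ q′
  ≼-subst = subst₂ ℚ._≤_

  fromℕ : ℕ → ℚ⁺
  -- A junk value, so that `log` is total. In log-likelihoods it occurs only with multiplier 0.
  fromℕ zero    = 𝟎
  fromℕ (suc n) = ℚ.mkℚ (ℤ.+ suc n) 0 (Coprime.sym (Coprime.1-coprimeTo (suc n))) ,⁺ _

  fromℕ-mono : ∀ {m n} .{{_ : NonZero m}} → m ≤ n → fromℕ m ≼ fromℕ n
  fromℕ-mono {suc m} {suc n} m≤n = ℚ.*≤* (ℤ.*-monoʳ-≤-nonNeg (ℤ.+ 1) (ℤ.+≤+ m≤n))

  fromℕ-cancel : ∀ {m n} .{{_ : NonZero n}} → fromℕ m ≼ fromℕ n → m ≤ n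
  fromℕ-cancel {zero}          _          = z≤n
  fromℕ-cancel {suc m} {suc n} (ℚ.*≤* le) = ℤ.drop‿+≤+ (ℤ.*-cancelʳ-≤-pos (ℤ.+ suc m) (ℤ.+ suc n) (ℤ.+ 1) le)

  fromℕ-* : ∀ m n .{{_ : NonZero m}} .{{_ : NonZero n}} → fromℕ (m * n) ≈⁺ fromℕ m ⊹ fromℕ n
  fromℕ-* (suc m) (suc n) = sym (ℚ.normalize-coprime (Coprime.sym (Coprime.1-coprimeTo (suc m * suc n))))

-- Everything about entropy uses only these laws: an ordered divisible abelian group with a
-- logarithm. Equality is comparison both ways, since one logarithm has many representations. The
-- decidable order is what allows a law of small cost to be found by search. The instance below is
-- sealed, so that no rational is ever computed in the arguments about entropy.
record LogarithmSpace : Set₁ where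
  infix  4 _≤ᵥ_ _≈ᵥ_ _≤ᵥ?_
  infixl 6 _+ᵥ_
  infix  8 -ᵥ_
  infixl 7 _÷_
  infixr 8 _·_
  field
    𝕍    : Set
    _≤ᵥ_ : 𝕍 → 𝕍 → Set
    _+ᵥ_ : 𝕍 → 𝕍 → 𝕍
    0ᵥ   : 𝕍
    -ᵥ_  : 𝕍 → 𝕍
    _÷_  : 𝕍 → ℕ → 𝕍
    log  : ℕ → 𝕍

  _≈ᵥ_ : 𝕍 → 𝕍 → Set
  x ≈ᵥ y = x ≤ᵥ y × y ≤ᵥ x

  𝕍-rawMonoid : RawMonoid 0ℓ 0ℓ
  𝕍-rawMonoid = record { _≈_ = _≈ᵥ_ ; _∙_ = _+ᵥ_ ; ε = 0ᵥ }

  _·_ : ℕ → 𝕍 → 𝕍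
  _·_ = times 𝕍-rawMonoid

  field
    ≤ᵥ-refl      : ∀ {x} → x ≤ᵥ x
    ≤ᵥ-trans     : ∀ {x y z} → x ≤ᵥ y → y ≤ᵥ z → x ≤ᵥ z
    ≤ᵥ-total     : ∀ x y → x ≤ᵥ y ⊎ y ≤ᵥ x
    _≤ᵥ?_        : ∀ x y → Dec (x ≤ᵥ y)
    +ᵥ-monoˡ     : ∀ {x y} z → x ≤ᵥ y → x +ᵥ z ≤ᵥ y +ᵥ z
    +ᵥ-comm      : ∀ x y → x +ᵥ y ≈ᵥ y +ᵥ x
    +ᵥ-assoc     : ∀ x y z → (x +ᵥ y) +ᵥ z ≈ᵥ x +ᵥ (y +ᵥ z)
    +ᵥ-identityˡ : ∀ x → 0ᵥ +ᵥ x ≈ᵥ x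
    -ᵥ-inverseˡ  : ∀ x → (-ᵥ x) +ᵥ x ≈ᵥ 0ᵥ
    ·-cancel     : ∀ n .{{_ : NonZero n}} {x y} → n · x ≤ᵥ n · y → x ≤ᵥ y
    ·-÷          : ∀ n .{{_ : NonZero n}} x → n · (x ÷ n) ≈ᵥ x
    log-mono     : ∀ {m n} .{{_ : NonZero m}} → m ≤ n → log m ≤ᵥ log n
    log-cancel-≤ : ∀ {m n} .{{_ : NonZero n}} → log m ≤ᵥ log n → m ≤ n
    log-*        : ∀ m n .{{_ : NonZero m}} .{{_ : NonZero n}} → log (m * n) ≈ᵥ log m +ᵥ log n

module DivisibleHull where

  open LogRational

  infix  4 _≤ᵥ_ _≈ᵥ_
  infixl 6 _+ᵥ_
  infix  8 -ᵥ_
  infixl 7 _÷_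
  infixr 8 _·_

  -- (q , d) stands for the real number log q / (d + 1).
  𝕍 : Set
  𝕍 = ℚ⁺ × ℕ

  -- Cross-multiplying log p / (d + 1) ≤ log q / (e + 1) turns it into a comparison of the powers p
  -- ^ (e + 1) and q ^ (d + 1).
  _≤ᵥ_ : 𝕍 → 𝕍 → Set
  (p , d) ≤ᵥ (q , e) = suc e ⋆ p ≼ suc d ⋆ q

  _≈ᵥ_ : 𝕍 → 𝕍 → Set
  x ≈ᵥ y = x ≤ᵥ y × y ≤ᵥ x

  -- Denominators are stored less one: e + d * suc e is (d + 1)(e + 1) - 1, and `÷` follows the same
  -- pattern. Fractions are never reduced.
  _+ᵥ_ : 𝕍 → 𝕍 → 𝕍
  (p , d) +ᵥ (q , e) = suc e ⋆ p ⊹ suc d ⋆ q , e + d * suc e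

  0ᵥ : 𝕍
  0ᵥ = 𝟎 , 0

  -ᵥ_ : 𝕍 → 𝕍
  -ᵥ (p , d) = neg p , d

  _÷_ : 𝕍 → ℕ → 𝕍
  x       ÷ zero  = 0ᵥ
  (p , d) ÷ suc k = p , k + d * suc k

  log : ℕ → 𝕍
  log n = fromℕ n , 0

  rawMonoid : RawMonoid 0ℓ 0ℓ
  rawMonoid = record { _≈_ = _≈ᵥ_ ; _∙_ = _+ᵥ_ ; ε = 0ᵥ }

  _·_ : ℕ → 𝕍 → 𝕍
  _·_ = times rawMonoid

  zeroʳ : ∀ n → n ⋆ 𝟎 ≈⁺ 𝟎
  zeroʳ zero    = refl
  zeroʳ (suc n) = trans (⊹-identityˡ (n ⋆ 𝟎)) (zeroʳ n)

  ≈-intro : ∀ {p q d e} → suc e ⋆ p ≈⁺ suc d ⋆ q → (p , d) ≈ᵥ (q , e)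
  ≈-intro eq = ℚ.≤-reflexive eq , ℚ.≤-reflexive (sym eq)

  ≈-intro′ : ∀ {p q d e} → p ≈⁺ q → d ≡ e → (p , d) ≈ᵥ (q , e)
  ≈-intro′ {p} {q} {d} p≈q refl = ≈-intro {p} {q} {d} {d} (⋆-congʳ (suc d) {p} {q} p≈q)

  ≤ᵥ-refl : ∀ {x} → x ≤ᵥ x
  ≤ᵥ-refl = ℚ.≤-refl

  ≤ᵥ-trans : ∀ {x y z} → x ≤ᵥ y → y ≤ᵥ z → x ≤ᵥ z
  ≤ᵥ-trans {p , d} {q , e} {r , f} x≤y y≤z = ⋆-cancel e {suc f ⋆ p} {suc d ⋆ r}
    (ℚ.≤-trans (≼-subst {suc f ⋆ (suc e ⋆ p)} {suc e ⋆ (suc f ⋆ p)} {suc f ⋆ (suc d ⋆ q)} {suc d ⋆ (suc f ⋆ q)}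
        (⋆-comm (suc f) (suc e) p) (⋆-comm (suc f) (suc d) q) (⋆-mono (suc f) {suc e ⋆ p} {suc d ⋆ q} x≤y))
      (≼-subst {suc d ⋆ (suc f ⋆ q)} {suc d ⋆ (suc f ⋆ q)} {suc d ⋆ (suc e ⋆ r)} {suc e ⋆ (suc d ⋆ r)}
        refl (⋆-comm (suc d) (suc e) r) (⋆-mono (suc d) {suc f ⋆ q} {suc e ⋆ r} y≤z)))

  ≤ᵥ-total : ∀ x y → x ≤ᵥ y ⊎ y ≤ᵥ x
  ≤ᵥ-total (p , d) (q , e) = ℚ.≤-total (value (suc e ⋆ p)) (value (suc d ⋆ q))

  _≤ᵥ?_ : ∀ x y → Dec (x ≤ᵥ y)
  (p , d) ≤ᵥ? (q , e) = value (suc e ⋆ p) ℚ.≤? value (suc d ⋆ q)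

  scale : ∀ k p q m n → k ⋆ (m ⋆ p ⊹ n ⋆ q) ≈⁺ (k * m) ⋆ p ⊹ (k * n) ⋆ q
  scale k p q m n = trans (⋆-distrib-⊹ (m ⋆ p) (n ⋆ q) k)
    (⊹-cong {k ⋆ (m ⋆ p)} {(k * m) ⋆ p} {k ⋆ (n ⋆ q)} {(k * n) ⋆ q} (⋆-assocˡ p k m) (⋆-assocˡ q k n))

  ⋆-congˡ : ∀ p {m n} → m ≡ n → m ⋆ p ≈⁺ n ⋆ p
  ⋆-congˡ p refl = refl

  +ᵥ-monoˡ : ∀ {x y} z → x ≤ᵥ y → x +ᵥ z ≤ᵥ y +ᵥ z
  +ᵥ-monoˡ {p , d} {q , e} (r , f) x≤y = ≼-subst
    {((F * F) ⋆ (E ⋆ p)) ⊹ (E * F * D) ⋆ r} {(E * F) ⋆ (F ⋆ p ⊹ D ⋆ r)}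
    {((F * F) ⋆ (D ⋆ q)) ⊹ (E * F * D) ⋆ r} {(D * F) ⋆ (F ⋆ q ⊹ E ⋆ r)}
    (sym (trans (scale (E * F) p r F D) (⊹-cong {(E * F * F) ⋆ p} {(F * F) ⋆ (E ⋆ p)} {(E * F * D) ⋆ r} {(E * F * D) ⋆ r}
       (trans (⋆-congˡ p (eq E F)) (sym (⋆-assocˡ p (F * F) E))) refl)))
    (sym (trans (scale (D * F) q r F E) (⊹-cong {(D * F * F) ⋆ q} {(F * F) ⋆ (D ⋆ q)} {(D * F * E) ⋆ r} {(E * F * D) ⋆ r}
       (trans (⋆-congˡ q (eq D F)) (sym (⋆-assocˡ q (F * F) D))) (⋆-congˡ r (eq′ D E F)))))
    (⊹-mono {(F * F) ⋆ (E ⋆ p)} {(F * F) ⋆ (D ⋆ q)} {(E * F * D) ⋆ r} {(E * F * D) ⋆ r}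
      (⋆-mono (F * F) {E ⋆ p} {D ⋆ q} x≤y) ℚ.≤-refl)
    where
    D = suc d ; E = suc e ; F = suc f
    eq : ∀ E F → E * F * F ≡ F * F * E
    eq = solve-∀
    eq′ : ∀ D E F → D * F * E ≡ E * F * D
    eq′ = solve-∀

  +ᵥ-comm : ∀ x y → x +ᵥ y ≈ᵥ y +ᵥ x
  +ᵥ-comm (p , d) (q , e) = ≈-intro′ {suc e ⋆ p ⊹ suc d ⋆ q} {suc d ⋆ q ⊹ suc e ⋆ p} (⊹-comm (suc e ⋆ p) (suc d ⋆ q)) (ℕ.suc-injective (ℕ.*-comm (suc d) (suc e)))

  +ᵥ-assoc : ∀ x y z → (x +ᵥ y) +ᵥ z ≈ᵥ x +ᵥ (y +ᵥ z)
  +ᵥ-assoc (p , d) (q , e) (r , f) = ≈-intro′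
    (trans (⊹-cong {F ⋆ (E ⋆ p ⊹ D ⋆ q)} {(F * E) ⋆ p ⊹ (F * D) ⋆ q} {(D * E) ⋆ r} {(D * E) ⋆ r} (scale F p q E D) refl)
    (trans (ℚ.*-assoc (value ((F * E) ⋆ p)) (value ((F * D) ⋆ q)) (value ((D * E) ⋆ r)))
    (⊹-cong {(F * E) ⋆ p} {(E * F) ⋆ p} {(F * D) ⋆ q ⊹ (D * E) ⋆ r} {D ⋆ (F ⋆ q ⊹ E ⋆ r)}
      (⋆-congˡ p (ℕ.*-comm F E))
      (sym (trans (scale D q r F E) (⊹-cong {(D * F) ⋆ q} {(F * D) ⋆ q} {(D * E) ⋆ r} {(D * E) ⋆ r} (⋆-congˡ q (ℕ.*-comm D F)) refl))))))
    (ℕ.suc-injective (ℕ.*-assoc D E F))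
    where D = suc d ; E = suc e ; F = suc f

  +ᵥ-identityˡ : ∀ x → 0ᵥ +ᵥ x ≈ᵥ x
  +ᵥ-identityˡ (p , d) = ≈-intro′
    (trans (⊹-cong {suc d ⋆ 𝟎} {𝟎} {1 ⋆ p} {p} (zeroʳ (suc d)) (⋆-homo-1 p)) (⊹-identityˡ p)) (ℕ.+-identityʳ d)

  -ᵥ-inverseˡ : ∀ x → (-ᵥ x) +ᵥ x ≈ᵥ 0ᵥ
  -ᵥ-inverseˡ (p , d) = ≈-intro {suc d ⋆ neg p ⊹ suc d ⋆ p} {𝟎} {d + d * suc d} {0}
    (trans (ℚ.*-identityʳ _) (trans (sym (⋆-distrib-⊹ (neg p) p (suc d)))
      (trans (⋆-congʳ (suc d) {neg p ⊹ p} {𝟎} (neg-inverseˡ p)) (trans (zeroʳ (suc d)) (sym (zeroʳ (suc d * suc d)))))))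

  -- Repeated addition multiplies denominators, so a multiple has the expected form only up to `≈ᵥ`.
  -- The laws of multiples are checked on this short form.
  ·-repr : ∀ n p d → n · (p , d) ≈ᵥ (n ⋆ p , d)
  ·-repr zero    p d = ≈-intro {𝟎} {𝟎} {0} {d} (trans (zeroʳ (suc d)) (sym (zeroʳ 1)))
  ·-repr (suc n) p d = ≤ᵥ-trans {(p , d) +ᵥ n · (p , d)} {(p , d) +ᵥ (n ⋆ p , d)} {suc n ⋆ p , d} (+ᵥ-monoʳ (p , d) {n · (p , d)} {n ⋆ p , d} (proj₁ ih)) (proj₁ step)
                     , ≤ᵥ-trans {suc n ⋆ p , d} {(p , d) +ᵥ (n ⋆ p , d)} {(p , d) +ᵥ n · (p , d)} (proj₂ step) (+ᵥ-monoʳ (p , d) {n ⋆ p , d} {n · (p , d)} (proj₂ ih))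
    where
    D = suc d
    ih = ·-repr n p d
    +ᵥ-monoʳ : ∀ z {x y} → x ≤ᵥ y → z +ᵥ x ≤ᵥ z +ᵥ y
    +ᵥ-monoʳ z {x} {y} x≤y = ≤ᵥ-trans {z +ᵥ x} {x +ᵥ z} {z +ᵥ y} (proj₁ (+ᵥ-comm z x))
      (≤ᵥ-trans {x +ᵥ z} {y +ᵥ z} {z +ᵥ y} (+ᵥ-monoˡ {x} {y} z x≤y) (proj₁ (+ᵥ-comm y z)))
    step : ((p , d) +ᵥ (n ⋆ p , d)) ≈ᵥ (suc n ⋆ p , d)
    step = ≈-intro {D ⋆ p ⊹ D ⋆ (n ⋆ p)} {suc n ⋆ p} {d + d * suc d} {d}
      (trans (⋆-congʳ D {D ⋆ p ⊹ D ⋆ (n ⋆ p)} {D ⋆ (suc n ⋆ p)} (sym (⋆-distrib-⊹ p (n ⋆ p) D)))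
        (⋆-assocˡ (suc n ⋆ p) D D))

  ·-cancel : ∀ n .{{_ : NonZero n}} {x y} → n · x ≤ᵥ n · y → x ≤ᵥ y
  ·-cancel n@(suc m) {p , d} {q , e} nx≤ny = ⋆-cancel m {suc e ⋆ p} {suc d ⋆ q}
    (≼-subst {suc e ⋆ (n ⋆ p)} {n ⋆ (suc e ⋆ p)} {suc d ⋆ (n ⋆ q)} {n ⋆ (suc d ⋆ q)}
      (⋆-comm (suc e) n p) (⋆-comm (suc d) n q)
      (≤ᵥ-trans {n ⋆ p , d} {n · (p , d)} {n ⋆ q , e} (proj₂ (·-repr n p d))
        (≤ᵥ-trans {n · (p , d)} {n · (q , e)} {n ⋆ q , e} nx≤ny (proj₁ (·-repr n q e)))))

  ·-÷ : ∀ n .{{_ : NonZero n}} x → n · (x ÷ n) ≈ᵥ x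
  ·-÷ n@(suc m) (p , d) = ≤ᵥ-trans {n · (p , k)} {n ⋆ p , k} {p , d} (proj₁ (·-repr n p k)) (proj₁ eq)
                        , ≤ᵥ-trans {p , d} {n ⋆ p , k} {n · (p , k)} (proj₂ eq) (proj₂ (·-repr n p k))
    where
    k = m + d * n
    eq : (n ⋆ p , k) ≈ᵥ (p , d)
    eq = ≈-intro {n ⋆ p} {p} {k} {d} (⋆-assocˡ p (suc d) n)

  log-mono : ∀ {m n} .{{_ : NonZero m}} → m ≤ n → log m ≤ᵥ log n
  log-mono {m} {n} m≤n = ⋆-mono 1 {fromℕ m} {fromℕ n} (fromℕ-mono m≤n)

  log-cancel-≤ : ∀ {m n} .{{_ : NonZero n}} → log m ≤ᵥ log n → m ≤ n
  log-cancel-≤ {m} {n} le = fromℕ-cancel (⋆-cancel 0 {fromℕ m} {fromℕ n} le)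

  log-* : ∀ m n .{{_ : NonZero m}} .{{_ : NonZero n}} → log (m * n) ≈ᵥ log m +ᵥ log n
  log-* m n = ≈-intro′ {fromℕ (m * n)} {1 ⋆ fromℕ m ⊹ 1 ⋆ fromℕ n} {0} {0} (trans (fromℕ-* m n)
    (sym (⊹-cong {1 ⋆ fromℕ m} {fromℕ m} {1 ⋆ fromℕ n} {fromℕ n} (⋆-homo-1 (fromℕ m)) (⋆-homo-1 (fromℕ n))))) refl

abstract
  logarithmSpace : LogarithmSpace
  logarithmSpace = record
    { 𝕍 = 𝕍 ; _≤ᵥ_ = _≤ᵥ_ ; _+ᵥ_ = _+ᵥ_ ; 0ᵥ = 0ᵥ ; -ᵥ_ = -ᵥ_ ; _÷_ = _÷_ ; log = log
    ; ≤ᵥ-refl = λ {x} → ≤ᵥ-refl {x} ; ≤ᵥ-trans = λ {x} {y} {z} → ≤ᵥ-trans {x} {y} {z}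
    ; ≤ᵥ-total = ≤ᵥ-total ; _≤ᵥ?_ = _≤ᵥ?_ ; +ᵥ-monoˡ = λ {x} {y} → +ᵥ-monoˡ {x} {y}
    ; +ᵥ-comm = +ᵥ-comm ; +ᵥ-assoc = +ᵥ-assoc ; +ᵥ-identityˡ = +ᵥ-identityˡ ; -ᵥ-inverseˡ = -ᵥ-inverseˡ
    ; ·-cancel = λ n {x} {y} → ·-cancel n {x} {y} ; ·-÷ = ·-÷
    ; log-mono = log-mono ; log-cancel-≤ = log-cancel-≤ ; log-* = log-*
    }
    where open DivisibleHull

open LogarithmSpace logarithmSpace

-ᵥ-anti : ∀ {x y} → x ≤ᵥ y → (-ᵥ y) ≤ᵥ (-ᵥ x)
-ᵥ-anti {x} {y} x≤y = ≤ᵥ-trans (proj₂ (+ᵥ-identityˡ (-ᵥ y)))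
  (≤ᵥ-trans (+ᵥ-monoˡ (-ᵥ y) (proj₂ (-ᵥ-inverseˡ x)))
  (≤ᵥ-trans (proj₁ (+ᵥ-assoc (-ᵥ x) x (-ᵥ y)))
  (≤ᵥ-trans (proj₁ (+ᵥ-comm (-ᵥ x) (x +ᵥ -ᵥ y)))
  (≤ᵥ-trans (+ᵥ-monoˡ (-ᵥ x) (≤ᵥ-trans (+ᵥ-monoˡ (-ᵥ y) x≤y)
    (≤ᵥ-trans (proj₁ (+ᵥ-comm y (-ᵥ y))) (proj₁ (-ᵥ-inverseˡ y)))))
  (proj₁ (+ᵥ-identityˡ (-ᵥ x)))))))

≈ᵥ-refl : ∀ {x} → x ≈ᵥ x
≈ᵥ-refl = ≤ᵥ-refl , ≤ᵥ-refl

≈ᵥ-sym : ∀ {x y} → x ≈ᵥ y → y ≈ᵥ x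
≈ᵥ-sym (p , q) = q , p

≈ᵥ-trans : ∀ {x y z} → x ≈ᵥ y → y ≈ᵥ z → x ≈ᵥ z
≈ᵥ-trans (p , q) (r , s) = ≤ᵥ-trans p r , ≤ᵥ-trans s q

+ᵥ-mono : ∀ {x y u v} → x ≤ᵥ y → u ≤ᵥ v → x +ᵥ u ≤ᵥ y +ᵥ v
+ᵥ-mono {x} {y} {u} {v} x≤y u≤v = ≤ᵥ-trans (+ᵥ-monoˡ u x≤y) (≤ᵥ-trans (proj₁ (+ᵥ-comm y u))
  (≤ᵥ-trans (+ᵥ-monoˡ y u≤v) (proj₁ (+ᵥ-comm v y))))

+ᵥ-cong : ∀ {x y u v} → x ≈ᵥ y → u ≈ᵥ v → x +ᵥ u ≈ᵥ y +ᵥ v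
+ᵥ-cong (p , q) (r , s) = +ᵥ-mono p r , +ᵥ-mono q s

𝕍-group : AbelianGroup 0ℓ 0ℓ
𝕍-group = record
  { Carrier = 𝕍 ; _≈_ = _≈ᵥ_ ; _∙_ = _+ᵥ_ ; ε = 0ᵥ ; _⁻¹ = -ᵥ_
  ; isAbelianGroup = record
    { isGroup = record
      { isMonoid = record
        { isSemigroup = record
          { isMagma = record
            { isEquivalence = record { refl = ≈ᵥ-refl ; sym = ≈ᵥ-sym ; trans = ≈ᵥ-trans }
            ; ∙-cong = +ᵥ-cong
            }
          ; assoc = +ᵥ-assoc
          }
        ; identity = +ᵥ-identityˡ , λ x → ≈ᵥ-trans (+ᵥ-comm x 0ᵥ) (+ᵥ-identityˡ x)
        }
      ; inverse = -ᵥ-inverseˡ , λ x → ≈ᵥ-trans (+ᵥ-comm x (-ᵥ x)) (-ᵥ-inverseˡ x)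
      ; ⁻¹-cong = λ (p , q) → -ᵥ-anti q , -ᵥ-anti p
      }
    ; comm = +ᵥ-comm
    }
  }

open AbelianGroup 𝕍-group using () renaming
  ( commutativeMonoid to 𝕍-monoid; identityʳ to +ᵥ-identityʳ; inverseʳ to -ᵥ-inverseʳ; setoid to 𝕍-setoid)
open Mult 𝕍-monoid using ()
  renaming (×-congʳ to ·-congʳ; ×-congˡ to ·-congˡ; ×-homo-+ to ·-homo-+; ×-homo-1 to ·-homo-1; ×-assocˡ to ·-assocˡ; ×-distrib-+ to ·-distrib-+)

·-mono : ∀ n {x y} → x ≤ᵥ y → n · x ≤ᵥ n · y
·-mono zero    x≤y = ≤ᵥ-refl
·-mono (suc n) x≤y = +ᵥ-mono x≤y (·-mono n x≤y)

infixl 6 _-ᵥ_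
_-ᵥ_ : 𝕍 → 𝕍 → 𝕍
x -ᵥ y = x +ᵥ (-ᵥ y)

𝕍-preorder : Preorder 0ℓ 0ℓ 0ℓ
𝕍-preorder = record
  { Carrier = 𝕍 ; _≈_ = _≈ᵥ_ ; _≲_ = _≤ᵥ_
  ; isPreorder = record
    { isEquivalence = AbelianGroup.isEquivalence 𝕍-group ; reflexive = proj₁ ; trans = ≤ᵥ-trans }
  }

import Relation.Binary.Reasoning.Setoid 𝕍-setoid as S

module 𝕍-Reasoning where
  open import Relation.Binary.Reasoning.Preorder 𝕍-preorder public

+ᵥ-cancelʳ-≤ : ∀ {x y} z → x +ᵥ z ≤ᵥ y +ᵥ z → x ≤ᵥ y
+ᵥ-cancelʳ-≤ {x} {y} z le = ≤ᵥ-trans (proj₂ (undo x)) (≤ᵥ-trans (+ᵥ-monoˡ (-ᵥ z) le) (proj₁ (undo y)))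
  where
  undo : ∀ x → (x +ᵥ z) +ᵥ (-ᵥ z) ≈ᵥ x
  undo x = ≈ᵥ-trans (+ᵥ-assoc x z (-ᵥ z)) (≈ᵥ-trans (+ᵥ-cong ≈ᵥ-refl (-ᵥ-inverseʳ z)) (+ᵥ-identityʳ x))

open import Algebra.Properties.CommutativeSemigroup (CommutativeMonoid.commutativeSemigroup 𝕍-monoid)
  using () renaming (interchange to +ᵥ-interchange)

-- Linear arithmetic over 𝕍: a goal l ⊑ r follows from hypotheses lᵢ ⊑ rᵢ with multipliers cᵢ as soon as
-- l + Σ cᵢ rᵢ and r + Σ cᵢ lᵢ have the same normal form.
module Linear where

  infixl 6 _:+_ _:-_
  infixr 8 _:·_
  infix  5 _⊑_

  data Expr (n : ℕ) : Set where
    var  : Fin n → Expr n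
    :0   : Expr n
    _:+_ _:-_ : Expr n → Expr n → Expr n
    _:·_ : ℕ → Expr n → Expr n

  data Ineq (n : ℕ) : Set where
    _⊑_ : Expr n → Expr n → Ineq n

  ⟦_⟧ : ∀ {n} → Expr n → Vec 𝕍 n → 𝕍
  ⟦ var i  ⟧ ρ = lookup ρ i
  ⟦ :0     ⟧ ρ = 0ᵥ
  ⟦ a :+ b ⟧ ρ = ⟦ a ⟧ ρ +ᵥ ⟦ b ⟧ ρ
  ⟦ a :- b ⟧ ρ = ⟦ a ⟧ ρ -ᵥ ⟦ b ⟧ ρ
  ⟦ k :· a ⟧ ρ = k · ⟦ a ⟧ ρ

  Holds : ∀ {n} → Vec 𝕍 n → Ineq n → Set
  Holds ρ (a ⊑ b) = ⟦ a ⟧ ρ ≤ᵥ ⟦ b ⟧ ρ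

  _⊞_ : ∀ {n} → Vec ℕ n → Vec ℕ n → Vec ℕ n
  _⊞_ = zipWith _+_

  -- Coefficients are natural numbers because `·` takes natural multiples, so an expression with
  -- subtractions is represented as the difference of a positive and a negative part.
  pos neg : ∀ {n} → Expr n → Vec ℕ n
  pos (var zero)    = 1 ∷ replicate _ 0
  pos (var (suc i)) = 0 ∷ pos (var i)
  pos :0            = replicate _ 0
  pos (a :+ b)      = pos a ⊞ pos b
  pos (a :- b)      = pos a ⊞ neg b
  pos (k :· a)      = Vec.map (k *_) (pos a)
  neg (var i)       = replicate _ 0
  neg :0            = replicate _ 0
  neg (a :+ b)      = neg a ⊞ neg b
  neg (a :- b)      = neg a ⊞ pos b
  neg (k :· a)      = Vec.map (k *_) (neg a)

  eval : ∀ {n} → Vec ℕ n → Vec 𝕍 n → 𝕍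
  eval []       []      = 0ᵥ
  eval (k ∷ ks) (x ∷ ρ) = k · x +ᵥ eval ks ρ

  eval-0 : ∀ {n} (ρ : Vec 𝕍 n) → eval (replicate n 0) ρ ≈ᵥ 0ᵥ
  eval-0 []      = ≈ᵥ-refl
  eval-0 (x ∷ ρ) = ≈ᵥ-trans (+ᵥ-identityˡ _) (eval-0 ρ)

  eval-⊞ : ∀ {n} (j k : Vec ℕ n) ρ → eval (j ⊞ k) ρ ≈ᵥ eval j ρ +ᵥ eval k ρ
  eval-⊞ []      []      []      = ≈ᵥ-sym (+ᵥ-identityˡ 0ᵥ)
  eval-⊞ (j ∷ js) (k ∷ ks) (x ∷ ρ) =
    ≈ᵥ-trans (+ᵥ-cong (·-homo-+ x j k) (eval-⊞ js ks ρ)) (+ᵥ-interchange (j · x) (k · x) (eval js ρ) (eval ks ρ))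

  eval-· : ∀ {n} c (k : Vec ℕ n) ρ → eval (Vec.map (c *_) k) ρ ≈ᵥ c · eval k ρ
  eval-· c []       []      = ≈ᵥ-sym (·-0 c)
    where
    ·-0 : ∀ c → c · 0ᵥ ≈ᵥ 0ᵥ
    ·-0 zero    = ≈ᵥ-refl
    ·-0 (suc c) = ≈ᵥ-trans (+ᵥ-identityˡ _) (·-0 c)
  eval-· c (k ∷ ks) (x ∷ ρ) = ≈ᵥ-trans (+ᵥ-cong (≈ᵥ-sym (·-assocˡ x c k)) (eval-· c ks ρ))
    (≈ᵥ-sym (·-distrib-+ (k · x) (eval ks ρ) c))

  cancel-neg : ∀ b x p → b +ᵥ x ≈ᵥ p → (-ᵥ b) +ᵥ p ≈ᵥ x
  cancel-neg b x p eq = ≈ᵥ-trans (+ᵥ-cong ≈ᵥ-refl (≈ᵥ-sym eq)) (≈ᵥ-trans (≈ᵥ-sym (+ᵥ-assoc (-ᵥ b) b x))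
    (≈ᵥ-trans (+ᵥ-cong (-ᵥ-inverseˡ b) ≈ᵥ-refl) (+ᵥ-identityˡ x)))

  correct : ∀ {n} (e : Expr n) ρ → ⟦ e ⟧ ρ +ᵥ eval (neg e) ρ ≈ᵥ eval (pos e) ρ
  correct (var i)  ρ = ≈ᵥ-trans (+ᵥ-cong ≈ᵥ-refl (eval-0 ρ)) (≈ᵥ-trans (+ᵥ-identityʳ _) (unit i ρ))
    where
    unit : ∀ {n} (i : Fin n) ρ → lookup ρ i ≈ᵥ eval (pos (var i)) ρ
    unit zero    (x ∷ ρ) = ≈ᵥ-sym (≈ᵥ-trans (+ᵥ-cong (·-homo-1 x) (eval-0 ρ)) (+ᵥ-identityʳ x))
    unit (suc i) (x ∷ ρ) = ≈ᵥ-trans (unit i ρ) (≈ᵥ-sym (+ᵥ-identityˡ _))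
  correct :0       ρ = +ᵥ-identityˡ _
  correct (a :+ b) ρ = ≈ᵥ-trans (+ᵥ-cong ≈ᵥ-refl (eval-⊞ (neg a) (neg b) ρ))
    (≈ᵥ-trans (+ᵥ-interchange (⟦ a ⟧ ρ) (⟦ b ⟧ ρ) _ _)
    (≈ᵥ-trans (+ᵥ-cong (correct a ρ) (correct b ρ)) (≈ᵥ-sym (eval-⊞ (pos a) (pos b) ρ))))
  correct (a :- b) ρ = ≈ᵥ-trans (+ᵥ-cong ≈ᵥ-refl (eval-⊞ (neg a) (pos b) ρ))
    (≈ᵥ-trans (+ᵥ-interchange (⟦ a ⟧ ρ) (-ᵥ ⟦ b ⟧ ρ) _ _)
    (≈ᵥ-trans (+ᵥ-cong (correct a ρ) (cancel-neg (⟦ b ⟧ ρ) _ _ (correct b ρ))) (≈ᵥ-sym (eval-⊞ (pos a) (neg b) ρ))))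
  correct (k :· a) ρ = ≈ᵥ-trans (+ᵥ-cong ≈ᵥ-refl (eval-· k (neg a) ρ))
    (≈ᵥ-trans (≈ᵥ-sym (·-distrib-+ (⟦ a ⟧ ρ) (eval (neg a) ρ) k))
    (≈ᵥ-trans (·-congʳ k (correct a ρ)) (≈ᵥ-sym (eval-· k (pos a) ρ))))

  lhs rhs : ∀ {n} → List (ℕ × Ineq n) → Expr n
  lhs []                  = :0
  lhs ((c , l ⊑ r) ∷ hs) = c :· l :+ lhs hs
  rhs []                  = :0
  rhs ((c , l ⊑ r) ∷ hs) = c :· r :+ rhs hs

  combine : ∀ {n} (ρ : Vec 𝕍 n) hs → All (λ h → Holds ρ (proj₂ h)) hs → ⟦ lhs hs ⟧ ρ ≤ᵥ ⟦ rhs hs ⟧ ρ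
  combine ρ []                 []       = ≤ᵥ-refl
  combine ρ ((c , l ⊑ r) ∷ hs) (p ∷ ps) = +ᵥ-mono (·-mono c p) (combine ρ hs ps)

  -- The two normal forms are compared after each negative part has been moved to the other side.
  -- With concrete expressions and multipliers both vectors are closed numerals, and `refl` decides
  -- the equation.
  Certificate : ∀ {n} → Ineq n → List (ℕ × Ineq n) → Set
  Certificate (l ⊑ r) hs =
    pos (l :+ rhs hs) ⊞ neg (r :+ lhs hs) ≡ pos (r :+ lhs hs) ⊞ neg (l :+ rhs hs)

  by : ∀ {n} (ρ : Vec 𝕍 n) (g : Ineq n) (hs : List (ℕ × Ineq n)) →
       Certificate g hs → All (λ h → Holds ρ (proj₂ h)) hs → Holds ρ g
  by ρ (l ⊑ r) hs check ps = +ᵥ-cancelʳ-≤ (eval (neg e₁) ρ) (+ᵥ-cancelʳ-≤ (⟦ rhs hs ⟧ ρ) (begin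
    (⟦ l ⟧ ρ +ᵥ n₁) +ᵥ ⟦ rhs hs ⟧ ρ  ≈⟨ shuffle (⟦ l ⟧ ρ) n₁ _ ⟩
    ⟦ e₁ ⟧ ρ +ᵥ n₁                   ≈⟨ same ⟩
    ⟦ e₂ ⟧ ρ +ᵥ n₁                   ≈⟨ shuffle (⟦ r ⟧ ρ) n₁ _ ⟨
    (⟦ r ⟧ ρ +ᵥ n₁) +ᵥ ⟦ lhs hs ⟧ ρ  ≲⟨ +ᵥ-mono ≤ᵥ-refl (combine ρ hs ps) ⟩
    (⟦ r ⟧ ρ +ᵥ n₁) +ᵥ ⟦ rhs hs ⟧ ρ  ∎))
    where
    open 𝕍-Reasoning
    e₁ = l :+ rhs hs
    e₂ = r :+ lhs hs
    n₁ = eval (neg e₁) ρ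
    n₂ = eval (neg e₂) ρ
    shuffle : ∀ x y z → (x +ᵥ y) +ᵥ z ≈ᵥ (x +ᵥ z) +ᵥ y
    shuffle x y z = ≈ᵥ-trans (+ᵥ-assoc x y z) (≈ᵥ-trans (+ᵥ-cong ≈ᵥ-refl (+ᵥ-comm y z)) (≈ᵥ-sym (+ᵥ-assoc x z y)))
    twice : (⟦ e₁ ⟧ ρ +ᵥ n₁) +ᵥ n₂ ≈ᵥ (⟦ e₂ ⟧ ρ +ᵥ n₁) +ᵥ n₂
    twice = S.begin
      (⟦ e₁ ⟧ ρ +ᵥ n₁) +ᵥ n₂             S.≈⟨ +ᵥ-cong (correct e₁ ρ) ≈ᵥ-refl ⟩
      eval (pos e₁) ρ +ᵥ n₂             S.≈⟨ eval-⊞ (pos e₁) (neg e₂) ρ ⟨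
      eval (pos e₁ ⊞ neg e₂) ρ          S.≡⟨ cong (λ v → eval v ρ) check ⟩
      eval (pos e₂ ⊞ neg e₁) ρ          S.≈⟨ eval-⊞ (pos e₂) (neg e₁) ρ ⟩
      eval (pos e₂) ρ +ᵥ n₁             S.≈⟨ +ᵥ-cong (correct e₂ ρ) ≈ᵥ-refl ⟨
      (⟦ e₂ ⟧ ρ +ᵥ n₂) +ᵥ n₁             S.≈⟨ shuffle _ n₂ n₁ ⟩
      (⟦ e₂ ⟧ ρ +ᵥ n₁) +ᵥ n₂             S.∎
    same : ⟦ e₁ ⟧ ρ +ᵥ n₁ ≈ᵥ ⟦ e₂ ⟧ ρ +ᵥ n₁
    same = +ᵥ-cancelʳ-≤ n₂ (proj₁ twice) , +ᵥ-cancelʳ-≤ n₂ (proj₂ twice)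

-- Finite sums

import Algebra.Properties.Group (AbelianGroup.group 𝕍-group) as 𝕍G

record Finite (A : Set) : Set where
  infix 4 _≟_
  field
    elements : List A
    complete : ∀ a → a ∈ elements
    unique   : Unique elements
    _≟_      : DecidableEquality A

open Finite {{...}} using (_≟_)

instance
  ×-finite : ∀ {A B} {{_ : Finite A}} {{_ : Finite B}} → Finite (A × B)
  ×-finite {{F}} {{F′}} = record
    { elements = cartesianProduct (Finite.elements F) (Finite.elements F′)
    ; complete = λ (a , b) → ∈-cartesianProduct⁺ (Finite.complete F a) (Finite.complete F′ b)
    ; unique   = Unique.cartesianProduct⁺ (Finite.unique F) (Finite.unique F′)
    ; _≟_      = ≡-dec (Finite._≟_ F) (Finite._≟_ F′)
    }

instance
  parity-finite : Finite Parity
  parity-finite = record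
    { elements = SampleSpace.elements scalars ; complete = SampleSpace.complete scalars
    ; unique = SampleSpace.unique scalars ; _≟_ = Parity._≟_ }

𝟙 : ∀ {P : Set} → Dec P → ℕ
𝟙 (yes _) = 1
𝟙 (no  _) = 0

𝟙-cong : ∀ {P Q : Set} → (P → Q) → (Q → P) → (p? : Dec P) (q? : Dec Q) → 𝟙 p? ≡ 𝟙 q?
𝟙-cong f g (yes p) (yes q) = refl
𝟙-cong f g (yes p) (no ¬q) = contradiction (f p) ¬q
𝟙-cong f g (no ¬p) (yes q) = contradiction (g q) ¬p
𝟙-cong f g (no ¬p) (no ¬q) = refl

𝟙-mono : ∀ {P Q : Set} → (P → Q) → (p? : Dec P) (q? : Dec Q) → 𝟙 p? ≤ 𝟙 q?
𝟙-mono f (yes p) (yes q) = ℕ.≤-refl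
𝟙-mono f (yes p) (no ¬q) = contradiction (f p) ¬q
𝟙-mono f (no ¬p) q?      = z≤n

𝟙≤1 : ∀ {P : Set} (p? : Dec P) → 𝟙 p? ≤ 1
𝟙≤1 (yes _) = ℕ.≤-refl
𝟙≤1 (no  _) = z≤n

𝟙-yes : ∀ {P : Set} → P → (p? : Dec P) → 𝟙 p? ≡ 1
𝟙-yes p (yes _) = refl
𝟙-yes p (no ¬p) = contradiction p ¬p

𝟙-no : ∀ {P : Set} → ¬ P → (p? : Dec P) → 𝟙 p? ≡ 0
𝟙-no ¬p (yes p) = contradiction p ¬p
𝟙-no ¬p (no _)  = refl

𝟙-× : ∀ {P Q : Set} (p? : Dec P) (q? : Dec Q) (pq? : Dec (P × Q)) → 𝟙 pq? ≡ 𝟙 p? * 𝟙 q?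
𝟙-× (yes p) (yes q) pq? = 𝟙-yes (p , q) pq?
𝟙-× (yes p) (no ¬q) pq? = 𝟙-no (¬q ∘ proj₂) pq?
𝟙-× (no ¬p) q?      pq? = 𝟙-no (¬p ∘ proj₁) pq?

δ : ∀ {A : Set} {{_ : Finite A}} → A → A → ℕ
δ a b = 𝟙 (a ≟ b)

δ-refl : ∀ {A : Set} {{_ : Finite A}} (a : A) → δ a a ≡ 1
δ-refl a = 𝟙-yes refl (a ≟ a)

δ-sym : ∀ {A : Set} {{_ : Finite A}} (a b : A) → δ a b ≡ δ b a
δ-sym a b = 𝟙-cong sym sym (a ≟ b) (b ≟ a)

-- One development serves sums of weights in ℕ and sums of logarithms in 𝕍. A monoid has no
-- multiplication, so indicator functions act through the natural multiples `✦`.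
module FiniteSum (M : CommutativeMonoid 0ℓ 0ℓ) where

  open CommutativeMonoid M using (Carrier; _≈_; _∙_; ε; ∙-cong; ∙-congˡ; identityˡ; identityʳ; assoc; setoid)
    renaming (refl to ≈-refl; sym to ≈-sym; trans to ≈-trans)
  open import Algebra.Properties.CommutativeSemigroup (CommutativeMonoid.commutativeSemigroup M) using (interchange)
  open Mult M using (×-distrib-+; ×-homo-+; ×-homo-1) renaming (_×_ to _✦_)

  sumL : ∀ {A : Set} → List A → (A → Carrier) → Carrier
  sumL []       f = ε
  sumL (x ∷ xs) f = f x ∙ sumL xs f

  sumL-cong : ∀ {A : Set} (xs : List A) {f g : A → Carrier} → (∀ x → f x ≈ g x) → sumL xs f ≈ sumL xs g
  sumL-cong []       eq = ≈-refl
  sumL-cong (x ∷ xs) eq = ∙-cong (eq x) (sumL-cong xs eq)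

  sumL-ε : ∀ {A : Set} (xs : List A) → sumL xs (λ _ → ε) ≈ ε
  sumL-ε []       = ≈-refl
  sumL-ε (x ∷ xs) = ≈-trans (identityˡ _) (sumL-ε xs)

  sumL-∙ : ∀ {A : Set} (xs : List A) (f g : A → Carrier) → sumL xs (λ x → f x ∙ g x) ≈ sumL xs f ∙ sumL xs g
  sumL-∙ []       f g = ≈-sym (identityˡ ε)
  sumL-∙ (x ∷ xs) f g = ≈-trans (∙-congˡ (sumL-∙ xs f g)) (interchange (f x) (g x) (sumL xs f) (sumL xs g))

  sumL-swap : ∀ {A B : Set} (xs : List A) (ys : List B) (f : A → B → Carrier) →
              sumL xs (λ x → sumL ys (f x)) ≈ sumL ys (λ y → sumL xs (λ x → f x y))
  sumL-swap []       ys f = ≈-sym (sumL-ε ys)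
  sumL-swap (x ∷ xs) ys f = ≈-trans (∙-congˡ (sumL-swap xs ys f)) (≈-sym (sumL-∙ ys (f x) _))

  sumL-++ : ∀ {A : Set} (xs ys : List A) (f : A → Carrier) → sumL (xs ++ ys) f ≈ sumL xs f ∙ sumL ys f
  sumL-++ []       ys f = ≈-sym (identityˡ _)
  sumL-++ (x ∷ xs) ys f = ≈-trans (∙-congˡ (sumL-++ xs ys f)) (≈-sym (assoc (f x) (sumL xs f) (sumL ys f)))

  sumL-map : ∀ {A B : Set} (φ : A → B) (xs : List A) (f : B → Carrier) → sumL (map φ xs) f ≈ sumL xs (f ∘ φ)
  sumL-map φ []       f = ≈-refl
  sumL-map φ (x ∷ xs) f = ∙-congˡ (sumL-map φ xs f)

  sumL-× : ∀ {A B : Set} (xs : List A) (ys : List B) (f : A × B → Carrier) →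
           sumL (cartesianProduct xs ys) f ≈ sumL xs (λ x → sumL ys (λ y → f (x , y)))
  sumL-× []       ys f = ≈-refl
  sumL-× (x ∷ xs) ys f = ≈-trans (sumL-++ (map (x ,_) ys) (cartesianProduct xs ys) f)
    (∙-cong (sumL-map (x ,_) ys f) (sumL-× xs ys f))

  sumL-✦ : ∀ {A : Set} (xs : List A) n (f : A → Carrier) → sumL xs (λ x → n ✦ f x) ≈ n ✦ sumL xs f
  sumL-✦ xs zero    f = sumL-ε xs
  sumL-✦ xs (suc n) f = ≈-trans (sumL-∙ xs f _) (∙-congˡ (sumL-✦ xs n f))

  ∑ : ∀ {A : Set} {{_ : Finite A}} → (A → Carrier) → Carrier
  ∑ {{F}} = sumL (Finite.elements F)

  module _ {A : Set} {{F : Finite A}} where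

    private xs = Finite.elements F

    ∑-cong : {f g : A → Carrier} → (∀ x → f x ≈ g x) → ∑ f ≈ ∑ g
    ∑-cong = sumL-cong xs

    ∑-ε : ∑ {A} (λ _ → ε) ≈ ε
    ∑-ε = sumL-ε xs

    ∑-∙ : (f g : A → Carrier) → ∑ (λ x → f x ∙ g x) ≈ ∑ f ∙ ∑ g
    ∑-∙ = sumL-∙ xs

    ∑-✦ : ∀ n (f : A → Carrier) → ∑ (λ x → n ✦ f x) ≈ n ✦ ∑ f
    ∑-✦ = sumL-✦ xs

    ∑-δ : ∀ a (f : A → Carrier) → ∑ (λ x → δ x a ✦ f x) ≈ f a
    ∑-δ a f = go xs (Finite.unique F) (Finite.complete F a)
      where
      absent : ∀ ys → All (λ y → ¬ a ≡ y) ys → sumL ys (λ x → δ x a ✦ f x) ≈ ε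
      absent []       []         = ≈-refl
      absent (y ∷ ys) (a≢y ∷ ps) rewrite 𝟙-no (a≢y ∘ sym) (y ≟ a) = ≈-trans (identityˡ _) (absent ys ps)
      go : ∀ ys → Unique ys → a ∈ ys → sumL ys (λ x → δ x a ✦ f x) ≈ f a
      go (y ∷ ys) (new AllPairs.∷ _) (here refl) rewrite δ-refl a =
        ≈-trans (∙-cong (×-homo-1 (f a)) (absent ys new)) (identityʳ (f a))
      go (y ∷ ys) (new AllPairs.∷ u) (there a∈ys) rewrite 𝟙-no (All.lookup new a∈ys) (y ≟ a) =
        ≈-trans (identityˡ _) (go ys u a∈ys)

  module _ {A B : Set} {{F : Finite A}} {{F′ : Finite B}} where

    ∑-swap : (f : A → B → Carrier) → ∑ (λ x → ∑ (f x)) ≈ ∑ (λ y → ∑ (λ x → f x y))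
    ∑-swap = sumL-swap (Finite.elements F) (Finite.elements F′)

    ∑-× : (f : A × B → Carrier) → ∑ f ≈ ∑ (λ x → ∑ (λ y → f (x , y)))
    ∑-× = sumL-× (Finite.elements F) (Finite.elements F′)

    ∑-fibre : (X : A → B) (f : A → Carrier) → ∑ f ≈ ∑ (λ b → ∑ (λ a → δ (X a) b ✦ f a))
    ∑-fibre X f = ≈-trans (∑-cong (λ a → ≈-sym (≈-trans (∑-cong (λ b → flip a b)) (∑-δ (X a) (λ _ → f a)))))
      (∑-swap (λ a b → δ (X a) b ✦ f a))
      where
      flip : ∀ a b → δ (X a) b ✦ f a ≈ δ b (X a) ✦ f a
      flip a b rewrite δ-sym (X a) b = ≈-refl

    ∑-bijection : (φ : A → B) (ψ : B → A) → (∀ a → ψ (φ a) ≡ a) → (∀ b → φ (ψ b) ≡ b) →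
                  (f : B → Carrier) → ∑ (f ∘ φ) ≈ ∑ f
    ∑-bijection φ ψ ψφ φψ f = ≈-trans (∑-fibre φ (f ∘ φ)) (∑-cong λ b →
      ≈-trans (∑-cong (swap b)) (≈-trans (∑-δ (ψ b) (f ∘ φ)) (reflexive (cong f (φψ b)))))
      where
      open CommutativeMonoid M using (reflexive)
      swap : ∀ b a → δ (φ a) b ✦ f (φ a) ≈ δ a (ψ b) ✦ f (φ a)
      swap b a rewrite 𝟙-cong {φ a ≡ b} {a ≡ ψ b} (λ eq → trans (sym (ψφ a)) (cong ψ eq))
                 (λ eq → trans (cong φ eq) (φψ b)) (φ a ≟ b) (a ≟ ψ b) = ≈-refl

open FiniteSum ℕ.+-0-commutativeMonoid using (∑)
private module ℕΣ = FiniteSum ℕ.+-0-commutativeMonoid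
open FiniteSum 𝕍-monoid using () renaming (∑ to ∑ᵥ)
module 𝕍Σ = FiniteSum 𝕍-monoid

module _ where
  open Mult ℕ.+-0-commutativeMonoid using () renaming (_×_ to _✦_)

  ✦≡* : ∀ n m → n ✦ m ≡ n * m
  ✦≡* zero    m = refl
  ✦≡* (suc n) m = cong (_+_ m) (✦≡* n m)

module _ {A : Set} {{F : Finite A}} where

  ∑-cong : {f g : A → ℕ} → (∀ x → f x ≡ g x) → ∑ f ≡ ∑ g
  ∑-cong = ℕΣ.∑-cong

  ∑-+ : (f g : A → ℕ) → ∑ (λ x → f x + g x) ≡ ∑ f + ∑ g
  ∑-+ = ℕΣ.∑-∙

  ∑-*ˡ : ∀ n (f : A → ℕ) → ∑ (λ x → n * f x) ≡ n * ∑ f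
  ∑-*ˡ n f = trans (∑-cong (λ x → sym (✦≡* n (f x)))) (trans (ℕΣ.∑-✦ n f) (✦≡* n (∑ f)))

  ∑-*ʳ : ∀ n (f : A → ℕ) → ∑ (λ x → f x * n) ≡ ∑ f * n
  ∑-*ʳ n f = trans (∑-cong (λ x → ℕ.*-comm (f x) n)) (trans (∑-*ˡ n f) (ℕ.*-comm n (∑ f)))

  ∑-δ : ∀ a (f : A → ℕ) → ∑ (λ x → δ x a * f x) ≡ f a
  ∑-δ a f = trans (∑-cong (λ x → sym (✦≡* (δ x a) (f x)))) (ℕΣ.∑-δ a f)

  private
    sumL-mono : ∀ (xs : List A) {f g : A → ℕ} → (∀ x → f x ≤ g x) → ℕΣ.sumL xs f ≤ ℕΣ.sumL xs g
    sumL-mono []       le = z≤n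
    sumL-mono (x ∷ xs) le = ℕ.+-mono-≤ (le x) (sumL-mono xs le)

    sumL-∈ : ∀ {xs : List A} {a} → a ∈ xs → (f : A → ℕ) → f a ≤ ℕΣ.sumL xs f
    sumL-∈ (here refl)          f = ℕ.m≤m+n _ _
    sumL-∈ {x ∷ xs} (there a∈xs) f = ℕ.≤-trans (sumL-∈ a∈xs f) (ℕ.m≤n+m _ (f x))

    sumL-mono-ᵥ : ∀ (xs : List A) {f g : A → 𝕍} → (∀ x → f x ≤ᵥ g x) → 𝕍Σ.sumL xs f ≤ᵥ 𝕍Σ.sumL xs g
    sumL-mono-ᵥ []       le = ≤ᵥ-refl
    sumL-mono-ᵥ (x ∷ xs) le = +ᵥ-mono (le x) (sumL-mono-ᵥ xs le)

    sumL-·ʳ : ∀ (xs : List A) (f : A → ℕ) v → 𝕍Σ.sumL xs (λ x → f x · v) ≈ᵥ ℕΣ.sumL xs f · v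
    sumL-·ʳ []       f v = ≈ᵥ-refl
    sumL-·ʳ (x ∷ xs) f v = ≈ᵥ-trans (+ᵥ-cong ≈ᵥ-refl (sumL-·ʳ xs f v)) (≈ᵥ-sym (·-homo-+ v (f x) (ℕΣ.sumL xs f)))

  ∑-mono : {f g : A → ℕ} → (∀ x → f x ≤ g x) → ∑ f ≤ ∑ g
  ∑-mono = sumL-mono (Finite.elements F)

  ∑-≥ : ∀ a (f : A → ℕ) → f a ≤ ∑ f
  ∑-≥ a f = sumL-∈ (Finite.complete F a) f

  ∑ᵥ-mono : {f g : A → 𝕍} → (∀ x → f x ≤ᵥ g x) → ∑ᵥ f ≤ᵥ ∑ᵥ g
  ∑ᵥ-mono = sumL-mono-ᵥ (Finite.elements F)

  ∑ᵥ-·ʳ : ∀ (f : A → ℕ) v → ∑ᵥ (λ x → f x · v) ≈ᵥ ∑ f · v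
  ∑ᵥ-·ʳ = sumL-·ʳ (Finite.elements F)

  ∑ᵥ-neg : (f : A → 𝕍) → ∑ᵥ (λ x → -ᵥ f x) ≈ᵥ -ᵥ ∑ᵥ f
  ∑ᵥ-neg f = ≈ᵥ-sym (inverseˡ-unique _ _ (≈ᵥ-trans (≈ᵥ-sym (𝕍Σ.∑-∙ f (λ x → -ᵥ f x)))
    (≈ᵥ-trans (𝕍Σ.∑-cong (λ x → -ᵥ-inverseʳ (f x))) (𝕍Σ.∑-ε {A}))))
    where
    inverseˡ-unique : ∀ x y → x +ᵥ y ≈ᵥ 0ᵥ → -ᵥ x ≈ᵥ y
    inverseˡ-unique x y eq = ≈ᵥ-sym (𝕍G.inverseʳ-unique x y eq)

  ∑ᵥ-- : (f g : A → 𝕍) → ∑ᵥ (λ x → f x -ᵥ g x) ≈ᵥ ∑ᵥ f -ᵥ ∑ᵥ g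
  ∑ᵥ-- f g = ≈ᵥ-trans (𝕍Σ.∑-∙ f (λ x → -ᵥ g x)) (+ᵥ-cong ≈ᵥ-refl (∑ᵥ-neg g))

module _ {A B : Set} {{F : Finite A}} {{F′ : Finite B}} where

  ∑-swap : (f : A → B → ℕ) → ∑ (λ x → ∑ (f x)) ≡ ∑ (λ y → ∑ (λ x → f x y))
  ∑-swap = ℕΣ.∑-swap

  ∑-× : (f : A × B → ℕ) → ∑ f ≡ ∑ (λ x → ∑ (λ y → f (x , y)))
  ∑-× = ℕΣ.∑-×

  ∑-bijection : (φ : A → B) (ψ : B → A) → (∀ a → ψ (φ a) ≡ a) → (∀ b → φ (ψ b) ≡ b) →
                (f : B → ℕ) → ∑ (f ∘ φ) ≡ ∑ f
  ∑-bijection = ℕΣ.∑-bijection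

  ∑-fibre : (X : A → B) (f : A → ℕ) → ∑ f ≡ ∑ (λ b → ∑ (λ a → δ (X a) b * f a))
  ∑-fibre X f = trans (ℕΣ.∑-fibre X f) (∑-cong (λ b → ∑-cong (λ a → ✦≡* (δ (X a) b) (f a))))

open Linear using (_:+_; _:-_; _:·_; _⊑_; var; :0; by)

pattern v₀ = var zero
pattern v₁ = var (suc zero)
pattern v₂ = var (suc (suc zero))
pattern v₃ = var (suc (suc (suc zero)))
pattern v₄ = var (suc (suc (suc (suc zero))))
pattern v₅ = var (suc (suc (suc (suc (suc zero)))))
pattern v₆ = var (suc (suc (suc (suc (suc (suc zero))))))
pattern v₇ = var (suc (suc (suc (suc (suc (suc (suc zero)))))))
pattern v₈ = var (suc (suc (suc (suc (suc (suc (suc (suc zero))))))))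
pattern v₉ = var (suc (suc (suc (suc (suc (suc (suc (suc (suc zero)))))))))
pattern v₁₀ = var (suc (suc (suc (suc (suc (suc (suc (suc (suc (suc zero))))))))))
pattern v₁₁ = var (suc (suc (suc (suc (suc (suc (suc (suc (suc (suc (suc zero)))))))))))
pattern v₁₂ = var (suc (suc (suc (suc (suc (suc (suc (suc (suc (suc (suc (suc zero))))))))))))
pattern v₁₃ = var (suc (suc (suc (suc (suc (suc (suc (suc (suc (suc (suc (suc (suc zero)))))))))))))
pattern v₁₄ = var (suc (suc (suc (suc (suc (suc (suc (suc (suc (suc (suc (suc (suc (suc zero))))))))))))))
pattern v₁₅ = var (suc (suc (suc (suc (suc (suc (suc (suc (suc (suc (suc (suc (suc (suc (suc zero)))))))))))))))
pattern v₁₆ = var (suc (suc (suc (suc (suc (suc (suc (suc (suc (suc (suc (suc (suc (suc (suc (suc zero))))))))))))))))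
pattern v₁₇ = var (suc (suc (suc (suc (suc (suc (suc (suc (suc (suc (suc (suc (suc (suc (suc (suc (suc zero)))))))))))))))))
pattern v₁₈ = var (suc (suc (suc (suc (suc (suc (suc (suc (suc (suc (suc (suc (suc (suc (suc (suc (suc (suc zero))))))))))))))))))
pattern v₁₉ = var (suc (suc (suc (suc (suc (suc (suc (suc (suc (suc (suc (suc (suc (suc (suc (suc (suc (suc (suc zero)))))))))))))))))))

-- Laws of the logarithm and the log-sum inequality.

log-1 : log 1 ≈ᵥ 0ᵥ
log-1 = by (log 1 ∷ []) (v₀ ⊑ :0) ((1 , v₀ :+ v₀ ⊑ v₀) ∷ []) refl (proj₂ (log-* 1 1) ∷ [])
      , by (log 1 ∷ []) (:0 ⊑ v₀) ((1 , v₀ ⊑ v₀ :+ v₀) ∷ []) refl (proj₁ (log-* 1 1) ∷ [])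

log≥0 : ∀ n .{{_ : NonZero n}} → 0ᵥ ≤ᵥ log n
log≥0 (suc n) = ≤ᵥ-trans (proj₂ log-1) (log-mono {1} {suc n} (s≤s z≤n))

log-^ : ∀ m n .{{_ : NonZero m}} → log (m ^ n) ≈ᵥ n · log m
log-^ m zero    = log-1
log-^ m (suc n) = ≈ᵥ-trans (log-* m (m ^ n)) (+ᵥ-cong ≈ᵥ-refl (log-^ m n))
  where instance _ = ℕ.m^n≢0 m n

÷-mono : ∀ n .{{_ : NonZero n}} {x y} → x ≤ᵥ y → x ÷ n ≤ᵥ y ÷ n
÷-mono n {x} {y} x≤y = ·-cancel n (≤ᵥ-trans (proj₁ (·-÷ n x)) (≤ᵥ-trans x≤y (proj₂ (·-÷ n y))))

÷-cong : ∀ n .{{_ : NonZero n}} {x y} → x ≈ᵥ y → x ÷ n ≈ᵥ y ÷ n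
÷-cong n (p , q) = ÷-mono n p , ÷-mono n q

·-cancel-≈ : ∀ n .{{_ : NonZero n}} {x y} → n · x ≈ᵥ n · y → x ≈ᵥ y
·-cancel-≈ n (p , q) = ·-cancel n p , ·-cancel n q

÷-+ : ∀ n .{{_ : NonZero n}} x y → (x +ᵥ y) ÷ n ≈ᵥ (x ÷ n) +ᵥ (y ÷ n)
÷-+ n x y = ·-cancel-≈ n (≈ᵥ-trans (·-÷ n (x +ᵥ y)) (≈ᵥ-trans (+ᵥ-cong (≈ᵥ-sym (·-÷ n x)) (≈ᵥ-sym (·-÷ n y)))
  (≈ᵥ-sym (·-distrib-+ (x ÷ n) (y ÷ n) n))))

·-distrib-- : ∀ n x y → n · (x -ᵥ y) ≈ᵥ n · x -ᵥ n · y
·-distrib-- n x y = by ρ (v₀ ⊑ v₁ :- v₂) ((1 , v₀ :+ v₂ ⊑ v₁) ∷ []) refl (proj₁ eq ∷ [])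
                  , by ρ (v₁ :- v₂ ⊑ v₀) ((1 , v₁ ⊑ v₀ :+ v₂) ∷ []) refl (proj₂ eq ∷ [])
  where
  ρ = n · (x -ᵥ y) ∷ n · x ∷ n · y ∷ []
  eq : n · (x -ᵥ y) +ᵥ n · y ≈ᵥ n · x
  eq = ≈ᵥ-trans (≈ᵥ-sym (·-distrib-+ (x -ᵥ y) y n)) (·-congʳ n
    (by (x ∷ y ∷ []) ((v₀ :- v₁) :+ v₁ ⊑ v₀) [] refl [] , by (x ∷ y ∷ []) (v₀ ⊑ (v₀ :- v₁) :+ v₁) [] refl []))

-- The logarithm of `weighted-AM-GM` with weights p and P at the points q / p and Q / P. Both points
-- are multiplied by p P to clear denominators; the powers of p P then cancel.
log-sum₂-pos : ∀ p q P Q .{{_ : NonZero p}} .{{_ : NonZero q}} .{{_ : NonZero P}} .{{_ : NonZero Q}} →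
  p · log q +ᵥ P · log Q +ᵥ (p + P) · log (p + P) ≤ᵥ (p + P) · log (q + Q) +ᵥ p · log p +ᵥ P · log P
log-sum₂-pos p q P Q =
  by (p · log q ∷ P · log Q ∷ n · log n ∷ n · log (q + Q) ∷ p · log p ∷ P · log P ∷ p · log P ∷ P · log p ∷
      log (a * b * n ^ n) ∷ log ((p * x + P * y) ^ n) ∷ [])
    (v₀ :+ v₁ :+ v₂ ⊑ v₃ :+ v₄ :+ v₅)
    ((1 , (v₀ :+ v₆) :+ (v₁ :+ v₇) :+ v₂ ⊑ v₈) ∷ (1 , v₈ ⊑ v₉) ∷ (1 , v₉ ⊑ ((v₄ :+ v₇) :+ (v₆ :+ v₅)) :+ v₃) ∷ []) refl
    (proj₂ lower ∷ log-mono {{abn≢0}} (weighted-AM-GM p P x y) ∷ proj₁ upper ∷ [])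
  where
  n = p + P
  x = q * P
  y = Q * p
  a = x ^ p
  b = y ^ P
  instance
    x≢0 = ℕ.m*n≢0 q P
    y≢0 = ℕ.m*n≢0 Q p
    n≢0 = ℕ.>-nonZero (ℕ.≤-trans (ℕ.>-nonZero⁻¹ p) (ℕ.m≤m+n p P))
    q+Q≢0 = ℕ.>-nonZero (ℕ.≤-trans (ℕ.>-nonZero⁻¹ q) (ℕ.m≤m+n q Q))
    a≢0 = ℕ.m^n≢0 x p
    b≢0 = ℕ.m^n≢0 y P
    n^n≢0′ = ℕ.m^n≢0 n n
    ab≢0 = ℕ.m*n≢0 a b
    pP≢0 = ℕ.m*n≢0 p P
    abn≢0 = ℕ.m*n≢0 (a * b) (n ^ n)
  power : ∀ u v k .{{_ : NonZero u}} .{{_ : NonZero v}} → log ((u * v) ^ k) ≈ᵥ k · log u +ᵥ k · log v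
  power u v k = ≈ᵥ-trans (log-^ (u * v) k {{ℕ.m*n≢0 u v}})
    (≈ᵥ-trans (·-congʳ k (log-* u v)) (·-distrib-+ (log u) (log v) k))
  lower : log (a * b * n ^ n) ≈ᵥ (p · log q +ᵥ p · log P) +ᵥ (P · log Q +ᵥ P · log p) +ᵥ n · log n
  lower = ≈ᵥ-trans (log-* (a * b) (n ^ n)) (+ᵥ-cong (≈ᵥ-trans (log-* a b) (+ᵥ-cong (power q P p) (power Q p P))) (log-^ n n))
  regroup : ∀ p q P Q → p * (q * P) + P * (Q * p) ≡ (p * P) * (q + Q)
  regroup = solve-∀
  upper : log ((p * x + P * y) ^ n) ≈ᵥ ((p · log p +ᵥ P · log p) +ᵥ (p · log P +ᵥ P · log P)) +ᵥ n · log (q + Q)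
  upper = ≈ᵥ-trans (subst (λ z → log ((p * x + P * y) ^ n) ≈ᵥ log (z ^ n)) (regroup p q P Q) ≈ᵥ-refl) (≈ᵥ-trans (power (p * P) (q + Q) n) (+ᵥ-cong
    (≈ᵥ-trans (·-congʳ n (log-* p P)) (≈ᵥ-trans (·-distrib-+ (log p) (log P) n)
      (+ᵥ-cong (·-homo-+ (log p) p P) (·-homo-+ (log P) p P)))) ≈ᵥ-refl))

-- Absolute continuity settles the cases with zeros: a term with p = 0 vanishes on the left, and its
-- q can only increase the logarithm on the right.
log-sum₂ : ∀ p q P Q → (q ≡ 0 → p ≡ 0) → (Q ≡ 0 → P ≡ 0) →
  p · log q +ᵥ P · log Q +ᵥ (p + P) · log (p + P) ≤ᵥ (p + P) · log (q + Q) +ᵥ p · log p +ᵥ P · log P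
log-sum₂ zero q P Q _ Q≡0⇒P≡0 = by (P · log Q ∷ P · log P ∷ P · log (q + Q) ∷ [])
  (:0 :+ v₀ :+ v₁ ⊑ v₂ :+ :0 :+ v₁) ((1 , v₀ ⊑ v₂) ∷ []) refl (grow P Q Q≡0⇒P≡0 ∷ [])
  where
  grow : ∀ P Q → (Q ≡ 0 → P ≡ 0) → P · log Q ≤ᵥ P · log (q + Q)
  grow P zero    imp rewrite imp refl = ≤ᵥ-refl
  grow P (suc Q) imp = ·-mono P (log-mono (ℕ.m≤n+m (suc Q) q))
log-sum₂ p@(suc _) zero    P Q imp _ with () ← imp refl
log-sum₂ p@(suc _) q@(suc _) zero Q _ _ = go p (p + 0) (ℕ.+-identityʳ p)
  where
  go : ∀ p n → n ≡ p → p · log q +ᵥ 0ᵥ +ᵥ n · log n ≤ᵥ n · log (q + Q) +ᵥ p · log p +ᵥ 0ᵥ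
  go p .p refl = by (p · log q ∷ p · log p ∷ p · log (q + Q) ∷ []) (v₀ :+ :0 :+ v₁ ⊑ v₂ :+ v₁ :+ :0)
    ((1 , v₀ ⊑ v₂) ∷ []) refl (·-mono p (log-mono (ℕ.m≤m+n q Q)) ∷ [])
log-sum₂ p@(suc _) q@(suc _) P@(suc _) zero    _ imp with () ← imp refl
log-sum₂ p@(suc _) q@(suc _) P@(suc _) Q@(suc _) _ _ = log-sum₂-pos p q P Q

module _ {A : Set} (p q : A → ℕ) (q≡0⇒p≡0 : ∀ a → q a ≡ 0 → p a ≡ 0) where

  private
    S = FiniteSum.sumL ℕ.+-0-commutativeMonoid
    Sᵥ = 𝕍Σ.sumL

  log-sum-list : ∀ xs → Sᵥ xs (λ a → p a · log (q a)) +ᵥ S xs p · log (S xs p) ≤ᵥ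
                        S xs p · log (S xs q) +ᵥ Sᵥ xs (λ a → p a · log (p a))
  log-sum-list []       = ≤ᵥ-refl
  log-sum-list (a ∷ xs) =
    by (p a · log (q a) ∷ P · log Q ∷ n · log n ∷ n · log (q a + Q) ∷ p a · log (p a) ∷ P · log P ∷
        Sᵥ xs (λ a → p a · log (q a)) ∷ Sᵥ xs (λ a → p a · log (p a)) ∷ [])
      ((v₀ :+ v₆) :+ v₂ ⊑ v₃ :+ (v₄ :+ v₇))
      ((1 , v₀ :+ v₁ :+ v₂ ⊑ v₃ :+ v₄ :+ v₅) ∷ (1 , v₆ :+ v₅ ⊑ v₁ :+ v₇) ∷ []) refl
      (log-sum₂ (p a) (q a) P Q (q≡0⇒p≡0 a) (zero-sum xs) ∷ log-sum-list xs ∷ [])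
    where
    P = S xs p
    Q = S xs q
    n = p a + P
    zero-sum : ∀ xs → S xs q ≡ 0 → S xs p ≡ 0
    zero-sum []       _  = refl
    zero-sum (a ∷ xs) eq rewrite q≡0⇒p≡0 a (ℕ.m+n≡0⇒m≡0 (q a) eq) = zero-sum xs (ℕ.m+n≡0⇒n≡0 (q a) eq)

-- Gibbs' inequality for unnormalised weights: relative entropy is nonnegative. The bound by the
-- size of the range, submodularity and the concentration estimate all rest on it.
log-sum : ∀ {A} {{_ : Finite A}} (p q : A → ℕ) → (∀ a → q a ≡ 0 → p a ≡ 0) →
          ∑ᵥ (λ a → p a · log (q a)) +ᵥ ∑ p · log (∑ p) ≤ᵥ ∑ p · log (∑ q) +ᵥ ∑ᵥ (λ a → p a · log (p a))
log-sum {{F}} p q imp = log-sum-list p q imp (Finite.elements F)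

-- Entropy

δ-× : ∀ {A B : Set} {{_ : Finite A}} {{_ : Finite B}} (a c : A) (b d : B) → δ (a , b) (c , d) ≡ δ a c * δ b d
δ-× a c b d = trans (𝟙-cong (λ { refl → refl , refl }) (λ { (refl , refl) → refl }) ((a , b) ≟ (c , d)) (a ≟ c ×-dec b ≟ d))
  (𝟙-× (a ≟ c) (b ≟ d) (a ≟ c ×-dec b ≟ d))

·-zero : ∀ n → n · 0ᵥ ≈ᵥ 0ᵥ
·-zero zero    = ≈ᵥ-refl
·-zero (suc n) = ≈ᵥ-trans (+ᵥ-identityˡ _) (·-zero n)

-ᵥ-cong : ∀ {x y} → x ≈ᵥ y → -ᵥ x ≈ᵥ -ᵥ y
-ᵥ-cong = AbelianGroup.⁻¹-cong 𝕍-group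

·-zero-or : ∀ n {x y} → (NonZero n → x ≈ᵥ y) → n · x ≈ᵥ n · y
·-zero-or zero    eq = ≈ᵥ-refl
·-zero-or (suc n) eq = ·-congʳ (suc n) (eq _)

·-zero-or-≤ : ∀ n {x y} → (NonZero n → x ≤ᵥ y) → n · x ≤ᵥ n · y
·-zero-or-≤ zero    le = ≤ᵥ-refl
·-zero-or-≤ (suc n) le = ·-mono (suc n) (le _)

NonZero-≤ : ∀ {m n} → .{{NonZero m}} → m ≤ n → NonZero n
NonZero-≤ {m} m≤n = ℕ.>-nonZero (ℕ.≤-trans (ℕ.>-nonZero⁻¹ m) m≤n)

∑-*-∑ : ∀ {A B : Set} {{_ : Finite A}} {{_ : Finite B}} (f : A → ℕ) (g : B → ℕ) →
        ∑ (λ (a , b) → f a * g b) ≡ ∑ f * ∑ g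
∑-*-∑ f g = trans (∑-× (λ (a , b) → f a * g b)) (trans (∑-cong (λ a → ∑-*ˡ (f a) g)) (∑-*ʳ (∑ g) f))

infixr 7 _⊠_
_⊠_ : ∀ {A B : Set} → (A → ℕ) → (B → ℕ) → A × B → ℕ
(p ⊠ q) (a , b) = p a * q b

module _ {Ω B : Set} {{_ : Finite Ω}} {{_ : Finite B}} where

  law : (Ω → ℕ) → (Ω → B) → B → ℕ
  law w X b = ∑ (λ ω → δ (X ω) b * w ω)

  law-cong : ∀ {w w′ X X′} → (∀ ω → w ω ≡ w′ ω) → (∀ ω → X ω ≡ X′ ω) → ∀ b → law w X b ≡ law w′ X′ b
  law-cong w≗w′ X≗X′ b = ∑-cong (λ ω → cong₂ _*_ (cong (λ x → δ x b) (X≗X′ ω)) (w≗w′ ω))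

  law-≥ : ∀ w X ω → w ω ≤ law w X (X ω)
  law-≥ w X ω = ℕ.≤-trans (ℕ.≤-reflexive (sym (trans (cong (_* w ω) (δ-refl (X ω))) (ℕ.*-identityˡ (w ω)))))
    (∑-≥ ω (λ ω′ → δ (X ω′) (X ω) * w ω′))

  ∑-law-* : ∀ w X (g : B → ℕ) → ∑ (λ b → law w X b * g b) ≡ ∑ (λ ω → w ω * g (X ω))
  ∑-law-* w X g = sym (trans (∑-fibre X (λ ω → w ω * g (X ω))) (∑-cong λ b →
    trans (∑-cong (λ ω → trans (at ω b) (sym (ℕ.*-assoc (δ (X ω) b) (w ω) (g b))))) (∑-*ʳ (g b) (λ ω → δ (X ω) b * w ω))))
    where
    at : ∀ ω b → δ (X ω) b * (w ω * g (X ω)) ≡ δ (X ω) b * (w ω * g b)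
    at ω b with X ω ≟ b
    ... | yes refl = refl
    ... | no  _    = refl

  ∑ᵥ-law : ∀ w X (φ : B → 𝕍) → ∑ᵥ (λ b → law w X b · φ b) ≈ᵥ ∑ᵥ (λ ω → w ω · φ (X ω))
  ∑ᵥ-law w X φ = ≈ᵥ-sym (≈ᵥ-trans (𝕍Σ.∑-fibre X (λ ω → w ω · φ (X ω))) (𝕍Σ.∑-cong λ b →
    ≈ᵥ-trans (𝕍Σ.∑-cong (λ ω → at ω b)) (∑ᵥ-·ʳ (λ ω → δ (X ω) b * w ω) (φ b))))
    where
    at : ∀ ω b → δ (X ω) b · w ω · φ (X ω) ≈ᵥ (δ (X ω) b * w ω) · φ b
    at ω b with X ω ≟ b
    ... | yes refl = ·-assocˡ (φ (X ω)) 1 (w ω)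
    ... | no  _    = ≈ᵥ-refl

  ∑-law : ∀ w X → ∑ (law w X) ≡ ∑ w
  ∑-law w X = trans (∑-cong (λ b → sym (ℕ.*-identityʳ (law w X b))))
    (trans (∑-law-* w X (λ _ → 1)) (∑-cong (λ ω → ℕ.*-identityʳ (w ω))))

  law≤∑ : ∀ w X b → law w X b ≤ ∑ w
  law≤∑ w X b = ∑-mono (λ ω → ℕ.≤-trans (ℕ.*-monoˡ-≤ (w ω) (𝟙≤1 (X ω ≟ b))) (ℕ.≤-reflexive (ℕ.*-identityˡ (w ω))))

  -- The entropy of X under the probability proportional to w is log (∑ w) - log-likelihood w X / ∑ w.
  log-likelihood : (Ω → ℕ) → (Ω → B) → 𝕍
  log-likelihood w X = ∑ᵥ (λ ω → w ω · log (law w X (X ω)))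

  log-likelihood-cong : ∀ {w w′ X X′} → (∀ ω → w ω ≡ w′ ω) → (∀ ω → X ω ≡ X′ ω) →
                        log-likelihood w X ≈ᵥ log-likelihood w′ X′
  log-likelihood-cong {w} {w′} {X} {X′} w≗w′ X≗X′ = 𝕍Σ.∑-cong (λ ω → ≡⇒≈ (cong₂ (λ n l → n · log l) (w≗w′ ω)
    (trans (law-cong w≗w′ X≗X′ (X ω)) (cong (law w′ X′) (X≗X′ ω)))))
    where
    ≡⇒≈ : ∀ {x y} → x ≡ y → x ≈ᵥ y
    ≡⇒≈ refl = ≈ᵥ-refl

  opaque
    entropy : (Ω → ℕ) → (Ω → B) → 𝕍
    entropy w X = log (∑ w) -ᵥ (log-likelihood w X ÷ ∑ w)

    entropy-def : ∀ w X {n} → ∑ w ≡ n → entropy w X ≈ᵥ log n -ᵥ (log-likelihood w X ÷ n)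
    entropy-def w X refl = ≈ᵥ-refl

  opaque
    unfolding entropy

    -- The form of the definition without division. It holds for mass 0 as well, so empty fibres
    -- need not be excluded from averages.
    mass-entropy : ∀ w X → ∑ w · entropy w X ≈ᵥ ∑ w · log (∑ w) -ᵥ log-likelihood w X
    mass-entropy w X with ∑ w in eq
    ... | zero    = ≈ᵥ-trans (≈ᵥ-sym (-ᵥ-inverseʳ 0ᵥ)) (+ᵥ-cong ≈ᵥ-refl (-ᵥ-cong (≈ᵥ-sym zero-sum)))
      where
      w≡0 : ∀ ω → w ω ≡ 0
      w≡0 ω = ℕ.n≤0⇒n≡0 (ℕ.≤-trans (∑-≥ ω w) (ℕ.≤-reflexive eq))
      zero-sum : log-likelihood w X ≈ᵥ 0ᵥ
      zero-sum = ≈ᵥ-trans (𝕍Σ.∑-cong at) (𝕍Σ.∑-ε {Ω})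
        where
        at : ∀ ω → w ω · log (law w X (X ω)) ≈ᵥ 0ᵥ
        at ω rewrite w≡0 ω = ≈ᵥ-refl
    ... | n@(suc _) = ≈ᵥ-trans (·-distrib-- n (log n) (log-likelihood w X ÷ n)) (+ᵥ-cong ≈ᵥ-refl (-ᵥ-cong (·-÷ n (log-likelihood w X))))

  entropy-from-≤ : ∀ {w X v} .{{_ : NonZero (∑ w)}} → ∑ w · log (∑ w) -ᵥ log-likelihood w X ≤ᵥ ∑ w · v → entropy w X ≤ᵥ v
  entropy-from-≤ {w} {X} le = ·-cancel (∑ w) (≤ᵥ-trans (proj₁ (mass-entropy w X)) le)

  opaque
    unfolding entropy

    entropy-cong : ∀ {w w′ X X′} → (∀ ω → w ω ≡ w′ ω) → (∀ ω → X ω ≡ X′ ω) → .{{_ : NonZero (∑ w)}} →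
                   entropy w X ≈ᵥ entropy w′ X′
    entropy-cong {w} {w′} {X} {X′} w≗w′ X≗X′ rewrite sym (∑-cong w≗w′) =
      +ᵥ-cong ≈ᵥ-refl (-ᵥ-cong (÷-cong (∑ w) (log-likelihood-cong w≗w′ X≗X′)))

  entropy≥0 : ∀ w X .{{_ : NonZero (∑ w)}} → 0ᵥ ≤ᵥ entropy w X
  entropy≥0 w X = ·-cancel (∑ w) (by (∑ w · 0ᵥ ∷ ∑ w · entropy w X ∷ ∑ w · log (∑ w) ∷ log-likelihood w X ∷ []) (v₀ ⊑ v₁)
    ((1 , v₀ ⊑ :0) ∷ (1 , v₃ ⊑ v₂) ∷ (1 , v₂ :- v₃ ⊑ v₁) ∷ []) refl
    (proj₁ (·-zero (∑ w)) ∷ bound ∷ proj₂ (mass-entropy w X) ∷ []))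
    where
    bound : log-likelihood w X ≤ᵥ ∑ w · log (∑ w)
    bound = ≤ᵥ-trans (∑ᵥ-mono (λ ω → ·-zero-or-≤ (w ω) (λ w≢0 →
      log-mono {{NonZero-≤ {{w≢0}} (law-≥ w X ω)}} (law≤∑ w X (X ω))))) (proj₁ (∑ᵥ-·ʳ w (log (∑ w))))

  entropy≤log-range : ∀ w X .{{_ : NonZero (∑ w)}} → entropy w X ≤ᵥ log (∑ {B} (λ _ → 1))
  entropy≤log-range w X = entropy-from-≤ {w} {X} (by (n · log n ∷ log-likelihood w X ∷ n · log (∑ {B} (λ _ → 1)) ∷
      ∑ᵥ (λ b → law w X b · log 1) ∷ ∑ᵥ (λ b → law w X b · log (law w X b)) ∷ [])
    (v₀ :- v₁ ⊑ v₂) ((1 , v₃ :+ v₀ ⊑ v₂ :+ v₄) ∷ (1 , :0 ⊑ v₃) ∷ (1 , v₄ ⊑ v₁) ∷ []) refl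
    ( subst (λ k → ∑ᵥ (λ b → law w X b · log 1) +ᵥ k · log k ≤ᵥ k · log (∑ {B} (λ _ → 1)) +ᵥ ∑ᵥ (λ b → law w X b · log (law w X b)))
        (∑-law w X) (log-sum (law w X) (λ _ → 1) (λ b ()))
    ∷ ≤ᵥ-trans (proj₂ (·-zero (∑ (law w X)))) (≤ᵥ-trans (·-mono (∑ (law w X)) (proj₂ log-1)) (proj₂ (∑ᵥ-·ʳ (law w X) (log 1))))
    ∷ proj₁ (∑ᵥ-law w X (log ∘ law w X)) ∷ []))
    where
    n = ∑ w

module _ {Ω B C : Set} {{_ : Finite Ω}} {{_ : Finite B}} {{_ : Finite C}} where

  law-∘ : ∀ (w : Ω → ℕ) (X : Ω → B) (Y : B → C) c → law (law w X) Y c ≡ law w (Y ∘ X) c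
  law-∘ w X Y c = trans (∑-cong (λ b → ℕ.*-comm (δ (Y b) c) (law w X b)))
    (trans (∑-law-* w X (λ b → δ (Y b) c)) (∑-cong (λ ω → ℕ.*-comm (w ω) (δ (Y (X ω)) c))))

  log-likelihood-law : ∀ (w : Ω → ℕ) (X : Ω → B) (Y : B → C) → log-likelihood (law w X) Y ≈ᵥ log-likelihood w (Y ∘ X)
  log-likelihood-law w X Y = ≈ᵥ-trans (∑ᵥ-law w X (λ b → log (law (law w X) Y (Y b))))
    (𝕍Σ.∑-cong (λ ω → subst (λ n → w ω · log n ≈ᵥ w ω · log (law w (Y ∘ X) (Y (X ω)))) (sym (law-∘ w X Y (Y (X ω)))) ≈ᵥ-refl))

  opaque
    unfolding entropy

    entropy-law : ∀ (w : Ω → ℕ) (X : Ω → B) (Y : B → C) .{{_ : NonZero (∑ w)}} → entropy (law w X) Y ≈ᵥ entropy w (Y ∘ X)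
    entropy-law w X Y rewrite ∑-law w X = +ᵥ-cong ≈ᵥ-refl (-ᵥ-cong (÷-cong (∑ w) (log-likelihood-law w X Y)))

  log-likelihood-refine : ∀ (w : Ω → ℕ) (X : Ω → B) (Y : Ω → C) →
    (∀ ω ω′ → NonZero (w ω) → NonZero (w ω′) → Y ω ≡ Y ω′ → X ω ≡ X ω′) → log-likelihood w Y ≤ᵥ log-likelihood w X
  log-likelihood-refine w X Y Y⇒X = ∑ᵥ-mono (λ ω → ·-zero-or-≤ (w ω) (λ w≢0 →
    log-mono {{NonZero-≤ {{w≢0}} (law-≥ w Y ω)}}
      (∑-mono (λ ω′ → *-zero-or-≤ (w ω′) (λ w′≢0 → 𝟙-mono (Y⇒X ω′ ω w′≢0 w≢0) (Y ω′ ≟ Y ω) (X ω′ ≟ X ω))))))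
    where
    *-zero-or-≤ : ∀ n {a b} → (NonZero n → a ≤ b) → a * n ≤ b * n
    *-zero-or-≤ zero    {a} {b} le = ℕ.≤-reflexive (trans (ℕ.*-zeroʳ a) (sym (ℕ.*-zeroʳ b)))
    *-zero-or-≤ (suc n) le = ℕ.*-monoˡ-≤ (suc n) (le _)

  opaque
    unfolding entropy

    -- On the support, each fibre of Y lies in a fibre of X, so the law of X is pointwise the larger
    -- one. That Y determines X is asked on the support only: this is how lying on a graph or in a
    -- coset becomes an entropy bound.
    entropy-refine : ∀ (w : Ω → ℕ) (X : Ω → B) (Y : Ω → C) .{{_ : NonZero (∑ w)}} →
                     (∀ ω ω′ → NonZero (w ω) → NonZero (w ω′) → Y ω ≡ Y ω′ → X ω ≡ X ω′) → entropy w X ≤ᵥ entropy w Y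
    entropy-refine w X Y Y⇒X = by (log (∑ w) ∷ log-likelihood w X ÷ ∑ w ∷ log-likelihood w Y ÷ ∑ w ∷ []) (v₀ :- v₁ ⊑ v₀ :- v₂)
      ((1 , v₂ ⊑ v₁) ∷ []) refl (÷-mono (∑ w) (log-likelihood-refine w X Y Y⇒X) ∷ [])

  entropy-function : ∀ (w : Ω → ℕ) (X : Ω → B) (Y : Ω → C) .{{_ : NonZero (∑ w)}} (α : C → B) → (∀ ω → α (Y ω) ≡ X ω) →
                     entropy w X ≤ᵥ entropy w Y
  entropy-function w X Y α eq = entropy-refine w X Y (λ ω ω′ _ _ Y≡ → trans (sym (eq ω)) (trans (cong α Y≡) (eq ω′)))

entropy-iso : ∀ {Ω B C : Set} {{_ : Finite Ω}} {{_ : Finite B}} {{_ : Finite C}}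
  (w : Ω → ℕ) (X : Ω → B) (Y : Ω → C) .{{_ : NonZero (∑ w)}} (α : C → B) (β : B → C) →
  (∀ ω → α (Y ω) ≡ X ω) → (∀ ω → β (X ω) ≡ Y ω) → entropy w X ≈ᵥ entropy w Y
entropy-iso w X Y α β eq eq′ = entropy-function w X Y α eq , entropy-function w Y X β eq′

instance
  ⊤-finite : Finite ⊤
  ⊤-finite = record { elements = tt ∷ [] ; complete = λ _ → here refl ; unique = [] AllPairs.∷ AllPairs.[] ; _≟_ = λ _ _ → yes refl }

module _ {Ω A B : Set} {{_ : Finite Ω}} {{_ : Finite A}} {{_ : Finite B}} (w : Ω → ℕ) (X : Ω → A) (Y : Ω → B) where

  law-marginalʳ : ∀ b → ∑ (λ a → law w < X , Y > (a , b)) ≡ law w Y b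
  law-marginalʳ b = trans (∑-swap (λ a ω → δ (X ω , Y ω) (a , b) * w ω)) (∑-cong (λ ω →
    trans (∑-cong (λ a → trans (cong (_* w ω) (trans (δ-× (X ω) a (Y ω) b) (cong (_* δ (Y ω) b) (δ-sym (X ω) a))))
                                (ℕ.*-assoc (δ a (X ω)) (δ (Y ω) b) (w ω))))
          (∑-δ (X ω) (λ _ → δ (Y ω) b * w ω))))

  law-marginalˡ : ∀ a → ∑ (λ b → law w < X , Y > (a , b)) ≡ law w X a
  law-marginalˡ a = trans (∑-swap (λ b ω → δ (X ω , Y ω) (a , b) * w ω)) (∑-cong (λ ω →
    trans (∑-cong (λ b → trans (cong (_* w ω) (trans (δ-× (X ω) a (Y ω) b) (trans (ℕ.*-comm (δ (X ω) a) (δ (Y ω) b)) (cong (_* δ (X ω) a) (δ-sym (Y ω) b)))))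
                                (ℕ.*-assoc (δ b (Y ω)) (δ (X ω) a) (w ω))))
          (∑-δ (Y ω) (λ _ → δ (X ω) a * w ω))))

module _ {Ω A B C : Set} {{_ : Finite Ω}} {{_ : Finite A}} {{_ : Finite B}} {{_ : Finite C}}
         (w : Ω → ℕ) (X : Ω → A) (Y : Ω → B) (Z : Ω → C) where

  private
    T : Ω → C × (A × B)
    T = < Z , < X , Y > >
    p : C × (A × B) → ℕ
    p = law w T
    a : C → A → ℕ
    a z x = law w < X , Z > (x , z)
    b : C → B → ℕ
    b z y = law w < Y , Z > (y , z)
    c : C → ℕ
    c = law w Z

    p≤a : ∀ z x y → p (z , (x , y)) ≤ a z x
    p≤a z x y = ∑-mono (λ ω → ℕ.*-monoˡ-≤ (w ω) (𝟙-mono (λ { refl → refl }) (T ω ≟ (z , (x , y))) ((X ω , Z ω) ≟ (x , z))))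

    p≤b : ∀ z x y → p (z , (x , y)) ≤ b z y
    p≤b z x y = ∑-mono (λ ω → ℕ.*-monoˡ-≤ (w ω) (𝟙-mono (λ { refl → refl }) (T ω ≟ (z , (x , y))) ((Y ω , Z ω) ≟ (y , z))))

    φ : C × (A × B) → 𝕍
    φ (z , (x , y)) = log (a z x) +ᵥ log (b z y)

    at : ∀ z → ∑ᵥ (λ i → p (z , i) · φ (z , i)) ≤ᵥ c z · log (c z) +ᵥ ∑ᵥ (λ i → p (z , i) · log (p (z , i)))
    at z = by (∑ᵥ (λ i → p (z , i) · φ (z , i)) ∷ ∑ᵥ (λ i → p (z , i) · log (q i)) ∷ c z · log (c z) ∷
               c z · log (c z * c z) ∷ ∑ᵥ (λ i → p (z , i) · log (p (z , i))) ∷ [])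
      (v₀ ⊑ v₂ :+ v₄) ((1 , v₀ ⊑ v₁) ∷ (1 , v₁ :+ v₂ ⊑ v₃ :+ v₄) ∷ (1 , v₃ ⊑ v₂ :+ v₂) ∷ []) refl
      (∑ᵥ-mono (λ (x , y) → proj₂ (split x y)) ∷ gibbs ∷ proj₁ square ∷ [])
      where
      q : A × B → ℕ
      q (x , y) = a z x * b z y
      split : ∀ x y → p (z , (x , y)) · log (q (x , y)) ≈ᵥ p (z , (x , y)) · φ (z , (x , y))
      split x y = ·-zero-or (p (z , (x , y))) (λ p≢0 →
        log-* (a z x) (b z y) {{NonZero-≤ {{p≢0}} (p≤a z x y)}} {{NonZero-≤ {{p≢0}} (p≤b z x y)}})
      square : c z · log (c z * c z) ≈ᵥ c z · log (c z) +ᵥ c z · log (c z)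
      square = ≈ᵥ-trans (·-zero-or (c z) (λ c≢0 → log-* (c z) (c z) {{c≢0}} {{c≢0}})) (·-distrib-+ (log (c z)) (log (c z)) (c z))
      absolutely-continuous : ∀ i → q i ≡ 0 → p (z , i) ≡ 0
      absolutely-continuous (x , y) q≡0 with ℕ.m*n≡0⇒m≡0∨n≡0 (a z x) q≡0
      ... | inj₁ a≡0 = ℕ.n≤0⇒n≡0 (ℕ.≤-trans (p≤a z x y) (ℕ.≤-reflexive a≡0))
      ... | inj₂ b≡0 = ℕ.n≤0⇒n≡0 (ℕ.≤-trans (p≤b z x y) (ℕ.≤-reflexive b≡0))
      total-q : ∑ q ≡ c z * c z
      total-q = trans (∑-*-∑ (a z) (b z)) (cong₂ _*_ (law-marginalʳ w X Z z) (law-marginalʳ w Y Z z))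
      gibbs : ∑ᵥ (λ i → p (z , i) · log (q i)) +ᵥ c z · log (c z) ≤ᵥ c z · log (c z * c z) +ᵥ ∑ᵥ (λ i → p (z , i) · log (p (z , i)))
      gibbs = subst₂ (λ P Q → ∑ᵥ (λ i → p (z , i) · log (q i)) +ᵥ P · log P ≤ᵥ P · log Q +ᵥ ∑ᵥ (λ i → p (z , i) · log (p (z , i))))
        (law-marginalˡ w Z < X , Y > z) total-q (log-sum (λ i → p (z , i)) q absolutely-continuous)

  -- Nonnegativity of the mutual information of X and Y given Z. For each z, Gibbs' inequality
  -- compares the joint law p (z , _) of mass c z with the product of its marginals, of mass c z * c
  -- z; the results are summed over z.
  log-likelihood-submodular : log-likelihood w < X , Z > +ᵥ log-likelihood w < Y , Z > ≤ᵥ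
                              log-likelihood w < Z , < X , Y > > +ᵥ log-likelihood w Z
  log-likelihood-submodular = begin
    log-likelihood w < X , Z > +ᵥ log-likelihood w < Y , Z >             ≈⟨ 𝕍Σ.∑-∙ (λ ω → w ω · log (a (Z ω) (X ω))) (λ ω → w ω · log (b (Z ω) (Y ω))) ⟨
    ∑ᵥ (λ ω → w ω · log (a (Z ω) (X ω)) +ᵥ w ω · log (b (Z ω) (Y ω)))   ≈⟨ 𝕍Σ.∑-cong (λ ω → ·-distrib-+ (log (a (Z ω) (X ω))) (log (b (Z ω) (Y ω))) (w ω)) ⟨
    ∑ᵥ (λ ω → w ω · φ (T ω))                                            ≈⟨ ∑ᵥ-law w T φ ⟨
    ∑ᵥ (λ t → p t · φ t)                                                ≈⟨ 𝕍Σ.∑-× (λ t → p t · φ t) ⟩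
    ∑ᵥ (λ z → ∑ᵥ (λ i → p (z , i) · φ (z , i)))                          ≲⟨ ∑ᵥ-mono at ⟩
    ∑ᵥ (λ z → c z · log (c z) +ᵥ ∑ᵥ (λ i → p (z , i) · log (p (z , i)))) ≈⟨ 𝕍Σ.∑-∙ (λ z → c z · log (c z)) (λ z → ∑ᵥ (λ i → p (z , i) · log (p (z , i)))) ⟩
    ∑ᵥ (λ z → c z · log (c z)) +ᵥ ∑ᵥ (λ z → ∑ᵥ (λ i → p (z , i) · log (p (z , i)))) ≈⟨ +ᵥ-cong (∑ᵥ-law w Z (log ∘ c)) (≈ᵥ-trans (≈ᵥ-sym (𝕍Σ.∑-× (λ t → p t · log (p t)))) (∑ᵥ-law w T (log ∘ p))) ⟩
    log-likelihood w Z +ᵥ log-likelihood w T                             ≈⟨ +ᵥ-comm (log-likelihood w Z) (log-likelihood w T) ⟩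
    log-likelihood w T +ᵥ log-likelihood w Z                             ∎
    where open 𝕍-Reasoning

  entropy-submodular : .{{_ : NonZero (∑ w)}} →
    entropy w < Z , < X , Y > > +ᵥ entropy w Z ≤ᵥ entropy w < X , Z > +ᵥ entropy w < Y , Z >
  entropy-submodular = by (log W ∷ L₁ ÷ W ∷ L₂ ÷ W ∷ L₃ ÷ W ∷ L₄ ÷ W ∷ (L₁ +ᵥ L₂) ÷ W ∷ (L₃ +ᵥ L₄) ÷ W ∷
      entropy w < X , Z > ∷ entropy w < Y , Z > ∷ entropy w < Z , < X , Y > > ∷ entropy w Z ∷ [])
    (v₉ :+ v₁₀ ⊑ v₇ :+ v₈)
    ((1 , v₁ :+ v₂ ⊑ v₅) ∷ (1 , v₅ ⊑ v₆) ∷ (1 , v₆ ⊑ v₃ :+ v₄) ∷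
     (1 , v₀ :- v₁ ⊑ v₇) ∷ (1 , v₀ :- v₂ ⊑ v₈) ∷ (1 , v₉ ⊑ v₀ :- v₃) ∷ (1 , v₁₀ ⊑ v₀ :- v₄) ∷ []) refl
    (proj₂ (÷-+ W L₁ L₂) ∷ ÷-mono W log-likelihood-submodular ∷ proj₁ (÷-+ W L₃ L₄) ∷
     proj₂ (entropy-def w < X , Z > refl) ∷ proj₂ (entropy-def w < Y , Z > refl) ∷
     proj₁ (entropy-def w < Z , < X , Y > > refl) ∷ proj₁ (entropy-def w Z refl) ∷ [])
    where
    W = ∑ w
    L₁ = log-likelihood w < X , Z >
    L₂ = log-likelihood w < Y , Z >
    L₃ = log-likelihood w < Z , < X , Y > >
    L₄ = log-likelihood w Z

entropy-const : ∀ {Ω} {{_ : Finite Ω}} (w : Ω → ℕ) .{{_ : NonZero (∑ w)}} → entropy w (λ _ → tt) ≈ᵥ 0ᵥ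
entropy-const w = ≤ᵥ-trans (entropy≤log-range w (λ _ → tt)) (proj₁ log-1) , entropy≥0 w (λ _ → tt)

entropy-subadditive : ∀ {Ω A B} {{_ : Finite Ω}} {{_ : Finite A}} {{_ : Finite B}} (w : Ω → ℕ) (X : Ω → A) (Y : Ω → B)
  .{{_ : NonZero (∑ w)}} → entropy w < X , Y > ≤ᵥ entropy w X +ᵥ entropy w Y
entropy-subadditive w X Y = by
  (entropy w < X , Y > ∷ entropy w X ∷ entropy w Y ∷ entropy w < Z , < X , Y > > ∷ entropy w Z ∷ entropy w < X , Z > ∷ entropy w < Y , Z > ∷ [])
  (v₀ ⊑ v₁ :+ v₂) ((1 , v₀ ⊑ v₃) ∷ (1 , v₃ :+ v₄ ⊑ v₅ :+ v₆) ∷ (1 , :0 ⊑ v₄) ∷ (1 , v₅ ⊑ v₁) ∷ (1 , v₆ ⊑ v₂) ∷ []) refl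
  ( entropy-function w < X , Y > < Z , < X , Y > > proj₂ (λ _ → refl) ∷ entropy-submodular w X Y Z ∷ proj₂ (entropy-const w)
  ∷ entropy-function w < X , Z > X (_, tt) (λ _ → refl) ∷ entropy-function w < Y , Z > Y (_, tt) (λ _ → refl) ∷ [])
  where
  Z = λ _ → tt

module _ {Ω Ω′ B : Set} {{_ : Finite Ω}} {{_ : Finite Ω′}} {{_ : Finite B}} where

  entropy-bijection : (φ : Ω′ → Ω) (ψ : Ω → Ω′) → (∀ a → ψ (φ a) ≡ a) → (∀ b → φ (ψ b) ≡ b) →
                      ∀ (w : Ω → ℕ) (X : Ω → B) .{{_ : NonZero (∑ w)}} → entropy (w ∘ φ) (X ∘ φ) ≈ᵥ entropy w X
  entropy-bijection φ ψ ψφ φψ w X = ≈ᵥ-trans (entropy-def (w ∘ φ) (X ∘ φ) (∑-bijection φ ψ ψφ φψ w))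
    (≈ᵥ-trans (+ᵥ-cong ≈ᵥ-refl (-ᵥ-cong (÷-cong (∑ w)
      (≈ᵥ-trans (𝕍Σ.∑-cong (λ ω → ≡⇒≈ (cong (λ n → w (φ ω) · log n) (∑-bijection φ ψ ψφ φψ (λ ω′ → δ (X ω′) (X (φ ω)) * w ω′)))))
        (𝕍Σ.∑-bijection φ ψ ψφ φψ (λ ω → w ω · log (law w X (X ω))))))))
    (≈ᵥ-sym (entropy-def w X refl)))
    where
    ≡⇒≈ : ∀ {x y} → x ≡ y → x ≈ᵥ y
    ≡⇒≈ refl = ≈ᵥ-refl

module _ {A B C D : Set} {{_ : Finite A}} {{_ : Finite B}} {{_ : Finite C}} {{_ : Finite D}}
         (p : A → ℕ) (q : B → ℕ) (X : A → C) (Y : B → D) where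

  private
    Z : A × B → C × D
    Z (a , b) = X a , Y b

  law-⊠ : ∀ x y → law (p ⊠ q) Z (x , y) ≡ law p X x * law q Y y
  law-⊠ x y = trans (∑-cong (λ (a , b) → trans (cong (_* (p a * q b)) (δ-× (X a) x (Y b) y))
      (interchange (δ (X a) x) (δ (Y b) y) (p a) (q b))))
    (∑-*-∑ (λ a → δ (X a) x * p a) (λ b → δ (Y b) y * q b))
    where
    interchange : ∀ a b c d → a * b * (c * d) ≡ a * c * (b * d)
    interchange = solve-∀

  log-likelihood-⊠ : log-likelihood (p ⊠ q) Z ≈ᵥ ∑ q · log-likelihood p X +ᵥ ∑ p · log-likelihood q Y
  log-likelihood-⊠ = S.begin
    log-likelihood (p ⊠ q) Z                               S.≈⟨ 𝕍Σ.∑-cong split ⟩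
    ∑ᵥ (λ (a , b) → q b · u a +ᵥ p a · v b)                S.≈⟨ 𝕍Σ.∑-∙ (λ (a , b) → q b · u a) (λ (a , b) → p a · v b) ⟩
    ∑ᵥ (λ (a , b) → q b · u a) +ᵥ ∑ᵥ (λ (a , b) → p a · v b) S.≈⟨ +ᵥ-cong (𝕍Σ.∑-× (λ (a , b) → q b · u a)) (𝕍Σ.∑-× (λ (a , b) → p a · v b)) ⟩
    ∑ᵥ (λ a → ∑ᵥ (λ b → q b · u a)) +ᵥ ∑ᵥ (λ a → ∑ᵥ (λ b → p a · v b)) S.≈⟨ +ᵥ-cong
        (≈ᵥ-trans (𝕍Σ.∑-cong (λ a → ∑ᵥ-·ʳ q (u a))) (𝕍Σ.∑-✦ (∑ q) u))
        (≈ᵥ-trans (𝕍Σ.∑-cong (λ a → 𝕍Σ.∑-✦ (p a) v)) (∑ᵥ-·ʳ p (∑ᵥ v))) ⟩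
    ∑ q · log-likelihood p X +ᵥ ∑ p · log-likelihood q Y   S.∎
    where
    u : A → 𝕍
    u a = p a · log (law p X (X a))
    v : B → 𝕍
    v b = q b · log (law q Y (Y b))
    split : ∀ ((a , b) : A × B) → (p a * q b) · log (law (p ⊠ q) Z (X a , Y b)) ≈ᵥ q b · u a +ᵥ p a · v b
    split (a , b) = ≈ᵥ-trans (·-zero-or (p a * q b) (λ pq≢0 →
        subst (λ n → log n ≈ᵥ log (law p X (X a)) +ᵥ log (law q Y (Y b))) (sym (law-⊠ (X a) (Y b)))
          (log-* (law p X (X a)) (law q Y (Y b))
            {{NonZero-≤ {{ℕ.m*n≢0⇒m≢0 (p a) {{pq≢0}}}} (law-≥ p X a)}} {{NonZero-≤ {{ℕ.m*n≢0⇒n≢0 (p a) {{pq≢0}}}} (law-≥ q Y b)}})))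
      (≈ᵥ-trans (·-distrib-+ _ _ (p a * q b)) (+ᵥ-cong
        (≈ᵥ-trans (·-congˡ (ℕ.*-comm (p a) (q b))) (≈ᵥ-sym (·-assocˡ _ (q b) (p a))))
        (≈ᵥ-sym (·-assocˡ _ (p a) (q b)))))

  entropy-⊠ : .{{_ : NonZero (∑ p)}} .{{_ : NonZero (∑ q)}} → entropy (p ⊠ q) Z ≈ᵥ entropy p X +ᵥ entropy q Y
  entropy-⊠ =
      by ρ (v₆ ⊑ v₇ :+ v₈) ((1 , v₀ ⊑ v₂ :+ v₄) ∷ (1 , v₃ :+ v₅ ⊑ v₁) ∷
          (1 , v₆ ⊑ v₀ :- v₁) ∷ (1 , v₂ :- v₃ ⊑ v₇) ∷ (1 , v₄ :- v₅ ⊑ v₈) ∷ []) refl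
        (proj₁ (log-* P Q) ∷ proj₂ quotient ∷ proj₁ d ∷ proj₂ dp ∷ proj₂ dq ∷ [])
    , by ρ (v₇ :+ v₈ ⊑ v₆) ((1 , v₂ :+ v₄ ⊑ v₀) ∷ (1 , v₁ ⊑ v₃ :+ v₅) ∷
          (1 , v₀ :- v₁ ⊑ v₆) ∷ (1 , v₇ ⊑ v₂ :- v₃) ∷ (1 , v₈ ⊑ v₄ :- v₅) ∷ []) refl
        (proj₂ (log-* P Q) ∷ proj₁ quotient ∷ proj₂ d ∷ proj₁ dp ∷ proj₁ dq ∷ [])
    where
    P = ∑ p
    Q = ∑ q
    instance _ = ℕ.m*n≢0 P Q
    ρ = log (P * Q) ∷ log-likelihood (p ⊠ q) Z ÷ (P * Q) ∷ log P ∷ log-likelihood p X ÷ P ∷ log Q ∷ log-likelihood q Y ÷ Q ∷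
        entropy (p ⊠ q) Z ∷ entropy p X ∷ entropy q Y ∷ []
    d = entropy-def (p ⊠ q) Z (∑-*-∑ p q)
    dp = entropy-def p X refl
    dq = entropy-def q Y refl
    quotient : log-likelihood (p ⊠ q) Z ÷ (P * Q) ≈ᵥ log-likelihood p X ÷ P +ᵥ log-likelihood q Y ÷ Q
    quotient = ·-cancel-≈ (P * Q) (≈ᵥ-trans (·-÷ (P * Q) _) (≈ᵥ-trans log-likelihood-⊠ (≈ᵥ-sym
      (≈ᵥ-trans (·-distrib-+ _ _ (P * Q)) (+ᵥ-cong
        (≈ᵥ-trans (·-congˡ (ℕ.*-comm P Q)) (≈ᵥ-trans (≈ᵥ-sym (·-assocˡ _ Q P)) (·-congʳ Q (·-÷ P _))))
        (≈ᵥ-trans (≈ᵥ-sym (·-assocˡ _ P Q)) (·-congʳ P (·-÷ Q _))))))))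

module _ {A B C : Set} {{_ : Finite A}} {{_ : Finite B}} {{_ : Finite C}} (p : A → ℕ) (q : B → ℕ)
         .{{p≢0 : NonZero (∑ p)}} .{{q≢0 : NonZero (∑ q)}} where

  ⊠-nonZero : NonZero (∑ (p ⊠ q))
  ⊠-nonZero = subst NonZero (sym (∑-*-∑ p q)) (ℕ.m*n≢0 (∑ p) (∑ q) {{p≢0}} {{q≢0}})

  private instance _ = ⊠-nonZero

  entropy-⊠-proj₁ : (X : A → C) → entropy (p ⊠ q) (X ∘ proj₁) ≈ᵥ entropy p X
  entropy-⊠-proj₁ X = ≈ᵥ-trans (entropy-iso (p ⊠ q) (X ∘ proj₁) (λ (a , b) → X a , tt) proj₁ (_, tt) (λ _ → refl) (λ _ → refl))
    (≈ᵥ-trans (entropy-⊠ p q X (λ _ → tt)) (≈ᵥ-trans (+ᵥ-cong ≈ᵥ-refl (entropy-const q {{q≢0}})) (+ᵥ-identityʳ _)))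

  entropy-⊠-proj₂ : (X : B → C) → entropy (p ⊠ q) (X ∘ proj₂) ≈ᵥ entropy q X
  entropy-⊠-proj₂ X = ≈ᵥ-trans (entropy-iso (p ⊠ q) (X ∘ proj₂) (λ (a , b) → tt , X b) proj₂ (tt ,_) (λ _ → refl) (λ _ → refl))
    (≈ᵥ-trans (entropy-⊠ p q (λ _ → tt) X) (≈ᵥ-trans (+ᵥ-cong (entropy-const p {{p≢0}}) ≈ᵥ-refl) (+ᵥ-identityˡ _)))

-- Scaling the weights by k amounts to taking the product with a one-point law of mass k, which has
-- entropy 0.
entropy-scale : ∀ {A B} {{_ : Finite A}} {{_ : Finite B}} k .{{_ : NonZero k}} (w : A → ℕ) (X : A → B) .{{_ : NonZero (∑ w)}} →
                entropy (λ a → k * w a) X ≈ᵥ entropy w X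
entropy-scale k w X {{w≢0}} = ≈ᵥ-trans
  (entropy-bijection (tt ,_) proj₂ (λ _ → refl) (λ _ → refl) (const ⊠ w) (X ∘ proj₂) {{⊠-nonZero {C = ⊤} const w {{k≢0}} {{w≢0}}}})
  (entropy-⊠-proj₂ const w {{k≢0}} {{w≢0}} X)
  where
  const : ⊤ → ℕ
  const _ = k
  k≢0 : NonZero (∑ const)
  k≢0 = subst NonZero (sym (ℕ.+-identityʳ k)) (ℕ.≢-nonZero (ℕ.≢-nonZero⁻¹ k))

module _ {I A B : Set} {{_ : Finite I}} {{_ : Finite A}} {{_ : Finite B}} (w : I × A → ℕ) (X : I × A → B) where

  private
    fibre : I → A → ℕ
    fibre i a = w (i , a)

  law-fibre : ∀ i b → law w < proj₁ , X > (i , b) ≡ law (fibre i) (λ a → X (i , a)) b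
  law-fibre i b = trans (∑-× (λ (j , a) → δ (j , X (j , a)) (i , b) * w (j , a))) (trans (∑-cong (λ j →
    trans (∑-cong (λ a → trans (cong (_* w (j , a)) (δ-× j i (X (j , a)) b)) (ℕ.*-assoc (δ j i) _ _)))
          (∑-*ˡ (δ j i) (λ a → δ (X (j , a)) b * w (j , a)))))
    (∑-δ i (λ j → ∑ (λ a → δ (X (j , a)) b * w (j , a)))))

  law-proj₁ : ∀ i → law w proj₁ i ≡ ∑ (fibre i)
  law-proj₁ i = trans (∑-× (λ (j , a) → δ j i * w (j , a))) (trans (∑-cong (λ j → ∑-*ˡ (δ j i) (fibre j))) (∑-δ i (λ j → ∑ (fibre j))))

  -- The chain rule, multiplied by the total mass: each fibre counts with its own mass, so sums of
  -- this shape are conditional entropies.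
  conditional-entropy : ∑ᵥ (λ i → ∑ (fibre i) · entropy (fibre i) (λ a → X (i , a))) ≈ᵥ
                        ∑ w · (entropy w < proj₁ , X > -ᵥ entropy w proj₁)
  conditional-entropy = S.begin
    ∑ᵥ (λ i → ∑ (fibre i) · entropy (fibre i) (λ a → X (i , a)))   S.≈⟨ 𝕍Σ.∑-cong (λ i → mass-entropy (fibre i) (λ a → X (i , a))) ⟩
    ∑ᵥ (λ i → ∑ (fibre i) · log (∑ (fibre i)) -ᵥ log-likelihood (fibre i) (λ a → X (i , a))) S.≈⟨ ∑ᵥ-- (λ i → ∑ (fibre i) · log (∑ (fibre i))) (λ i → log-likelihood (fibre i) (λ a → X (i , a))) ⟩
    ∑ᵥ (λ i → ∑ (fibre i) · log (∑ (fibre i))) -ᵥ ∑ᵥ (λ i → log-likelihood (fibre i) (λ a → X (i , a))) S.≈⟨ +ᵥ-cong masses (-ᵥ-cong joint) ⟩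
    log-likelihood w proj₁ -ᵥ log-likelihood w < proj₁ , X >         S.≈⟨ tidy ⟩
    ∑ w · (entropy w < proj₁ , X > -ᵥ entropy w proj₁)              S.∎
    where
    masses : ∑ᵥ (λ i → ∑ (fibre i) · log (∑ (fibre i))) ≈ᵥ log-likelihood w proj₁
    masses = ≈ᵥ-trans (𝕍Σ.∑-cong (λ i → ≡⇒≈ (cong (λ n → n · log n) (sym (law-proj₁ i))))) (∑ᵥ-law w proj₁ (log ∘ law w proj₁))
      where
      ≡⇒≈ : ∀ {x y} → x ≡ y → x ≈ᵥ y
      ≡⇒≈ refl = ≈ᵥ-refl
    joint : ∑ᵥ (λ i → log-likelihood (fibre i) (λ a → X (i , a))) ≈ᵥ log-likelihood w < proj₁ , X >
    joint = ≈ᵥ-sym (≈ᵥ-trans (𝕍Σ.∑-× (λ (i , a) → w (i , a) · log (law w < proj₁ , X > (i , X (i , a)))))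
      (𝕍Σ.∑-cong (λ i → 𝕍Σ.∑-cong (λ a → subst (λ n → w (i , a) · log (law w < proj₁ , X > (i , X (i , a))) ≈ᵥ w (i , a) · log n)
        (law-fibre i (X (i , a))) ≈ᵥ-refl))))
    tidy : log-likelihood w proj₁ -ᵥ log-likelihood w < proj₁ , X > ≈ᵥ ∑ w · (entropy w < proj₁ , X > -ᵥ entropy w proj₁)
    tidy = by ρ (v₀ :- v₁ ⊑ v₂) ((1 , v₃ :- v₄ ⊑ v₂) ∷ (1 , v₅ :- v₁ ⊑ v₃) ∷ (1 , v₄ ⊑ v₅ :- v₀) ∷ []) refl
             (proj₂ d ∷ proj₂ e₁ ∷ proj₁ e₂ ∷ [])
         , by ρ (v₂ ⊑ v₀ :- v₁) ((1 , v₂ ⊑ v₃ :- v₄) ∷ (1 , v₃ ⊑ v₅ :- v₁) ∷ (1 , v₅ :- v₀ ⊑ v₄) ∷ []) refl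
             (proj₁ d ∷ proj₁ e₁ ∷ proj₂ e₂ ∷ [])
      where
      d = ·-distrib-- (∑ w) (entropy w < proj₁ , X >) (entropy w proj₁)
      e₁ = mass-entropy w < proj₁ , X >
      e₂ = mass-entropy w proj₁
      ρ = log-likelihood w proj₁ ∷ log-likelihood w < proj₁ , X > ∷ ∑ w · (entropy w < proj₁ , X > -ᵥ entropy w proj₁) ∷
          ∑ w · entropy w < proj₁ , X > ∷ ∑ w · entropy w proj₁ ∷ ∑ w · log (∑ w) ∷ []

-- Entropies of sums in a Boolean group

record Dist (A : Set) {{_ : Finite A}} : Set where
  constructor _,ᵈ_
  field
    weight  : A → ℕ
    nonZero : NonZero (∑ weight)

open Dist

module _ {Ω : Set} {{_ : Finite Ω}} where

  Ent : {B : Set} {{_ : Finite B}} → Dist Ω → (Ω → B) → 𝕍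
  Ent μ X = entropy (weight μ) X

  push : {B : Set} {{_ : Finite B}} → Dist Ω → (Ω → B) → Dist B
  push μ X = law (weight μ) X ,ᵈ subst NonZero (sym (∑-law (weight μ) X)) (nonZero μ)

infixr 7 _⊗ᵈ_
_⊗ᵈ_ : ∀ {A B : Set} {{_ : Finite A}} {{_ : Finite B}} → Dist A → Dist B → Dist (A × B)
μ ⊗ᵈ ν = (weight μ ⊠ weight ν) ,ᵈ ⊠-nonZero {C = ⊤} (weight μ) (weight ν) {{nonZero μ}} {{nonZero ν}}

module _ {Ω B C : Set} {{_ : Finite Ω}} {{_ : Finite B}} {{_ : Finite C}} (μ : Dist Ω) where

  Ent-push : (X : Ω → B) (Y : B → C) → Ent (push μ X) Y ≈ᵥ Ent μ (Y ∘ X)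
  Ent-push X Y = entropy-law (weight μ) X Y {{nonZero μ}}

  Ent-function : (X : Ω → B) (Y : Ω → C) (α : C → B) → (∀ ω → α (Y ω) ≡ X ω) → Ent μ X ≤ᵥ Ent μ Y
  Ent-function X Y = entropy-function (weight μ) X Y {{nonZero μ}}

  Ent-iso : (X : Ω → B) (Y : Ω → C) (α : C → B) (β : B → C) → (∀ ω → α (Y ω) ≡ X ω) → (∀ ω → β (X ω) ≡ Y ω) → Ent μ X ≈ᵥ Ent μ Y
  Ent-iso X Y = entropy-iso (weight μ) X Y {{nonZero μ}}

  Ent-subadditive : (X : Ω → B) (Y : Ω → C) → Ent μ < X , Y > ≤ᵥ Ent μ X +ᵥ Ent μ Y
  Ent-subadditive X Y = entropy-subadditive (weight μ) X Y {{nonZero μ}}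

module _ {Ω A B C : Set} {{_ : Finite Ω}} {{_ : Finite A}} {{_ : Finite B}} {{_ : Finite C}} (μ : Dist Ω) where

  Ent-submodular : (X : Ω → A) (Y : Ω → B) (Z : Ω → C) → Ent μ < Z , < X , Y > > +ᵥ Ent μ Z ≤ᵥ Ent μ < X , Z > +ᵥ Ent μ < Y , Z >
  Ent-submodular X Y Z = entropy-submodular (weight μ) X Y Z {{nonZero μ}}

module _ {Ω Ω′ B : Set} {{_ : Finite Ω}} {{_ : Finite Ω′}} {{_ : Finite B}} where

  Ent-reindex : (μ′ : Dist Ω′) (μ : Dist Ω) (φ : Ω′ → Ω) (ψ : Ω → Ω′) → (∀ a → ψ (φ a) ≡ a) → (∀ b → φ (ψ b) ≡ b) →
                (∀ ω → weight μ′ ω ≡ weight μ (φ ω)) → (Y : Ω′ → B) (X : Ω → B) → (∀ ω → Y ω ≡ X (φ ω)) → Ent μ′ Y ≈ᵥ Ent μ X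
  Ent-reindex μ′ μ φ ψ ψφ φψ eq Y X eq′ =
    ≈ᵥ-trans (entropy-cong eq eq′ {{nonZero μ′}}) (entropy-bijection φ ψ ψφ φψ (weight μ) X {{nonZero μ}})

module _ {A B : Set} {{_ : Finite A}} {{_ : Finite B}} (μ : Dist A) (ν : Dist B) where

  Ent-⊗ : ∀ {C D : Set} {{_ : Finite C}} {{_ : Finite D}} (X : A → C) (Y : B → D) →
          Ent (μ ⊗ᵈ ν) (λ (a , b) → X a , Y b) ≈ᵥ Ent μ X +ᵥ Ent ν Y
  Ent-⊗ X Y = entropy-⊠ (weight μ) (weight ν) X Y {{nonZero μ}} {{nonZero ν}}

  Ent-⊗-proj₁ : ∀ {C : Set} {{_ : Finite C}} (X : A → C) → Ent (μ ⊗ᵈ ν) (X ∘ proj₁) ≈ᵥ Ent μ X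
  Ent-⊗-proj₁ X = entropy-⊠-proj₁ (weight μ) (weight ν) {{nonZero μ}} {{nonZero ν}} X

law-id : ∀ {A : Set} {{_ : Finite A}} (w : A → ℕ) a → law w id a ≡ w a
law-id w a = ∑-δ a w

module _ {A B C D : Set} {{_ : Finite A}} {{_ : Finite B}} {{_ : Finite C}} {{_ : Finite D}} (μ : Dist A) (ν : Dist B) where

  Ent-⊗-pushʳ : (Y : B → C) (X : A × C → D) → Ent (μ ⊗ᵈ push ν Y) X ≈ᵥ Ent (μ ⊗ᵈ ν) (λ (a , b) → X (a , Y b))
  Ent-⊗-pushʳ Y X = ≈ᵥ-trans
    (≈ᵥ-sym (entropy-cong (λ (a , c) → trans (law-⊠ (weight μ) (weight ν) id Y a c) (cong (_* law (weight ν) Y c) (law-id (weight μ) a)))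
      (λ _ → refl) {{nonZero (push (μ ⊗ᵈ ν) (λ (a , b) → a , Y b))}}))
    (Ent-push (μ ⊗ᵈ ν) (λ (a , b) → a , Y b) X)

-- Deciding identities in Boolean groups, and sums of independent variables.

infixl 6 _:⊕_
data Sum (n : ℕ) : Set where
  :var : Fin n → Sum n
  _:⊕_ : Sum n → Sum n → Sum n

normal : ∀ {n} → Sum n → Vec Parity n
normal (:var zero)    = 1ℙ ∷ replicate _ 0ℙ
normal (:var (suc i)) = 0ℙ ∷ normal (:var i)
normal (s :⊕ t)       = zipWith Parity._+_ (normal s) (normal t)

pattern a₀ = :var zero
pattern a₁ = :var (suc zero)
pattern a₂ = :var (suc (suc zero))
pattern a₃ = :var (suc (suc (suc zero)))
pattern a₄ = :var (suc (suc (suc (suc zero))))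
pattern a₅ = :var (suc (suc (suc (suc (suc zero)))))

record BooleanGroup (G : Set) : Set where
  infixl 6 _⊕_
  field
    _⊕_  : G → G → G
    𝟘    : G
    ⊕-assoc    : ∀ x y z → (x ⊕ y) ⊕ z ≡ x ⊕ (y ⊕ z)
    ⊕-comm     : ∀ x y → x ⊕ y ≡ y ⊕ x
    ⊕-identity : ∀ x → 𝟘 ⊕ x ≡ x
    ⊕-self     : ∀ x → x ⊕ x ≡ 𝟘

  ⟦_⟧ : ∀ {n} → Sum n → Vec G n → G
  ⟦ :var i ⟧ ρ = lookup ρ i
  ⟦ s :⊕ t ⟧ ρ = ⟦ s ⟧ ρ ⊕ ⟦ t ⟧ ρ

  eval : ∀ {n} → Vec Parity n → Vec G n → G
  eval []        []      = 𝟘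
  eval (0ℙ ∷ bs) (x ∷ ρ) = eval bs ρ
  eval (1ℙ ∷ bs) (x ∷ ρ) = x ⊕ eval bs ρ

  eval-replicate : ∀ {n} (ρ : Vec G n) → eval (replicate n 0ℙ) ρ ≡ 𝟘
  eval-replicate []      = refl
  eval-replicate (x ∷ ρ) = eval-replicate ρ

  ⊕-exchange : ∀ x a b → x ⊕ (a ⊕ b) ≡ a ⊕ (x ⊕ b)
  ⊕-exchange x a b = trans (sym (⊕-assoc x a b)) (trans (cong (_⊕ b) (⊕-comm x a)) (⊕-assoc a x b))

  ⊕-cancel : ∀ x a → x ⊕ (x ⊕ a) ≡ a
  ⊕-cancel x a = trans (sym (⊕-assoc x x a)) (trans (cong (_⊕ a) (⊕-self x)) (⊕-identity a))

  eval-+ : ∀ {n} (b c : Vec Parity n) ρ → eval (zipWith Parity._+_ b c) ρ ≡ eval b ρ ⊕ eval c ρ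
  eval-+ []        []        []      = sym (⊕-identity 𝟘)
  eval-+ (0ℙ ∷ bs) (0ℙ ∷ cs) (x ∷ ρ) = eval-+ bs cs ρ
  eval-+ (0ℙ ∷ bs) (1ℙ ∷ cs) (x ∷ ρ) = trans (cong (x ⊕_) (eval-+ bs cs ρ)) (⊕-exchange x (eval bs ρ) (eval cs ρ))
  eval-+ (1ℙ ∷ bs) (0ℙ ∷ cs) (x ∷ ρ) = trans (cong (x ⊕_) (eval-+ bs cs ρ)) (sym (⊕-assoc x (eval bs ρ) (eval cs ρ)))
  eval-+ (1ℙ ∷ bs) (1ℙ ∷ cs) (x ∷ ρ) = trans (eval-+ bs cs ρ) (sym (trans (⊕-assoc x (eval bs ρ) (x ⊕ eval cs ρ))
    (trans (cong (x ⊕_) (⊕-exchange (eval bs ρ) x (eval cs ρ))) (⊕-cancel x _))))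

  normal-correct : ∀ {n} (s : Sum n) ρ → ⟦ s ⟧ ρ ≡ eval (normal s) ρ
  normal-correct (:var zero)    (x ∷ ρ) = sym (trans (cong (x ⊕_) (eval-replicate ρ)) (trans (⊕-comm x 𝟘) (⊕-identity x)))
  normal-correct (:var (suc i)) (x ∷ ρ) = normal-correct (:var i) ρ
  normal-correct (s :⊕ t)       ρ       = trans (cong₂ _⊕_ (normal-correct s ρ) (normal-correct t ρ)) (sym (eval-+ (normal s) (normal t) ρ))

  -- In a Boolean group a sum depends only on the parity of the number of occurrences of each
  -- variable, so it is enough that the parity vectors agree, and `refl` checks that.
  xor : ∀ {n} (ρ : Vec G n) (s t : Sum n) → normal s ≡ normal t → ⟦ s ⟧ ρ ≡ ⟦ t ⟧ ρ
  xor ρ s t eq = trans (normal-correct s ρ) (trans (cong (λ b → eval b ρ) eq) (sym (normal-correct t ρ)))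

module SumsetEntropy {G : Set} {{FG : Finite G}} (𝔾 : BooleanGroup G) where

  open BooleanGroup 𝔾 public

  plus : G × G → G
  plus (x , y) = x ⊕ y

  infixr 6 _⊛_ _⊛ʷ_
  _⊛ʷ_ : (G → ℕ) → (G → ℕ) → G → ℕ
  p ⊛ʷ q = law (p ⊠ q) plus

  _⊛_ : Dist G → Dist G → Dist G
  μ ⊛ ν = push (μ ⊗ᵈ ν) plus

  H : Dist G → 𝕍
  H μ = Ent μ id

  H-⊛ : ∀ μ ν → H (μ ⊛ ν) ≈ᵥ Ent (μ ⊗ᵈ ν) plus
  H-⊛ μ ν = Ent-push (μ ⊗ᵈ ν) plus id

  H-⊛-⊛ : ∀ μ ν ξ → H (μ ⊛ ν ⊛ ξ) ≈ᵥ Ent (μ ⊗ᵈ ν ⊗ᵈ ξ) (λ (a , b , c) → a ⊕ (b ⊕ c))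
  H-⊛-⊛ μ ν ξ = ≈ᵥ-trans (H-⊛ μ (ν ⊛ ξ)) (Ent-⊗-pushʳ μ (ν ⊗ᵈ ξ) plus plus)

  H-⊛-comm : ∀ μ ν → H (μ ⊛ ν) ≈ᵥ H (ν ⊛ μ)
  H-⊛-comm μ ν = ≈ᵥ-trans (H-⊛ μ ν) (≈ᵥ-trans
    (Ent-reindex (μ ⊗ᵈ ν) (ν ⊗ᵈ μ) ×-swap ×-swap (λ _ → refl) (λ _ → refl) (λ (a , b) → ℕ.*-comm (weight μ a) (weight ν b))
      plus plus (λ (a , b) → ⊕-comm a b))
    (≈ᵥ-sym (H-⊛ ν μ)))

  H-⊛-swap : ∀ μ ν ξ → H (μ ⊛ ν ⊛ ξ) ≈ᵥ H (ν ⊛ μ ⊛ ξ)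
  H-⊛-swap μ ν ξ = ≈ᵥ-trans (H-⊛-⊛ μ ν ξ) (≈ᵥ-trans
    (Ent-reindex (μ ⊗ᵈ ν ⊗ᵈ ξ) (ν ⊗ᵈ μ ⊗ᵈ ξ) σ σ (λ _ → refl) (λ _ → refl)
      (λ (a , b , c) → trans (sym (ℕ.*-assoc (weight μ a) _ _)) (trans (cong (_* weight ξ c) (ℕ.*-comm (weight μ a) (weight ν b))) (ℕ.*-assoc (weight ν b) _ _)))
      (λ (a , b , c) → a ⊕ (b ⊕ c)) (λ (a , b , c) → a ⊕ (b ⊕ c)) (λ (a , b , c) → ⊕-exchange a b c))
    (≈ᵥ-sym (H-⊛-⊛ ν μ ξ)))
    where
    σ : G × G × G → G × G × G
    σ (a , b , c) = b , a , c

  H-⊛-monoˡ : ∀ μ ν → H ν ≤ᵥ H (μ ⊛ ν)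
  H-⊛-monoˡ μ ν = by (H ν ∷ H (μ ⊛ ν) ∷ H μ ∷ Ent (μ ⊗ᵈ ν) < proj₁ , plus > ∷ Ent (μ ⊗ᵈ ν) proj₁ ∷ Ent (μ ⊗ᵈ ν) plus ∷ [])
    (v₀ ⊑ v₁) ((1 , v₂ :+ v₀ ⊑ v₃) ∷ (1 , v₃ ⊑ v₄ :+ v₅) ∷ (1 , v₄ ⊑ v₂) ∷ (1 , v₅ ⊑ v₁) ∷ []) refl
    ( ≤ᵥ-trans (proj₂ (Ent-⊗ μ ν id id)) (Ent-function (μ ⊗ᵈ ν) id < proj₁ , plus > (λ (a , s) → a , a ⊕ s)
        (λ (a , b) → cong (a ,_) (⊕-cancel a b)))
    ∷ Ent-subadditive (μ ⊗ᵈ ν) proj₁ plus ∷ proj₁ (Ent-⊗-proj₁ μ ν id) ∷ proj₂ (H-⊛ μ ν) ∷ [])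

  H-⊛-monoʳ : ∀ μ ν → H μ ≤ᵥ H (μ ⊛ ν)
  H-⊛-monoʳ μ ν = ≤ᵥ-trans (H-⊛-monoˡ ν μ) (proj₁ (H-⊛-comm ν μ))

  -- The Kaimanovich–Vershik inequality.
  H-⊛-submodular : ∀ μ ν ξ → H (μ ⊛ ν ⊛ ξ) +ᵥ H ν ≤ᵥ H (μ ⊛ ν) +ᵥ H (ν ⊛ ξ)
  H-⊛-submodular μ ν ξ = by
    (H (μ ⊛ ν ⊛ ξ) ∷ H ν ∷ H (μ ⊛ ν) ∷ H (ν ⊛ ξ) ∷ H μ ∷ H ξ ∷ Ent ω < Z , < X , Y > > ∷ Ent ω Z ∷ Ent ω < X , Z > ∷ Ent ω < Y , Z > ∷ [])
    (v₀ :+ v₁ ⊑ v₂ :+ v₃)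
    ((1 , v₀ ⊑ v₇) ∷ (1 , v₄ :+ (v₁ :+ v₅) ⊑ v₆) ∷ (1 , v₆ :+ v₇ ⊑ v₈ :+ v₉) ∷ (1 , v₈ ⊑ v₄ :+ v₃) ∷ (1 , v₉ ⊑ v₂ :+ v₅) ∷ []) refl
    ( proj₁ (H-⊛-⊛ μ ν ξ) ∷ full ∷ Ent-submodular ω X Y Z ∷ first ∷ last ∷ [])
    where
    ω = μ ⊗ᵈ ν ⊗ᵈ ξ
    -- Submodularity is applied given the total sum `Z`. The pair of `X` and `Z` amounts to the
    -- independent pair a, b ⊕ c, and that of `Y` and `Z` to the independent pair a ⊕ b, c.
    X Y Z : G × G × G → G
    X (a , b , c) = a
    Y (a , b , c) = c
    Z (a , b , c) = a ⊕ (b ⊕ c)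
    full : H μ +ᵥ (H ν +ᵥ H ξ) ≤ᵥ Ent ω < Z , < X , Y > >
    full = ≤ᵥ-trans (proj₂ (≈ᵥ-trans (Ent-⊗ μ (ν ⊗ᵈ ξ) id id) (+ᵥ-cong ≈ᵥ-refl (Ent-⊗ ν ξ id id))))
      (Ent-function ω id < Z , < X , Y > > (λ (s , a , c) → a , (s ⊕ a) ⊕ c , c)
        (λ (a , b , c) → cong (λ x → a , x , c) (xor (a ∷ b ∷ c ∷ []) (((a₀ :⊕ (a₁ :⊕ a₂)) :⊕ a₀) :⊕ a₂) a₁ refl)))
    first : Ent ω < X , Z > ≤ᵥ H μ +ᵥ H (ν ⊛ ξ)
    first = ≤ᵥ-trans (Ent-function ω < X , Z > (λ (a , b , c) → a , b ⊕ c) (λ (a , s) → a , a ⊕ s) (λ _ → refl))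
      (proj₁ (≈ᵥ-trans (Ent-⊗ μ (ν ⊗ᵈ ξ) id plus) (+ᵥ-cong ≈ᵥ-refl (≈ᵥ-sym (H-⊛ ν ξ)))))
    last : Ent ω < Y , Z > ≤ᵥ H (μ ⊛ ν) +ᵥ H ξ
    last = ≤ᵥ-trans (Ent-function ω < Y , Z > (λ (a , b , c) → a ⊕ b , c) (λ (s , c) → c , s ⊕ c)
        (λ (a , b , c) → cong (c ,_) (⊕-assoc a b c)))
      (proj₁ (≈ᵥ-trans (Ent-reindex ω ((μ ⊗ᵈ ν) ⊗ᵈ ξ) (λ (a , b , c) → (a , b) , c) (λ ((a , b) , c) → a , b , c) (λ _ → refl) (λ _ → refl)
          (λ (a , b , c) → sym (ℕ.*-assoc (weight μ a) (weight ν b) (weight ξ c))) (λ (a , b , c) → a ⊕ b , c) (λ (x , c) → plus x , c) (λ _ → refl))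
        (≈ᵥ-trans (Ent-⊗ (μ ⊗ᵈ ν) ξ plus id) (+ᵥ-cong (≈ᵥ-sym (H-⊛ μ ν)) ≈ᵥ-refl))))

  -- In characteristic two sums are differences, so this is Ruzsa's triangle inequality. It follows
  -- from the Kaimanovich-Vershik inequality because convolving μ ⊛ ξ with ν does not lower its
  -- entropy.
  H-triangle : ∀ μ ν ξ → H (μ ⊛ ξ) +ᵥ H ν ≤ᵥ H (μ ⊛ ν) +ᵥ H (ν ⊛ ξ)
  H-triangle μ ν ξ = ≤ᵥ-trans (+ᵥ-monoˡ (H ν) (≤ᵥ-trans (H-⊛-monoˡ ν (μ ⊛ ξ)) (proj₁ (H-⊛-swap ν μ ξ)))) (H-⊛-submodular μ ν ξ)

  -- Twice the entropic Ruzsa distance.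
  distance : (G → ℕ) → (G → ℕ) → 𝕍
  distance p q = 2 · entropy (p ⊛ʷ q) id -ᵥ entropy p id -ᵥ entropy q id

  D : Dist G → Dist G → 𝕍
  D μ ν = distance (weight μ) (weight ν)

  D≥0 : ∀ μ ν → 0ᵥ ≤ᵥ D μ ν
  D≥0 μ ν = by (H (μ ⊛ ν) ∷ H μ ∷ H ν ∷ []) (:0 ⊑ 2 :· v₀ :- v₁ :- v₂) ((1 , v₁ ⊑ v₀) ∷ (1 , v₂ ⊑ v₀) ∷ []) refl
    (H-⊛-monoʳ μ ν ∷ H-⊛-monoˡ μ ν ∷ [])

-- Conditionally independent copies and the Balog–Szemerédi–Gowers lemma

module LinearSums where

  open Linear using (Expr; ⟦_⟧)

  ·-linear : ∀ k {n} (e : Expr n) (ρ : Vec 𝕍 n) → k · ⟦ e ⟧ ρ ≈ᵥ ⟦ e ⟧ (Vec.map (k ·_) ρ)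
  ·-linear k (var i)  ρ rewrite Vec.lookup-map i (k ·_) ρ = ≈ᵥ-refl
  ·-linear k :0       ρ = ·-zero k
  ·-linear k (a :+ b) ρ = ≈ᵥ-trans (·-distrib-+ _ _ k) (+ᵥ-cong (·-linear k a ρ) (·-linear k b ρ))
  ·-linear k (a :- b) ρ = ≈ᵥ-trans (·-distrib-- k _ _) (+ᵥ-cong (·-linear k a ρ) (-ᵥ-cong (·-linear k b ρ)))
  ·-linear k (j :· a) ρ = ≈ᵥ-trans (·-assocˡ _ k j) (≈ᵥ-trans (·-congˡ (ℕ.*-comm k j))
    (≈ᵥ-trans (≈ᵥ-sym (·-assocˡ _ j k)) (·-congʳ j (·-linear k a ρ))))

  module _ {I : Set} {{_ : Finite I}} (c : I → ℕ) where

    average : (I → 𝕍) → 𝕍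
    average φ = ∑ᵥ (λ i → c i · φ i)

    -- A cost is a linear expression in entropies, so its average over an index is computed by
    -- averaging each entropy separately, by the chain rule.
    ∑-linear : ∀ {n} (e : Expr n) (ρ : Vec (I → 𝕍) n) →
               average (λ i → ⟦ e ⟧ (Vec.map (λ φ → φ i) ρ)) ≈ᵥ ⟦ e ⟧ (Vec.map average ρ)
    ∑-linear (var j)  ρ rewrite Vec.lookup-map j average ρ =
      𝕍Σ.∑-cong (λ i → subst (λ x → c i · lookup (Vec.map (λ φ → φ i) ρ) j ≈ᵥ c i · x) (Vec.lookup-map j (λ φ → φ i) ρ) ≈ᵥ-refl)
    ∑-linear :0       ρ = ≈ᵥ-trans (𝕍Σ.∑-cong (λ i → ·-zero (c i))) (𝕍Σ.∑-ε {I})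
    ∑-linear (a :+ b) ρ = ≈ᵥ-trans (𝕍Σ.∑-cong (λ i → ·-distrib-+ _ _ (c i)))
      (≈ᵥ-trans (𝕍Σ.∑-∙ {I} _ _) (+ᵥ-cong (∑-linear a ρ) (∑-linear b ρ)))
    ∑-linear (a :- b) ρ = ≈ᵥ-trans (𝕍Σ.∑-cong (λ i → ·-distrib-- (c i) _ _))
      (≈ᵥ-trans (∑ᵥ-- {I} _ _) (+ᵥ-cong (∑-linear a ρ) (-ᵥ-cong (∑-linear b ρ))))
    ∑-linear (k :· a) ρ = ≈ᵥ-trans (𝕍Σ.∑-cong (λ i → ≈ᵥ-trans (·-assocˡ _ (c i) k) (≈ᵥ-trans (·-congˡ (ℕ.*-comm (c i) k)) (≈ᵥ-sym (·-assocˡ _ k (c i))))))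
      (≈ᵥ-trans (𝕍Σ.∑-✦ {I} k _) (·-congʳ k (∑-linear a ρ)))

open LinearSums

module _ {I : Set} {{F : Finite I}} (c : I → ℕ) (v : I → 𝕍) (t : 𝕍) where

  -- Failure of the search is reported as a weak inequality for the average. It is one hypothesis of
  -- a linear argument, so nothing has to be known about single indices.
  select : (∃[ i ] NonZero (c i) × v i ≤ᵥ t) ⊎ ∑ c · t ≤ᵥ ∑ᵥ (λ i → c i · v i)
  select = go (Finite.elements F)
    where
    go : ∀ xs → (∃[ i ] NonZero (c i) × v i ≤ᵥ t) ⊎
                FiniteSum.sumL ℕ.+-0-commutativeMonoid xs c · t ≤ᵥ 𝕍Σ.sumL xs (λ i → c i · v i)
    go []       = inj₂ ≤ᵥ-refl
    go (x ∷ xs) with go xs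
    ... | inj₁ found = inj₁ found
    ... | inj₂ rest with c x in eq | v x ≤ᵥ? t
    ...   | zero  | _       = inj₂ (≤ᵥ-trans rest (proj₂ (+ᵥ-identityˡ _)))
    ...   | suc n | yes v≤t = inj₁ (x , subst NonZero (sym eq) _ , v≤t)
    ...   | suc n | no  v≰t with ≤ᵥ-total t (v x)
    ...     | inj₁ t≤v = inj₂ (≤ᵥ-trans (proj₁ (·-homo-+ t (suc n) _)) (+ᵥ-mono (·-mono (suc n) t≤v) rest))
    ...     | inj₂ v≤t = contradiction v≤t v≰t

module _ {I : Set} {{F : Finite I}} (c : I → ℕ) (v : I → 𝕍) (t : 𝕍) where

  private
    C : List I → ℕ
    C xs = FiniteSum.sumL ℕ.+-0-commutativeMonoid xs c
    V : List I → 𝕍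
    V xs = 𝕍Σ.sumL xs (λ i → c i · v i)

  -- If v exceeded t at every index of positive weight, the average would exceed t strictly. The
  -- strictness is carried through the induction as a negation that becomes effective once the
  -- partial mass is positive.
  below-average : .{{_ : NonZero (∑ c)}} → ∑ᵥ (λ i → c i · v i) ≤ᵥ ∑ c · t → ∃[ i ] NonZero (c i) × v i ≤ᵥ t
  below-average {{nz}} le = ⊎.[_,_]′ id (λ (_ , above) → contradiction le (above (ℕ.≢-nonZero (ℕ.≢-nonZero⁻¹ (∑ c)))))
    (go (Finite.elements F))
    where
    go : ∀ xs → (∃[ i ] NonZero (c i) × v i ≤ᵥ t) ⊎ (C xs · t ≤ᵥ V xs × (NonZero (C xs) → ¬ V xs ≤ᵥ C xs · t))
    go []       = inj₂ (≤ᵥ-refl , λ ())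
    go (x ∷ xs) with go xs
    ... | inj₁ found = inj₁ found
    ... | inj₂ (rest , above) with c x in eq | v x ≤ᵥ? t
    ...   | zero  | _       = inj₂ (≤ᵥ-trans rest (proj₂ (+ᵥ-identityˡ _)) , λ nz le → above nz (≤ᵥ-trans (proj₂ (+ᵥ-identityˡ _)) le))
    ...   | suc n | yes v≤t = inj₁ (x , subst NonZero (sym eq) _ , v≤t)
    ...   | suc n | no  v≰t = inj₂ (≤ᵥ-trans (proj₁ (·-homo-+ t (suc n) (C xs))) (+ᵥ-mono (·-mono (suc n) t≤v) rest) , strictly)
      where
      t≤v : t ≤ᵥ v x
      t≤v = ⊎.[_,_]′ id (λ le → contradiction le v≰t) (≤ᵥ-total t (v x))
      strictly : NonZero (suc n + C xs) → ¬ suc n · v x +ᵥ V xs ≤ᵥ (suc n + C xs) · t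
      strictly _ le = v≰t (·-cancel (suc n) (by (suc n · v x ∷ suc n · t ∷ V xs ∷ C xs · t ∷ (suc n + C xs) · t ∷ []) (v₀ ⊑ v₁)
        ((1 , v₀ :+ v₂ ⊑ v₄) ∷ (1 , v₄ ⊑ v₁ :+ v₃) ∷ (1 , v₃ ⊑ v₂) ∷ []) refl (le ∷ proj₁ (·-homo-+ t (suc n) (C xs)) ∷ rest ∷ [])))

∣! : ∀ {n N} .{{_ : NonZero n}} → n ≤ N → n ∣ N !
∣! {suc n} n≤N = ∣-trans (m∣m*n (n !)) (m≤n⇒m!∣n! n≤N)

cofactor : ∀ n N → n ≤ N → Σ[ u ∈ ℕ ] (NonZero n → u * n ≡ N !)
cofactor zero      N _   = 0 , λ ()
cofactor n@(suc _) N n≤N with ∣! n≤N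
... | divides u eq = u , λ _ → sym eq

-- Two copies of A that are conditionally independent given I.  Integer weights are kept by
-- clearing the denominators ∑ (fibre i) with the common multiple mass !.
module Coupling {I A : Set} {{FI : Finite I}} {{FA : Finite A}} (ρ : Dist (I × A)) where

  fibre : I → A → ℕ
  fibre i a = weight ρ (i , a)

  mass : ℕ
  mass = ∑ (weight ρ)

  private
    M : ℕ
    M = mass !

    fibre≤mass : ∀ i → ∑ (fibre i) ≤ mass
    fibre≤mass i = ℕ.≤-trans (∑-≥ i (λ j → ∑ (fibre j))) (ℕ.≤-reflexive (sym (∑-× (weight ρ))))

    u : I → ℕ
    u i = proj₁ (cofactor (∑ (fibre i)) mass (fibre≤mass i))

    u-mass : ∀ i {k} → k ≤ ∑ (fibre i) → u i * (k * ∑ (fibre i)) ≡ M * k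
    u-mass i {zero}  _  = trans (ℕ.*-zeroʳ (u i)) (sym (ℕ.*-zeroʳ M))
    u-mass i {suc k} le = trans (regroup (u i) (suc k) n) (cong (_* suc k) (proj₂ (cofactor n mass (fibre≤mass i)) (NonZero-≤ le)))
      where
      n = ∑ (fibre i)
      regroup : ∀ u k n → u * (k * n) ≡ u * n * k
      regroup = solve-∀

    w : I × (A × A) → ℕ
    w (i , (a , c)) = u i * (fibre i a * fibre i c)

    w-fibre : ∀ i → ∑ (λ (ac : A × A) → w (i , ac)) ≡ M * ∑ (fibre i)
    w-fibre i = trans (∑-*ˡ (u i) (fibre i ⊠ fibre i)) (trans (cong (u i *_) (∑-*-∑ (fibre i) (fibre i))) (u-mass i ℕ.≤-refl))

    w-mass : ∑ w ≡ M * mass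
    w-mass = trans (∑-× w) (trans (∑-cong w-fibre) (trans (∑-*ˡ M (λ i → ∑ (fibre i))) (cong (M *_) (sym (∑-× (weight ρ))))))

    w≢0 : NonZero (∑ w)
    w≢0 = subst NonZero (sym w-mass) (ℕ.m*n≢0 M mass {{mass ℕ.!≢0}} {{nonZero ρ}})

  coupled : Dist (I × (A × A))
  coupled = w ,ᵈ w≢0

  module _ {B : Set} {{_ : Finite B}} (X : I × A → B) where

    -- Summing out the second copy multiplies every weight by the constant `mass !`, which entropy
    -- ignores.
    coupled-first : Ent coupled (λ (i , (a , c)) → X (i , a)) ≈ᵥ Ent ρ X
    coupled-first = ≈ᵥ-trans (Ent-reindex coupled ω′ φ ψ (λ _ → refl) (λ _ → refl) (λ _ → refl) _ (X ∘ proj₁) (λ _ → refl))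
      (≈ᵥ-trans (≈ᵥ-sym (Ent-push ω′ proj₁ X))
      (≈ᵥ-trans (entropy-cong marginal (λ _ → refl) {{nonZero (push ω′ proj₁)}})
        (entropy-scale M {{mass ℕ.!≢0}} (weight ρ) X {{nonZero ρ}})))
      where
      φ : I × (A × A) → (I × A) × A
      φ (i , (a , c)) = (i , a) , c
      ψ : (I × A) × A → I × (A × A)
      ψ ((i , a) , c) = i , (a , c)
      w′ : (I × A) × A → ℕ
      w′ = w ∘ ψ
      ω′ : Dist ((I × A) × A)
      ω′ = w′ ,ᵈ subst NonZero (sym (∑-bijection ψ φ (λ _ → refl) (λ _ → refl) w)) w≢0
      marginal : ∀ ia → law w′ proj₁ ia ≡ M * weight ρ ia
      marginal (i , a) = trans (law-proj₁ w′ (λ _ → tt) (i , a)) (trans (∑-*ˡ (u i) (λ c → fibre i a * fibre i c))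
        (trans (cong (u i *_) (∑-*ˡ (fibre i a) (fibre i))) (u-mass i (∑-≥ a (fibre i)))))

    coupled-second : Ent coupled (λ (i , (a , c)) → X (i , c)) ≈ᵥ Ent ρ X
    coupled-second = ≈ᵥ-trans (Ent-reindex coupled coupled σ σ (λ _ → refl) (λ _ → refl)
      (λ (i , (a , c)) → cong (u i *_) (ℕ.*-comm (fibre i a) (fibre i c))) _ (λ (i , (a , c)) → X (i , a)) (λ _ → refl)) coupled-first
      where
      σ : I × (A × A) → I × (A × A)
      σ (i , (a , c)) = i , (c , a)

  module _ {B : Set} {{_ : Finite B}} (X : A × A → B) where

    conditional-coupled : ∑ᵥ (λ i → ∑ (fibre i) · entropy (fibre i ⊠ fibre i) X) ≈ᵥ
                          mass · (Ent coupled (λ (i , ac) → i , X ac) -ᵥ Ent ρ proj₁)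
    conditional-coupled = ·-cancel-≈ M {{mass ℕ.!≢0}} (S.begin
      M · ∑ᵥ (λ i → ∑ (fibre i) · entropy (fibre i ⊠ fibre i) X)     S.≈⟨ 𝕍Σ.∑-✦ {I} M _ ⟨
      ∑ᵥ (λ i → M · ∑ (fibre i) · entropy (fibre i ⊠ fibre i) X)     S.≈⟨ 𝕍Σ.∑-cong (λ i → at i) ⟩
      ∑ᵥ (λ i → ∑ (λ (ac : A × A) → w (i , ac)) · entropy (λ ac → w (i , ac)) X) S.≈⟨ conditional-entropy w (X ∘ proj₂) ⟩
      ∑ w · (entropy w < proj₁ , X ∘ proj₂ > -ᵥ entropy w proj₁)     S.≈⟨ ·-congˡ w-mass ⟩
      (M * mass) · (entropy w < proj₁ , X ∘ proj₂ > -ᵥ entropy w proj₁) S.≈⟨ ·-congʳ (M * mass) (+ᵥ-cong ≈ᵥ-refl (-ᵥ-cong (coupled-first proj₁))) ⟩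
      (M * mass) · (Ent coupled (λ (i , ac) → i , X ac) -ᵥ Ent ρ proj₁) S.≈⟨ ·-assocˡ _ M mass ⟨
      M · mass · (Ent coupled (λ (i , ac) → i , X ac) -ᵥ Ent ρ proj₁) S.∎)
      where
      at : ∀ i → M · ∑ (fibre i) · entropy (fibre i ⊠ fibre i) X ≈ᵥ
                 ∑ (λ (ac : A × A) → w (i , ac)) · entropy (λ ac → w (i , ac)) X
      at i = ≈ᵥ-trans (·-assocˡ _ M (∑ (fibre i))) (≈ᵥ-trans (·-congˡ (sym (w-fibre i)))
        (·-zero-or (∑ (λ (ac : A × A) → w (i , ac))) (λ nz →
          ≈ᵥ-sym (entropy-scale (u i) {{ℕ.m*n≢0⇒m≢0 (u i) {{subst NonZero (∑-*ˡ (u i) (fibre i ⊠ fibre i)) nz}}}} (fibre i ⊠ fibre i) X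
            {{ℕ.m*n≢0⇒n≢0 (u i) {{subst NonZero (∑-*ˡ (u i) (fibre i ⊠ fibre i)) nz}}}}))))

  conditional-Ent : ∑ᵥ (λ i → ∑ (fibre i) · entropy (fibre i) id) ≈ᵥ mass · (Ent ρ id -ᵥ Ent ρ proj₁)
  conditional-Ent = conditional-entropy (weight ρ) proj₂

  -- Given the index the two copies are independent with equal laws, so the conditional entropy
  -- given the index doubles.
  coupled-total : Ent coupled id ≈ᵥ 2 · Ent ρ id -ᵥ Ent ρ proj₁
  coupled-total =
      by ρ′ (v₀ ⊑ 2 :· v₁ :- v₂) ((1 , v₀ :- v₂ ⊑ 2 :· (v₁ :- v₂)) ∷ []) refl (proj₁ eq ∷ [])
    , by ρ′ (2 :· v₁ :- v₂ ⊑ v₀) ((1 , 2 :· (v₁ :- v₂) ⊑ v₀ :- v₂) ∷ []) refl (proj₂ eq ∷ [])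
    where
    ρ′ = Ent coupled id ∷ Ent ρ id ∷ Ent ρ proj₁ ∷ []
    at : ∀ i → ∑ (fibre i) · entropy (fibre i ⊠ fibre i) id ≈ᵥ 2 · ∑ (fibre i) · entropy (fibre i) id
    at i = ≈ᵥ-trans (·-zero-or (∑ (fibre i)) (λ nz → ≈ᵥ-trans (entropy-⊠ (fibre i) (fibre i) id id {{nz}} {{nz}})
        (+ᵥ-cong ≈ᵥ-refl (≈ᵥ-sym (+ᵥ-identityʳ _)))))
      (≈ᵥ-trans (·-assocˡ _ (∑ (fibre i)) 2) (≈ᵥ-trans (·-congˡ (ℕ.*-comm (∑ (fibre i)) 2)) (≈ᵥ-sym (·-assocˡ _ 2 (∑ (fibre i))))))
    eq : Ent coupled id -ᵥ Ent ρ proj₁ ≈ᵥ 2 · (Ent ρ id -ᵥ Ent ρ proj₁)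
    eq = ·-cancel-≈ mass {{nonZero ρ}} (≈ᵥ-trans (≈ᵥ-sym (conditional-coupled id)) (≈ᵥ-trans (𝕍Σ.∑-cong at)
      (≈ᵥ-trans (𝕍Σ.∑-✦ {I} 2 _) (≈ᵥ-trans (·-congʳ 2 conditional-Ent)
        (≈ᵥ-trans (·-assocˡ _ 2 mass) (≈ᵥ-trans (·-congˡ (ℕ.*-comm 2 mass)) (≈ᵥ-sym (·-assocˡ _ mass 2))))))))

module Families {G : Set} {{FG : Finite G}} (𝔾 : BooleanGroup G) where

  open SumsetEntropy 𝔾

  entropy-⊛ʷ : ∀ p q .{{_ : NonZero (∑ (p ⊠ q))}} → entropy (p ⊛ʷ q) id ≈ᵥ entropy (p ⊠ q) plus
  entropy-⊛ʷ p q = entropy-law (p ⊠ q) plus id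

  module BSG {C : Set} {{FC : Finite C}} (ρ : Dist ((C × G) × G)) where

    open Coupling ρ

    private
      ω = coupled
      s : (C × G) × G → C
      s ((c , w) , a) = c
      EA = Ent ρ (λ ((c , w) , a) → a , c)
      EB = Ent ρ (λ ((c , w) , a) → a ⊕ w , c)
      Z : (C × G) × (G × G) → C
      Z ((z , w) , (a , c)) = z
      W Y A₁ A₂ B₁ B₂ : (C × G) × (G × G) → G
      W  ((z , w) , (a , c)) = w
      Y  ((z , w) , (a , c)) = (a ⊕ c) ⊕ w
      A₁ ((z , w) , (a , c)) = a
      A₂ ((z , w) , (a , c)) = c
      B₁ ((z , w) , (a , c)) = a ⊕ w
      B₂ ((z , w) , (a , c)) = c ⊕ w

      -- The variable Y is a sum in two ways, A₁ ⊕ B₂ = B₁ ⊕ A₂. Given Z, the sum a ⊕ c is a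
      -- function of W and Y, which brings in Y here. The variables A₁, B₁, Y and Z determine
      -- everything, so `step₂` bounds Y from above by A₁ and B₁ given Y; the last two steps use one
      -- of the two expressions of Y each.
      step₁ : Ent ω (λ (i , (a , c)) → i , (a ⊕ c)) +ᵥ Ent ρ s ≤ᵥ Ent ρ proj₁ +ᵥ Ent ω < Y , Z >
      step₁ = ≤ᵥ-trans (+ᵥ-mono (Ent-function ω _ < Z , < W , Y > > (λ (z , (w , y)) → (z , w) , y ⊕ w)
                (λ ((z , w) , (a , c)) → cong ((z , w) ,_) (xor (a ∷ c ∷ w ∷ []) (((a₀ :⊕ a₁) :⊕ a₂) :⊕ a₂) (a₀ :⊕ a₁) refl)))
              (proj₂ (coupled-first s)))
        (≤ᵥ-trans (Ent-submodular ω W Y Z) (+ᵥ-monoˡ _ (≤ᵥ-trans (Ent-function ω < W , Z > (λ ((z , w) , _) → z , w) ×-swap (λ _ → refl))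
          (proj₁ (coupled-first proj₁)))))

      step₂ : Ent ω id +ᵥ Ent ω < Y , Z > ≤ᵥ Ent ω < A₁ , < Y , Z > > +ᵥ Ent ω < B₁ , < Y , Z > >
      step₂ = ≤ᵥ-trans (+ᵥ-monoˡ _ (Ent-function ω id < < Y , Z > , < A₁ , B₁ > > (λ ((y , z) , (a , b)) → (z , a ⊕ b) , (a , y ⊕ b))
          (λ ((z , w) , (a , c)) → cong₂ (λ w c → (z , w) , (a , c)) (xor (a ∷ w ∷ []) (a₀ :⊕ (a₀ :⊕ a₁)) a₁ refl)
            (xor (a ∷ c ∷ w ∷ []) (((a₀ :⊕ a₁) :⊕ a₂) :⊕ (a₀ :⊕ a₂)) a₁ refl))))
        (Ent-submodular ω A₁ B₁ < Y , Z >)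

      step₃ : Ent ω < A₁ , < Y , Z > > +ᵥ Ent ρ s ≤ᵥ EA +ᵥ EB
      step₃ = ≤ᵥ-trans (+ᵥ-mono (Ent-function ω < A₁ , < Y , Z > > < Z , < A₁ , B₂ > > (λ (z , (a , b)) → a , (a ⊕ b , z))
                (λ ((z , w) , (a , c)) → cong (λ y → a , (y , z)) (sym (⊕-assoc a c w))))
              (proj₂ (coupled-first s)))
        (≤ᵥ-trans (Ent-submodular ω A₁ B₂ Z) (+ᵥ-mono (proj₁ (coupled-first _)) (proj₁ (coupled-second (λ ((c , w) , a) → a ⊕ w , c)))))

      step₄ : Ent ω < B₁ , < Y , Z > > +ᵥ Ent ρ s ≤ᵥ EB +ᵥ EA
      step₄ = ≤ᵥ-trans (+ᵥ-mono (Ent-function ω < B₁ , < Y , Z > > < Z , < B₁ , A₂ > > (λ (z , (b , c)) → b , (b ⊕ c , z))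
                (λ ((z , w) , (a , c)) → cong (λ y → a ⊕ w , (y , z)) (xor (a ∷ c ∷ w ∷ []) ((a₀ :⊕ a₂) :⊕ a₁) ((a₀ :⊕ a₁) :⊕ a₂) refl)))
              (proj₂ (coupled-first s)))
        (≤ᵥ-trans (Ent-submodular ω B₁ A₂ Z) (+ᵥ-mono (proj₁ (coupled-first (λ ((c , w) , a) → a ⊕ w , c))) (proj₁ (coupled-second (λ ((c , w) , a) → a , c)))))

    -- The entropic Balog–Szemerédi–Gowers lemma for A and B = A ⊕ W, conditionally on C.  Given C and W = A ⊕ B,
    -- the law of B is a translate of the law of A, so that only the latter appears.
    balog-szemerédi-gowers : ∑ᵥ (λ i → ∑ (fibre i) · entropy (fibre i ⊛ʷ fibre i) id) ≤ᵥ
      mass · (2 · EA +ᵥ 2 · EB -ᵥ 3 · Ent ρ s -ᵥ 2 · Ent ρ id +ᵥ Ent ρ proj₁)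
    balog-szemerédi-gowers = ≤ᵥ-trans (proj₁ (𝕍Σ.∑-cong (λ i → ·-zero-or (∑ (fibre i)) (λ nz →
        entropy-⊛ʷ (fibre i) (fibre i) {{⊠-nonZero {C = ⊤} (fibre i) (fibre i) {{nz}} {{nz}}}}))))
      (≤ᵥ-trans (proj₁ (conditional-coupled plus)) (·-mono mass
        (by (Ent ω (λ (i , (a , c)) → i , (a ⊕ c)) ∷ Ent ρ proj₁ ∷ EA ∷ EB ∷ Ent ρ s ∷ Ent ρ id ∷
             Ent ω < Y , Z > ∷ Ent ω < A₁ , < Y , Z > > ∷ Ent ω < B₁ , < Y , Z > > ∷ Ent ω id ∷ [])
          (v₀ :- v₁ ⊑ 2 :· v₂ :+ 2 :· v₃ :- 3 :· v₄ :- 2 :· v₅ :+ v₁)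
          ((1 , v₀ :+ v₄ ⊑ v₁ :+ v₆) ∷ (1 , v₉ :+ v₆ ⊑ v₇ :+ v₈) ∷ (1 , v₇ :+ v₄ ⊑ v₂ :+ v₃) ∷ (1 , v₈ :+ v₄ ⊑ v₃ :+ v₂) ∷
           (1 , 2 :· v₅ :- v₁ ⊑ v₉) ∷ []) refl
          (step₁ ∷ step₂ ∷ step₃ ∷ step₄ ∷ proj₂ coupled-total ∷ []))))

module _ {A B : Set} {{_ : Finite A}} {{_ : Finite B}} (f : A → ℕ) (g : B → ℕ) where

  ∑ᵥ-⊠-proj₁ : (u : A → 𝕍) → ∑ᵥ (λ (a , b) → (f a * g b) · u a) ≈ᵥ ∑ g · ∑ᵥ (λ a → f a · u a)
  ∑ᵥ-⊠-proj₁ u = ≈ᵥ-trans (𝕍Σ.∑-× (λ (a , b) → (f a * g b) · u a)) (≈ᵥ-trans (𝕍Σ.∑-cong (λ a →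
    ≈ᵥ-trans (∑ᵥ-·ʳ (λ b → f a * g b) (u a)) (≈ᵥ-trans (·-congˡ (trans (∑-*ˡ (f a) g) (ℕ.*-comm (f a) (∑ g)))) (≈ᵥ-sym (·-assocˡ (u a) (∑ g) (f a))))))
    (𝕍Σ.∑-✦ {A} (∑ g) (λ a → f a · u a)))

  ∑ᵥ-⊠-proj₂ : (v : B → 𝕍) → ∑ᵥ (λ (a , b) → (f a * g b) · v b) ≈ᵥ ∑ f · ∑ᵥ (λ b → g b · v b)
  ∑ᵥ-⊠-proj₂ v = ≈ᵥ-trans (𝕍Σ.∑-× (λ (a , b) → (f a * g b) · v b)) (≈ᵥ-trans (𝕍Σ.∑-cong (λ a →
    ≈ᵥ-trans (𝕍Σ.∑-cong (λ b → ≈ᵥ-sym (·-assocˡ (v b) (f a) (g b)))) (𝕍Σ.∑-✦ {B} (f a) (λ b → g b · v b))))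
    (∑ᵥ-·ʳ f (∑ᵥ (λ b → g b · v b))))

module _ {A B C D E : Set} {{_ : Finite A}} {{_ : Finite B}} {{_ : Finite C}} {{_ : Finite D}} {{_ : Finite E}}
         (μ : Dist A) (ν : Dist B) where

  Ent-⊗-push : (X : A → C) (Y : B → D) (Z : C × D → E) → Ent (push μ X ⊗ᵈ push ν Y) Z ≈ᵥ Ent (μ ⊗ᵈ ν) (λ (a , b) → Z (X a , Y b))
  Ent-⊗-push X Y Z = ≈ᵥ-trans
    (≈ᵥ-sym (entropy-cong (λ (c , d) → law-⊠ (weight μ) (weight ν) X Y c d) (λ _ → refl)
      {{nonZero (push (μ ⊗ᵈ ν) (λ (a , b) → X a , Y b))}}))
    (Ent-push (μ ⊗ᵈ ν) (λ (a , b) → X a , Y b) Z)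

module Selection {G : Set} {{FG : Finite G}} (𝔾 : BooleanGroup G) (ξ : Dist G) where

  open SumsetEntropy 𝔾
  open Families 𝔾
  open Linear using (Expr) renaming (⟦_⟧ to ⟪_⟫)

  dist : (p : G → ℕ) → NonZero (∑ p) → Dist G
  dist = _,ᵈ_

  -- The variables stand for the entropies of p ⊛ q, p, q, ξ ⊛ p, ξ ⊛ q and ξ, in this order.
  costₑ : Expr 6
  costₑ = 16 :· (2 :· v₀ :- v₁ :- v₂) :+ (2 :· v₃ :- v₅ :- v₁) :+ (2 :· v₄ :- v₅ :- v₂)

  -- 16 (d(p,q) + d(ξ,p) / 16 + d(ξ,q) / 16) for the doubled distance d, that is, the functional τ with η = 1/16.
  cost : (G → ℕ) → (G → ℕ) → 𝕍
  cost p q = 16 · distance p q +ᵥ distance (weight ξ) p +ᵥ distance (weight ξ) q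

  costₑ-mono : ∀ (x y : Vec 𝕍 6) → let _!_ = lookup in
    x ! zero ≤ᵥ y ! zero → y ! suc zero ≤ᵥ x ! suc zero → y ! suc (suc zero) ≤ᵥ x ! suc (suc zero) →
    x ! suc (suc (suc zero)) ≤ᵥ y ! suc (suc (suc zero)) → x ! suc (suc (suc (suc zero))) ≤ᵥ y ! suc (suc (suc (suc zero))) →
    y ! suc (suc (suc (suc (suc zero)))) ≤ᵥ x ! suc (suc (suc (suc (suc zero)))) → ⟪ costₑ ⟫ x ≤ᵥ ⟪ costₑ ⟫ y
  costₑ-mono (x₀ ∷ x₁ ∷ x₂ ∷ x₃ ∷ x₄ ∷ x₅ ∷ []) (y₀ ∷ y₁ ∷ y₂ ∷ y₃ ∷ y₄ ∷ y₅ ∷ []) p₀ p₁ p₂ p₃ p₄ p₅ =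
    by (x₀ ∷ x₁ ∷ x₂ ∷ x₃ ∷ x₄ ∷ x₅ ∷ y₀ ∷ y₁ ∷ y₂ ∷ y₃ ∷ y₄ ∷ y₅ ∷ [])
      (16 :· (2 :· v₀ :- v₁ :- v₂) :+ (2 :· v₃ :- v₅ :- v₁) :+ (2 :· v₄ :- v₅ :- v₂) ⊑
       16 :· (2 :· v₆ :- v₇ :- v₈) :+ (2 :· v₉ :- v₁₁ :- v₇) :+ (2 :· v₁₀ :- v₁₁ :- v₈))
      ((32 , v₀ ⊑ v₆) ∷ (17 , v₇ ⊑ v₁) ∷ (17 , v₈ ⊑ v₂) ∷ (2 , v₃ ⊑ v₉) ∷ (2 , v₄ ⊑ v₁₀) ∷ (2 , v₁₁ ⊑ v₅) ∷ []) refl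
      (p₀ ∷ p₁ ∷ p₂ ∷ p₃ ∷ p₄ ∷ p₅ ∷ [])

  -- Conditioning the sum of x and y on the index i does not raise its entropy. Independence of ξ
  -- makes the sum, given i, distributed as ξ convolved with the fibre.
  reference : ∀ {I} {{_ : Finite I}} (ρ : Dist (I × G)) → let open Coupling ρ in
    ∑ᵥ (λ i → ∑ (fibre i) · entropy (weight ξ ⊛ʷ fibre i) id) ≤ᵥ mass · Ent (ξ ⊗ᵈ ρ) (λ (x , (i , y)) → x ⊕ y)
  reference {I} ρ = ·-cancel n {{nonZero ξ}} (begin
    n · ∑ᵥ (λ i → ∑ (fibre i) · entropy (weight ξ ⊛ʷ fibre i) id)    ≈⟨ 𝕍Σ.∑-✦ {I} n _ ⟨
    ∑ᵥ (λ i → n · ∑ (fibre i) · entropy (weight ξ ⊛ʷ fibre i) id)    ≈⟨ 𝕍Σ.∑-cong {I} at ⟩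
    ∑ᵥ (λ i → ∑ (λ (xy : G × G) → w (i , xy)) · entropy (λ xy → w (i , xy)) plus) ≈⟨ conditional-entropy w (plus ∘ proj₂) ⟩
    ∑ w · (Ent ω < proj₁ , plus ∘ proj₂ > -ᵥ Ent ω proj₁)              ≲⟨ ·-mono (∑ w) (by
        (Ent ω < proj₁ , plus ∘ proj₂ > ∷ Ent ω proj₁ ∷ Ent ω (plus ∘ proj₂) ∷ []) (v₀ :- v₁ ⊑ v₂) ((1 , v₀ ⊑ v₁ :+ v₂) ∷ []) refl
        (Ent-subadditive ω proj₁ (plus ∘ proj₂) ∷ [])) ⟩
    ∑ w · Ent ω (plus ∘ proj₂)                                         ≈⟨ ·-congˡ w-mass ⟩
    (n * mass) · Ent ω (plus ∘ proj₂)                                  ≈⟨ ·-congʳ (n * mass) (Ent-reindex ω (ξ ⊗ᵈ ρ) φ ψ (λ _ → refl) (λ _ → refl) (λ _ → refl) _ _ (λ _ → refl)) ⟩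
    (n * mass) · Ent (ξ ⊗ᵈ ρ) (λ (x , (i , y)) → x ⊕ y)                ≈⟨ ·-assocˡ _ n mass ⟨
    n · mass · Ent (ξ ⊗ᵈ ρ) (λ (x , (i , y)) → x ⊕ y)                  ∎)
    where
    open 𝕍-Reasoning
    open Coupling ρ
    n = ∑ (weight ξ)
    φ : I × (G × G) → G × (I × G)
    φ (i , (x , y)) = x , (i , y)
    ψ : G × (I × G) → I × (G × G)
    ψ (x , (i , y)) = i , (x , y)
    w : I × (G × G) → ℕ
    w = (weight ξ ⊠ weight ρ) ∘ φ
    w-mass : ∑ w ≡ n * mass
    w-mass = trans (∑-bijection φ ψ (λ _ → refl) (λ _ → refl) (weight ξ ⊠ weight ρ)) (∑-*-∑ (weight ξ) (weight ρ))
    ω : Dist (I × (G × G))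
    ω = w ,ᵈ subst NonZero (sym w-mass) (ℕ.m*n≢0 n mass {{nonZero ξ}} {{nonZero ρ}})
    at : ∀ i → n · ∑ (fibre i) · entropy (weight ξ ⊛ʷ fibre i) id ≈ᵥ ∑ (weight ξ ⊠ fibre i) · entropy (weight ξ ⊠ fibre i) plus
    at i = ≈ᵥ-trans (·-assocˡ _ n (∑ (fibre i))) (≈ᵥ-trans (·-congˡ (sym (∑-*-∑ (weight ξ) (fibre i))))
      (·-zero-or (∑ (weight ξ ⊠ fibre i)) (λ nz → entropy-⊛ʷ (weight ξ) (fibre i) {{nz}})))

  module _ {I J : Set} {{_ : Finite I}} {{_ : Finite J}} (ρ : Dist (I × G)) (κ : Dist (J × G)) where

    private
      module ρ = Coupling ρ
      module κ = Coupling κ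
      c : I × J → ℕ
      c (i , j) = ∑ (ρ.fibre i) * ∑ (κ.fibre j)
      joint : (I × G) × (J × G) → (I × J) × G
      joint ((i , x) , (j , y)) = (i , j) , x ⊕ y
      outer : (I × G) × (J × G) → I × J
      outer ((i , x) , (j , y)) = i , j
      W = ρ.mass * κ.mass

      total : ∑ c ≡ W
      total = trans (∑-*-∑ (λ i → ∑ (ρ.fibre i)) (λ j → ∑ (κ.fibre j))) (cong₂ _*_ (sym (∑-× (weight ρ))) (sym (∑-× (weight κ))))

    conditional-⊛ : ∑ᵥ (λ (i , j) → c (i , j) · entropy (ρ.fibre i ⊛ʷ κ.fibre j) id) ≈ᵥ
                    W · (Ent (ρ ⊗ᵈ κ) joint -ᵥ Ent (ρ ⊗ᵈ κ) outer)
    conditional-⊛ = ≈ᵥ-trans (𝕍Σ.∑-cong (λ (i , j) → at i j)) (≈ᵥ-trans (conditional-entropy w (plus ∘ proj₂))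
      (≈ᵥ-trans (·-congˡ w-mass) (·-congʳ W (+ᵥ-cong
        (Ent-reindex ω (ρ ⊗ᵈ κ) φ ψ (λ _ → refl) (λ _ → refl) (λ _ → refl) _ joint (λ _ → refl))
        (-ᵥ-cong (Ent-reindex ω (ρ ⊗ᵈ κ) φ ψ (λ _ → refl) (λ _ → refl) (λ _ → refl) _ outer (λ _ → refl)))))))
      where
      φ : (I × J) × (G × G) → (I × G) × (J × G)
      φ ((i , j) , (x , y)) = (i , x) , (j , y)
      ψ : (I × G) × (J × G) → (I × J) × (G × G)
      ψ ((i , x) , (j , y)) = (i , j) , (x , y)
      w : (I × J) × (G × G) → ℕ
      w = (weight ρ ⊠ weight κ) ∘ φ
      w-mass : ∑ w ≡ W
      w-mass = trans (∑-bijection φ ψ (λ _ → refl) (λ _ → refl) (weight ρ ⊠ weight κ)) (∑-*-∑ (weight ρ) (weight κ))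
      ω : Dist ((I × J) × (G × G))
      ω = w ,ᵈ subst NonZero (sym w-mass) (ℕ.m*n≢0 ρ.mass κ.mass {{nonZero ρ}} {{nonZero κ}})
      at : ∀ i j → c (i , j) · entropy (ρ.fibre i ⊛ʷ κ.fibre j) id ≈ᵥ ∑ (ρ.fibre i ⊠ κ.fibre j) · entropy (ρ.fibre i ⊠ κ.fibre j) plus
      at i j = ≈ᵥ-trans (·-congˡ (sym (∑-*-∑ (ρ.fibre i) (κ.fibre j))))
        (·-zero-or (∑ (ρ.fibre i ⊠ κ.fibre j)) (λ nz → entropy-⊛ʷ (ρ.fibre i) (κ.fibre j) {{nz}}))

    -- The cost is averaged over all pairs of fibres, one of each law. If no pair reaches t, then t
    -- is at most an expression in unconditional entropies, since the chain rule evaluates the terms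
    -- with known index and `reference` bounds those with ξ.
    select-pair : ∀ t → (Σ[ μ ∈ Dist G ] Σ[ ν ∈ Dist G ] cost (weight μ) (weight ν) ≤ᵥ t) ⊎
      t ≤ᵥ ⟪ costₑ ⟫ (Ent (ρ ⊗ᵈ κ) joint -ᵥ Ent (ρ ⊗ᵈ κ) outer ∷ Ent ρ id -ᵥ Ent ρ proj₁ ∷ Ent κ id -ᵥ Ent κ proj₁ ∷
        Ent (ξ ⊗ᵈ ρ) (λ (x , (i , y)) → x ⊕ y) ∷ Ent (ξ ⊗ᵈ κ) (λ (x , (i , y)) → x ⊕ y) ∷ H ξ ∷ [])
    select-pair t with select c (λ (i , j) → cost (ρ.fibre i) (κ.fibre j)) t
    ... | inj₁ ((i , j) , nz , le) = inj₁ (dist (ρ.fibre i) (ℕ.m*n≢0⇒m≢0 (∑ (ρ.fibre i)) {{nz}}) , dist (κ.fibre j) (ℕ.m*n≢0⇒n≢0 (∑ (ρ.fibre i)) {{nz}}) , le)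
    ... | inj₂ le = inj₂ (·-cancel W {{ℕ.m*n≢0 ρ.mass κ.mass {{nonZero ρ}} {{nonZero κ}}}} (begin
      W · t                                   ≈⟨ ·-congˡ total ⟨
      ∑ c · t                                 ≲⟨ le ⟩
      average c (λ (i , j) → cost (ρ.fibre i) (κ.fibre j)) ≈⟨ ∑-linear c costₑ φs ⟩
      ⟪ costₑ ⟫ (Vec.map (average c) φs)      ≲⟨ monotone ⟩
      ⟪ costₑ ⟫ (Vec.map (W ·_) bounds)       ≈⟨ ·-linear W costₑ bounds ⟨
      W · ⟪ costₑ ⟫ bounds                    ∎))
      where
      open 𝕍-Reasoning
      φ₀ φ₁ φ₂ φ₃ φ₄ φ₅ : I × J → 𝕍
      φ₀ (i , j) = entropy (ρ.fibre i ⊛ʷ κ.fibre j) id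
      φ₁ (i , j) = entropy (ρ.fibre i) id
      φ₂ (i , j) = entropy (κ.fibre j) id
      φ₃ (i , j) = entropy (weight ξ ⊛ʷ ρ.fibre i) id
      φ₄ (i , j) = entropy (weight ξ ⊛ʷ κ.fibre j) id
      φ₅ (i , j) = H ξ
      φs : Vec (I × J → 𝕍) 6
      φs = φ₀ ∷ φ₁ ∷ φ₂ ∷ φ₃ ∷ φ₄ ∷ φ₅ ∷ []
      bounds : Vec 𝕍 6
      bounds = Ent (ρ ⊗ᵈ κ) joint -ᵥ Ent (ρ ⊗ᵈ κ) outer ∷ Ent ρ id -ᵥ Ent ρ proj₁ ∷ Ent κ id -ᵥ Ent κ proj₁ ∷
        Ent (ξ ⊗ᵈ ρ) (λ (x , (i , y)) → x ⊕ y) ∷ Ent (ξ ⊗ᵈ κ) (λ (x , (i , y)) → x ⊕ y) ∷ H ξ ∷ []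
      left : ∀ (u : I → 𝕍) → average c (λ (i , j) → u i) ≈ᵥ κ.mass · ∑ᵥ (λ i → ∑ (ρ.fibre i) · u i)
      left u = ≈ᵥ-trans (∑ᵥ-⊠-proj₁ (λ i → ∑ (ρ.fibre i)) (λ j → ∑ (κ.fibre j)) u) (·-congˡ (sym (∑-× (weight κ))))
      right : ∀ (u : J → 𝕍) → average c (λ (i , j) → u j) ≈ᵥ ρ.mass · ∑ᵥ (λ j → ∑ (κ.fibre j) · u j)
      right u = ≈ᵥ-trans (∑ᵥ-⊠-proj₂ (λ i → ∑ (ρ.fibre i)) (λ j → ∑ (κ.fibre j)) u) (·-congˡ (sym (∑-× (weight ρ))))
      assocˡ : ∀ v → κ.mass · ρ.mass · v ≈ᵥ W · v
      assocˡ v = ≈ᵥ-trans (·-assocˡ v κ.mass ρ.mass) (·-congˡ (ℕ.*-comm κ.mass ρ.mass))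
      assocʳ : ∀ v → ρ.mass · κ.mass · v ≈ᵥ W · v
      assocʳ v = ·-assocˡ v ρ.mass κ.mass
      monotone : ⟪ costₑ ⟫ (Vec.map (average c) φs) ≤ᵥ ⟪ costₑ ⟫ (Vec.map (W ·_) bounds)
      monotone = costₑ-mono (Vec.map (average c) φs) (Vec.map (W ·_) bounds)
        (proj₁ conditional-⊛)
        (proj₂ (≈ᵥ-trans (left _) (≈ᵥ-trans (·-congʳ κ.mass ρ.conditional-Ent) (assocˡ _))))
        (proj₂ (≈ᵥ-trans (right _) (≈ᵥ-trans (·-congʳ ρ.mass κ.conditional-Ent) (assocʳ _))))
        (≤ᵥ-trans (proj₁ (left _)) (≤ᵥ-trans (·-mono κ.mass (reference ρ)) (proj₁ (assocˡ _))))
        (≤ᵥ-trans (proj₁ (right _)) (≤ᵥ-trans (·-mono ρ.mass (reference κ)) (proj₁ (assocʳ _))))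
        (proj₂ (≈ᵥ-trans (∑ᵥ-·ʳ c (H ξ)) (·-congˡ total)))

  module _ {I : Set} {{_ : Finite I}} (ρ : Dist (I × G)) where

    open Coupling ρ

    -- Here the same fibre occurs twice, and the entropy of its sum with itself is not given by the
    -- chain rule. The bound R will come from the Balog-Szemerédi-Gowers lemma.
    select-diagonal : ∀ t R → ∑ᵥ (λ i → ∑ (fibre i) · entropy (fibre i ⊛ʷ fibre i) id) ≤ᵥ mass · R →
      (Σ[ μ ∈ Dist G ] cost (weight μ) (weight μ) ≤ᵥ t) ⊎
      t ≤ᵥ ⟪ costₑ ⟫ (R ∷ Ent ρ id -ᵥ Ent ρ proj₁ ∷ Ent ρ id -ᵥ Ent ρ proj₁ ∷
        Ent (ξ ⊗ᵈ ρ) (λ (x , (i , y)) → x ⊕ y) ∷ Ent (ξ ⊗ᵈ ρ) (λ (x , (i , y)) → x ⊕ y) ∷ H ξ ∷ [])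
    select-diagonal t R bound with select (λ i → ∑ (fibre i)) (λ i → cost (fibre i) (fibre i)) t
    ... | inj₁ (i , nz , le) = inj₁ (dist (fibre i) nz , le)
    ... | inj₂ le = inj₂ (·-cancel mass {{nonZero ρ}} (begin
      mass · t                                ≈⟨ ·-congˡ (∑-× (weight ρ)) ⟩
      ∑ c · t                                 ≲⟨ le ⟩
      average c (λ i → cost (fibre i) (fibre i)) ≈⟨ ∑-linear c costₑ φs ⟩
      ⟪ costₑ ⟫ (Vec.map (average c) φs)      ≲⟨ monotone ⟩
      ⟪ costₑ ⟫ (Vec.map (mass ·_) bounds)    ≈⟨ ·-linear mass costₑ bounds ⟨
      mass · ⟪ costₑ ⟫ bounds                 ∎))
      where
      open 𝕍-Reasoning
      c : I → ℕ
      c i = ∑ (fibre i)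
      φ₁ φ₃ : I → 𝕍
      φ₁ i = entropy (fibre i) id
      φ₃ i = entropy (weight ξ ⊛ʷ fibre i) id
      φs : Vec (I → 𝕍) 6
      φs = (λ i → entropy (fibre i ⊛ʷ fibre i) id) ∷ φ₁ ∷ φ₁ ∷ φ₃ ∷ φ₃ ∷ (λ _ → H ξ) ∷ []
      bounds : Vec 𝕍 6
      bounds = R ∷ Ent ρ id -ᵥ Ent ρ proj₁ ∷ Ent ρ id -ᵥ Ent ρ proj₁ ∷
        Ent (ξ ⊗ᵈ ρ) (λ (x , (i , y)) → x ⊕ y) ∷ Ent (ξ ⊗ᵈ ρ) (λ (x , (i , y)) → x ⊕ y) ∷ H ξ ∷ []
      monotone : ⟪ costₑ ⟫ (Vec.map (average c) φs) ≤ᵥ ⟪ costₑ ⟫ (Vec.map (mass ·_) bounds)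
      monotone = costₑ-mono (Vec.map (average c) φs) (Vec.map (mass ·_) bounds) bound (proj₂ conditional-Ent) (proj₂ conditional-Ent) (reference ρ) (reference ρ)
        (proj₂ (≈ᵥ-trans (∑ᵥ-·ʳ c (H ξ)) (·-congˡ (sym (∑-× (weight ρ))))))

-- Descent to a law with almost no doubling

module Decrement {G : Set} {{FG : Finite G}} (𝔾 : BooleanGroup G) (ξ : Dist G) where

  open SumsetEntropy 𝔾
  open Families 𝔾
  open Selection 𝔾 ξ
  open Linear using (Expr) renaming (⟦_⟧ to ⟪_⟫)

  -- The sum is the index: the fibres are the laws of x conditioned on the values of x ⊕ y.
  difference : Dist G → Dist G → Dist (G × G)
  difference α β = push (α ⊗ᵈ β) (λ (x , y) → x ⊕ y , x)

  module _ (α β : Dist G) where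

    difference-total : Ent (difference α β) id ≈ᵥ H α +ᵥ H β
    difference-total = ≈ᵥ-trans (Ent-push (α ⊗ᵈ β) _ id) (≈ᵥ-trans
      (Ent-iso (α ⊗ᵈ β) _ id (λ (x , y) → x ⊕ y , x) (λ (s , x) → x , s ⊕ x) (λ _ → refl)
        (λ (x , y) → cong (x ,_) (xor (x ∷ y ∷ []) ((a₀ :⊕ a₁) :⊕ a₀) a₁ refl)))
      (Ent-⊗ α β id id))

    difference-sum : Ent (difference α β) proj₁ ≈ᵥ H (α ⊛ β)
    difference-sum = ≈ᵥ-trans (Ent-push (α ⊗ᵈ β) _ proj₁) (≈ᵥ-sym (H-⊛ α β))

    difference-reference : Ent (ξ ⊗ᵈ difference α β) (λ (x , (i , y)) → x ⊕ y) ≈ᵥ H (ξ ⊛ α)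
    difference-reference = ≈ᵥ-trans (Ent-⊗-pushʳ ξ (α ⊗ᵈ β) _ _) (≈ᵥ-trans
      (Ent-reindex (ξ ⊗ᵈ α ⊗ᵈ β) ((ξ ⊗ᵈ α) ⊗ᵈ β) (λ (x , (y , z)) → (x , y) , z) (λ ((x , y) , z) → x , (y , z)) (λ _ → refl) (λ _ → refl)
        (λ (x , (y , z)) → sym (ℕ.*-assoc (weight ξ x) _ _)) _ (plus ∘ proj₁) (λ _ → refl))
      (≈ᵥ-trans (Ent-⊗-proj₁ (ξ ⊗ᵈ α) β plus) (≈ᵥ-sym (H-⊛ ξ α))))

  Quad : Set
  Quad = (G × G) × (G × G)

  cross : Quad → (G × G) × G
  cross ((x , y) , (x′ , y′)) = (x ⊕ y , x′ ⊕ y′) , x ⊕ x′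

  select-difference : ∀ α β γ κ t → (Σ[ μ ∈ Dist G ] Σ[ ν ∈ Dist G ] cost (weight μ) (weight ν) ≤ᵥ t) ⊎
    t ≤ᵥ ⟪ costₑ ⟫ (Ent ((α ⊗ᵈ β) ⊗ᵈ (γ ⊗ᵈ κ)) cross -ᵥ (H (α ⊛ β) +ᵥ H (γ ⊛ κ)) ∷ H α +ᵥ H β -ᵥ H (α ⊛ β) ∷ H γ +ᵥ H κ -ᵥ H (γ ⊛ κ) ∷
      H (ξ ⊛ α) ∷ H (ξ ⊛ γ) ∷ H ξ ∷ [])
  select-difference α β γ κ t = ⊎.map₂ (λ le → ≤ᵥ-trans le improve) (select-pair (difference α β) (difference γ κ) t)
    where
    split : G × G → G × G
    split (x , y) = x ⊕ y , x
    joint : (G × G) × (G × G) → (G × G) × G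
    joint ((i , x) , (j , y)) = (i , j) , x ⊕ y
    outer : (G × G) × (G × G) → G × G
    outer ((i , x) , (j , y)) = i , j
    π = difference α β ⊗ᵈ difference γ κ
    xs ys : Vec 𝕍 6
    xs = Ent π joint -ᵥ Ent π outer ∷ Ent (difference α β) id -ᵥ Ent (difference α β) proj₁ ∷ Ent (difference γ κ) id -ᵥ Ent (difference γ κ) proj₁ ∷
      Ent (ξ ⊗ᵈ difference α β) (λ (x , (i , y)) → x ⊕ y) ∷ Ent (ξ ⊗ᵈ difference γ κ) (λ (x , (i , y)) → x ⊕ y) ∷ H ξ ∷ []
    ys = Ent ((α ⊗ᵈ β) ⊗ᵈ (γ ⊗ᵈ κ)) cross -ᵥ (H (α ⊛ β) +ᵥ H (γ ⊛ κ)) ∷ H α +ᵥ H β -ᵥ H (α ⊛ β) ∷ H γ +ᵥ H κ -ᵥ H (γ ⊛ κ) ∷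
      H (ξ ⊛ α) ∷ H (ξ ⊛ γ) ∷ H ξ ∷ []
    Ent-joint : Ent π joint ≈ᵥ Ent ((α ⊗ᵈ β) ⊗ᵈ (γ ⊗ᵈ κ)) cross
    Ent-joint = Ent-⊗-push (α ⊗ᵈ β) (γ ⊗ᵈ κ) split split joint
    Ent-outer : Ent π outer ≈ᵥ H (α ⊛ β) +ᵥ H (γ ⊛ κ)
    Ent-outer = ≈ᵥ-trans (Ent-⊗ (difference α β) (difference γ κ) proj₁ proj₁) (+ᵥ-cong (difference-sum α β) (difference-sum γ κ))
    improve : ⟪ costₑ ⟫ xs ≤ᵥ ⟪ costₑ ⟫ ys
    improve = costₑ-mono xs ys (proj₁ (+ᵥ-cong Ent-joint (-ᵥ-cong Ent-outer)))
      (proj₂ (+ᵥ-cong (difference-total α β) (-ᵥ-cong (difference-sum α β))))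
      (proj₂ (+ᵥ-cong (difference-total γ κ) (-ᵥ-cong (difference-sum γ κ))))
      (proj₁ (difference-reference α β)) (proj₁ (difference-reference γ κ)) ≤ᵥ-refl

  H-⊛-swapʳ : ∀ α β γ → H (α ⊛ β ⊛ γ) ≈ᵥ H (α ⊛ γ ⊛ β)
  H-⊛-swapʳ α β γ = ≈ᵥ-trans (H-⊛-⊛ α β γ) (≈ᵥ-trans
    (Ent-reindex (α ⊗ᵈ β ⊗ᵈ γ) (α ⊗ᵈ γ ⊗ᵈ β) (λ (a , (b , c)) → a , (c , b)) (λ (a , (b , c)) → a , (c , b)) (λ _ → refl) (λ _ → refl)
      (λ (a , (b , c)) → cong (weight α a *_) (ℕ.*-comm (weight β b) (weight γ c))) _ _ (λ (a , (b , c)) → cong (a ⊕_) (⊕-comm b c)))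
    (≈ᵥ-sym (H-⊛-⊛ α γ β)))

  module _ (μ ν : Dist G) where

    private
      ω : Dist Quad
      ω = (μ ⊗ᵈ μ) ⊗ᵈ (ν ⊗ᵈ ν)

      U W W′ S : Quad → G
      U  ((x₁ , y₁) , (x₂ , y₂)) = x₁ ⊕ x₂
      W  ((x₁ , y₁) , (x₂ , y₂)) = x₁ ⊕ y₁
      W′ ((x₁ , y₁) , (x₂ , y₂)) = x₂ ⊕ y₂
      S  ((x₁ , y₁) , (x₂ , y₂)) = (x₁ ⊕ y₁) ⊕ (x₂ ⊕ y₂)

      h₀ h₁ h₂ s h₁₁ h₂₂ S₄ Q K₁ K₂ Kₛ K₁₁ K₂₂ : 𝕍
      h₀ = H ξ
      h₁ = H μ
      h₂ = H ν
      s = H (μ ⊛ ν)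
      h₁₁ = H (μ ⊛ μ)
      h₂₂ = H (ν ⊛ ν)
      S₄ = Ent ω S
      Q = Ent ω cross
      K₁ = H (ξ ⊛ μ)
      K₂ = H (ξ ⊛ ν)
      Kₛ = H (ξ ⊛ μ ⊛ ν)
      K₁₁ = H (ξ ⊛ μ ⊛ μ)
      K₂₂ = H (ξ ⊛ ν ⊛ ν)

      -- Given the sum `S` of all four variables, the Balog-Szemerédi-Gowers lemma is applied to `U`
      -- = x₁ ⊕ x₂ and x₂ ⊕ y₁, whose sum is `W` = x₁ ⊕ y₁. All three have small entropy given `S`.
      ρ : Dist ((G × G) × G)
      ρ = push ω < < S , W > , U >

      regroup : ∀ a b c d → (a * b) * (c * d) ≡ (a * d) * (c * b)
      regroup = solve-∀

      regroup′ : ∀ a b c d → (a * b) * (c * d) ≡ (a * c) * (b * d)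
      regroup′ = solve-∀

      -- After y₁ and y₂ are exchanged, the sums x₁ ⊕ y₂, x₂ ⊕ y₁, x₁ ⊕ x₂ and the sums x₁ ⊕ y₁, x₂
      -- ⊕ y₂, x₁ ⊕ x₂ determine each other. Hence one unknown `Q` serves both families of
      -- conditioned sums.
      crossed : Ent ((μ ⊗ᵈ ν) ⊗ᵈ (ν ⊗ᵈ μ)) cross ≈ᵥ Q
      crossed = ≈ᵥ-trans
        (Ent-reindex ((μ ⊗ᵈ ν) ⊗ᵈ (ν ⊗ᵈ μ)) ω φ φ (λ _ → refl) (λ _ → refl)
          (λ ((x₁ , y₂) , (x₂ , y₁)) → regroup (weight μ x₁) (weight ν y₂) (weight ν x₂) (weight μ y₁)) cross X (λ _ → refl))
        (Ent-iso ω X cross (λ ((w , w′) , u) → (u ⊕ w′ , u ⊕ w) , u) (λ ((p , q) , u) → (u ⊕ q , u ⊕ p) , u)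
          (λ ((x₁ , y₁) , (x₂ , y₂)) → cong₂ (λ p q → (p , q) , x₁ ⊕ x₂)
            (xor (x₁ ∷ x₂ ∷ y₂ ∷ []) ((a₀ :⊕ a₁) :⊕ (a₁ :⊕ a₂)) (a₀ :⊕ a₂) refl)
            (xor (x₁ ∷ x₂ ∷ y₁ ∷ []) ((a₀ :⊕ a₁) :⊕ (a₀ :⊕ a₂)) (a₁ :⊕ a₂) refl))
          (λ ((x₁ , y₁) , (x₂ , y₂)) → cong₂ (λ p q → (p , q) , x₁ ⊕ x₂)
            (xor (x₁ ∷ x₂ ∷ y₁ ∷ []) ((a₀ :⊕ a₁) :⊕ (a₁ :⊕ a₂)) (a₀ :⊕ a₂) refl)
            (xor (x₁ ∷ x₂ ∷ y₂ ∷ []) ((a₀ :⊕ a₁) :⊕ (a₀ :⊕ a₂)) (a₁ :⊕ a₂) refl)))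
        where
        φ : Quad → Quad
        φ ((x , y) , (x′ , y′)) = (x , y′) , (x′ , y)
        X : Quad → (G × G) × G
        X ((x₁ , y₁) , (x₂ , y₂)) = (x₁ ⊕ y₂ , x₂ ⊕ y₁) , x₁ ⊕ x₂

      two-sums : ∀ (φ : Quad → Quad) → (∀ q → φ (φ q) ≡ q) → (∀ q → weight ω q ≡ weight ((μ ⊗ᵈ ν) ⊗ᵈ (μ ⊗ᵈ ν)) (φ q)) →
                 Ent ω (λ q → plus (proj₁ (φ q)) , plus (proj₂ (φ q))) ≈ᵥ s +ᵥ s
      two-sums φ φφ eq = ≈ᵥ-trans (Ent-reindex ω ((μ ⊗ᵈ ν) ⊗ᵈ (μ ⊗ᵈ ν)) φ φ φφ φφ eq _ (λ (p , q) → plus p , plus q) (λ _ → refl))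
        (≈ᵥ-trans (Ent-⊗ (μ ⊗ᵈ ν) (μ ⊗ᵈ ν) plus plus) (≈ᵥ-sym (+ᵥ-cong (H-⊛ μ ν) (H-⊛ μ ν))))

      sum-U : Ent ρ (λ ((c , w) , a) → a , c) ≤ᵥ s +ᵥ s
      sum-U = ≤ᵥ-trans (proj₁ (Ent-push ω _ _)) (≤ᵥ-trans (Ent-function ω < U , S > (λ ((x₁ , y₁) , (x₂ , y₂)) → x₁ ⊕ x₂ , y₁ ⊕ y₂)
          (λ (u , v) → u , u ⊕ v) (λ ((x₁ , y₁) , (x₂ , y₂)) → cong (x₁ ⊕ x₂ ,_)
            (xor (x₁ ∷ y₁ ∷ x₂ ∷ y₂ ∷ []) ((a₀ :⊕ a₂) :⊕ (a₁ :⊕ a₃)) ((a₀ :⊕ a₁) :⊕ (a₂ :⊕ a₃)) refl)))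
        (proj₁ (two-sums (λ ((x₁ , y₁) , (x₂ , y₂)) → (x₁ , x₂) , (y₁ , y₂)) (λ _ → refl)
          (λ ((x₁ , y₁) , (x₂ , y₂)) → regroup′ (weight μ x₁) (weight μ y₁) (weight ν x₂) (weight ν y₂)))))

      sum-V : Ent ρ (λ ((c , w) , a) → a ⊕ w , c) ≤ᵥ s +ᵥ s
      sum-V = ≤ᵥ-trans (proj₁ (Ent-push ω _ _)) (≤ᵥ-trans (Ent-function ω _ (λ ((x₁ , y₁) , (x₂ , y₂)) → x₁ ⊕ y₂ , x₂ ⊕ y₁)
          (λ (u , v) → v , u ⊕ v) (λ ((x₁ , y₁) , (x₂ , y₂)) → cong₂ _,_
            (xor (x₁ ∷ y₁ ∷ x₂ ∷ y₂ ∷ []) (a₂ :⊕ a₁) ((a₀ :⊕ a₂) :⊕ (a₀ :⊕ a₁)) refl)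
            (xor (x₁ ∷ y₁ ∷ x₂ ∷ y₂ ∷ []) ((a₀ :⊕ a₃) :⊕ (a₂ :⊕ a₁)) ((a₀ :⊕ a₁) :⊕ (a₂ :⊕ a₃)) refl)))
        (≤ᵥ-trans (Ent-function ω _ (λ ((x₁ , y₁) , (x₂ , y₂)) → x₁ ⊕ y₂ , y₁ ⊕ x₂) id
            (λ ((x₁ , y₁) , (x₂ , y₂)) → cong (x₁ ⊕ y₂ ,_) (⊕-comm y₁ x₂)))
        (≤ᵥ-trans (proj₁ (Ent-reindex ω ((μ ⊗ᵈ ν) ⊗ᵈ (μ ⊗ᵈ ν)) (λ ((x₁ , y₁) , (x₂ , y₂)) → (x₁ , y₂) , (y₁ , x₂)) (λ ((x₁ , y₂) , (y₁ , x₂)) → (x₁ , y₁) , (x₂ , y₂))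
            (λ _ → refl) (λ _ → refl) (λ ((x₁ , y₁) , (x₂ , y₂)) → regroup″ (weight μ x₁) (weight μ y₁) (weight ν x₂) (weight ν y₂)) _ (λ (p , q) → plus p , plus q) (λ _ → refl)))
          (proj₁ (≈ᵥ-trans (Ent-⊗ (μ ⊗ᵈ ν) (μ ⊗ᵈ ν) plus plus) (≈ᵥ-sym (+ᵥ-cong (H-⊛ μ ν) (H-⊛ μ ν))))))))
        where
        regroup″ : ∀ a b c d → (a * b) * (c * d) ≡ (a * d) * (b * c)
        regroup″ = solve-∀

      sum-W : Ent ρ proj₁ ≈ᵥ h₁₁ +ᵥ h₂₂
      sum-W = ≈ᵥ-trans (Ent-push ω _ proj₁) (≈ᵥ-trans
        (Ent-iso ω < S , W > < W , W′ > (λ (w , w′) → w ⊕ w′ , w) (λ (s , w) → w , s ⊕ w) (λ _ → refl)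
          (λ ((x₁ , y₁) , (x₂ , y₂)) → cong (x₁ ⊕ y₁ ,_)
            (xor (x₁ ∷ y₁ ∷ x₂ ∷ y₂ ∷ []) (((a₀ :⊕ a₁) :⊕ (a₂ :⊕ a₃)) :⊕ (a₀ :⊕ a₁)) (a₂ :⊕ a₃) refl)))
        (≈ᵥ-trans (Ent-⊗ (μ ⊗ᵈ μ) (ν ⊗ᵈ ν) plus plus) (≈ᵥ-sym (+ᵥ-cong (H-⊛ μ μ) (H-⊛ ν ν)))))

      total-ρ : Ent ρ id ≈ᵥ Q
      total-ρ = ≈ᵥ-trans (Ent-push ω _ id) (Ent-iso ω < < S , W > , U > cross
        (λ ((w , w′) , u) → (w ⊕ w′ , w) , u) (λ ((s , w) , u) → (w , s ⊕ w) , u) (λ _ → refl)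
        (λ ((x₁ , y₁) , (x₂ , y₂)) → cong (λ w′ → (x₁ ⊕ y₁ , w′) , x₁ ⊕ x₂)
          (xor (x₁ ∷ y₁ ∷ x₂ ∷ y₂ ∷ []) (((a₀ :⊕ a₁) :⊕ (a₂ :⊕ a₃)) :⊕ (a₀ :⊕ a₁)) (a₂ :⊕ a₃) refl)))

      reference-ρ : Ent (ξ ⊗ᵈ ρ) (λ (x , (i , y)) → x ⊕ y) ≈ᵥ Kₛ
      reference-ρ = ≈ᵥ-trans (Ent-⊗-pushʳ ξ ω _ _) (≈ᵥ-trans
        (Ent-reindex (ξ ⊗ᵈ ω) ((ξ ⊗ᵈ μ ⊗ᵈ ν) ⊗ᵈ (μ ⊗ᵈ ν)) (λ (x , ((x₁ , y₁) , (x₂ , y₂))) → (x , (x₁ , x₂)) , (y₁ , y₂))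
          (λ ((x , (x₁ , x₂)) , (y₁ , y₂)) → x , ((x₁ , y₁) , (x₂ , y₂))) (λ _ → refl) (λ _ → refl)
          (λ (x , ((x₁ , y₁) , (x₂ , y₂))) → regroup₅ (weight ξ x) (weight μ x₁) (weight μ y₁) (weight ν x₂) (weight ν y₂))
          _ ((λ (x , (x₁ , x₂)) → x ⊕ (x₁ ⊕ x₂)) ∘ proj₁) (λ _ → refl))
        (≈ᵥ-trans (Ent-⊗-proj₁ (ξ ⊗ᵈ μ ⊗ᵈ ν) (μ ⊗ᵈ ν) (λ (x , (x₁ , x₂)) → x ⊕ (x₁ ⊕ x₂))) (≈ᵥ-sym (H-⊛-⊛ ξ μ ν))))
        where
        regroup₅ : ∀ x a b c d → x * ((a * b) * (c * d)) ≡ (x * (a * c)) * (b * d)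
        regroup₅ = solve-∀

      quadruple-sum : H ((μ ⊛ μ) ⊛ (ν ⊛ ν)) ≈ᵥ S₄
      quadruple-sum = ≈ᵥ-trans (H-⊛ (μ ⊛ μ) (ν ⊛ ν)) (Ent-⊗-push (μ ⊗ᵈ μ) (ν ⊗ᵈ ν) plus plus plus)

      R : 𝕍
      R = 4 · s +ᵥ 4 · s -ᵥ 3 · S₄ -ᵥ 2 · Q +ᵥ (h₁₁ +ᵥ h₂₂)

      R-bound : let open Coupling ρ in ∑ᵥ (λ i → ∑ (fibre i) · entropy (fibre i ⊛ʷ fibre i) id) ≤ᵥ mass · R
      R-bound = ≤ᵥ-trans (BSG.balog-szemerédi-gowers ρ) (·-mono (Coupling.mass ρ)
        (by (Ent ρ (λ ((c , w) , a) → a , c) ∷ Ent ρ (λ ((c , w) , a) → a ⊕ w , c) ∷ Ent ρ (λ ((c , w) , a) → c) ∷ Ent ρ id ∷ Ent ρ proj₁ ∷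
             s ∷ S₄ ∷ Q ∷ h₁₁ ∷ h₂₂ ∷ [])
          (2 :· v₀ :+ 2 :· v₁ :- 3 :· v₂ :- 2 :· v₃ :+ v₄ ⊑ 4 :· v₅ :+ 4 :· v₅ :- 3 :· v₆ :- 2 :· v₇ :+ (v₈ :+ v₉))
          ((2 , v₀ ⊑ v₅ :+ v₅) ∷ (2 , v₁ ⊑ v₅ :+ v₅) ∷ (3 , v₆ ⊑ v₂) ∷ (2 , v₇ ⊑ v₃) ∷ (1 , v₄ ⊑ v₈ :+ v₉) ∷ []) refl
          (sum-U ∷ sum-V ∷ proj₂ (Ent-push ω _ _) ∷ proj₂ total-ρ ∷ proj₁ sum-W ∷ [])))

    private
      t : 𝕍
      t = cost (weight μ) (weight ν) -ᵥ D μ ν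

      -- The four competitors, in the variables of `costₑ`: x conditioned on sums of a copy of μ and
      -- one of ν; x conditioned on sums of two copies of the same law; a fibre of `ρ` paired with
      -- itself; and the sums μ ⊛ μ and ν ⊛ ν.
      crossed-family paired-family diagonal-family doubled : Vec 𝕍 6
      crossed-family  = Ent ((μ ⊗ᵈ ν) ⊗ᵈ (ν ⊗ᵈ μ)) cross -ᵥ (s +ᵥ H (ν ⊛ μ)) ∷ h₁ +ᵥ h₂ -ᵥ s ∷ h₂ +ᵥ h₁ -ᵥ H (ν ⊛ μ) ∷ K₁ ∷ K₂ ∷ h₀ ∷ []
      paired-family   = Q -ᵥ (h₁₁ +ᵥ h₂₂) ∷ h₁ +ᵥ h₁ -ᵥ h₁₁ ∷ h₂ +ᵥ h₂ -ᵥ h₂₂ ∷ K₁ ∷ K₂ ∷ h₀ ∷ []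
      diagonal-family = R ∷ Ent ρ id -ᵥ Ent ρ proj₁ ∷ Ent ρ id -ᵥ Ent ρ proj₁ ∷
        Ent (ξ ⊗ᵈ ρ) (λ (x , (i , y)) → x ⊕ y) ∷ Ent (ξ ⊗ᵈ ρ) (λ (x , (i , y)) → x ⊕ y) ∷ h₀ ∷ []
      doubled         = H ((μ ⊛ μ) ⊛ (ν ⊛ ν)) ∷ h₁₁ ∷ h₂₂ ∷ K₁₁ ∷ K₂₂ ∷ h₀ ∷ []

      swapped : Kₛ +ᵥ h₂ ≤ᵥ K₂ +ᵥ s
      swapped = ≤ᵥ-trans (+ᵥ-monoˡ h₂ (proj₁ (H-⊛-swapʳ ξ μ ν))) (≤ᵥ-trans (H-⊛-submodular ξ ν μ)
        (proj₁ (+ᵥ-cong (≈ᵥ-refl {K₂}) (H-⊛-comm ν μ))))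

      Dₑ tₑ Rₑ : Expr 19
      Dₑ = 2 :· v₃ :- v₁ :- v₂
      Rₑ = 4 :· v₃ :+ 4 :· v₃ :- 3 :· v₆ :- 2 :· v₇ :+ (v₄ :+ v₅)
      cₑ : (a p q k l : Expr 19) → Expr 19
      cₑ a p q k l = 16 :· (2 :· a :- p :- q) :+ (2 :· k :- v₀ :- p) :+ (2 :· l :- v₀ :- q)
      tₑ = cₑ v₃ v₁ v₂ v₈ v₉ :- Dₑ

      -- Taken 133, 112, 80 and 240 times, the four failed decrements leave only 70 · D μ ν ≤ 0. The
      -- remaining hypotheses bound the triple convolutions with ξ by the Kaimanovich-Vershik
      -- inequality and identify different forms of the same entropy.
      no-decrement : t ≤ᵥ ⟪ costₑ ⟫ crossed-family → t ≤ᵥ ⟪ costₑ ⟫ paired-family → t ≤ᵥ ⟪ costₑ ⟫ diagonal-family →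
                     t ≤ᵥ ⟪ costₑ ⟫ doubled → D μ ν ≤ᵥ 0ᵥ
      no-decrement b c f a = ·-cancel 70 {D μ ν} {0ᵥ}
        (by (h₀ ∷ h₁ ∷ h₂ ∷ s ∷ h₁₁ ∷ h₂₂ ∷ S₄ ∷ Q ∷ K₁ ∷ K₂ ∷ Kₛ ∷ K₁₁ ∷ K₂₂ ∷ H (ν ⊛ μ) ∷ H ((μ ⊛ μ) ⊛ (ν ⊛ ν)) ∷
             Ent ((μ ⊗ᵈ ν) ⊗ᵈ (ν ⊗ᵈ μ)) cross ∷ Ent ρ id ∷ Ent ρ proj₁ ∷ Ent (ξ ⊗ᵈ ρ) (λ (x , (i , y)) → x ⊕ y) ∷ [])
          (70 :· Dₑ ⊑ 70 :· :0)
          ((133 , tₑ ⊑ cₑ (v₁₅ :- (v₃ :+ v₁₃)) (v₁ :+ v₂ :- v₃) (v₂ :+ v₁ :- v₁₃) v₈ v₉) ∷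
           (112 , tₑ ⊑ cₑ (v₇ :- (v₄ :+ v₅)) (v₁ :+ v₁ :- v₄) (v₂ :+ v₂ :- v₅) v₈ v₉) ∷
           (80 , tₑ ⊑ cₑ Rₑ (v₁₆ :- v₁₇) (v₁₆ :- v₁₇) v₁₈ v₁₈) ∷
           (240 , tₑ ⊑ cₑ v₁₄ v₄ v₅ v₁₁ v₁₂) ∷
           (160 , v₁₀ :+ v₁ ⊑ v₈ :+ v₃) ∷ (160 , v₁₀ :+ v₂ ⊑ v₉ :+ v₃) ∷ (480 , v₁₁ :+ v₁ ⊑ v₈ :+ v₄) ∷ (480 , v₁₂ :+ v₂ ⊑ v₉ :+ v₅) ∷
           (4256 , v₁₅ ⊑ v₇) ∷ (1995 , v₃ ⊑ v₁₃) ∷ (7680 , v₁₄ ⊑ v₆) ∷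
           (2720 , v₇ ⊑ v₁₆) ∷ (2720 , v₁₇ ⊑ v₄ :+ v₅) ∷ (320 , v₁₈ ⊑ v₁₀) ∷ []) refl
          ( b ∷ c ∷ f ∷ a ∷ H-⊛-submodular ξ μ ν ∷ swapped ∷ H-⊛-submodular ξ μ μ ∷ H-⊛-submodular ξ ν ν
          ∷ proj₁ crossed ∷ proj₁ (H-⊛-comm μ ν) ∷ proj₁ quadruple-sum ∷ proj₂ total-ρ ∷ proj₁ sum-W ∷ proj₁ reference-ρ ∷ []))

      Decreased : Set
      Decreased = Σ[ μ′ ∈ Dist G ] Σ[ ν′ ∈ Dist G ] cost (weight μ′) (weight ν′) ≤ᵥ t

      select-doubled : Decreased ⊎ t ≤ᵥ ⟪ costₑ ⟫ doubled
      select-doubled = ⊎.map₁ (λ le → μ ⊛ μ , ν ⊛ ν , le) (≤ᵥ-total (⟪ costₑ ⟫ doubled) t)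

    decrement : (Σ[ μ′ ∈ Dist G ] Σ[ ν′ ∈ Dist G ] cost (weight μ′) (weight ν′) ≤ᵥ cost (weight μ) (weight ν) -ᵥ D μ ν) ⊎ D μ ν ≤ᵥ 0ᵥ
    decrement =
      either inj₁ (λ b →
      either inj₁ (λ c →
      either (λ (κ , le) → inj₁ (κ , κ , le)) (λ f →
      either inj₁ (λ a → inj₂ (no-decrement b c f a))
        select-doubled)
        (select-diagonal ρ t R R-bound))
        (select-difference μ μ ν ν t))
        (select-difference μ ν ν μ t)
      where
      either : ∀ {A B : Set} → (A → Decreased ⊎ D μ ν ≤ᵥ 0ᵥ) → (B → Decreased ⊎ D μ ν ≤ᵥ 0ᵥ) → A ⊎ B → Decreased ⊎ D μ ν ≤ᵥ 0ᵥ
      either f g = ⊎.[_,_]′ f g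

n≤2^n : ∀ n → n ≤ 2 ^ n
n≤2^n zero    = z≤n
n≤2^n (suc n) = ℕ.≤-trans (ℕ.+-mono-≤ (ℕ.m^n>0 2 n) (n≤2^n n)) (ℕ.≤-reflexive (cong (2 ^ n +_) (sym (ℕ.+-identityʳ (2 ^ n)))))

module Descent {G : Set} {{FG : Finite G}} (𝔾 : BooleanGroup G) (ξ : Dist G)
               (κ : 𝕍) (κ≥0 : 0ᵥ ≤ᵥ κ) (N : ℕ) (log2≤Nκ : log 2 ≤ᵥ N · κ) where

  open SumsetEntropy 𝔾
  open Selection 𝔾 ξ
  open Decrement 𝔾 ξ

  D≤cost : ∀ μ ν → 16 · D μ ν ≤ᵥ cost (weight μ) (weight ν)
  D≤cost μ ν = by (D μ ν ∷ D ξ μ ∷ D ξ ν ∷ []) (16 :· v₀ ⊑ 16 :· v₀ :+ v₁ :+ v₂) ((1 , :0 ⊑ v₁) ∷ (1 , :0 ⊑ v₂) ∷ []) refl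
    (D≥0 ξ μ ∷ D≥0 ξ ν ∷ [])

  Dξ≤cost : ∀ μ ν → D ξ μ ≤ᵥ cost (weight μ) (weight ν)
  Dξ≤cost μ ν = by (D μ ν ∷ D ξ μ ∷ D ξ ν ∷ []) (v₁ ⊑ 16 :· v₀ :+ v₁ :+ v₂) ((16 , :0 ⊑ v₀) ∷ (1 , :0 ⊑ v₂) ∷ []) refl
    (D≥0 μ ν ∷ D≥0 ξ ν ∷ [])

  Close : Dist G → Dist G → Set
  Close μ ν = Σ[ μ′ ∈ Dist G ] Σ[ ν′ ∈ Dist G ] D μ′ ν′ ≤ᵥ κ × cost (weight μ′) (weight ν′) ≤ᵥ cost (weight μ) (weight ν)

  -- While D μ ν exceeds κ, each step lowers the cost by at least κ, so n counts the steps that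
  -- remain. With n = 0 the cost is at most 0, which forces D μ ν ≤ 0.
  descend : ∀ n μ ν → cost (weight μ) (weight ν) ≤ᵥ n · κ → Close μ ν
  descend n μ ν le = go n le (D μ ν ≤ᵥ? κ)
    where
    stuck : ¬ D μ ν ≤ᵥ κ → ¬ D μ ν ≤ᵥ 0ᵥ
    stuck D≰κ D≤0 = D≰κ (≤ᵥ-trans D≤0 κ≥0)
    κ≤D : ¬ D μ ν ≤ᵥ κ → κ ≤ᵥ D μ ν
    κ≤D D≰κ = ⊎.[_,_]′ (λ le → contradiction le D≰κ) id (≤ᵥ-total (D μ ν) κ)
    go : ∀ n → cost (weight μ) (weight ν) ≤ᵥ n · κ → Dec (D μ ν ≤ᵥ κ) → Close μ ν
    go n       le (yes D≤κ) = μ , ν , D≤κ , ≤ᵥ-refl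
    go zero    le (no D≰κ)  = contradiction (·-cancel 16 {D μ ν} {0ᵥ} (≤ᵥ-trans (D≤cost μ ν) (≤ᵥ-trans le (proj₂ (·-zero 16))))) (stuck D≰κ)
    go (suc n) le (no D≰κ)  = ⊎.[_,_]′ next (λ D≤0 → contradiction D≤0 (stuck D≰κ)) (decrement μ ν)
      where
      next : Σ[ μ′ ∈ Dist G ] Σ[ ν′ ∈ Dist G ] cost (weight μ′) (weight ν′) ≤ᵥ cost (weight μ) (weight ν) -ᵥ D μ ν → Close μ ν
      next (μ′ , ν′ , less) = further (descend n μ′ ν′ (by
          (cost (weight μ′) (weight ν′) ∷ cost (weight μ) (weight ν) ∷ D μ ν ∷ κ ∷ n · κ ∷ []) (v₀ ⊑ v₄)
          ((1 , v₀ ⊑ v₁ :- v₂) ∷ (1 , v₁ ⊑ v₃ :+ v₄) ∷ (1 , v₃ ⊑ v₂) ∷ []) refl (less ∷ le ∷ κ≤D D≰κ ∷ [])))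
        where
        further : Close μ′ ν′ → Close μ ν
        further (μ″ , ν″ , close , le″) = μ″ , ν″ , close , (by
          (cost (weight μ″) (weight ν″) ∷ cost (weight μ′) (weight ν′) ∷ cost (weight μ) (weight ν) ∷ D μ ν ∷ [])
          (v₀ ⊑ v₂) ((1 , v₀ ⊑ v₁) ∷ (1 , v₁ ⊑ v₂ :- v₃) ∷ (1 , :0 ⊑ v₃) ∷ []) refl (le″ ∷ less ∷ D≥0 μ ν ∷ []))

  private
    g : ℕ
    g = ∑ {G} (λ _ → 1)

    g≢0 : NonZero g
    g≢0 = NonZero-≤ (∑-≥ 𝟘 (λ _ → 1))

    -- The crude bound g ≤ 2 ^ g suffices, because the number of steps does not enter the result.
    log-g : log g ≤ᵥ (g * N) · κ
    log-g = ≤ᵥ-trans (log-mono {{g≢0}} (n≤2^n g)) (≤ᵥ-trans (proj₁ (log-^ 2 g)) (≤ᵥ-trans (·-mono g log2≤Nκ) (proj₁ (·-assocˡ κ g N))))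

    initial : cost (weight ξ) (weight ξ) ≤ᵥ (36 * (g * N)) · κ
    initial = ≤ᵥ-trans (by (H (ξ ⊛ ξ) ∷ H ξ ∷ log g ∷ (g * N) · κ ∷ [])
        (16 :· (2 :· v₀ :- v₁ :- v₁) :+ (2 :· v₀ :- v₁ :- v₁) :+ (2 :· v₀ :- v₁ :- v₁) ⊑ 36 :· v₃)
        ((36 , v₀ ⊑ v₂) ∷ (36 , v₂ ⊑ v₃) ∷ (36 , :0 ⊑ v₁) ∷ []) refl
        (entropy≤log-range (weight (ξ ⊛ ξ)) id {{nonZero (ξ ⊛ ξ)}} ∷ log-g ∷ entropy≥0 (weight ξ) id {{nonZero ξ}} ∷ []))
      (proj₁ (·-assocˡ κ 36 (g * N)))

  -- The entropic polynomial Freiman–Ruzsa theorem, except that μ is not yet uniform on a subgroup.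
  near-idempotent : Σ[ μ ∈ Dist G ] H (μ ⊛ μ) ≤ᵥ H μ +ᵥ κ × D ξ μ ≤ᵥ 18 · D ξ ξ
  near-idempotent = conclude (descend (36 * (g * N)) ξ ξ initial)
    where
    conclude : Close ξ ξ → Σ[ μ ∈ Dist G ] H (μ ⊛ μ) ≤ᵥ H μ +ᵥ κ × D ξ μ ≤ᵥ 18 · D ξ ξ
    conclude (μ , ν , close , le) = μ
      -- The triangle inequality through ν passes from the pair μ, ν to μ with itself.
      , ·-cancel 2 {H (μ ⊛ μ)} {H μ +ᵥ κ} (by (H (μ ⊛ μ) ∷ H μ ∷ H ν ∷ H (μ ⊛ ν) ∷ H (ν ⊛ μ) ∷ κ ∷ []) (2 :· v₀ ⊑ 2 :· (v₁ :+ v₅))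
          ((2 , v₀ :+ v₂ ⊑ v₃ :+ v₄) ∷ (2 , v₄ ⊑ v₃) ∷ (2 , 2 :· v₃ :- v₁ :- v₂ ⊑ v₅) ∷ []) refl
          (H-triangle μ ν μ ∷ proj₁ (H-⊛-comm ν μ) ∷ close ∷ []))
      -- 18 = 16 + 1 + 1: the cost of the initial pair ξ, ξ is 18 · D ξ ξ.
      , by (cost (weight μ) (weight ν) ∷ D ξ μ ∷ D ξ ξ ∷ []) (v₁ ⊑ 18 :· v₂) ((1 , v₁ ⊑ v₀) ∷ (1 , v₀ ⊑ 16 :· v₂ :+ v₂ :+ v₂) ∷ []) refl
          (Dξ≤cost μ ν ∷ le ∷ [])

-- Laws with almost no doubling and subgroups

∃? : ∀ {A : Set} {{_ : Finite A}} {P : A → Set} → (∀ a → Dec (P a)) → Dec (∃ P)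
∃? {{F}} P? = Dec.map′ Any.satisfied (λ (a , Pa) → lose (Finite.complete F a) Pa) (Any.any? P? (Finite.elements F))

·-cancelʳ-≤ : ∀ {x} → ¬ x ≤ᵥ 0ᵥ → ∀ m n → m · x ≤ᵥ n · x → m ≤ n
·-cancelʳ-≤ {x} x≰0 m n le with m ℕ.≤? n
... | yes m≤n = m≤n
... | no  m≰n with ℕ.m≤n⇒∃[o]m+o≡n (ℕ.≰⇒> m≰n)
...   | d , refl = contradiction (by (x ∷ n · x ∷ d · x ∷ (n + d) · x ∷ []) (v₀ ⊑ :0)
        ((1 , v₀ :+ v₃ ⊑ v₁) ∷ (1 , v₁ :+ v₂ ⊑ v₃) ∷ (1 , :0 ⊑ v₂) ∷ []) refl
        (le ∷ proj₂ (·-homo-+ x n d) ∷ ≤ᵥ-trans (proj₂ (·-zero d)) (·-mono d x≥0) ∷ [])) x≰0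
  where
  x≥0 : 0ᵥ ≤ᵥ x
  x≥0 = ⊎.[_,_]′ (λ le → contradiction le x≰0) id (≤ᵥ-total x 0ᵥ)

log-likelihood-id : ∀ {A : Set} {{_ : Finite A}} (w : A → ℕ) → log-likelihood w id ≈ᵥ ∑ᵥ (λ a → w a · log (w a))
log-likelihood-id {A} w = 𝕍Σ.∑-cong {A} (λ a → subst (λ n → w a · log (law w id a) ≈ᵥ w a · log n) (law-id w a) ≈ᵥ-refl)

-- The gain log (k + 1) - log k in the arithmetic-geometric mean inequality 4ab ≤ (a + b)² when the ratio a / b
-- exceeds (r + 1) / r, where k = 4r(r + 1).
four-ab : ∀ a b → 4 * (a * b) ≤ (a + b) * (a + b)
four-ab a b = ⊎.[_,_]′ (λ a≤b → ordered a b a≤b)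
    (λ b≤a → subst₂ _≤_ (cong (4 *_) (ℕ.*-comm b a)) (cong₂ _*_ (ℕ.+-comm b a) (ℕ.+-comm b a)) (ordered b a b≤a)) (ℕ.≤-total a b)
  where
  eq : ∀ a d → 4 * (a * (a + d)) + d * d ≡ (a + (a + d)) * (a + (a + d))
  eq = solve-∀
  ordered : ∀ a b → a ≤ b → 4 * (a * b) ≤ (a + b) * (a + b)
  ordered a b a≤b with ℕ.m≤n⇒∃[o]m+o≡n a≤b
  ... | d , refl = ℕ.≤-trans (ℕ.m≤m+n _ (d * d)) (ℕ.≤-reflexive (eq a d))

-- Equality holds at a = r + 1, b = r, where 4ab = k and (a + b)² = (2r + 1)² = k + 1; this
-- determines k. In general the gap d = a - b satisfies b ≤ r d, so d² makes up the difference.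
four-ab-strict : ∀ r a b → suc r * b ≤ r * a →
  suc (4 * (r * suc r)) * (4 * (a * b)) ≤ 4 * (r * suc r) * ((a + b) * (a + b))
four-ab-strict zero    a b le rewrite ℕ.n≤0⇒n≡0 (ℕ.≤-trans (ℕ.≤-reflexive (sym (ℕ.+-identityʳ b))) le) | ℕ.*-zeroʳ a = z≤n
four-ab-strict r@(suc _) a b le with ℕ.m≤n⇒∃[o]m+o≡n b≤a
  where
  b≤a : b ≤ a
  b≤a = ℕ.*-cancelˡ-≤ r (ℕ.≤-trans (ℕ.m≤n+m (r * b) b) le)
... | d , refl = ℕ.≤-trans (ℕ.+-monoˡ-≤ (4 * (r * suc r) * (4 * ((b + d) * b))) (ℕ.*-monoʳ-≤ 4 key)) (ℕ.≤-reflexive (eq r b d))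
  where
  b≤rd : b ≤ r * d
  b≤rd = ℕ.+-cancelʳ-≤ (r * b) b (r * d) (ℕ.≤-trans le (ℕ.≤-reflexive (trans (ℕ.*-distribˡ-+ r b d) (ℕ.+-comm (r * b) (r * d)))))
  key : (b + d) * b ≤ r * suc r * (d * d)
  key = ℕ.≤-trans (ℕ.*-mono-≤ (ℕ.+-monoˡ-≤ d b≤rd) b≤rd) (ℕ.≤-reflexive (eq′ r d))
    where
    eq′ : ∀ r d → (r * d + d) * (r * d) ≡ r * suc r * (d * d)
    eq′ = solve-∀
  eq : ∀ r b d → 4 * (r * suc r * (d * d)) + 4 * (r * suc r) * (4 * ((b + d) * b)) ≡ 4 * (r * suc r) * ((b + d + b) * (b + d + b))
  eq = solve-∀

module Concentration {G : Set} {{FG : Finite G}} (𝔾 : BooleanGroup G) (μ : Dist G)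
                     (r : ℕ) (κ gain : 𝕍) (gain>0 : ¬ gain ≤ᵥ 0ᵥ) (rκ≤gain : r · κ ≤ᵥ gain)
                     (gain-≤ : gain +ᵥ log (4 * (r * suc r)) ≤ᵥ log (suc (4 * (r * suc r)))) (r≢0 : NonZero r) where

  open SumsetEntropy 𝔾

  p : G → ℕ
  p = weight μ

  P : ℕ
  P = ∑ p

  instance
    P≢0 : NonZero P
    P≢0 = nonZero μ

  q : G → ℕ
  q = p ⊛ʷ p

  ∑-translate : ∀ x (f : G → ℕ) → ∑ (λ y → f (x ⊕ y)) ≡ ∑ f
  ∑-translate x f = ∑-bijection (x ⊕_) (x ⊕_) (⊕-cancel x) (⊕-cancel x) f

  convolution : ∀ y → q y ≡ ∑ (λ x → p x * p (x ⊕ y))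
  convolution y = trans (∑-× (λ (x , z) → δ (x ⊕ z) y * (p x * p z))) (∑-cong (λ x →
    trans (∑-cong (λ z → cong (_* (p x * p z)) (𝟙-cong (λ eq → trans (sym (⊕-cancel x z)) (cong (x ⊕_) eq))
                                                       (λ eq → trans (cong (x ⊕_) eq) (⊕-cancel x y)) (x ⊕ z ≟ y) (z ≟ x ⊕ y))))
          (∑-δ (x ⊕ y) (λ z → p x * p z))))

  ∑q : ∑ q ≡ P * P
  ∑q = trans (∑-law (p ⊠ p) plus) (∑-*-∑ p p)

  -- The law of a sample x of μ together with its sum y with an independent sample, which is then x
  -- ⊕ y.
  w : G × G → ℕ
  w (x , y) = p x * p (x ⊕ y)

  ∑w : ∑ w ≡ P * P
  ∑w = trans (∑-× w) (trans (∑-cong (λ x → trans (∑-*ˡ (p x) (λ y → p (x ⊕ y))) (cong (p x *_) (∑-translate x p)))) (∑-*ʳ P p))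

  -- Twice the average of the densities at y of the translate of μ by x and of μ ⊛ μ, both brought
  -- to mass P * P.
  s : G × G → ℕ
  s (x , y) = P * p (x ⊕ y) + q y

  Bad : G × G → Set
  Bad (x , y) = suc r * q y ≤ r * (P * p (x ⊕ y))

  bad? : ∀ xy → Dec (Bad xy)
  bad? (x , y) = suc r * q y ℕ.≤? r * (P * p (x ⊕ y))

  bad : ℕ
  bad = ∑ (λ xy → w xy * 𝟙 (bad? xy))

  private
    A₀ A₁ S : 𝕍
    A₀ = ∑ᵥ (λ z → p z · log (p z))
    A₁ = ∑ᵥ (λ y → q y · log (q y))
    S  = average w (λ xy → log (s xy))

    A₁-average : A₁ ≈ᵥ average w (λ (x , y) → log (q y))
    A₁-average = ≈ᵥ-trans (𝕍Σ.∑-cong {G} (λ y → ≈ᵥ-trans (·-congˡ (convolution y)) (≈ᵥ-sym (∑ᵥ-·ʳ (λ x → p x * p (x ⊕ y)) (log (q y))))))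
      (≈ᵥ-trans (𝕍Σ.∑-swap (λ y x → (p x * p (x ⊕ y)) · log (q y))) (≈ᵥ-sym (𝕍Σ.∑-× (λ (x , y) → w (x , y) · log (q y)))))

    translated : ∀ (u : G → 𝕍) → average w (λ (x , y) → u (x ⊕ y)) ≈ᵥ P · ∑ᵥ (λ z → p z · u z)
    translated u = ≈ᵥ-trans (𝕍Σ.∑-× (λ (x , y) → w (x , y) · u (x ⊕ y))) (≈ᵥ-trans (𝕍Σ.∑-cong {G} (λ x →
      ≈ᵥ-trans (𝕍Σ.∑-cong {G} (λ y → ≈ᵥ-sym (·-assocˡ (u (x ⊕ y)) (p x) (p (x ⊕ y)))))
      (≈ᵥ-trans (𝕍Σ.∑-✦ {G} (p x) (λ y → p (x ⊕ y) · u (x ⊕ y)))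
        (·-congʳ (p x) (𝕍Σ.∑-bijection (x ⊕_) (x ⊕_) (⊕-cancel x) (⊕-cancel x) (λ z → p z · u z))))))
      (∑ᵥ-·ʳ p (∑ᵥ (λ z → p z · u z))))

    constant : ∀ v → average w (λ _ → v) ≈ᵥ (P * P) · v
    constant v = ≈ᵥ-trans (∑ᵥ-·ʳ w v) (·-congˡ ∑w)

    -- Gibbs' inequality for the law of x ⊕ X against its average with the law of X ⊕ X.
    gibbs : S +ᵥ (P * P) · log P ≤ᵥ (P * P) · log 2 +ᵥ (P * P) · log P +ᵥ (P * P) · log P +ᵥ P · A₀
    gibbs = by (S ∷ (P * P) · log P ∷ (P * P) · log 2 ∷ P · A₀ ∷ ∑ᵥ (λ x → p x · (T x +ᵥ P · log P)) ∷ ∑ᵥ (λ x → p x · (P · L +ᵥ A₀)) ∷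
               P · (P · L) ∷ P · P · log P ∷ ∑ᵥ (λ x → p x · T x) ∷ ∑ᵥ (λ x → p x · (P · log P)) ∷ [])
      (v₀ :+ v₁ ⊑ v₂ :+ v₁ :+ v₁ :+ v₃)
      ((1 , v₀ ⊑ v₈) ∷ (1 , v₁ ⊑ v₉) ∷ (1 , v₈ :+ v₉ ⊑ v₄) ∷ (1 , v₄ ⊑ v₅) ∷ (1 , v₅ ⊑ v₆ :+ v₃) ∷ (1 , v₆ ⊑ v₂ :+ v₁ :+ v₁) ∷ []) refl
      ( proj₁ S-split
      ∷ ≤ᵥ-trans (proj₂ (·-assocˡ (log P) P P)) (proj₂ (∑ᵥ-·ʳ p (P · log P)))
      ∷ proj₂ (≈ᵥ-trans (𝕍Σ.∑-cong {G} (λ x → ·-distrib-+ (T x) (P · log P) (p x))) (𝕍Σ.∑-∙ {G} (λ x → p x · T x) (λ x → p x · (P · log P))))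
      ∷ ∑ᵥ-mono {G} (λ x → ·-mono (p x) (at x))
      ∷ proj₁ (≈ᵥ-trans (∑ᵥ-·ʳ p (P · L +ᵥ A₀)) (·-distrib-+ (P · L) A₀ P))
      ∷ proj₁ (≈ᵥ-trans (·-assocˡ L P P) (≈ᵥ-trans (·-congʳ (P * P) L-split) (≈ᵥ-trans (·-distrib-+ (log 2 +ᵥ log P) (log P) (P * P))
          (+ᵥ-cong (·-distrib-+ (log 2) (log P) (P * P)) ≈ᵥ-refl))))
      ∷ [])
      where
      L : 𝕍
      L = log (2 * P * P)
      T : G → 𝕍
      T x = ∑ᵥ (λ y → p (x ⊕ y) · log (s (x , y)))
      L-split : L ≈ᵥ (log 2 +ᵥ log P) +ᵥ log P
      L-split = ≈ᵥ-trans (log-* (2 * P) P {{ℕ.m*n≢0 2 P}}) (+ᵥ-cong (log-* 2 P) ≈ᵥ-refl)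
      S-split : S ≈ᵥ ∑ᵥ (λ x → p x · T x)
      S-split = ≈ᵥ-trans (𝕍Σ.∑-× (λ xy → w xy · log (s xy))) (𝕍Σ.∑-cong {G} (λ x →
        ≈ᵥ-trans (𝕍Σ.∑-cong {G} (λ y → ≈ᵥ-sym (·-assocˡ (log (s (x , y))) (p x) (p (x ⊕ y)))))
          (𝕍Σ.∑-✦ {G} (p x) (λ y → p (x ⊕ y) · log (s (x , y))))))
      total-s : ∀ x → ∑ (λ y → s (x , y)) ≡ 2 * P * P
      total-s x = trans (∑-+ (λ y → P * p (x ⊕ y)) q) (trans (cong₂ _+_ (trans (∑-*ˡ P (λ y → p (x ⊕ y))) (cong (P *_) (∑-translate x p))) ∑q) (double P))
        where
        double : ∀ P → P * P + P * P ≡ 2 * P * P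
        double = solve-∀
      at : ∀ x → T x +ᵥ P · log P ≤ᵥ P · L +ᵥ A₀
      at x = by (T x ∷ P · log P ∷ P · L ∷ A₀ ∷ ∑ᵥ (λ y → p (x ⊕ y) · log (p (x ⊕ y))) ∷ [])
        (v₀ :+ v₁ ⊑ v₂ :+ v₃) ((1 , v₀ :+ v₁ ⊑ v₂ :+ v₄) ∷ (1 , v₄ ⊑ v₃) ∷ []) refl
        ( subst₂ (λ m n → T x +ᵥ m · log m ≤ᵥ m · log n +ᵥ ∑ᵥ (λ y → p (x ⊕ y) · log (p (x ⊕ y)))) (∑-translate x p) (total-s x)
            (log-sum (λ y → p (x ⊕ y)) (λ y → s (x , y)) (λ y s≡0 → ℕ.m*n≡0⇒m≡0 (p (x ⊕ y)) P (trans (ℕ.*-comm (p (x ⊕ y)) P) (ℕ.m+n≡0⇒m≡0 (P * p (x ⊕ y)) s≡0))))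
        ∷ proj₁ (𝕍Σ.∑-bijection (x ⊕_) (x ⊕_) (⊕-cancel x) (⊕-cancel x) (λ z → p z · log (p z))) ∷ [])

    near-idempotent-bound : H (μ ⊛ μ) ≤ᵥ H μ +ᵥ κ → (P * P) · log P +ᵥ P · A₀ ≤ᵥ A₁ +ᵥ (P * P) · κ
    near-idempotent-bound le = by ((P * P) · log P ∷ P · A₀ ∷ A₁ ∷ (P * P) · κ ∷ (P * P) · log (P * P) ∷ (P * P) · H (μ ⊛ μ) ∷
        (P * P) · H μ ∷ (P * P) · (H μ +ᵥ κ) ∷ []) (v₀ :+ v₁ ⊑ v₂ :+ v₃)
      ((1 , v₄ :- v₂ ⊑ v₅) ∷ (1 , v₅ ⊑ v₇) ∷ (1 , v₇ ⊑ v₆ :+ v₃) ∷ (1 , v₆ ⊑ v₀ :- v₁) ∷ (1 , v₀ :+ v₀ ⊑ v₄) ∷ []) refl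
      ( proj₂ output ∷ ·-mono (P * P) le ∷ proj₁ (·-distrib-+ (H μ) κ (P * P)) ∷ proj₁ input
      ∷ proj₂ (≈ᵥ-trans (·-congʳ (P * P) (log-* P P)) (·-distrib-+ (log P) (log P) (P * P))) ∷ [])
      where
      output : (P * P) · H (μ ⊛ μ) ≈ᵥ (P * P) · log (P * P) -ᵥ A₁
      output = subst (λ n → n · H (μ ⊛ μ) ≈ᵥ n · log n -ᵥ A₁) ∑q
        (≈ᵥ-trans (mass-entropy q id) (+ᵥ-cong ≈ᵥ-refl (-ᵥ-cong (log-likelihood-id q))))
      input : (P * P) · H μ ≈ᵥ (P * P) · log P -ᵥ P · A₀
      input = ≈ᵥ-trans (≈ᵥ-sym (·-assocˡ (H μ) P P)) (≈ᵥ-trans (·-congʳ P (mass-entropy p id))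
        (≈ᵥ-trans (·-distrib-- P (P · log P) (log-likelihood p id)) (+ᵥ-cong (·-assocˡ (log P) P P)
          (-ᵥ-cong (·-congʳ P (log-likelihood-id p))))))

    e₀ e₁ : Linear.Expr 6
    e₀ = v₃ :+ 2 :· v₄ :+ v₅ :+ v₁ :+ v₂
    e₁ = 2 :· v₀

    φs : Vec (G × G → 𝕍) 6
    φs = (λ xy → log (s xy)) ∷ (λ (x , y) → log (p (x ⊕ y))) ∷ (λ (x , y) → log (q y)) ∷ (λ xy → 𝟙 (bad? xy) · gain) ∷
         (λ _ → log 2) ∷ (λ _ → log P) ∷ []

    log-4ab : ∀ a b .{{_ : NonZero a}} .{{_ : NonZero b}} → log (4 * (a * b)) ≈ᵥ (log 2 +ᵥ log 2) +ᵥ (log a +ᵥ log b)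
    log-4ab a b = ≈ᵥ-trans (log-* 4 (a * b)) (+ᵥ-cong (log-* 2 2) (log-* a b))
      where instance _ = ℕ.m*n≢0 a b

    gain-pointwise : ∀ a b (d : Dec (suc r * b ≤ r * a)) .{{_ : NonZero a}} .{{_ : NonZero b}} →
      𝟙 d · gain +ᵥ 2 · log 2 +ᵥ (log a +ᵥ log b) ≤ᵥ 2 · log (a + b)
    gain-pointwise a b (no _) = by (log 2 ∷ log a ∷ log b ∷ log (a + b) ∷ log (4 * (a * b)) ∷ log ((a + b) * (a + b)) ∷ [])
      (:0 :+ 2 :· v₀ :+ (v₁ :+ v₂) ⊑ 2 :· v₃) ((1 , (v₀ :+ v₀) :+ (v₁ :+ v₂) ⊑ v₄) ∷ (1 , v₄ ⊑ v₅) ∷ (1 , v₅ ⊑ v₃ :+ v₃) ∷ []) refl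
      (proj₂ (log-4ab a b) ∷ log-mono (four-ab a b) ∷ proj₁ (log-* (a + b) (a + b)) ∷ [])
      where
      instance
        ab≢0 = ℕ.m*n≢0 a b
        4ab≢0 = ℕ.m*n≢0 4 (a * b)
        a+b≢0 = NonZero-≤ (ℕ.m≤m+n a b)
    gain-pointwise a b (yes le) = by (log 2 ∷ log a ∷ log b ∷ log (a + b) ∷ log (4 * (a * b)) ∷ log ((a + b) * (a + b)) ∷ gain ∷ log m ∷ log (suc m) ∷
        log (suc m * (4 * (a * b))) ∷ log (m * ((a + b) * (a + b))) ∷ [])
      (1 :· v₆ :+ 2 :· v₀ :+ (v₁ :+ v₂) ⊑ 2 :· v₃)
      ((1 , (v₀ :+ v₀) :+ (v₁ :+ v₂) ⊑ v₄) ∷ (1 , v₈ :+ v₄ ⊑ v₉) ∷ (1 , v₉ ⊑ v₁₀) ∷ (1 , v₁₀ ⊑ v₇ :+ v₅) ∷ (1 , v₅ ⊑ v₃ :+ v₃) ∷ (1 , v₆ :+ v₇ ⊑ v₈) ∷ []) refl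
      ( proj₂ (log-4ab a b) ∷ proj₂ (log-* (suc m) (4 * (a * b))) ∷ log-mono (four-ab-strict r a b le)
      ∷ proj₁ (log-* m ((a + b) * (a + b))) ∷ proj₁ (log-* (a + b) (a + b)) ∷ gain-≤ ∷ [])
      where
      m = 4 * (r * suc r)
      instance
        r≢0′ = r≢0
        ab≢0 = ℕ.m*n≢0 a b
        4ab≢0 = ℕ.m*n≢0 4 (a * b)
        a+b≢0 = NonZero-≤ (ℕ.m≤m+n a b)
        rr≢0 = ℕ.m*n≢0 r (suc r)
        m≢0 = ℕ.m*n≢0 4 (r * suc r)
        m4ab≢0 = ℕ.m*n≢0 (suc m) (4 * (a * b))
        square≢0 = ℕ.m*n≢0 (a + b) (a + b)

    pointwise : ∀ xy → w xy · Linear.⟦ e₀ ⟧ (Vec.map (λ φ → φ xy) φs) ≤ᵥ w xy · Linear.⟦ e₁ ⟧ (Vec.map (λ φ → φ xy) φs)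
    pointwise (x , y) = ·-zero-or-≤ (w (x , y)) (λ w≢0 → go (p≢0 w≢0) (q≢0 w≢0))
      where
      p≢0 : NonZero (w (x , y)) → NonZero (p (x ⊕ y))
      p≢0 w≢0 = ℕ.m*n≢0⇒n≢0 (p x) {{w≢0}}
      q≢0 : NonZero (w (x , y)) → NonZero (q y)
      q≢0 w≢0 = NonZero-≤ {{w≢0}} (ℕ.≤-trans (∑-≥ x (λ x → p x * p (x ⊕ y))) (ℕ.≤-reflexive (sym (convolution y))))
      go : NonZero (p (x ⊕ y)) → NonZero (q y) → Linear.⟦ e₀ ⟧ (Vec.map (λ φ → φ (x , y)) φs) ≤ᵥ Linear.⟦ e₁ ⟧ (Vec.map (λ φ → φ (x , y)) φs)
      go a′≢0 b≢0 = by (log (s (x , y)) ∷ log (p (x ⊕ y)) ∷ log (q y) ∷ 𝟙 (bad? (x , y)) · gain ∷ log 2 ∷ log P ∷ log (P * p (x ⊕ y)) ∷ [])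
        (v₃ :+ 2 :· v₄ :+ v₅ :+ v₁ :+ v₂ ⊑ 2 :· v₀) ((1 , v₃ :+ 2 :· v₄ :+ (v₆ :+ v₂) ⊑ 2 :· v₀) ∷ (1 , v₅ :+ v₁ ⊑ v₆) ∷ []) refl
        ( gain-pointwise (P * p (x ⊕ y)) (q y) (bad? (x , y)) {{ℕ.m*n≢0 P (p (x ⊕ y)) {{nonZero μ}} {{a′≢0}}}} {{b≢0}}
        ∷ proj₂ (log-* P (p (x ⊕ y)) {{nonZero μ}} {{a′≢0}}) ∷ [])

    bad-average : average w (λ xy → 𝟙 (bad? xy) · gain) ≈ᵥ bad · gain
    bad-average = ≈ᵥ-trans (𝕍Σ.∑-cong {G × G} (λ xy → ·-assocˡ gain (w xy) (𝟙 (bad? xy)))) (∑ᵥ-·ʳ (λ xy → w xy * 𝟙 (bad? xy)) gain)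

  -- On average over x, the relative entropy of x ⊕ X from X ⊕ X is H (μ ⊛ μ) - H μ, hence at most
  -- κ. Gibbs' inequality is applied with the half sum of the two laws as reference, and the
  -- arithmetic-geometric mean inequality passes from the half sum to the two laws with a surplus of
  -- `gain` at each bad pair. So the bad pairs have mass at most P² κ / gain.
  few-bad : H (μ ⊛ μ) ≤ᵥ H μ +ᵥ κ → r * bad ≤ P * P
  few-bad near = ·-cancelʳ-≤ gain>0 (r * bad) (P * P) (by
      ((r * bad) · gain ∷ (P * P) · gain ∷ r · bad · gain ∷ r · (P * P) · κ ∷ (P * P) · r · κ ∷ []) (v₀ ⊑ v₁)
      ((1 , v₀ ⊑ v₂) ∷ (1 , v₂ ⊑ v₃) ∷ (1 , v₃ ⊑ v₄) ∷ (1 , v₄ ⊑ v₁) ∷ []) refl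
      ( proj₂ (·-assocˡ gain r bad) ∷ ·-mono r bound
      ∷ proj₁ (≈ᵥ-trans (·-assocˡ κ r (P * P)) (≈ᵥ-trans (·-congˡ (ℕ.*-comm r (P * P))) (≈ᵥ-sym (·-assocˡ κ (P * P) r))))
      ∷ ·-mono (P * P) rκ≤gain ∷ []))
    where
    bound : bad · gain ≤ᵥ (P * P) · κ
    bound = by (bad · gain ∷ (P * P) · κ ∷ S ∷ P · A₀ ∷ A₁ ∷ (P * P) · log 2 ∷ (P * P) · log P ∷
        average w (λ xy → 𝟙 (bad? xy) · gain) ∷ average w (λ _ → log 2) ∷ average w (λ _ → log P) ∷
        average w (λ (x , y) → log (p (x ⊕ y))) ∷ average w (λ (x , y) → log (q y)) ∷
        average w (λ xy → Linear.⟦ e₀ ⟧ (Vec.map (λ φ → φ xy) φs)) ∷ average w (λ xy → Linear.⟦ e₁ ⟧ (Vec.map (λ φ → φ xy) φs)) ∷ [])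
      (v₀ ⊑ v₁)
      ((1 , v₀ ⊑ v₇) ∷ (1 , v₇ :+ 2 :· v₈ :+ v₉ :+ v₁₀ :+ v₁₁ ⊑ v₁₂) ∷ (1 , v₁₂ ⊑ v₁₃) ∷ (1 , v₁₃ ⊑ 2 :· v₂) ∷
       (2 , v₅ ⊑ v₈) ∷ (1 , v₆ ⊑ v₉) ∷ (1 , v₃ ⊑ v₁₀) ∷ (1 , v₄ ⊑ v₁₁) ∷
       (2 , v₂ :+ v₆ ⊑ v₅ :+ v₆ :+ v₆ :+ v₃) ∷ (1 , v₆ :+ v₃ ⊑ v₄ :+ v₁) ∷ []) refl
      ( proj₂ bad-average ∷ proj₂ (∑-linear w e₀ φs) ∷ ∑ᵥ-mono {G × G} pointwise ∷ proj₁ (∑-linear w e₁ φs)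
      ∷ proj₂ (constant (log 2)) ∷ proj₂ (constant (log P)) ∷ proj₂ (translated (λ z → log (p z))) ∷ proj₁ A₁-average
      ∷ gibbs ∷ near-idempotent-bound near ∷ [])

module NearSubgroup {G : Set} {{FG : Finite G}} (𝔾 : BooleanGroup G) (μ : Dist G)
                    (r : ℕ) (κ gain : 𝕍) (gain>0 : ¬ gain ≤ᵥ 0ᵥ) (rκ≤gain : r · κ ≤ᵥ gain)
                    (gain-≤ : gain +ᵥ log (4 * (r * suc r)) ≤ᵥ log (suc (4 * (r * suc r)))) (1000≤r : 1000 ≤ r)
                    (near : SumsetEntropy.H 𝔾 (SumsetEntropy._⊛_ 𝔾 μ μ) ≤ᵥ SumsetEntropy.H 𝔾 μ +ᵥ κ) where

  open SumsetEntropy 𝔾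

  r≢0 : NonZero r
  r≢0 = NonZero-≤ {1000} 1000≤r

  open Concentration 𝔾 μ r κ gain gain>0 rκ≤gain gain-≤ r≢0

  -- The total variation distance between the law of x ⊕ X and that of X ⊕ X, scaled by P².
  TV : G → ℕ
  TV x = ∑ (λ y → P * p (x ⊕ y) ∸ q y)

  private
    pointwise-TV : ∀ a b (d : Dec (suc r * b ≤ r * a)) → r * (a ∸ b) ≤ b + r * (𝟙 d * a)
    pointwise-TV a b (yes _) = ℕ.≤-trans (ℕ.*-monoʳ-≤ r (ℕ.≤-trans (ℕ.m∸n≤m a b) (ℕ.≤-reflexive (sym (ℕ.*-identityˡ a))))) (ℕ.m≤n+m _ b)
    pointwise-TV a b (no ¬le) = ℕ.≤-trans (ℕ.≤-reflexive (ℕ.*-distribˡ-∸ r a b))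
      (ℕ.≤-trans (ℕ.m≤n+o⇒m∸n≤o (r * a) (r * b) (ℕ.≤-trans (ℕ.<⇒≤ (ℕ.≰⇒> ¬le)) (ℕ.≤-reflexive (ℕ.+-comm b (r * b))))) (ℕ.m≤m+n b _))

    -- Off the bad pairs, the excess of P * p (x ⊕ y) over q y is at most q y / r. On the bad pairs
    -- it is at most P * p (x ⊕ y), whose total is controlled by `few-bad`. Each part contributes P³
    -- on the right.
    average-TV : r * ∑ (λ x → p x * TV x) ≤ P * (P * P) + P * (P * P)
    average-TV = begin
      r * ∑ (λ x → p x * TV x)                                                 ≡⟨ ∑-*ˡ r (λ x → p x * TV x) ⟨
      ∑ (λ x → r * (p x * TV x))                                               ≡⟨ ∑-cong {G} (λ x → trans (exchange r (p x) (TV x)) (trans (cong (p x *_) (sym (∑-*ˡ {G} r _))) (sym (∑-*ˡ {G} (p x) _)))) ⟩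
      ∑ (λ x → ∑ (λ y → p x * (r * (P * p (x ⊕ y) ∸ q y))))                    ≤⟨ ∑-mono {G} (λ x → ∑-mono {G} (λ y → bound x y)) ⟩
      ∑ (λ x → ∑ (λ y → p x * q y + (r * P) * (w (x , y) * 𝟙 (bad? (x , y)))))  ≡⟨ ∑-cong {G} (λ x → trans (∑-+ {G} (λ y → p x * q y) _) (cong₂ _+_ (∑-*ˡ (p x) q) (∑-*ˡ (r * P) (λ y → w (x , y) * 𝟙 (bad? (x , y)))))) ⟩
      ∑ (λ x → p x * ∑ q + (r * P) * ∑ (λ y → w (x , y) * 𝟙 (bad? (x , y))))    ≡⟨ trans (∑-+ {G} (λ x → p x * ∑ q) _) (cong₂ _+_ (∑-*ʳ (∑ q) p) (∑-*ˡ (r * P) (λ x → ∑ (λ y → w (x , y) * 𝟙 (bad? (x , y)))))) ⟩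
      P * ∑ q + (r * P) * ∑ (λ x → ∑ (λ y → w (x , y) * 𝟙 (bad? (x , y))))     ≡⟨ cong₂ _+_ (cong (P *_) ∑q) (trans (cong ((r * P) *_) (sym (∑-× (λ xy → w xy * 𝟙 (bad? xy))))) (regroup r P bad)) ⟩
      P * (P * P) + P * (r * bad)                                              ≤⟨ ℕ.+-monoʳ-≤ (P * (P * P)) (ℕ.*-monoʳ-≤ P (few-bad near)) ⟩
      P * (P * P) + P * (P * P)                                                ∎
      where
      open ℕ.≤-Reasoning
      exchange : ∀ a b c → a * (b * c) ≡ b * (a * c)
      exchange = solve-∀
      regroup : ∀ r P b → r * P * b ≡ P * (r * b)
      regroup = solve-∀
      expand : ∀ px b r i P p′ → px * (b + r * (i * (P * p′))) ≡ px * b + r * P * (px * p′ * i)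
      expand = solve-∀
      bound : ∀ x y → p x * (r * (P * p (x ⊕ y) ∸ q y)) ≤ p x * q y + (r * P) * (w (x , y) * 𝟙 (bad? (x , y)))
      bound x y = ℕ.≤-trans (ℕ.*-monoʳ-≤ (p x) (pointwise-TV (P * p (x ⊕ y)) (q y) (bad? (x , y))))
        (ℕ.≤-reflexive (expand (p x) (q y) r (𝟙 (bad? (x , y))) P (p (x ⊕ y))))

  Good : G → Set
  Good x = 50 * TV x ≤ P * P

  good? : ∀ x → Dec (Good x)
  good? x = 50 * TV x ℕ.≤? P * P

  -- For an indicator E, the mass that μ gives to the translate of E by h.
  translated-mass : (G → ℕ) → G → ℕ
  translated-mass E h = ∑ (λ z → E (h ⊕ z) * p z)

  good : G → ℕ
  good x = 𝟙 (good? x)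

  good-mass : ℕ
  good-mass = ∑ (λ x → good x * p x)

  -- Markov's inequality: `TV` has mean at most 2P² / r, so it exceeds P² / 50 on mass at most 100 P
  -- / r. This is where r has to be at least 1000.
  good-mass-large : 9 * P ≤ 10 * good-mass
  good-mass-large = ℕ.*-cancelˡ-≤ r {{r≢0}} (ℕ.+-cancelʳ-≤ (r * P) _ _ (begin
    r * (9 * P) + r * P                        ≡⟨ eq₁ r P ⟩
    10 * (r * P)                               ≤⟨ ℕ.*-monoʳ-≤ 10 scaled ⟩
    10 * (r * good-mass + 100 * P)             ≡⟨ eq₂ r good-mass P ⟩
    r * (10 * good-mass) + 1000 * P            ≤⟨ ℕ.+-monoʳ-≤ (r * (10 * good-mass)) (ℕ.*-monoˡ-≤ P 1000≤r) ⟩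
    r * (10 * good-mass) + r * P               ∎))
    where
    open ℕ.≤-Reasoning
    eq₁ : ∀ r P → r * (9 * P) + r * P ≡ 10 * (r * P)
    eq₁ = solve-∀
    eq₂ : ∀ r g P → 10 * (r * g + 100 * P) ≡ r * (10 * g) + 1000 * P
    eq₂ = solve-∀
    markov : ∀ x → p x * (P * P) ≤ good x * p x * (P * P) + 50 * (p x * TV x)
    markov x with good? x
    ... | yes _ = ℕ.≤-trans (ℕ.≤-reflexive (cong (_* (P * P)) (sym (ℕ.*-identityˡ (p x))))) (ℕ.m≤m+n _ _)
    ... | no ¬g = ℕ.≤-trans (ℕ.*-monoʳ-≤ (p x) (ℕ.<⇒≤ (ℕ.≰⇒> ¬g))) (ℕ.≤-reflexive (exchange (p x) (TV x)))
      where
      exchange : ∀ a b → a * (50 * b) ≡ 50 * (a * b)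
      exchange = solve-∀
    total : P * (P * P) ≤ good-mass * (P * P) + 50 * ∑ (λ x → p x * TV x)
    total = subst₂ _≤_ (∑-*ʳ (P * P) p) (trans (∑-+ {G} (λ x → good x * p x * (P * P)) (λ x → 50 * (p x * TV x)))
      (cong₂ _+_ (∑-*ʳ (P * P) (λ x → good x * p x)) (∑-*ˡ 50 (λ x → p x * TV x)))) (∑-mono {G} markov)
    scaled : r * P ≤ r * good-mass + 100 * P
    scaled = ℕ.*-cancelʳ-≤ (r * P) (r * good-mass + 100 * P) (P * P) {{ℕ.m*n≢0 P P}} (begin
      r * P * (P * P)                                               ≡⟨ ℕ.*-assoc r P (P * P) ⟩
      r * (P * (P * P))                                             ≤⟨ ℕ.*-monoʳ-≤ r total ⟩
      r * (good-mass * (P * P) + 50 * ∑ (λ x → p x * TV x))         ≡⟨ eq₃ r good-mass P (∑ (λ x → p x * TV x)) ⟩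
      r * good-mass * (P * P) + 50 * (r * ∑ (λ x → p x * TV x))     ≤⟨ ℕ.+-monoʳ-≤ (r * good-mass * (P * P)) (ℕ.*-monoʳ-≤ 50 average-TV) ⟩
      r * good-mass * (P * P) + 50 * (P * (P * P) + P * (P * P))    ≡⟨ eq₄ r good-mass P ⟩
      (r * good-mass + 100 * P) * (P * P)                           ∎)
      where
      eq₃ : ∀ r g P t → r * (g * (P * P) + 50 * t) ≡ r * g * (P * P) + 50 * (r * t)
      eq₃ = solve-∀
      eq₄ : ∀ r g P → r * g * (P * P) + 50 * (P * (P * P) + P * (P * P)) ≡ (r * g + 100 * P) * (P * P)
      eq₄ = solve-∀

  module _ (E : G → ℕ) (E≤1 : ∀ y → E y ≤ 1) where

    private
      c : G → ℕ
      c x = ∑ (λ y → E y * p (x ⊕ y))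

      e : ℕ
      e = ∑ (λ y → E y * q y)

      excess : ∀ i a b → i ≤ 1 → i * a ≤ i * b + (a ∸ b)
      excess i a b i≤1 = ℕ.≤-trans (ℕ.*-monoʳ-≤ i (ℕ.m≤n+m∸n a b)) (ℕ.≤-trans (ℕ.≤-reflexive (ℕ.*-distribˡ-+ i b (a ∸ b)))
        (ℕ.+-monoʳ-≤ (i * b) (ℕ.≤-trans (ℕ.*-monoˡ-≤ (a ∸ b) i≤1) (ℕ.≤-reflexive (ℕ.*-identityˡ (a ∸ b))))))

      scale : ∀ x → P * c x ≡ ∑ (λ y → E y * (P * p (x ⊕ y)))
      scale x = trans (sym (∑-*ˡ {G} P _)) (∑-cong {G} (λ y → exchange P (E y) (p (x ⊕ y))))
        where
        exchange : ∀ a b c → a * (b * c) ≡ b * (a * c)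
        exchange = solve-∀

      above : ∀ x → P * c x ≤ e + TV x
      above x = ℕ.≤-trans (ℕ.≤-reflexive (scale x)) (ℕ.≤-trans (∑-mono {G} (λ y → excess (E y) (P * p (x ⊕ y)) (q y) (E≤1 y)))
        (ℕ.≤-reflexive (∑-+ {G} (λ y → E y * q y) _)))

      TV-sym : ∀ x → ∑ (λ y → q y ∸ P * p (x ⊕ y)) ≡ TV x
      TV-sym x = ℕ.+-cancelˡ-≡ (P * P) _ _ (begin
        P * P + ∑ (λ y → q y ∸ P * p (x ⊕ y))                ≡⟨ cong (_+ ∑ (λ y → q y ∸ P * p (x ⊕ y))) (trans (∑-*ˡ P (λ y → p (x ⊕ y))) (cong (P *_) (∑-translate x p))) ⟨
        ∑ (λ y → P * p (x ⊕ y)) + ∑ (λ y → q y ∸ P * p (x ⊕ y)) ≡⟨ ∑-+ {G} (λ y → P * p (x ⊕ y)) _ ⟨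
        ∑ (λ y → P * p (x ⊕ y) + (q y ∸ P * p (x ⊕ y)))      ≡⟨ ∑-cong {G} (λ y → balance (P * p (x ⊕ y)) (q y)) ⟩
        ∑ (λ y → q y + (P * p (x ⊕ y) ∸ q y))                ≡⟨ ∑-+ {G} q _ ⟩
        ∑ q + TV x                                           ≡⟨ cong (_+ TV x) ∑q ⟩
        P * P + TV x                                         ∎)
        where
        open ≡-Reasoning
        balance : ∀ a b → a + (b ∸ a) ≡ b + (a ∸ b)
        balance a b with ℕ.≤-total a b
        ... | inj₁ a≤b = trans (ℕ.m+[n∸m]≡n a≤b) (sym (trans (cong (b +_) (ℕ.m≤n⇒m∸n≡0 a≤b)) (ℕ.+-identityʳ b)))
        ... | inj₂ b≤a = trans (trans (cong (a +_) (ℕ.m≤n⇒m∸n≡0 b≤a)) (ℕ.+-identityʳ a)) (sym (ℕ.m+[n∸m]≡n b≤a))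

      below : ∀ x → e ≤ P * c x + TV x
      below x = ℕ.≤-trans (∑-mono {G} (λ y → excess (E y) (q y) (P * p (x ⊕ y)) (E≤1 y)))
        (ℕ.≤-reflexive (trans (∑-+ {G} (λ y → E y * (P * p (x ⊕ y))) _) (cong₂ _+_ (sym (scale x)) (TV-sym x))))

    -- Both translates of μ give E nearly the mass that μ ⊛ μ gives it, with an error of 1/50 each.
    -- The total variation may be used in either direction because the two densities have the same
    -- mass.
    good-overlap : ∀ {x x′} → Good x → Good x′ → 25 * c x ≤ 25 * c x′ + P
    good-overlap {x} {x′} g g′ = ℕ.*-cancelˡ-≤ (2 * P) {{ℕ.m*n≢0 2 P}} (begin
      2 * P * (25 * c x)                              ≡⟨ eq₁ P (c x) ⟩
      50 * (P * c x)                                  ≤⟨ ℕ.*-monoʳ-≤ 50 (ℕ.≤-trans (above x) (ℕ.+-monoˡ-≤ (TV x) (below x′))) ⟩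
      50 * (P * c x′ + TV x′ + TV x)                  ≡⟨ eq₂ (P * c x′) (TV x′) (TV x) ⟩
      50 * (P * c x′) + (50 * TV x′ + 50 * TV x)      ≤⟨ ℕ.+-monoʳ-≤ (50 * (P * c x′)) (ℕ.+-mono-≤ g′ g) ⟩
      50 * (P * c x′) + (P * P + P * P)               ≡⟨ eq₃ P (c x′) ⟩
      2 * P * (25 * c x′ + P)                         ∎)
      where
      open ℕ.≤-Reasoning
      eq₁ : ∀ P c → 2 * P * (25 * c) ≡ 50 * (P * c)
      eq₁ = solve-∀
      eq₂ : ∀ a b c → 50 * (a + b + c) ≡ 50 * a + (50 * b + 50 * c)
      eq₂ = solve-∀
      eq₃ : ∀ P c → 50 * (P * c) + (P * P + P * P) ≡ 2 * P * (25 * c + P)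
      eq₃ = solve-∀

  -- The difference set of the good elements. No span is taken: good elements carry so much mass
  -- that this set is already closed.
  InH : G → Set
  InH h = ∃[ x ] Good x × Good (x ⊕ h)

  inH? : ∀ h → Dec (InH h)
  inH? h = ∃? (λ x → good? x ×-dec good? (x ⊕ h))

  module _ (E : G → ℕ) (E≤1 : ∀ y → E y ≤ 1) {h : G} where

    private
      rotate : ∀ x x′ h → (∀ z → x′ ⊕ (x ⊕ z) ≡ h ⊕ z) → ∑ (λ y → E (x′ ⊕ y) * p (x ⊕ y)) ≡ translated-mass E h
      rotate x x′ h eq = trans (∑-cong {G} (λ y → cong (λ u → E u * p (x ⊕ y)) (trans (sym (cong (x′ ⊕_) (⊕-cancel x y))) (eq (x ⊕ y)))))
        (∑-translate x (λ z → E (h ⊕ z) * p z))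

      first : ∀ x z → (x ⊕ h) ⊕ (x ⊕ z) ≡ h ⊕ z
      first x z = xor (x ∷ h ∷ z ∷ []) ((a₀ :⊕ a₁) :⊕ (a₀ :⊕ a₂)) (a₁ :⊕ a₂) refl

      second : ∀ x z → (x ⊕ h) ⊕ ((x ⊕ h) ⊕ z) ≡ 𝟘 ⊕ z
      second x z = trans (⊕-cancel (x ⊕ h) z) (sym (⊕-identity z))

    -- Since h is the sum of the good elements x and x ⊕ h, translating by h compares two translates
    -- of μ that are both close to μ ⊛ μ.
    H-shift-≥ : InH h → 25 * translated-mass E 𝟘 ≤ 25 * translated-mass E h + P
    H-shift-≥ (x , g , g′) = subst₂ (λ a b → 25 * a ≤ 25 * b + P) (rotate (x ⊕ h) (x ⊕ h) 𝟘 (second x)) (rotate x (x ⊕ h) h (first x))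
      (good-overlap (λ y → E ((x ⊕ h) ⊕ y)) (λ y → E≤1 ((x ⊕ h) ⊕ y)) g′ g)

  private
    translated-𝟘 : translated-mass good 𝟘 ≡ good-mass
    translated-𝟘 = ∑-cong {G} (λ z → cong (λ u → good u * p z) (⊕-identity z))

  -- Two shifts by elements of the set cost the good elements at most 2P / 25 of their mass. If h ⊕
  -- h′ were not a difference of good elements, the good set and its translate would be disjoint, so
  -- that 50 times the good mass would be at most 27 P; it is at least 45 P.
  H-closed : ∀ {h h′} → InH h → InH h′ → InH (h ⊕ h′)
  H-closed {h} {h′} ih ih′ = go (inH? (h ⊕ h′))
    where
    open ℕ.≤-Reasoning
    m = translated-mass good (h ⊕ h′)
    shifted : 25 * good-mass ≤ 25 * m + (P + P)
    shifted = begin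
      25 * good-mass                                             ≡⟨ cong (25 *_) translated-𝟘 ⟨
      25 * translated-mass good 𝟘                                ≤⟨ H-shift-≥ good (λ y → 𝟙≤1 (good? y)) ih′ ⟩
      25 * translated-mass good h′ + P                           ≡⟨ cong (λ k → 25 * k + P) (∑-cong {G} (λ z → cong (λ u → good (h′ ⊕ u) * p z) (sym (⊕-identity z)))) ⟩
      25 * translated-mass (λ y → good (h′ ⊕ y)) 𝟘 + P           ≤⟨ ℕ.+-monoˡ-≤ P (H-shift-≥ (λ y → good (h′ ⊕ y)) (λ y → 𝟙≤1 (good? (h′ ⊕ y))) ih) ⟩
      25 * translated-mass (λ y → good (h′ ⊕ y)) h + P + P       ≡⟨ ℕ.+-assoc (25 * translated-mass (λ y → good (h′ ⊕ y)) h) P P ⟩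
      25 * translated-mass (λ y → good (h′ ⊕ y)) h + (P + P)     ≡⟨ cong (λ k → 25 * k + (P + P)) (∑-cong {G} (λ z → cong (λ u → good u * p z)
                                                                     (xor (h ∷ h′ ∷ z ∷ []) (a₁ :⊕ (a₀ :⊕ a₂)) ((a₀ :⊕ a₁) :⊕ a₂) refl))) ⟩
      25 * m + (P + P)                                           ∎
    go : Dec (InH (h ⊕ h′)) → InH (h ⊕ h′)
    go (yes in-H) = in-H
    go (no  ∉H)   = ⊥-elim (ℕ.<⇒≱ room squeezed)
      where
      at-most-one : ∀ z → good z + good ((h ⊕ h′) ⊕ z) ≤ 1
      at-most-one z = exclusive (good? z) (good? ((h ⊕ h′) ⊕ z)) (λ g g′ → ∉H (z , g , subst Good (⊕-comm (h ⊕ h′) z) g′))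
        where
        exclusive : ∀ {A B : Set} (a : Dec A) (b : Dec B) → (A → B → ⊥) → 𝟙 a + 𝟙 b ≤ 1
        exclusive (yes a) (yes b) ¬ab = ⊥-elim (¬ab a b)
        exclusive (yes _) (no _)  _   = ℕ.≤-refl
        exclusive (no _)  b       _   = 𝟙≤1 b
      disjoint : good-mass + m ≤ P
      disjoint = ℕ.≤-trans (ℕ.≤-reflexive (sym (∑-+ {G} (λ z → good z * p z) (λ z → good ((h ⊕ h′) ⊕ z) * p z))))
        (∑-mono {G} (λ z → ℕ.≤-trans (ℕ.≤-reflexive (sym (ℕ.*-distribʳ-+ (p z) (good z) (good ((h ⊕ h′) ⊕ z)))))
          (ℕ.≤-trans (ℕ.*-monoˡ-≤ (p z) (at-most-one z)) (ℕ.≤-reflexive (ℕ.*-identityˡ (p z))))))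
      overfull : 5 * (10 * good-mass) ≤ 27 * P
      overfull = begin
        5 * (10 * good-mass)                     ≡⟨ eq₁ good-mass ⟩
        25 * good-mass + 25 * good-mass          ≤⟨ ℕ.+-monoˡ-≤ (25 * good-mass) shifted ⟩
        25 * m + (P + P) + 25 * good-mass        ≡⟨ eq₂ m P good-mass ⟩
        25 * (good-mass + m) + (P + P)           ≤⟨ ℕ.+-monoˡ-≤ (P + P) (ℕ.*-monoʳ-≤ 25 disjoint) ⟩
        25 * P + (P + P)                         ≡⟨ eq₃ P ⟩
        27 * P                                   ∎
        where
        eq₁ : ∀ g → 5 * (10 * g) ≡ 25 * g + 25 * g
        eq₁ = solve-∀
        eq₂ : ∀ m P g → 25 * m + (P + P) + 25 * g ≡ 25 * (g + m) + (P + P)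
        eq₂ = solve-∀
        eq₃ : ∀ P → 25 * P + (P + P) ≡ 27 * P
        eq₃ = solve-∀
      squeezed : 5 * (9 * P) ≤ 27 * P
      squeezed = ℕ.≤-trans {5 * (9 * P)} {5 * (10 * good-mass)} {27 * P} (ℕ.*-monoʳ-≤ 5 {9 * P} {10 * good-mass} good-mass-large) overfull
      room : 27 * P < 5 * (9 * P)
      room = ℕ.<-≤-trans (ℕ.*-monoˡ-< P {27} {45} (ℕ.m≤m+n 28 17)) (ℕ.≤-reflexive (ℕ.*-assoc 5 9 P))

  some-good : ∃ Good
  some-good with ∃? good?
  ... | yes found = found
  ... | no  none  = contradiction (ℕ.≤-trans good-mass-large (ℕ.≤-reflexive (cong (10 *_) empty))) (ℕ.<⇒≱ (ℕ.≤-trans (ℕ.>-nonZero⁻¹ P) (ℕ.m≤m+n P _)))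
    where
    empty : good-mass ≡ 0
    empty = trans (∑-cong {G} (λ x → cong (_* p x) (𝟙-no (λ g → none (x , g)) (good? x)))) (∑-*ˡ 0 p)

  H-𝟘 : InH 𝟘
  H-𝟘 = x , g , subst Good (trans (sym (⊕-identity x)) (⊕-comm 𝟘 x)) g
    where
    x = proj₁ some-good
    g = proj₂ some-good

-- Cosets of the subgroup in comparison with μ and ξ.

heavy-excess : ∀ k b → 2 * b ≤ k → k ≤ 2 * (k ∸ b)
heavy-excess k b le with ℕ.m≤n⇒∃[o]m+o≡n le
... | d , refl = ℕ.≤-trans (ℕ.m≤m+n (2 * b + d) d) (ℕ.≤-reflexive (trans (eq₁ b d)
  (cong (2 *_) (trans (sym (ℕ.m+n∸m≡n b (b + d))) (cong (_∸ b) (eq₂ b d))))))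
  where
  eq₁ : ∀ b d → 2 * b + d + d ≡ 2 * (b + d)
  eq₁ = solve-∀
  eq₂ : ∀ b d → b + (b + d) ≡ 2 * b + d
  eq₂ = solve-∀

module Quotient {G : Set} {{FG : Finite G}} (𝔾 : BooleanGroup G) (μ : Dist G)
                    (r : ℕ) (κ gain : 𝕍) (gain>0 : ¬ gain ≤ᵥ 0ᵥ) (rκ≤gain : r · κ ≤ᵥ gain)
                    (gain-≤ : gain +ᵥ log (4 * (r * suc r)) ≤ᵥ log (suc (4 * (r * suc r)))) (1000≤r : 1000 ≤ r)
                    (near : SumsetEntropy.H 𝔾 (SumsetEntropy._⊛_ 𝔾 μ μ) ≤ᵥ SumsetEntropy.H 𝔾 μ +ᵥ κ)
                (ξ : Dist G) where

  open SumsetEntropy 𝔾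
  open NearSubgroup 𝔾 μ r κ gain gain>0 rκ≤gain gain-≤ 1000≤r near
  open Concentration 𝔾 μ r κ gain gain>0 rκ≤gain gain-≤ r≢0

  n : ℕ
  n = ∑ (λ h → 𝟙 (inH? h))

  instance
    n≢0 : NonZero n
    n≢0 = NonZero-≤ (ℕ.≤-trans (ℕ.≤-reflexive (sym (𝟙-yes H-𝟘 (inH? 𝟘)))) (∑-≥ 𝟘 (λ h → 𝟙 (inH? h))))

  private
    -- The set of points where translation by h does not raise the density is used as the test set
    -- E; there the total loss is the difference of the masses of E and of its translate.
    shift-loss : ∀ {h} → InH h → 25 * ∑ (λ y → p y ∸ p (h ⊕ y)) ≤ P
    shift-loss {h} ih = ℕ.+-cancelʳ-≤ (25 * translated-mass E h) _ _ (begin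
      25 * ∑ (λ y → p y ∸ p (h ⊕ y)) + 25 * translated-mass E h    ≡⟨ ℕ.*-distribˡ-+ 25 (∑ (λ y → p y ∸ p (h ⊕ y))) (translated-mass E h) ⟨
      25 * (∑ (λ y → p y ∸ p (h ⊕ y)) + translated-mass E h)       ≡⟨ cong (λ k → 25 * (∑ (λ y → p y ∸ p (h ⊕ y)) + k)) rotate ⟨
      25 * (∑ (λ y → p y ∸ p (h ⊕ y)) + ∑ (λ y → E y * p (h ⊕ y))) ≡⟨ cong (25 *_) (∑-+ (λ y → p y ∸ p (h ⊕ y)) (λ y → E y * p (h ⊕ y))) ⟨
      25 * ∑ (λ y → (p y ∸ p (h ⊕ y)) + E y * p (h ⊕ y))           ≤⟨ ℕ.*-monoʳ-≤ 25 (∑-mono {G} (λ y → at (p y) (p (h ⊕ y)) (p (h ⊕ y) ℕ.≤? p y))) ⟩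
      25 * ∑ (λ y → E y * p y)                                     ≡⟨ cong (25 *_) (∑-cong {G} (λ y → cong (λ u → E u * p y) (⊕-identity y))) ⟨
      25 * translated-mass E 𝟘                                     ≤⟨ H-shift-≥ E (λ y → 𝟙≤1 (p (h ⊕ y) ℕ.≤? p y)) ih ⟩
      25 * translated-mass E h + P                                 ≡⟨ ℕ.+-comm (25 * translated-mass E h) P ⟩
      P + 25 * translated-mass E h                                 ∎)
      where
      open ℕ.≤-Reasoning
      E : G → ℕ
      E y = 𝟙 (p (h ⊕ y) ℕ.≤? p y)
      at : ∀ a b (d : Dec (b ≤ a)) → (a ∸ b) + 𝟙 d * b ≤ 𝟙 d * a
      at a b (yes b≤a) = ℕ.≤-reflexive (trans (cong (a ∸ b +_) (ℕ.*-identityˡ b)) (trans (ℕ.m∸n+n≡m b≤a) (sym (ℕ.*-identityˡ a))))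
      at a b (no  b≰a) = ℕ.≤-reflexive (trans (ℕ.+-identityʳ (a ∸ b)) (ℕ.m≤n⇒m∸n≡0 (ℕ.<⇒≤ (ℕ.≰⇒> b≰a))))
      rotate : ∑ (λ y → E y * p (h ⊕ y)) ≡ translated-mass E h
      rotate = trans (∑-cong {G} (λ y → cong (λ u → E u * p (h ⊕ y)) (sym (⊕-cancel h y)))) (∑-translate h (λ z → E (h ⊕ z) * p z))

    -- The values of p on a coset of the subgroup add up to at most P, so n * p y - P is at most the
    -- sum over the subgroup of the losses p y - p (h ⊕ y). Summation over y gives at most P / 25
    -- for each h.
    total-excess : 25 * ∑ (λ y → n * p y ∸ P) ≤ n * P
    total-excess = begin
      25 * ∑ (λ y → n * p y ∸ P)                                   ≤⟨ ℕ.*-monoʳ-≤ 25 (∑-mono {G} at) ⟩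
      25 * ∑ (λ y → ∑ (λ h → 𝟙 (inH? h) * (p y ∸ p (h ⊕ y))))      ≡⟨ cong (25 *_) (trans (∑-swap (λ y h → 𝟙 (inH? h) * (p y ∸ p (h ⊕ y)))) (∑-cong {G} (λ h → ∑-*ˡ (𝟙 (inH? h)) (λ y → p y ∸ p (h ⊕ y))))) ⟩
      25 * ∑ (λ h → 𝟙 (inH? h) * ∑ (λ y → p y ∸ p (h ⊕ y)))        ≡⟨ ∑-*ˡ 25 (λ h → 𝟙 (inH? h) * ∑ (λ y → p y ∸ p (h ⊕ y))) ⟨
      ∑ (λ h → 25 * (𝟙 (inH? h) * ∑ (λ y → p y ∸ p (h ⊕ y))))      ≤⟨ ∑-mono {G} (λ h → loss h (inH? h)) ⟩
      ∑ (λ h → 𝟙 (inH? h) * P)                                     ≡⟨ ∑-*ʳ P (λ h → 𝟙 (inH? h)) ⟩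
      n * P                                                        ∎
      where
      open ℕ.≤-Reasoning
      loss : ∀ h (d : Dec (InH h)) → 25 * (𝟙 d * ∑ (λ y → p y ∸ p (h ⊕ y))) ≤ 𝟙 d * P
      loss h (yes ih) = ℕ.≤-trans (ℕ.≤-reflexive (cong (25 *_) (ℕ.*-identityˡ (∑ (λ y → p y ∸ p (h ⊕ y)))))) (ℕ.≤-trans (shift-loss ih) (ℕ.≤-reflexive (sym (ℕ.*-identityˡ P))))
      loss h (no  _)  = z≤n
      at : ∀ y → n * p y ∸ P ≤ ∑ (λ h → 𝟙 (inH? h) * (p y ∸ p (h ⊕ y)))
      at y = ℕ.m≤n+o⇒m∸n≤o (n * p y) P (begin
        n * p y                                                                    ≡⟨ ∑-*ʳ (p y) (λ h → 𝟙 (inH? h)) ⟨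
        ∑ (λ h → 𝟙 (inH? h) * p y)                                                 ≤⟨ ∑-mono {G} (λ h → term h) ⟩
        ∑ (λ h → p (y ⊕ h) + 𝟙 (inH? h) * (p y ∸ p (h ⊕ y)))                       ≡⟨ ∑-+ (λ h → p (y ⊕ h)) (λ h → 𝟙 (inH? h) * (p y ∸ p (h ⊕ y))) ⟩
        ∑ (λ h → p (y ⊕ h)) + ∑ (λ h → 𝟙 (inH? h) * (p y ∸ p (h ⊕ y)))              ≡⟨ cong (_+ ∑ (λ h → 𝟙 (inH? h) * (p y ∸ p (h ⊕ y)))) (∑-translate y p) ⟩
        P + ∑ (λ h → 𝟙 (inH? h) * (p y ∸ p (h ⊕ y)))                                ∎)
        where
        term : ∀ h → 𝟙 (inH? h) * p y ≤ p (y ⊕ h) + 𝟙 (inH? h) * (p y ∸ p (h ⊕ y))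
        term h = subst (λ u → 𝟙 (inH? h) * p y ≤ p u + 𝟙 (inH? h) * (p y ∸ p (h ⊕ y))) (⊕-comm h y) (go (p (h ⊕ y)) (inH? h))
          where
          go : ∀ b (d : Dec (InH h)) → 𝟙 d * p y ≤ b + 𝟙 d * (p y ∸ b)
          go b (yes _) = ℕ.≤-trans (ℕ.≤-reflexive (ℕ.*-identityˡ (p y))) (ℕ.≤-trans (ℕ.m≤n+m∸n (p y) b)
            (ℕ.≤-reflexive (cong (b +_) (sym (ℕ.*-identityˡ (p y ∸ b))))))
          go b (no _)  = z≤n

  -- Goodness keeps the support inside one coset; the second condition caps the density at twice
  -- that of the uniform law on a coset, which bounds the entropy from below.
  light? : ∀ y → Dec (Good y × n * p y ≤ 2 * P)
  light? y = good? y ×-dec (n * p y ℕ.≤? 2 * P)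

  light-mass : ℕ
  light-mass = ∑ (λ y → 𝟙 (light? y) * p y)

  -- Where n * p y exceeds 2P it is at most twice its excess over P, so by `total-excess` such
  -- points have mass at most 2P / 25. This leaves 9/10 - 2/25 = 41/50 of the mass.
  light-mass-large : P ≤ 2 * light-mass
  light-mass-large = ℕ.*-cancelˡ-≤ 25 (ℕ.≤-trans (ℕ.*-monoˡ-≤ P {25} {41} (ℕ.m≤m+n 25 16)) (ℕ.+-cancelʳ-≤ (4 * P) _ _ (begin
    41 * P + 4 * P                        ≡⟨ ℕ.*-distribʳ-+ P 41 4 ⟨
    45 * P                                ≡⟨ ℕ.*-assoc 5 9 P ⟩
    5 * (9 * P)                           ≤⟨ ℕ.*-monoʳ-≤ 5 good-mass-large ⟩
    5 * (10 * good-mass)                  ≡⟨ eq₁ good-mass ⟩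
    2 * (25 * good-mass)                  ≤⟨ ℕ.*-monoʳ-≤ 2 cancelled ⟩
    2 * (25 * light-mass + 2 * P)         ≡⟨ eq₂ light-mass P ⟩
    25 * (2 * light-mass) + 4 * P         ∎)))
    where
    open ℕ.≤-Reasoning
    eq₁ : ∀ g → 5 * (10 * g) ≡ 2 * (25 * g)
    eq₁ = solve-∀
    eq₂ : ∀ l P → 2 * (25 * l + 2 * P) ≡ 25 * (2 * l) + 4 * P
    eq₂ = solve-∀
    at : ∀ y (g : Dec (Good y)) (l : Dec (n * p y ≤ 2 * P)) → n * (𝟙 g * p y) ≤ n * (𝟙 (g ×-dec l) * p y) + 2 * (n * p y ∸ P)
    at y (yes _) (yes _) = ℕ.m≤m+n _ _
    at y (no _)  _       = ℕ.≤-trans (ℕ.≤-reflexive (ℕ.*-zeroʳ n)) z≤n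
    at y (yes _) (no np≰2P) = ℕ.≤-trans (ℕ.≤-reflexive (cong (n *_) (ℕ.*-identityˡ (p y))))
      (ℕ.≤-trans (heavy-excess (n * p y) P (ℕ.<⇒≤ (ℕ.≰⇒> np≰2P))) (ℕ.m≤n+m (2 * (n * p y ∸ P)) (n * 0)))
    summed : n * good-mass ≤ n * light-mass + 2 * ∑ (λ y → n * p y ∸ P)
    summed = subst₂ _≤_ (∑-*ˡ n (λ y → good y * p y)) (trans (∑-+ (λ y → n * (𝟙 (light? y) * p y)) (λ y → 2 * (n * p y ∸ P)))
      (cong₂ _+_ (∑-*ˡ n (λ y → 𝟙 (light? y) * p y)) (∑-*ˡ 2 (λ y → n * p y ∸ P)))) (∑-mono {G} (λ y → at y (good? y) (n * p y ℕ.≤? 2 * P)))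
    cancelled : 25 * good-mass ≤ 25 * light-mass + 2 * P
    cancelled = ℕ.*-cancelˡ-≤ n (begin
      n * (25 * good-mass)                                        ≡⟨ eq₅ n good-mass ⟩
      25 * (n * good-mass)                                        ≤⟨ ℕ.*-monoʳ-≤ 25 summed ⟩
      25 * (n * light-mass + 2 * ∑ (λ y → n * p y ∸ P))           ≡⟨ eq₆ n light-mass (∑ (λ y → n * p y ∸ P)) ⟩
      n * (25 * light-mass) + 2 * (25 * ∑ (λ y → n * p y ∸ P))    ≤⟨ ℕ.+-monoʳ-≤ (n * (25 * light-mass)) (ℕ.*-monoʳ-≤ 2 total-excess) ⟩
      n * (25 * light-mass) + 2 * (n * P)                         ≡⟨ eq₇ n light-mass P ⟩
      n * (25 * light-mass + 2 * P)                               ∎)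
      where
      eq₅ : ∀ n g → n * (25 * g) ≡ 25 * (n * g)
      eq₅ = solve-∀
      eq₆ : ∀ n l s → 25 * (n * l + 2 * s) ≡ n * (25 * l) + 2 * (25 * s)
      eq₆ = solve-∀
      eq₇ : ∀ n l P → n * (25 * l) + 2 * (n * P) ≡ n * (25 * l + 2 * P)
      eq₇ = solve-∀

  private
    label : G → Parity
    label y = if does (light? y) then 1ℙ else 0ℙ

    tagged : Dist (Parity × G)
    tagged = push μ (λ y → label y , y)

    open Coupling tagged using (fibre; mass)

    fibre-weight : ∀ i y → fibre i y ≡ δ (label y) i * p y
    fibre-weight i y = trans (∑-cong {G} (λ z → trans (cong (_* p z) (trans (δ-× (label z) i z y) (ℕ.*-comm (δ (label z) i) (δ z y))))
        (ℕ.*-assoc (δ z y) (δ (label z) i) (p z))))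
      (∑-δ y (λ z → δ (label z) i * p z))

    light-weight : ∀ y → fibre 1ℙ y ≡ 𝟙 (light? y) * p y
    light-weight y = trans (fibre-weight 1ℙ y) (cong (_* p y) (go (light? y)))
      where
      go : (d : Dec (Good y × n * p y ≤ 2 * P)) → δ (if does d then 1ℙ else 0ℙ) 1ℙ ≡ 𝟙 d
      go (yes _) = refl
      go (no _)  = refl

    ∑-light : ∑ (fibre 1ℙ) ≡ light-mass
    ∑-light = ∑-cong {G} light-weight

    light-mass≢0 : NonZero (∑ (fibre 1ℙ))
    light-mass≢0 = subst NonZero (sym ∑-light) (go light-mass light-mass-large)
      where
      go : ∀ l → P ≤ 2 * l → NonZero l
      go zero    P≤0 = contradiction P≤0 (ℕ.<⇒≱ (ℕ.>-nonZero⁻¹ P))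
      go (suc _) _   = _

  W : Dist G
  W = fibre 1ℙ ,ᵈ light-mass≢0

  private
    V : ℕ
    V = ∑ (fibre 1ℙ)

    P≤2V : P ≤ 2 * V
    P≤2V = subst (λ l → P ≤ 2 * l) (sym ∑-light) light-mass-large

    in-light : ∀ y → NonZero (weight W y) → Good y × n * p y ≤ 2 * P
    in-light y nz = go (light? y) (subst NonZero (light-weight y) nz)
      where
      go : (d : Dec (Good y × n * p y ≤ 2 * P)) → NonZero (𝟙 d * p y) → Good y × n * p y ≤ 2 * P
      go (yes l) _ = l

    W≤p : ∀ y → weight W y ≤ p y
    W≤p y = ℕ.≤-trans (ℕ.≤-reflexive (light-weight y)) (ℕ.≤-trans (ℕ.*-monoˡ-≤ (p y) (𝟙≤1 (light? y))) (ℕ.≤-reflexive (ℕ.*-identityˡ (p y))))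

  W-support : ∀ y y′ → NonZero (weight W y) → NonZero (weight W y′) → InH (y ⊕ y′)
  W-support y y′ nz nz′ = y , proj₁ (in-light y nz) , subst Good (sym (⊕-cancel y y′)) (proj₁ (in-light y′ nz′))

  -- Each point has weight at most 2P / n, and the light points have mass at least P / 2, so no
  -- probability under `W` exceeds 4 / n.
  log-n≤ : log n ≤ᵥ H W +ᵥ log 4
  log-n≤ = ·-cancel V {{light-mass≢0}} (by
      (V · log n ∷ V · (H W +ᵥ log 4) ∷ V · H W ∷ V · log 4 ∷ V · log V ∷ log-likelihood (weight W) id ∷
       ∑ᵥ (λ y → weight W y · log (weight W y)) ∷ ∑ᵥ (λ y → weight W y · (log n +ᵥ log (weight W y))) ∷ ∑ᵥ (λ y → weight W y · (log 4 +ᵥ log V)) ∷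
       ∑ᵥ (λ y → weight W y · log n) ∷ V · (log 4 +ᵥ log V) ∷ [])
    (v₀ ⊑ v₁)
    ((1 , v₂ :+ v₃ ⊑ v₁) ∷ (1 , v₄ :- v₅ ⊑ v₂) ∷ (1 , v₅ ⊑ v₆) ∷ (1 , v₉ :+ v₆ ⊑ v₇) ∷ (1 , v₇ ⊑ v₈) ∷ (1 , v₈ ⊑ v₁₀) ∷ (1 , v₁₀ ⊑ v₃ :+ v₄) ∷ (1 , v₀ ⊑ v₉) ∷ []) refl
    ( proj₂ (·-distrib-+ (H W) (log 4) V) ∷ proj₂ (mass-entropy (weight W) id) ∷ proj₁ (log-likelihood-id (weight W))
    ∷ proj₂ (≈ᵥ-trans (𝕍Σ.∑-cong {G} (λ y → ·-distrib-+ (log n) (log (weight W y)) (weight W y))) (𝕍Σ.∑-∙ {G} (λ y → weight W y · log n) (λ y → weight W y · log (weight W y))))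
    ∷ ∑ᵥ-mono {G} (λ y → ·-zero-or-≤ (weight W y) (at y))
    ∷ proj₁ (∑ᵥ-·ʳ (weight W) (log 4 +ᵥ log V)) ∷ proj₁ (·-distrib-+ (log 4) (log V) V) ∷ proj₂ (∑ᵥ-·ʳ (weight W) (log n)) ∷ []))
    where
    at : ∀ y → NonZero (weight W y) → log n +ᵥ log (weight W y) ≤ᵥ log 4 +ᵥ log V
    at y nz = ≤ᵥ-trans (proj₂ (log-* n (weight W y) {{n≢0}} {{nz}})) (≤ᵥ-trans
      (log-mono {{ℕ.m*n≢0 n (weight W y) {{n≢0}} {{nz}}}} (ℕ.≤-trans (ℕ.*-monoʳ-≤ n (W≤p y)) (ℕ.≤-trans (proj₂ (in-light y nz))
        (ℕ.≤-trans (ℕ.*-monoʳ-≤ 2 P≤2V) (ℕ.≤-reflexive (sym (ℕ.*-assoc 2 2 V)))))))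
      (proj₁ (log-* 4 V {{_}} {{light-mass≢0}})))

  -- Conditioning on a two-valued label raises the distance to ξ by at most log 2 on average. The
  -- distances are nonnegative and the light label has at least half of the mass, so its own
  -- distance is at most twice the average.
  D-W : D ξ W ≤ᵥ 2 · (D ξ μ +ᵥ log 2)
  D-W = ·-cancel V {{light-mass≢0}} (by
      (V · D ξ W ∷ V · 2 · (D ξ μ +ᵥ log 2) ∷ mass · (D ξ μ +ᵥ log 2) ∷ (2 * V) · (D ξ μ +ᵥ log 2) ∷ [])
      (v₀ ⊑ v₁) ((1 , v₀ ⊑ v₂) ∷ (1 , v₂ ⊑ v₃) ∷ (1 , v₃ ⊑ v₁) ∷ []) refl
      ( ≤ᵥ-trans single average-bound ∷ grow (subst (_≤ 2 * V) (sym mass≡P) P≤2V)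
      ∷ proj₂ (≈ᵥ-trans (·-assocˡ (D ξ μ +ᵥ log 2) V 2) (·-congˡ (ℕ.*-comm V 2))) ∷ []))
    where
    open Selection 𝔾 ξ using (reference)
    mass≡P : mass ≡ P
    mass≡P = ∑-law p (λ y → label y , y)
    slack≥0 : 0ᵥ ≤ᵥ D ξ μ +ᵥ log 2
    slack≥0 = by (D ξ μ ∷ log 2 ∷ []) (:0 ⊑ v₀ :+ v₁) ((1 , :0 ⊑ v₀) ∷ (1 , :0 ⊑ v₁) ∷ []) refl (D≥0 ξ μ ∷ log≥0 2 ∷ [])
    grow : ∀ {a b} → a ≤ b → a · (D ξ μ +ᵥ log 2) ≤ᵥ b · (D ξ μ +ᵥ log 2)
    grow {a} {b} a≤b with ℕ.m≤n⇒∃[o]m+o≡n a≤b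
    ... | d , refl = by (a · (D ξ μ +ᵥ log 2) ∷ d · (D ξ μ +ᵥ log 2) ∷ (a + d) · (D ξ μ +ᵥ log 2) ∷ []) (v₀ ⊑ v₂)
      ((1 , v₀ :+ v₁ ⊑ v₂) ∷ (1 , :0 ⊑ v₁) ∷ []) refl
      (proj₂ (·-homo-+ (D ξ μ +ᵥ log 2) a d) ∷ ≤ᵥ-trans (proj₂ (·-zero d)) (·-mono d slack≥0) ∷ [])
    c : Parity → ℕ
    c i = ∑ (fibre i)
    φs : Vec (Parity → 𝕍) 3
    φs = (λ i → entropy (weight ξ ⊛ʷ fibre i) id) ∷ (λ _ → H ξ) ∷ (λ i → entropy (fibre i) id) ∷ []
    dₑ : Linear.Expr 3
    dₑ = 2 :· v₀ :- v₁ :- v₂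
    nonneg : ∀ i → 0ᵥ ≤ᵥ c i · distance (weight ξ) (fibre i)
    nonneg i = ≤ᵥ-trans (proj₂ (·-zero (c i))) (·-zero-or-≤ (c i) {0ᵥ} {distance (weight ξ) (fibre i)} (λ nz → D≥0 ξ (part nz)))
      where
      part : NonZero (c i) → Dist G
      part nz = fibre i ,ᵈ nz
    single : V · D ξ W ≤ᵥ average c (λ i → distance (weight ξ) (fibre i))
    single = by (c 0ℙ · distance (weight ξ) (fibre 0ℙ) ∷ V · D ξ W ∷ []) (v₁ ⊑ v₀ :+ (v₁ :+ :0)) ((1 , :0 ⊑ v₀) ∷ []) refl (nonneg 0ℙ ∷ [])
    K : 𝕍
    K = Ent (ξ ⊗ᵈ tagged) (λ (x , (i , y)) → x ⊕ y)
    total : ∑ c ≡ mass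
    total = sym (∑-× (weight tagged))
    average-bound : average c (λ i → distance (weight ξ) (fibre i)) ≤ᵥ mass · (D ξ μ +ᵥ log 2)
    average-bound = by
        (average c (λ i → distance (weight ξ) (fibre i)) ∷ mass · (D ξ μ +ᵥ log 2) ∷
         average c (λ i → entropy (weight ξ ⊛ʷ fibre i) id) ∷ average c (λ _ → H ξ) ∷ average c (λ i → entropy (fibre i) id) ∷
         mass · K ∷ mass · H ξ ∷ mass · (Ent tagged id -ᵥ Ent tagged proj₁) ∷ mass · (2 · K -ᵥ H ξ -ᵥ (Ent tagged id -ᵥ Ent tagged proj₁)) ∷ [])
        (v₀ ⊑ v₁)
        ((1 , v₀ ⊑ 2 :· v₂ :- v₃ :- v₄) ∷ (2 , v₂ ⊑ v₅) ∷ (1 , v₆ ⊑ v₃) ∷ (1 , v₇ ⊑ v₄) ∷ (1 , 2 :· v₅ :- v₆ :- v₇ ⊑ v₈) ∷ (1 , v₈ ⊑ v₁) ∷ []) refl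
        ( proj₁ (∑-linear c dₑ φs) ∷ reference tagged ∷ proj₂ (≈ᵥ-trans (∑ᵥ-·ʳ c (H ξ)) (·-congˡ total))
        ∷ proj₂ (Coupling.conditional-Ent tagged)
        ∷ proj₂ (·-linear mass dₑ (K ∷ H ξ ∷ (Ent tagged id -ᵥ Ent tagged proj₁) ∷ [])) ∷ ·-mono mass final ∷ [])
      where
      final : 2 · K -ᵥ H ξ -ᵥ (Ent tagged id -ᵥ Ent tagged proj₁) ≤ᵥ D ξ μ +ᵥ log 2
      final = by (K ∷ H ξ ∷ Ent tagged id ∷ Ent tagged proj₁ ∷ H (ξ ⊛ μ) ∷ H μ ∷ log 2 ∷ [])
        (2 :· v₀ :- v₁ :- (v₂ :- v₃) ⊑ (2 :· v₄ :- v₁ :- v₅) :+ v₆) ((2 , v₀ ⊑ v₄) ∷ (1 , v₅ ⊑ v₂) ∷ (1 , v₃ ⊑ v₆) ∷ []) refl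
        ( proj₁ (≈ᵥ-trans (Ent-⊗-pushʳ ξ μ (λ y → label y , y) (λ (x , (i , y)) → x ⊕ y)) (≈ᵥ-sym (H-⊛ ξ μ)))
        ∷ ≤ᵥ-trans (Ent-function μ id (λ y → label y , y) proj₂ (λ _ → refl)) (proj₂ (Ent-push μ (λ y → label y , y) id))
        ∷ entropy≤log-range (weight tagged) proj₁ {{nonZero tagged}} ∷ [])

  private
    first : {Q : G → Set} → (∀ y → Dec (Q y)) → List G → G → G
    first Q? []       d = d
    first Q? (y ∷ ys) d with Q? y
    ... | yes _ = y
    ... | no  _ = first Q? ys d

    first-satisfies : ∀ {Q : G → Set} (Q? : ∀ y → Dec (Q y)) ys d {y} → y ∈ ys → Q y → Q (first Q? ys d)
    first-satisfies Q? (y ∷ ys) d y∈ Qy with Q? y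
    ... | yes q = q
    first-satisfies Q? (y ∷ ys) d (here refl) Qy | no ¬q = contradiction Qy ¬q
    first-satisfies Q? (y ∷ ys) d (there y∈)  Qy | no ¬q = first-satisfies Q? ys d y∈ Qy

    first-cong : ∀ {Q R : G → Set} (Q? : ∀ y → Dec (Q y)) (R? : ∀ y → Dec (R y)) → (∀ y → Q y → R y) → (∀ y → R y → Q y) →
                 ∀ ys d d′ {y} → y ∈ ys → Q y → first Q? ys d ≡ first R? ys d′
    first-cong Q? R? f g (y ∷ ys) d d′ y∈ Qy with Q? y | R? y
    ... | yes _ | yes _ = refl
    ... | yes q | no ¬r = contradiction (f y q) ¬r
    ... | no ¬q | yes r = contradiction (g y r) ¬q
    first-cong Q? R? f g (y ∷ ys) d d′ (here refl) Qy | no ¬q | no _ = contradiction Qy ¬q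
    first-cong Q? R? f g (y ∷ ys) d d′ (there y∈)  Qy | no ¬q | no _ = first-cong Q? R? f g ys d d′ y∈ Qy

  rep : G → G
  rep x = first (λ y → inH? (x ⊕ y)) (Finite.elements FG) x

  private
    self : ∀ x → InH (x ⊕ x)
    self x = subst InH (sym (⊕-self x)) H-𝟘

    rep-coset : ∀ x → InH (x ⊕ rep x)
    rep-coset x = first-satisfies (λ y → inH? (x ⊕ y)) (Finite.elements FG) x (Finite.complete FG x) (self x)

  rep⇒H : ∀ x x′ → rep x ≡ rep x′ → InH (x ⊕ x′)
  rep⇒H x x′ eq = subst InH (xor (x ∷ x′ ∷ rep x′ ∷ []) ((a₀ :⊕ a₂) :⊕ (a₁ :⊕ a₂)) (a₀ :⊕ a₁) refl)
    (H-closed (subst (λ r → InH (x ⊕ r)) eq (rep-coset x)) (rep-coset x′))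

  H⇒rep : ∀ x x′ → InH (x ⊕ x′) → rep x ≡ rep x′
  H⇒rep x x′ ih = first-cong (λ y → inH? (x ⊕ y)) (λ y → inH? (x′ ⊕ y))
    (λ y xy → subst InH (xor (x ∷ x′ ∷ y ∷ []) ((a₀ :⊕ a₁) :⊕ (a₀ :⊕ a₂)) (a₁ :⊕ a₂) refl) (H-closed ih xy))
    (λ y x′y → subst InH (xor (x ∷ x′ ∷ y ∷ []) ((a₀ :⊕ a₁) :⊕ (a₁ :⊕ a₂)) (a₀ :⊕ a₂) refl) (H-closed ih x′y))
    (Finite.elements FG) x x′ (Finite.complete FG x) (self x)

  -- The support of `W` lies in one coset, so x ⊕ y determines the coset of x. Submodularity given
  -- that coset, applied to x ⊕ y and x, yields the bound.
  rep-entropy : Ent ξ rep +ᵥ H W ≤ᵥ H (ξ ⊛ W)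
  rep-entropy = by (Ent ξ rep ∷ H W ∷ H (ξ ⊛ W) ∷ H ξ ∷ Ent ω < Z , < plus , proj₁ > > ∷ Ent ω Z ∷ Ent ω < plus , Z > ∷ Ent ω < proj₁ , Z > ∷ Ent ω plus ∷ [])
    (v₀ :+ v₁ ⊑ v₂)
    ((1 , v₃ :+ v₁ ⊑ v₄) ∷ (1 , v₄ :+ v₅ ⊑ v₆ :+ v₇) ∷ (1 , v₀ ⊑ v₅) ∷ (1 , v₇ ⊑ v₃) ∷ (1 , v₆ ⊑ v₈) ∷ (1 , v₈ ⊑ v₂) ∷ []) refl
    ( ≤ᵥ-trans (proj₂ (Ent-⊗ ξ W id id)) (Ent-function ω id < Z , < plus , proj₁ > > (λ (_ , (s , x)) → x , s ⊕ x)
        (λ (x , y) → cong (x ,_) (xor (x ∷ y ∷ []) ((a₀ :⊕ a₁) :⊕ a₀) a₁ refl)))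
    ∷ Ent-submodular ω plus proj₁ Z ∷ proj₂ (Ent-⊗-proj₁ ξ W rep)
    ∷ ≤ᵥ-trans (Ent-function ω < proj₁ , Z > proj₁ (λ x → x , rep x) (λ _ → refl)) (proj₁ (Ent-⊗-proj₁ ξ W id))
    ∷ entropy-refine (weight ω) < plus , Z > plus {{nonZero ω}} determined ∷ proj₂ (H-⊛ ξ W) ∷ [])
    where
    ω = ξ ⊗ᵈ W
    Z : G × G → G
    Z (x , y) = rep x
    determined : ∀ (xy xy′ : G × G) → NonZero (weight ω xy) → NonZero (weight ω xy′) → plus xy ≡ plus xy′ → (plus xy , Z xy) ≡ (plus xy′ , Z xy′)
    determined (x , y) (x′ , y′) nz nz′ eq = cong₂ _,_ eq (H⇒rep x x′ (subst InH same
      (W-support y y′ (ℕ.m*n≢0⇒n≢0 (weight ξ x) {{nz}}) (ℕ.m*n≢0⇒n≢0 (weight ξ x′) {{nz′}}))))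
      where
      same : y ⊕ y′ ≡ x ⊕ x′
      same = trans (xor (x ∷ y ∷ x′ ∷ y′ ∷ []) (a₁ :⊕ a₃) (((a₀ :⊕ a₁) :⊕ a₃) :⊕ a₀) refl)
        (trans (cong (λ s → (s ⊕ y′) ⊕ x) eq) (xor (x ∷ y ∷ x′ ∷ y′ ∷ []) (((a₂ :⊕ a₃) :⊕ a₃) :⊕ a₀) (a₀ :⊕ a₂) refl))

  coset-mass : G → ℕ
  coset-mass x = ∑ (λ y → 𝟙 (inH? (y ⊕ x)) * weight ξ y)

  private
    Δ : 𝕍
    Δ = 2 · (D ξ μ +ᵥ log 2)

    law-rep : ∀ x → law (weight ξ) rep (rep x) ≡ coset-mass x
    law-rep x = ∑-cong {G} (λ y → cong (_* weight ξ y) (𝟙-cong (rep⇒H y x) (H⇒rep y x) (rep y ≟ rep x) (inH? (y ⊕ x))))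

  -- The mean of the negative logarithm of the probability of the coset of x is the entropy of `rep`
  -- under ξ. It is at most H (ξ ⊛ W) - H W, hence at most D ξ W, and some x does not exceed the
  -- mean.
  heavy-coset : Σ[ x ∈ G ] NonZero (coset-mass x) × log (∑ (weight ξ)) ≤ᵥ log (coset-mass x) +ᵥ Δ
  heavy-coset = conclude (below-average (weight ξ) v Δ {{nonZero ξ}} average≤)
    where
    X = ∑ (weight ξ)
    v : G → 𝕍
    v x = log X -ᵥ log (law (weight ξ) rep (rep x))
    average≤ : ∑ᵥ (λ x → weight ξ x · v x) ≤ᵥ X · Δ
    average≤ = by (∑ᵥ (λ x → weight ξ x · v x) ∷ X · Δ ∷ X · log X ∷ log-likelihood (weight ξ) rep ∷ X · Ent ξ rep ∷
        ∑ᵥ (λ x → weight ξ x · log X) ∷ ∑ᵥ (λ x → weight ξ x · log X -ᵥ weight ξ x · log (law (weight ξ) rep (rep x))) ∷ [])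
      (v₀ ⊑ v₁) ((1 , v₀ ⊑ v₆) ∷ (1 , v₆ ⊑ v₅ :- v₃) ∷ (1 , v₅ ⊑ v₂) ∷ (1 , v₂ :- v₃ ⊑ v₄) ∷ (1 , v₄ ⊑ v₁) ∷ []) refl
      ( proj₁ (𝕍Σ.∑-cong {G} (λ x → ·-distrib-- (weight ξ x) (log X) (log (law (weight ξ) rep (rep x)))))
      ∷ proj₁ (∑ᵥ-- {G} (λ x → weight ξ x · log X) (λ x → weight ξ x · log (law (weight ξ) rep (rep x))))
      ∷ proj₁ (∑ᵥ-·ʳ (weight ξ) (log X)) ∷ proj₂ (mass-entropy (weight ξ) rep)
      ∷ ·-mono X (≤ᵥ-trans (by (Ent ξ rep ∷ H W ∷ H (ξ ⊛ W) ∷ H ξ ∷ []) (v₀ ⊑ 2 :· v₂ :- v₃ :- v₁)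
          ((1 , v₀ :+ v₁ ⊑ v₂) ∷ (1 , v₃ ⊑ v₂) ∷ []) refl (rep-entropy ∷ H-⊛-monoʳ ξ W ∷ [])) D-W) ∷ [])
    conclude : (∃[ x ] NonZero (weight ξ x) × v x ≤ᵥ Δ) → Σ[ x ∈ G ] NonZero (coset-mass x) × log X ≤ᵥ log (coset-mass x) +ᵥ Δ
    conclude (x , nz , le) = x , subst NonZero (law-rep x) (NonZero-≤ {{nz}} (law-≥ (weight ξ) rep x))
      , subst (λ l → log X ≤ᵥ log l +ᵥ Δ) (law-rep x) (by (log X ∷ log (law (weight ξ) rep (rep x)) ∷ Δ ∷ []) (v₀ ⊑ v₁ :+ v₂)
          ((1 , v₀ :- v₁ ⊑ v₂) ∷ []) refl (le ∷ []))

  subgroup-size : log n ≤ᵥ H ξ +ᵥ Δ +ᵥ log 4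
  subgroup-size = by (log n ∷ H W ∷ log 4 ∷ H ξ ∷ H (ξ ⊛ W) ∷ Δ ∷ []) (v₀ ⊑ v₃ :+ v₅ :+ v₂)
    ((1 , v₀ ⊑ v₁ :+ v₂) ∷ (1 , 2 :· v₄ :- v₃ :- v₁ ⊑ v₅) ∷ (2 , v₁ ⊑ v₄) ∷ []) refl (log-n≤ ∷ D-W ∷ H-⊛-monoˡ ξ W ∷ [])

-- The graph of f

-- Bernoulli's inequality for 1 + 1/m. At k = m it gives 2 mᵐ ≤ (m + 1)ᵐ, so m gains amount to at
-- least log 2.
ratio-bound : ∀ m k → (m + k) * m ^ k ≤ m * suc m ^ k
ratio-bound m zero    = ℕ.≤-reflexive (cong (_* 1) (ℕ.+-identityʳ m))
ratio-bound m (suc k) = begin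
  (m + suc k) * (m * m ^ k)          ≤⟨ ℕ.m≤m+n _ (k * m ^ k) ⟩
  (m + suc k) * (m * m ^ k) + k * m ^ k ≡⟨ eq₁ m k (m ^ k) ⟩
  suc m * ((m + k) * m ^ k)          ≤⟨ ℕ.*-monoʳ-≤ (suc m) (ratio-bound m k) ⟩
  suc m * (m * suc m ^ k)            ≡⟨ eq₂ m (suc m ^ k) ⟩
  m * (suc m * suc m ^ k)            ∎
  where
  open ℕ.≤-Reasoning
  eq₁ : ∀ m k x → (m + suc k) * (m * x) + k * x ≡ suc m * ((m + k) * x)
  eq₁ = solve-∀
  eq₂ : ∀ m x → suc m * (m * x) ≡ m * (suc m * x)
  eq₂ = solve-∀

module Constants (r : ℕ) {{r≢0 : NonZero r}} where

  private
    m : ℕ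
    m = 4 * (r * suc r)

    instance
      rr≢0 = ℕ.m*n≢0 r (suc r)
      m≢0 = ℕ.m*n≢0 4 (r * suc r)
      m^m≢0 = ℕ.m^n≢0 m m
      [1+m]^m≢0 = ℕ.m^n≢0 (suc m) m

  steps : ℕ
  steps = m * r

  gain κ : 𝕍
  gain = log (suc m) -ᵥ log m
  κ = gain ÷ r

  gain-≤ : gain +ᵥ log m ≤ᵥ log (suc m)
  gain-≤ = by (log (suc m) ∷ log m ∷ []) ((v₀ :- v₁) :+ v₁ ⊑ v₀) [] refl []

  gain>0 : ¬ gain ≤ᵥ 0ᵥ
  gain>0 le = ℕ.<-irrefl refl (log-cancel-≤ {suc m} {m} (by (log (suc m) ∷ log m ∷ []) (v₀ ⊑ v₁) ((1 , v₀ :- v₁ ⊑ :0) ∷ []) refl (le ∷ [])))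

  rκ≤gain : r · κ ≤ᵥ gain
  rκ≤gain = proj₁ (·-÷ r gain)

  κ≥0 : 0ᵥ ≤ᵥ κ
  κ≥0 = ·-cancel r (≤ᵥ-trans (proj₁ (·-zero r)) (≤ᵥ-trans (by (log (suc m) ∷ log m ∷ []) (:0 ⊑ v₀ :- v₁) ((1 , v₁ ⊑ v₀) ∷ []) refl
    (log-mono (ℕ.n≤1+n m) ∷ [])) (proj₂ (·-÷ r gain))))

  log2≤ : log 2 ≤ᵥ steps · κ
  log2≤ = by (log 2 ∷ m · gain ∷ m · log (suc m) ∷ m · log m ∷ log (2 * m ^ m) ∷ log (suc m ^ m) ∷ steps · κ ∷ [])
    (v₀ ⊑ v₆)
    ((1 , v₂ :- v₃ ⊑ v₁) ∷ (1 , v₀ :+ v₃ ⊑ v₄) ∷ (1 , v₄ ⊑ v₅) ∷ (1 , v₅ ⊑ v₂) ∷ (1 , v₁ ⊑ v₆) ∷ []) refl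
    ( proj₂ (·-distrib-- m (log (suc m)) (log m))
    ∷ proj₂ (≈ᵥ-trans (log-* 2 (m ^ m)) (+ᵥ-cong ≈ᵥ-refl (log-^ m m)))
    ∷ log-mono {{ℕ.m*n≢0 2 (m ^ m)}} (ℕ.*-cancelˡ-≤ m (ℕ.≤-trans (ℕ.≤-reflexive (eq m (m ^ m))) (ratio-bound m m)))
    ∷ proj₁ (log-^ (suc m) m)
    ∷ ≤ᵥ-trans (·-mono m (proj₂ (·-÷ r gain))) (proj₁ (·-assocˡ κ m r)) ∷ [])
    where
    eq : ∀ m x → m * (2 * x) ≡ (m + m) * x
    eq = solve-∀

entropy-indicator : ∀ {A : Set} {{_ : Finite A}} (w : A → ℕ) → (∀ a → w a ≤ 1) → .{{_ : NonZero (∑ w)}} → log (∑ w) ≤ᵥ entropy w id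
entropy-indicator {A} w w≤1 = ·-cancel (∑ w) (by (∑ w · log (∑ w) ∷ ∑ w · entropy w id ∷ log-likelihood w id ∷ ∑ᵥ (λ a → w a · log (w a)) ∷ [])
  (v₀ ⊑ v₁) ((1 , v₀ :- v₂ ⊑ v₁) ∷ (1 , v₂ ⊑ v₃) ∷ (1 , v₃ ⊑ :0) ∷ []) refl
  ( proj₂ (mass-entropy w id) ∷ proj₁ (log-likelihood-id w)
  ∷ ≤ᵥ-trans (∑ᵥ-mono {A} (λ a → at (w a) (w≤1 a))) (proj₁ (𝕍Σ.∑-ε {A})) ∷ []))
  where
  at : ∀ n → n ≤ 1 → n · log n ≤ᵥ 0ᵥ
  at zero    _         = ≤ᵥ-refl
  at (suc _) (s≤s z≤n) = ≤ᵥ-trans (proj₁ (+ᵥ-identityʳ (log 1))) (proj₁ log-1)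

entropy≤log-mass : ∀ {A : Set} {{_ : Finite A}} (w : A → ℕ) .{{_ : NonZero (∑ w)}} → entropy w id ≤ᵥ log (∑ w)
entropy≤log-mass {A} w = ·-cancel (∑ w) (by (∑ w · log (∑ w) ∷ ∑ w · entropy w id ∷ log-likelihood w id ∷ ∑ᵥ (λ a → w a · log (w a)) ∷ [])
  (v₁ ⊑ v₀) ((1 , v₁ ⊑ v₀ :- v₂) ∷ (1 , v₃ ⊑ v₂) ∷ (1 , :0 ⊑ v₃) ∷ []) refl
  ( proj₁ (mass-entropy w id) ∷ proj₂ (log-likelihood-id w)
  ∷ ≤ᵥ-trans (proj₂ (𝕍Σ.∑-ε {A})) (∑ᵥ-mono {A} (λ a → at (w a))) ∷ []))
  where
  at : ∀ n → 0ᵥ ≤ᵥ n · log n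
  at n = ≤ᵥ-trans (proj₂ (·-zero n)) (·-zero-or-≤ n (λ n≢0 → log≥0 n {{n≢0}}))

product-group : ∀ {A B : Set} → BooleanGroup A → BooleanGroup B → BooleanGroup (A × B)
product-group 𝔸 𝔹 = record
  { _⊕_ = λ (a , b) (a′ , b′) → a A.⊕ a′ , b B.⊕ b′ ; 𝟘 = A.𝟘 , B.𝟘
  ; ⊕-assoc = λ (a , b) (a′ , b′) (a″ , b″) → cong₂ _,_ (A.⊕-assoc a a′ a″) (B.⊕-assoc b b′ b″)
  ; ⊕-comm = λ (a , b) (a′ , b′) → cong₂ _,_ (A.⊕-comm a a′) (B.⊕-comm b b′)
  ; ⊕-identity = λ (a , b) → cong₂ _,_ (A.⊕-identity a) (B.⊕-identity b)
  ; ⊕-self = λ (a , b) → cong₂ _,_ (A.⊕-self a) (B.⊕-self b)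
  }
  where
  module A = BooleanGroup 𝔸
  module B = BooleanGroup 𝔹

module Graph {A B : Set} {{FA : Finite A}} {{FB : Finite B}} (𝔸 : BooleanGroup A) (𝔹 : BooleanGroup B) (f : A → B) where

  module A = BooleanGroup 𝔸
  module B = BooleanGroup 𝔹

  𝔾 : BooleanGroup (A × B)
  𝔾 = product-group 𝔸 𝔹

  open SumsetEntropy 𝔾
  open Families 𝔾

  size : ℕ
  size = ∑ {A} (λ _ → 1)

  homomorphic? : ∀ ((x , z) : A × A) → Dec (f (x A.⊕ z) ≡ f x B.⊕ f z)
  homomorphic? (x , z) = f (x A.⊕ z) ≟ f x B.⊕ f z

  indicator : A × A → ℕ
  indicator xz = 𝟙 (homomorphic? xz)

  pairs : ℕ
  pairs = ∑ indicator

  module _ (pairs≢0 : NonZero pairs) where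

    private
      ε : Dist (A × A)
      ε = indicator ,ᵈ pairs≢0

      -- In the notation of the Balog-Szemerédi-Gowers lemma, A is the graph point over x and W the
      -- sum of the graph points over x and z, so that B is the graph point over z. There is nothing
      -- to condition on, and C is trivial.
      Φ : A × A → (⊤ × (A × B)) × (A × B)
      Φ (x , z) = (tt , (x A.⊕ z , f x B.⊕ f z)) , (x , f x)

      ρ : Dist ((⊤ × (A × B)) × (A × B))
      ρ = push ε Φ

      open Coupling ρ
      open BSG ρ using (balog-szemerédi-gowers)

      a : 𝕍
      a = log size

    -- The bracket is log (1/p), where p is the proportion of homomorphic pairs. The factor 7 is
    -- what the linear arithmetic below yields.
    t : 𝕍
    t = 7 · (2 · log size -ᵥ log pairs)

    private
      total : log pairs ≤ᵥ Ent ρ id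
      total = ≤ᵥ-trans (entropy-indicator indicator (λ xz → 𝟙≤1 (homomorphic? xz)) {{pairs≢0}})
        (≤ᵥ-trans (Ent-function ε id Φ (λ ((_ , (s , _)) , (x , _)) → x , x A.⊕ s) (λ (x , z) → cong (x ,_) (A.⊕-cancel x z)))
          (proj₂ (Ent-push ε Φ id)))

      range : (X : A × A → A) → Ent ε X ≤ᵥ a
      range X = entropy≤log-range indicator X {{pairs≢0}}

      first-bound : Ent ρ (λ ((c , w) , x) → x , c) ≤ᵥ a
      first-bound = ≤ᵥ-trans (proj₁ (Ent-push ε Φ (λ ((c , w) , x) → x , c)))
        (≤ᵥ-trans (Ent-function ε _ proj₁ (λ x → (x , f x) , tt) (λ _ → refl)) (range proj₁))

      second-bound : Ent ρ (λ ((c , w) , x) → x ⊕ w , c) ≤ᵥ a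
      second-bound = ≤ᵥ-trans (proj₁ (Ent-push ε Φ (λ ((c , w) , x) → x ⊕ w , c)))
        (≤ᵥ-trans (Ent-function ε _ proj₂ (λ z → (z , f z) , tt)
          (λ (x , z) → cong₂ (λ u v → (u , v) , tt) (sym (A.⊕-cancel x z)) (sym (B.⊕-cancel (f x) (f z))))) (range proj₂))

      -- Here the equation f (x + z) = f x + f z enters: on the support the sum of the two graph
      -- points lies on the graph again, so x + z determines it.
      sum-bound : Ent ρ proj₁ ≤ᵥ a
      sum-bound = ≤ᵥ-trans (proj₁ (Ent-push ε Φ proj₁))
        (≤ᵥ-trans (entropy-refine indicator (proj₁ ∘ Φ) X {{pairs≢0}} determined) (range X))
        where
        X : A × A → A
        X (x , z) = x A.⊕ z
        holds : ∀ xz → NonZero (indicator xz) → f (X xz) ≡ f (proj₁ xz) B.⊕ f (proj₂ xz)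
        holds xz nz with homomorphic? xz
        ... | yes eq = eq
        determined : ∀ xz xz′ → NonZero (indicator xz) → NonZero (indicator xz′) → X xz ≡ X xz′ → proj₁ (Φ xz) ≡ proj₁ (Φ xz′)
        determined xz xz′ nz nz′ eq = cong (tt ,_) (cong₂ _,_ eq (trans (sym (holds xz nz)) (trans (cong f eq) (holds xz′ nz′))))

      -- For the law ξ of a fibre this is D ξ ξ plus the deficit a - H ξ. Both terms are
      -- nonnegative, so a single choice of the fibre bounds doubling and size together.
      v : ⊤ × (A × B) → 𝕍
      v i = 2 · entropy (fibre i ⊛ʷ fibre i) id -ᵥ 3 · entropy (fibre i) id +ᵥ a

      c : ⊤ × (A × B) → ℕ
      c i = ∑ (fibre i)

      vₑ : Linear.Expr 3
      vₑ = 2 :· v₀ :- 3 :· v₁ :+ v₂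

      average≤ : ∑ᵥ (λ i → c i · v i) ≤ᵥ ∑ c · t
      average≤ = subst (λ n → ∑ᵥ (λ i → c i · v i) ≤ᵥ n · t) (∑-× (weight ρ)) (by
        ( ∑ᵥ (λ i → c i · v i) ∷ mass · t
        ∷ average c (λ i → entropy (fibre i ⊛ʷ fibre i) id) ∷ average c (λ i → entropy (fibre i) id) ∷ average c (λ _ → a)
        ∷ mass · R ∷ mass · E ∷ mass · a ∷ mass · (2 · R -ᵥ 3 · E +ᵥ a) ∷ [])
        (v₀ ⊑ v₁)
        ((1 , v₀ ⊑ 2 :· v₂ :- 3 :· v₃ :+ v₄) ∷ (2 , v₂ ⊑ v₅) ∷ (3 , v₆ ⊑ v₃) ∷ (1 , v₄ ⊑ v₇) ∷ (1 , 2 :· v₅ :- 3 :· v₆ :+ v₇ ⊑ v₈) ∷ (1 , v₈ ⊑ v₁) ∷ []) refl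
        ( proj₁ (∑-linear c vₑ ((λ i → entropy (fibre i ⊛ʷ fibre i) id) ∷ (λ i → entropy (fibre i) id) ∷ (λ _ → a) ∷ []))
        ∷ balog-szemerédi-gowers ∷ proj₂ conditional-Ent
        ∷ proj₁ (≈ᵥ-trans (∑ᵥ-·ʳ c a) (·-congˡ (sym (∑-× (weight ρ)))))
        ∷ proj₂ (·-linear mass vₑ (R ∷ E ∷ a ∷ [])) ∷ ·-mono mass final ∷ []))
        where
        R E : 𝕍
        R = 2 · Ent ρ (λ ((c , w) , x) → x , c) +ᵥ 2 · Ent ρ (λ ((c , w) , x) → x ⊕ w , c) -ᵥ 3 · Ent ρ (λ ((c , w) , x) → c) -ᵥ 2 · Ent ρ id +ᵥ Ent ρ proj₁
        E = Ent ρ id -ᵥ Ent ρ proj₁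
        final : 2 · R -ᵥ 3 · E +ᵥ a ≤ᵥ t
        final = by (Ent ρ (λ ((c , w) , x) → x , c) ∷ Ent ρ (λ ((c , w) , x) → x ⊕ w , c) ∷ Ent ρ (λ ((c , w) , x) → c) ∷ Ent ρ id ∷ Ent ρ proj₁ ∷ a ∷ log pairs ∷ [])
          (2 :· (2 :· v₀ :+ 2 :· v₁ :- 3 :· v₂ :- 2 :· v₃ :+ v₄) :- 3 :· (v₃ :- v₄) :+ v₅ ⊑ 7 :· (2 :· v₅ :- v₆))
          ((4 , v₀ ⊑ v₅) ∷ (4 , v₁ ⊑ v₅) ∷ (6 , :0 ⊑ v₂) ∷ (7 , v₆ ⊑ v₃) ∷ (5 , v₄ ⊑ v₅) ∷ []) refl
          (first-bound ∷ second-bound ∷ entropy≥0 (weight ρ) (λ ((c , w) , x) → c) {{nonZero ρ}} ∷ total ∷ sum-bound ∷ [])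

    OnGraph : A × B → Set
    OnGraph (x , y) = y ≡ f x

    onGraph? : ∀ xy → Dec (OnGraph xy)
    onGraph? (x , y) = y ≟ f x

    graph-part : Σ[ ξ ∈ Dist (A × B) ] (∀ xy → weight ξ xy ≤ 𝟙 (onGraph? xy)) × D ξ ξ ≤ᵥ t × log size ≤ᵥ log (∑ (weight ξ)) +ᵥ t × H ξ ≤ᵥ log size
    graph-part = conclude (below-average c v t {{subst NonZero (∑-× (weight ρ)) (nonZero ρ)}} average≤)
      where
      -- Once the sum is fixed, x determines z, so a point of the fibre receives weight from at most
      -- one pair.
      below-graph : ∀ i xy → fibre i xy ≤ 𝟙 (onGraph? xy)
      below-graph (tt , (s , u)) (x , y) = ℕ.≤-trans (∑-mono {A × A} at) (ℕ.≤-reflexive (∑-δ (x , x A.⊕ s) (λ _ → 𝟙 (onGraph? (x , y)))))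
        where
        at : ∀ (xz : A × A) → δ (Φ xz) ((tt , (s , u)) , (x , y)) * indicator xz ≤ δ xz (x , x A.⊕ s) * 𝟙 (onGraph? (x , y))
        at (x′ , z′) = ℕ.≤-trans (ℕ.*-mono-≤ (ℕ.≤-trans (𝟙-mono both (Φ (x′ , z′) ≟ ((tt , (s , u)) , (x , y))) (((x′ , z′) ≟ (x , x A.⊕ s)) ×-dec onGraph? (x , y)))
            (ℕ.≤-reflexive (𝟙-× ((x′ , z′) ≟ (x , x A.⊕ s)) (onGraph? (x , y)) _))) (𝟙≤1 (homomorphic? (x′ , z′)))) (ℕ.≤-reflexive (ℕ.*-identityʳ _))
          where
          both : Φ (x′ , z′) ≡ ((tt , (s , u)) , (x , y)) → ((x′ , z′) ≡ (x , x A.⊕ s)) × OnGraph (x , y)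
          both refl = cong (x′ ,_) (sym (A.⊕-cancel x′ z′)) , refl
      conclude : (∃[ i ] NonZero (c i) × v i ≤ᵥ t) →
        Σ[ ξ ∈ Dist (A × B) ] (∀ xy → weight ξ xy ≤ 𝟙 (onGraph? xy)) × D ξ ξ ≤ᵥ t × log size ≤ᵥ log (∑ (weight ξ)) +ᵥ t × H ξ ≤ᵥ log size
      conclude (i , nz , le) = ξ , below-graph i
        , by (H (ξ ⊛ ξ) ∷ H ξ ∷ a ∷ t ∷ []) (2 :· v₀ :- v₁ :- v₁ ⊑ v₃) ((1 , 2 :· v₀ :- 3 :· v₁ :+ v₂ ⊑ v₃) ∷ (1 , v₁ ⊑ v₂) ∷ []) refl (le ∷ small ∷ [])
        , by (H (ξ ⊛ ξ) ∷ H ξ ∷ a ∷ t ∷ log (∑ (weight ξ)) ∷ []) (v₂ ⊑ v₄ :+ v₃)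
            ((1 , 2 :· v₀ :- 3 :· v₁ :+ v₂ ⊑ v₃) ∷ (2 , v₁ ⊑ v₀) ∷ (1 , v₁ ⊑ v₄) ∷ []) refl
            (le ∷ H-⊛-monoˡ ξ ξ ∷ entropy≤log-mass (fibre i) {{nz}} ∷ [])
        , small
        where
        ξ : Dist (A × B)
        ξ = fibre i ,ᵈ nz
        on : ∀ xy → NonZero (fibre i xy) → OnGraph xy
        on xy nz′ with onGraph? xy | below-graph i xy
        ... | yes eq | _  = eq
        ... | no  _  | le = contradiction (NonZero-≤ {{nz′}} le) (λ ())
        small : H ξ ≤ᵥ a
        small = ≤ᵥ-trans (entropy-refine (fibre i) id proj₁ {{nz}}
            (λ (x , y) (x′ , y′) n₁ n₂ eq → cong₂ _,_ eq (trans (on (x , y) n₁) (trans (cong f eq) (sym (on (x′ , y′) n₂))))))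
          (entropy≤log-range (fibre i) proj₁ {{nz}})

-- Linear algebra over 𝔽₂

instance
  vec-finite : ∀ {n} → Finite (Vec 𝔽₂ n)
  vec-finite {n} = record
    { elements = SampleSpace.elements (vectors n) ; complete = SampleSpace.complete (vectors n)
    ; unique = SampleSpace.unique (vectors n) ; _≟_ = _≟ᵛ_ }

vec-group : ∀ n → BooleanGroup (Vec 𝔽₂ n)
vec-group n = record
  { _⊕_ = _+ᵛ_ ; 𝟘 = ε ; ⊕-assoc = assoc ; ⊕-comm = comm ; ⊕-identity = identityˡ ; ⊕-self = inverseˡ }
  where open AbelianGroup (𝔽₂^ n)

𝟎ᵛ : ∀ {n} → Vec 𝔽₂ n
𝟎ᵛ {n} = AbelianGroup.ε (𝔽₂^ n)

Additive : ∀ {m n} → (Vec 𝔽₂ m → Vec 𝔽₂ n) → Set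
Additive φ = ∀ x y → φ (x +ᵛ y) ≡ φ x +ᵛ φ y

additive-𝟎 : ∀ {m n} {φ : Vec 𝔽₂ m → Vec 𝔽₂ n} → Additive φ → φ 𝟎ᵛ ≡ 𝟎ᵛ
additive-𝟎 {m} {n} {φ} add = trans (cong φ (sym (V.⊕-self 𝟎ᵛ))) (trans (add 𝟎ᵛ 𝟎ᵛ) (BooleanGroup.⊕-self (vec-group n) (φ 𝟎ᵛ)))
  where module V = BooleanGroup (vec-group m)

-- Induction on m, with the first coordinate 0 left to the smaller case. If some (1 ∷ a , b)
-- satisfies Q, translation by it defines φ on vectors with first coordinate 1. If not, nothing is
-- required there, and φ ignores the coordinate so as to remain additive and total.
section : ∀ m n (Q : Vec 𝔽₂ m → Vec 𝔽₂ n → Set) → (∀ x y → Dec (Q x y)) → Q 𝟎ᵛ 𝟎ᵛ →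
          (∀ {x y x′ y′} → Q x y → Q x′ y′ → Q (x +ᵛ x′) (y +ᵛ y′)) →
          Σ[ φ ∈ (Vec 𝔽₂ m → Vec 𝔽₂ n) ] Additive φ × (∀ x y → Q x y → Q x (φ x))
section zero n Q Q? Q0 Q+ = (λ _ → 𝟎ᵛ) , (λ _ _ → sym (BooleanGroup.⊕-self (vec-group n) 𝟎ᵛ)) , λ { [] y _ → Q0 }
section (suc m) n Q Q? Q0 Q+ = extend (∃? (λ a → ∃? (λ b → Q? (1ℙ ∷ a) b))) (section m n (λ x y → Q (0ℙ ∷ x) y) (λ x y → Q? (0ℙ ∷ x) y) Q0 Q+)
  where
  module V = BooleanGroup (vec-group m)
  module W = BooleanGroup (vec-group n)
  extend : Dec (∃[ a ] ∃[ b ] Q (1ℙ ∷ a) b) →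
           Σ[ φ ∈ (Vec 𝔽₂ m → Vec 𝔽₂ n) ] Additive φ × (∀ x y → Q (0ℙ ∷ x) y → Q (0ℙ ∷ x) (φ x)) →
           Σ[ φ ∈ (Vec 𝔽₂ (suc m) → Vec 𝔽₂ n) ] Additive φ × (∀ x y → Q x y → Q x (φ x))
  extend (no none) (φ , add , sec) = ψ , ψ-add , ψ-sec
    where
    ψ : Vec 𝔽₂ (suc m) → Vec 𝔽₂ n
    ψ (_ ∷ x) = φ x
    ψ-add : Additive ψ
    ψ-add (_ ∷ x) (_ ∷ y) = add x y
    ψ-sec : ∀ x y → Q x y → Q x (ψ x)
    ψ-sec (0ℙ ∷ x) y Qxy = sec x y Qxy
    ψ-sec (1ℙ ∷ x) y Qxy = contradiction (x , y , Qxy) none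
  extend (yes (a , b , Qab)) (φ , add , sec) = ψ , ψ-add , ψ-sec
    where
    ψ : Vec 𝔽₂ (suc m) → Vec 𝔽₂ n
    ψ (0ℙ ∷ x) = φ x
    ψ (1ℙ ∷ x) = φ (x +ᵛ a) +ᵛ b
    ψ-add : Additive ψ
    ψ-add (0ℙ ∷ x) (0ℙ ∷ y) = add x y
    ψ-add (0ℙ ∷ x) (1ℙ ∷ y) = trans (cong (_+ᵛ b) (trans (cong φ (V.⊕-assoc x y a)) (add x (y +ᵛ a)))) (W.⊕-assoc (φ x) (φ (y +ᵛ a)) b)
    ψ-add (1ℙ ∷ x) (0ℙ ∷ y) = trans (cong (_+ᵛ b) (trans (cong φ (V.xor (x ∷ y ∷ a ∷ []) ((a₀ :⊕ a₁) :⊕ a₂) ((a₀ :⊕ a₂) :⊕ a₁) refl)) (add (x +ᵛ a) y)))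
      (W.xor (φ (x +ᵛ a) ∷ φ y ∷ b ∷ []) ((a₀ :⊕ a₁) :⊕ a₂) ((a₀ :⊕ a₂) :⊕ a₁) refl)
    ψ-add (1ℙ ∷ x) (1ℙ ∷ y) = trans (cong φ (V.xor (x ∷ y ∷ a ∷ []) (a₀ :⊕ a₁) ((a₀ :⊕ a₂) :⊕ (a₁ :⊕ a₂)) refl)) (trans (add (x +ᵛ a) (y +ᵛ a))
      (W.xor (φ (x +ᵛ a) ∷ φ (y +ᵛ a) ∷ b ∷ []) (a₀ :⊕ a₁) ((a₀ :⊕ a₂) :⊕ (a₁ :⊕ a₂)) refl))
    ψ-sec : ∀ x y → Q x y → Q x (ψ x)
    ψ-sec (0ℙ ∷ x) y Qxy = sec x y Qxy
    ψ-sec (1ℙ ∷ x) y Qxy = subst (λ u → Q (1ℙ ∷ u) (φ (x +ᵛ a) +ᵛ b)) (V.xor (x ∷ a ∷ []) ((a₀ :⊕ a₁) :⊕ a₁) a₀ refl)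
      (Q+ (sec (x +ᵛ a) (y +ᵛ b) (Q+ Qxy Qab)) Qab)

∑-∷ : ∀ {m} (f : Vec 𝔽₂ (suc m) → ℕ) → ∑ f ≡ ∑ (λ x → f (0ℙ ∷ x)) + ∑ (λ x → f (1ℙ ∷ x))
∑-∷ {m} f = trans (sym (∑-bijection (λ (i , x) → i ∷ x) (λ { (i ∷ x) → i , x }) (λ _ → refl) (λ { (_ ∷ _) → refl }) f))
  (trans (∑-× (λ (i , x) → f (i ∷ x))) (cong (∑ (λ x → f (0ℙ ∷ x)) +_) (ℕ.+-identityʳ (∑ (λ x → f (1ℙ ∷ x))))))

one? : ∀ i → Dec (i ≡ 1ℙ)
one? i = i ≟ 1ℙ

-- Averaging over all linear functionals, each nonzero vector is mapped to 1 by half of them.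
halving : ∀ m (t : Vec 𝔽₂ m → ℕ) → t 𝟎ᵛ ≡ 0 →
  Σ[ ℓ ∈ (Vec 𝔽₂ m → Parity) ] (∀ x y → ℓ (x +ᵛ y) ≡ ℓ x Parity.+ ℓ y) × ∑ t ≤ 2 * ∑ (λ x → 𝟙 (one? (ℓ x)) * t x)
halving zero t t0 = (λ _ → 0ℙ) , (λ _ _ → refl) , ℕ.≤-trans (ℕ.≤-reflexive (trans (ℕ.+-identityʳ (t [])) t0)) z≤n
halving (suc m) t t0 = extend (halving m (λ x → t (0ℙ ∷ x)) t0)
  where
  T₁ : ℕ
  T₁ = ∑ (λ x → t (1ℙ ∷ x))
  extend : Σ[ ℓ ∈ (Vec 𝔽₂ m → Parity) ] (∀ x y → ℓ (x +ᵛ y) ≡ ℓ x Parity.+ ℓ y) × ∑ (λ x → t (0ℙ ∷ x)) ≤ 2 * ∑ (λ x → 𝟙 (one? (ℓ x)) * t (0ℙ ∷ x)) →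
           Σ[ ℓ ∈ (Vec 𝔽₂ (suc m) → Parity) ] (∀ x y → ℓ (x +ᵛ y) ≡ ℓ x Parity.+ ℓ y) × ∑ t ≤ 2 * ∑ (λ x → 𝟙 (one? (ℓ x)) * t x)
  extend (ℓ , add , le) = choose (ℕ.≤-total n₀ n₁)
    where
    n₀ n₁ : ℕ
    n₀ = ∑ (λ x → 𝟙 (one? (ℓ x)) * t (1ℙ ∷ x))
    n₁ = ∑ (λ x → 𝟙 (one? (1ℙ Parity.+ ℓ x)) * t (1ℙ ∷ x))
    -- The two extensions of ℓ to the new coordinate take opposite values on vectors beginning with
    -- 1, so one of them is 1 on at least half of their weight. The average is thus realised one
    -- coordinate at a time.
    split : T₁ ≡ n₀ + n₁
    split = trans (∑-cong {Vec 𝔽₂ m} (λ x → at (ℓ x) (t (1ℙ ∷ x)))) (∑-+ {Vec 𝔽₂ m} _ _)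
      where
      at : ∀ i k → k ≡ 𝟙 (one? i) * k + 𝟙 (one? (1ℙ Parity.+ i)) * k
      at 0ℙ k = sym (ℕ.*-identityˡ k)
      at 1ℙ k = sym (trans (ℕ.+-identityʳ (1 * k)) (ℕ.*-identityˡ k))
    ℓ′ : Parity → Vec 𝔽₂ (suc m) → Parity
    ℓ′ s (0ℙ ∷ x) = ℓ x
    ℓ′ s (1ℙ ∷ x) = s Parity.+ ℓ x
    ℓ′-add : ∀ s x y → ℓ′ s (x +ᵛ y) ≡ ℓ′ s x Parity.+ ℓ′ s y
    ℓ′-add s (0ℙ ∷ x) (0ℙ ∷ y) = add x y
    ℓ′-add s (0ℙ ∷ x) (1ℙ ∷ y) = trans (cong (s Parity.+_) (add x y)) (lemma s (ℓ x) (ℓ y))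
      where
      lemma : ∀ s i j → s Parity.+ (i Parity.+ j) ≡ i Parity.+ (s Parity.+ j)
      lemma s i j = trans (sym (Parity.+-assoc s i j)) (trans (cong (Parity._+ j) (Parity.+-comm s i)) (Parity.+-assoc i s j))
    ℓ′-add s (1ℙ ∷ x) (0ℙ ∷ y) = trans (cong (s Parity.+_) (add x y)) (sym (Parity.+-assoc s (ℓ x) (ℓ y)))
    ℓ′-add s (1ℙ ∷ x) (1ℙ ∷ y) = trans (add x y) (lemma s (ℓ x) (ℓ y))
      where
      lemma : ∀ s i j → i Parity.+ j ≡ (s Parity.+ i) Parity.+ (s Parity.+ j)
      lemma 0ℙ i  j = refl
      lemma 1ℙ 0ℙ 0ℙ = refl
      lemma 1ℙ 0ℙ 1ℙ = refl
      lemma 1ℙ 1ℙ 0ℙ = refl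
      lemma 1ℙ 1ℙ 1ℙ = refl
    bound : ∀ s → T₁ ≤ 2 * ∑ (λ x → 𝟙 (one? (s Parity.+ ℓ x)) * t (1ℙ ∷ x)) → ∑ t ≤ 2 * ∑ (λ x → 𝟙 (one? (ℓ′ s x)) * t x)
    bound s half = ℕ.≤-trans (ℕ.≤-reflexive (∑-∷ t)) (ℕ.≤-trans (ℕ.+-mono-≤ le half)
      (ℕ.≤-reflexive (trans (sym (ℕ.*-distribˡ-+ 2 (∑ (λ x → 𝟙 (one? (ℓ x)) * t (0ℙ ∷ x))) (∑ (λ x → 𝟙 (one? (s Parity.+ ℓ x)) * t (1ℙ ∷ x))))) (cong (2 *_) (sym (∑-∷ (λ x → 𝟙 (one? (ℓ′ s x)) * t x)))))))
    choose : n₀ ≤ n₁ ⊎ n₁ ≤ n₀ → Σ[ ℓ ∈ (Vec 𝔽₂ (suc m) → Parity) ] (∀ x y → ℓ (x +ᵛ y) ≡ ℓ x Parity.+ ℓ y) × ∑ t ≤ 2 * ∑ (λ x → 𝟙 (one? (ℓ x)) * t x)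
    choose (inj₁ n₀≤n₁) = ℓ′ 1ℙ , ℓ′-add 1ℙ , bound 1ℙ (ℕ.≤-trans (ℕ.≤-reflexive split) (ℕ.≤-trans (ℕ.+-monoˡ-≤ n₁ n₀≤n₁) (ℕ.≤-reflexive (cong (n₁ +_) (sym (ℕ.+-identityʳ n₁))))))
    choose (inj₂ n₁≤n₀) = ℓ′ 0ℙ , ℓ′-add 0ℙ , bound 0ℙ (ℕ.≤-trans (ℕ.≤-reflexive split) (ℕ.≤-trans (ℕ.+-monoʳ-≤ n₀ n₁≤n₀) (ℕ.≤-reflexive (cong (n₀ +_) (sym (ℕ.+-identityʳ n₀))))))

agreement : ∀ {m n} → (Vec 𝔽₂ m → Vec 𝔽₂ n) → (Vec 𝔽₂ m → Vec 𝔽₂ n) → ℕ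
agreement f g = ∑ (λ x → 𝟙 (f x ≟ g x))

_•_ : ∀ {n} → Parity → Vec 𝔽₂ n → Vec 𝔽₂ n
0ℙ • v = 𝟎ᵛ
1ℙ • v = v

•-+ : ∀ {n} i j (v : Vec 𝔽₂ n) → (i Parity.+ j) • v ≡ i • v +ᵛ j • v
•-+ {n} 0ℙ j  v = sym (BooleanGroup.⊕-identity (vec-group n) (j • v))
•-+ {n} 1ℙ 0ℙ v = sym (trans (BooleanGroup.⊕-comm (vec-group n) v 𝟎ᵛ) (BooleanGroup.⊕-identity (vec-group n) v))
•-+ {n} 1ℙ 1ℙ v = sym (BooleanGroup.⊕-self (vec-group n) v)

-- A linear functional equal to 1 on at least half of the nonzero agreements turns φ + v into a linear map.
linearise : ∀ m n {{_ : NonZero m}} (f φ : Vec 𝔽₂ m → Vec 𝔽₂ n) → Additive φ → ∀ v →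
  Σ[ g ∈ (Vec 𝔽₂ m → Vec 𝔽₂ n) ] Additive g × agreement f (λ x → φ x +ᵛ v) ≤ 4 * agreement f g
linearise m@(suc m′) n f φ φ-add v = build (halving m t t-𝟎)
  where
  module V = BooleanGroup (vec-group n)
  N : ℕ
  N = agreement f (λ x → φ x +ᵛ v)
  match? : ∀ x → Dec (f x ≡ φ x +ᵛ v)
  match? x = f x ≟ φ x +ᵛ v
  nonzero : Vec 𝔽₂ m → ℕ
  nonzero x = 1 ∸ δ x 𝟎ᵛ
  t : Vec 𝔽₂ m → ℕ
  t x = nonzero x * 𝟙 (match? x)
  t-𝟎 : t 𝟎ᵛ ≡ 0
  t-𝟎 = cong (λ k → (1 ∸ k) * 𝟙 (match? 𝟎ᵛ)) (δ-refl {Vec 𝔽₂ m} 𝟎ᵛ)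
  N≤ : N ≤ ∑ t + 1
  N≤ = ℕ.≤-trans (∑-mono {Vec 𝔽₂ m} at) (ℕ.≤-reflexive (trans (∑-+ t (λ x → δ x 𝟎ᵛ * 1)) (cong (∑ t +_) (∑-δ {Vec 𝔽₂ m} 𝟎ᵛ (λ _ → 1)))))
    where
    at : ∀ x → 𝟙 (match? x) ≤ t x + δ x 𝟎ᵛ * 1
    at x with x ≟ᵛ 𝟎ᵛ
    ... | yes _ = ℕ.≤-trans (𝟙≤1 (match? x)) (ℕ.m≤n+m 1 0)
    ... | no  _ = ℕ.≤-reflexive (sym (trans (ℕ.+-identityʳ _) (ℕ.+-identityʳ _)))
  build : Σ[ ℓ ∈ (Vec 𝔽₂ m → Parity) ] (∀ x y → ℓ (x +ᵛ y) ≡ ℓ x Parity.+ ℓ y) × ∑ t ≤ 2 * ∑ (λ x → 𝟙 (one? (ℓ x)) * t x) →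
          Σ[ g ∈ (Vec 𝔽₂ m → Vec 𝔽₂ n) ] Additive g × N ≤ 4 * agreement f g
  build (ℓ , ℓ-add , half) = choose (∑ t) refl
    where
    g : Vec 𝔽₂ m → Vec 𝔽₂ n
    g x = φ x +ᵛ ℓ x • v
    g-add : Additive g
    g-add x y = trans (cong₂ _+ᵛ_ (φ-add x y) (trans (cong (_• v) (ℓ-add x y)) (•-+ (ℓ x) (ℓ y) v)))
      (V.xor (φ x ∷ φ y ∷ ℓ x • v ∷ ℓ y • v ∷ []) ((a₀ :⊕ a₁) :⊕ (a₂ :⊕ a₃)) ((a₀ :⊕ a₂) :⊕ (a₁ :⊕ a₃)) refl)
    agrees : ∑ t ≤ 2 * agreement f g
    agrees = ℕ.≤-trans half (ℕ.*-monoʳ-≤ 2 (∑-mono {Vec 𝔽₂ m} at))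
      where
      at : ∀ x → 𝟙 (one? (ℓ x)) * t x ≤ 𝟙 (f x ≟ g x)
      at x with ℓ x
      ... | 0ℙ = z≤n
      ... | 1ℙ = ℕ.≤-trans (ℕ.≤-reflexive (ℕ.*-identityˡ (t x))) (ℕ.≤-trans (ℕ.*-monoˡ-≤ (𝟙 (match? x)) (ℕ.m∸n≤m 1 (δ x 𝟎ᵛ))) (ℕ.≤-reflexive (ℕ.*-identityˡ _)))
    e : Vec 𝔽₂ m
    e = 1ℙ ∷ 𝟎ᵛ
    h : Vec 𝔽₂ m → Vec 𝔽₂ n
    h (i ∷ _) = i • f e
    h-add : Additive h
    h-add (i ∷ _) (j ∷ _) = •-+ i j (f e)
    choose : ∀ T → ∑ t ≡ T → Σ[ g ∈ (Vec 𝔽₂ m → Vec 𝔽₂ n) ] Additive g × N ≤ 4 * agreement f g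
    -- The only possible agreement is then at the zero vector, so N ≤ 1. The map `h` agrees with f
    -- at the first basis vector `e`, which exists because m is positive.
    choose zero eq = h , h-add , ℕ.≤-trans N≤ (ℕ.≤-trans (ℕ.≤-reflexive (cong (_+ 1) eq))
      (ℕ.≤-trans (ℕ.≤-trans (ℕ.≤-reflexive (sym (𝟙-yes refl (f e ≟ h e)))) (∑-≥ e (λ x → 𝟙 (f x ≟ h x)))) (ℕ.m≤m+n _ _)))
    choose (suc T) eq = g , g-add , (begin
      N                      ≤⟨ N≤ ⟩
      ∑ t + 1                ≤⟨ ℕ.+-monoʳ-≤ (∑ t) (ℕ.≤-trans (s≤s z≤n) (ℕ.≤-reflexive (sym eq))) ⟩
      ∑ t + ∑ t              ≤⟨ ℕ.+-mono-≤ agrees agrees ⟩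
      2 * agreement f g + 2 * agreement f g ≡⟨ ℕ.*-distribʳ-+ (agreement f g) 2 2 ⟨
      4 * agreement f g      ∎)
      where open ℕ.≤-Reasoning

module Extraction {m n : ℕ} {{_ : NonZero m}} (f : Vec 𝔽₂ m → Vec 𝔽₂ n)
  (InH : Vec 𝔽₂ m × Vec 𝔽₂ n → Set) (inH? : ∀ h → Dec (InH h)) (H-𝟘 : InH (𝟎ᵛ , 𝟎ᵛ))
  (H-closed : ∀ {x y x′ y′} → InH (x , y) → InH (x′ , y′) → InH (x +ᵛ x′ , y +ᵛ y′))
  (c : Vec 𝔽₂ m) (d : Vec 𝔽₂ n) where

  private
    module V = BooleanGroup (vec-group m)
    module W = BooleanGroup (vec-group n)

  onCoset? : ∀ x → Dec (InH (x +ᵛ c , f x +ᵛ d))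
  onCoset? x = inH? (x +ᵛ c , f x +ᵛ d)

  S |H| : ℕ
  S   = ∑ (λ x → 𝟙 (onCoset? x))
  |H| = ∑ (λ h → 𝟙 (inH? h))

  private
    vertical? : ∀ y → Dec (InH (𝟎ᵛ , y))
    vertical? y = inH? (𝟎ᵛ , y)

    |H₀| : ℕ
    |H₀| = ∑ (λ y → 𝟙 (vertical? y))

    -- Points of the graph have distinct first coordinates, so adding the vertical elements to those
    -- in the coset yields distinct elements.
    S-H₀ : S * |H₀| ≤ |H|
    S-H₀ = begin
      S * |H₀|                                                       ≡⟨ ∑-*-∑ (λ x → 𝟙 (onCoset? x)) (λ y → 𝟙 (vertical? y)) ⟨
      ∑ (λ (x , y) → 𝟙 (onCoset? x) * 𝟙 (vertical? y))               ≤⟨ ∑-mono {Vec 𝔽₂ m × Vec 𝔽₂ n} (λ (x , y) → at x y) ⟩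
      ∑ (λ (x , y) → 𝟙 (inH? (x +ᵛ c , (f x +ᵛ d) +ᵛ y)))            ≡⟨ ∑-× (λ (x , y) → 𝟙 (inH? (x +ᵛ c , (f x +ᵛ d) +ᵛ y))) ⟩
      ∑ (λ x → ∑ (λ y → 𝟙 (inH? (x +ᵛ c , (f x +ᵛ d) +ᵛ y))))        ≡⟨ ∑-cong {Vec 𝔽₂ m} (λ x → ∑-bijection ((f x +ᵛ d) +ᵛ_) ((f x +ᵛ d) +ᵛ_) (W.⊕-cancel (f x +ᵛ d)) (W.⊕-cancel (f x +ᵛ d)) (λ y → 𝟙 (inH? (x +ᵛ c , y)))) ⟩
      ∑ (λ x → ∑ (λ y → 𝟙 (inH? (x +ᵛ c , y))))                      ≡⟨ ∑-bijection (_+ᵛ c) (_+ᵛ c) involutive involutive (λ x → ∑ (λ y → 𝟙 (inH? (x , y)))) ⟩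
      ∑ (λ x → ∑ (λ y → 𝟙 (inH? (x , y))))                           ≡⟨ ∑-× (λ h → 𝟙 (inH? h)) ⟨
      |H|                                                            ∎
      where
      open ℕ.≤-Reasoning
      involutive : ∀ x → (x +ᵛ c) +ᵛ c ≡ x
      involutive x = V.xor (x ∷ c ∷ []) ((a₀ :⊕ a₁) :⊕ a₁) a₀ refl
      at : ∀ x y → 𝟙 (onCoset? x) * 𝟙 (vertical? y) ≤ 𝟙 (inH? (x +ᵛ c , (f x +ᵛ d) +ᵛ y))
      at x y = ℕ.≤-trans (ℕ.≤-reflexive (sym (𝟙-× (onCoset? x) (vertical? y) (onCoset? x ×-dec vertical? y))))
        (𝟙-mono (λ (p , q) → subst (λ u → InH (u , (f x +ᵛ d) +ᵛ y)) (trans (V.⊕-comm (x +ᵛ c) 𝟎ᵛ) (V.⊕-identity (x +ᵛ c))) (H-closed p q)) _ _)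

    linear : Σ[ φ ∈ (Vec 𝔽₂ m → Vec 𝔽₂ n) ] Additive φ × (∀ x y → InH (x , y) → InH (x , φ x))
    linear = section m n (λ x y → InH (x , y)) (λ x y → inH? (x , y)) H-𝟘 H-closed

    φ = proj₁ linear
    φ-add = proj₁ (proj₂ linear)
    φ-sec = proj₂ (proj₂ linear)

    e : Vec 𝔽₂ n
    e = φ c +ᵛ d

    offset : Vec 𝔽₂ m → Vec 𝔽₂ n
    offset x = (f x +ᵛ φ x) +ᵛ e

    -- Over x + c the subgroup contains the value coming from f and the value of φ; their sum is
    -- vertical. Hence on the coset f differs from φ by one of |H₀| constants.
    offset-vertical : ∀ x → InH (x +ᵛ c , f x +ᵛ d) → InH (𝟎ᵛ , offset x)
    offset-vertical x p = subst InH (cong₂ _,_ (V.⊕-self (x +ᵛ c)) (trans (cong ((f x +ᵛ d) +ᵛ_) (φ-add x c))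
        (W.xor (f x ∷ d ∷ φ x ∷ φ c ∷ []) ((a₀ :⊕ a₁) :⊕ (a₂ :⊕ a₃)) ((a₀ :⊕ a₂) :⊕ (a₃ :⊕ a₁)) refl)))
      (H-closed p (φ-sec (x +ᵛ c) (f x +ᵛ d) p))

    N : Vec 𝔽₂ n → ℕ
    N v = agreement f (λ x → φ x +ᵛ (e +ᵛ v))

    S≤∑N : S ≤ ∑ (λ v → 𝟙 (vertical? v) * N v)
    S≤∑N = begin
      S                                                                   ≤⟨ ∑-mono {Vec 𝔽₂ m} at ⟩
      ∑ (λ x → ∑ (λ v → 𝟙 (vertical? v) * 𝟙 (f x ≟ φ x +ᵛ (e +ᵛ v))))     ≡⟨ ∑-swap (λ x v → 𝟙 (vertical? v) * 𝟙 (f x ≟ φ x +ᵛ (e +ᵛ v))) ⟩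
      ∑ (λ v → ∑ (λ x → 𝟙 (vertical? v) * 𝟙 (f x ≟ φ x +ᵛ (e +ᵛ v))))     ≡⟨ ∑-cong {Vec 𝔽₂ n} (λ v → ∑-*ˡ {Vec 𝔽₂ m} (𝟙 (vertical? v)) (λ x → 𝟙 (f x ≟ φ x +ᵛ (e +ᵛ v)))) ⟩
      ∑ (λ v → 𝟙 (vertical? v) * N v)                                     ∎
      where
      open ℕ.≤-Reasoning
      at : ∀ x → 𝟙 (onCoset? x) ≤ ∑ (λ v → 𝟙 (vertical? v) * 𝟙 (f x ≟ φ x +ᵛ (e +ᵛ v)))
      at x = ℕ.≤-trans (ℕ.≤-trans (𝟙-mono (λ p → offset-vertical x p , W.xor (f x ∷ φ x ∷ e ∷ []) a₀ (a₁ :⊕ (a₂ :⊕ ((a₀ :⊕ a₁) :⊕ a₂))) refl)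
            (onCoset? x) (vertical? (offset x) ×-dec (f x ≟ φ x +ᵛ (e +ᵛ offset x))))
          (ℕ.≤-reflexive (𝟙-× (vertical? (offset x)) (f x ≟ φ x +ᵛ (e +ᵛ offset x)) _)))
        (∑-≥ (offset x) (λ v → 𝟙 (vertical? v) * 𝟙 (f x ≟ φ x +ᵛ (e +ᵛ v))))

    H₀≢0 : NonZero |H₀|
    H₀≢0 = NonZero-≤ (ℕ.≤-trans (ℕ.≤-reflexive (sym (𝟙-yes H-𝟘 (vertical? 𝟎ᵛ)))) (∑-≥ 𝟎ᵛ (λ y → 𝟙 (vertical? y))))

    pigeonhole : ∃[ v ] S ≤ |H₀| * N v
    pigeonhole with ∃? (λ v → S ℕ.≤? |H₀| * N v)
    ... | yes found = found
    ... | no  none  = contradiction (ℕ.*-cancelˡ-≤ |H₀| {{H₀≢0}} too-many) (ℕ.<⇒≱ (ℕ.≤-reflexive (ℕ.+-comm 1 S)))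
      where
      open ℕ.≤-Reasoning
      -- If every count fails, it fails strictly. The extra indicator records the strictness, and
      -- the sum over the vertical elements gains |H₀|.
      at : ∀ v (p : Dec (InH (𝟎ᵛ , v))) → |H₀| * (𝟙 p * N v) + 𝟙 p ≤ 𝟙 p * S
      at v (no _)  = ℕ.≤-reflexive (trans (ℕ.+-identityʳ _) (ℕ.*-zeroʳ |H₀|))
      at v (yes _) = ℕ.≤-trans (ℕ.≤-reflexive (trans (ℕ.+-comm _ 1) (cong (λ k → suc (|H₀| * k)) (ℕ.*-identityˡ (N v)))))
        (ℕ.≤-trans (ℕ.≰⇒> (λ le → none (v , le))) (ℕ.≤-reflexive (sym (ℕ.*-identityˡ S))))
      too-many : |H₀| * (S + 1) ≤ |H₀| * S
      too-many = begin
        |H₀| * (S + 1)                                                ≡⟨ trans (ℕ.*-distribˡ-+ |H₀| S 1) (cong (|H₀| * S +_) (ℕ.*-identityʳ |H₀|)) ⟩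
        |H₀| * S + |H₀|                                               ≤⟨ ℕ.+-monoˡ-≤ |H₀| (ℕ.*-monoʳ-≤ |H₀| S≤∑N) ⟩
        |H₀| * ∑ (λ v → 𝟙 (vertical? v) * N v) + |H₀|                 ≡⟨ cong (_+ |H₀|) (∑-*ˡ {Vec 𝔽₂ n} |H₀| (λ v → 𝟙 (vertical? v) * N v)) ⟨
        ∑ (λ v → |H₀| * (𝟙 (vertical? v) * N v)) + |H₀|               ≡⟨ ∑-+ {Vec 𝔽₂ n} (λ v → |H₀| * (𝟙 (vertical? v) * N v)) (λ v → 𝟙 (vertical? v)) ⟨
        ∑ (λ v → |H₀| * (𝟙 (vertical? v) * N v) + 𝟙 (vertical? v))    ≤⟨ ∑-mono {Vec 𝔽₂ n} (λ v → at v (vertical? v)) ⟩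
        ∑ (λ v → 𝟙 (vertical? v) * S)                                 ≡⟨ ∑-*ʳ {Vec 𝔽₂ n} S (λ v → 𝟙 (vertical? v)) ⟩
        |H₀| * S                                                      ∎

  -- The pigeonhole bound S ≤ |H₀| * N v loses a factor |H₀|, which multiplication by S ≤ |H| / |H₀|
  -- removes.
  homomorphism : Σ[ g ∈ (Vec 𝔽₂ m → Vec 𝔽₂ n) ] Additive g × S * S ≤ |H| * (4 * agreement f g)
  homomorphism = conclude (linearise m n f φ φ-add (e +ᵛ proj₁ pigeonhole))
    where
    v = proj₁ pigeonhole
    conclude : Σ[ g ∈ (Vec 𝔽₂ m → Vec 𝔽₂ n) ] Additive g × N v ≤ 4 * agreement f g →
               Σ[ g ∈ (Vec 𝔽₂ m → Vec 𝔽₂ n) ] Additive g × S * S ≤ |H| * (4 * agreement f g)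
    conclude (g , g-add , N≤) = g , g-add , (begin
      S * S                        ≤⟨ ℕ.*-monoʳ-≤ S (proj₂ pigeonhole) ⟩
      S * (|H₀| * N v)             ≡⟨ ℕ.*-assoc S |H₀| (N v) ⟨
      S * |H₀| * N v               ≤⟨ ℕ.*-mono-≤ S-H₀ N≤ ⟩
      |H| * (4 * agreement f g)    ∎)
      where open ℕ.≤-Reasoning

-- The inequality between counts.

opaque
  -- Opaque because `Constants` contains powers mᵐ with m = 4r(r + 1), about four million, which
  -- must never be computed.
  resolution : ℕ
  resolution = 1000

  1000≤resolution : 1000 ≤ resolution
  1000≤resolution = ℕ.≤-refl

  -- 770 = 7 · 110: the argument below loses 110 times t = 7 · (2 · log size - log pairs).
  loss : ℕ
  loss = 769

  log-^-loss : ∀ n .{{_ : NonZero n}} → log (n ^ suc loss) ≈ᵥ 770 · log n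
  log-^-loss n = log-^ n 770

instance
  resolution≢0 : NonZero resolution
  resolution≢0 = NonZero-≤ {1000} 1000≤resolution

module _ {m n : ℕ} {{m≢0 : NonZero m}} (f : Vec 𝔽₂ m → Vec 𝔽₂ n) where

  open Graph (vec-group m) (vec-group n) f
  open Constants resolution

  -- The bound that f agrees with g with probability at least 2⁻¹⁰ p⁷⁷⁰, where p is the proportion
  -- of homomorphic pairs, cleared of denominators.
  Approximation : Set
  Approximation = Σ[ g ∈ (Vec 𝔽₂ m → Vec 𝔽₂ n) ] Additive g × size * pairs ^ suc loss ≤ agreement f g * (2 ^ 10 * (size * size) ^ suc loss)

  module _ (pairs≢0 : NonZero pairs) (ξ : Dist (Vec 𝔽₂ m × Vec 𝔽₂ n))
           (below : ∀ xy → weight ξ xy ≤ 𝟙 (onGraph? pairs≢0 xy))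
           (close : SumsetEntropy.D 𝔾 ξ ξ ≤ᵥ t pairs≢0) (large : log size ≤ᵥ log (∑ (weight ξ)) +ᵥ t pairs≢0)
           (small : SumsetEntropy.H 𝔾 ξ ≤ᵥ log size) where

    open SumsetEntropy 𝔾 using (H; D; _⊛_)

    module _ (μ : Dist (Vec 𝔽₂ m × Vec 𝔽₂ n)) (near : H (μ ⊛ μ) ≤ᵥ H μ +ᵥ κ) (ξμ : D ξ μ ≤ᵥ 18 · D ξ ξ) where

      open NearSubgroup 𝔾 μ resolution κ gain gain>0 rκ≤gain gain-≤ 1000≤resolution near using (InH; inH?; H-𝟘; H-closed)
      module Q = Quotient 𝔾 μ resolution κ gain gain>0 rκ≤gain gain-≤ 1000≤resolution near ξ

      extract : Σ[ x ∈ Vec 𝔽₂ m × Vec 𝔽₂ n ] NonZero (Q.coset-mass x) × log (∑ (weight ξ)) ≤ᵥ log (Q.coset-mass x) +ᵥ 2 · (D ξ μ +ᵥ log 2) → Approximation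
      extract ((c , d) , mass≢0 , heavy) = finish E.homomorphism
        where
        module E = Extraction f InH inH? H-𝟘 H-closed c d
        mass≤S : Q.coset-mass (c , d) ≤ E.S
        mass≤S = begin
          Q.coset-mass (c , d)                                           ≤⟨ ∑-mono {Vec 𝔽₂ m × Vec 𝔽₂ n} (λ (x , y) → ℕ.*-monoʳ-≤ (𝟙 (inH? (x +ᵛ c , y +ᵛ d))) (below (x , y))) ⟩
          ∑ (λ (x , y) → 𝟙 (inH? (x +ᵛ c , y +ᵛ d)) * δ y (f x))         ≡⟨ ∑-× (λ (x , y) → 𝟙 (inH? (x +ᵛ c , y +ᵛ d)) * δ y (f x)) ⟩
          ∑ (λ x → ∑ (λ y → 𝟙 (inH? (x +ᵛ c , y +ᵛ d)) * δ y (f x)))     ≡⟨ ∑-cong {Vec 𝔽₂ m} (λ x → trans (∑-cong {Vec 𝔽₂ n} (λ y → ℕ.*-comm (𝟙 (inH? (x +ᵛ c , y +ᵛ d))) (δ y (f x))))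
                                                                              (∑-δ (f x) (λ y → 𝟙 (inH? (x +ᵛ c , y +ᵛ d))))) ⟩
          E.S                                                            ∎
          where open ℕ.≤-Reasoning
        instance
          S≢0 : NonZero E.S
          S≢0 = NonZero-≤ {{mass≢0}} mass≤S
          SS≢0 : NonZero (E.S * E.S)
          SS≢0 = ℕ.m*n≢0 E.S E.S
          size≢0 : NonZero size
          size≢0 = NonZero-≤ (∑-≥ (𝟎ᵛ {m}) (λ _ → 1))
          pairs^≢0 : NonZero (pairs ^ suc loss)
          pairs^≢0 = ℕ.m^n≢0 pairs (suc loss) {{pairs≢0}}
          size²≢0 : NonZero (size * size)
          size²≢0 = ℕ.m*n≢0 size size
          size^≢0 : NonZero ((size * size) ^ suc loss)
          size^≢0 = ℕ.m^n≢0 (size * size) (suc loss)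
          rest≢0 : NonZero (2 ^ 10 * (size * size) ^ suc loss)
          rest≢0 = ℕ.m*n≢0 (2 ^ 10) ((size * size) ^ suc loss)
        finish : Σ[ g ∈ (Vec 𝔽₂ m → Vec 𝔽₂ n) ] Additive g × E.S * E.S ≤ E.|H| * (4 * agreement f g) → Approximation
        -- In S² ≤ |H| · 4 · agreement, the two factors S and the size of the subgroup lose
        -- `D ξ μ +ᵥ log 2` twice each, six times in all; that is 6 log 2 and 6 · 18 = 108 times t.
        -- The mass of ξ loses t twice more, and three factors of 4 or less precise bounds are only
        -- two: 4 from `count` and 4 from `subgroup-size`. The total is 110 t and 10 log 2.
        finish (g , g-add , count) = g , g-add , log-cancel-≤ {{ℕ.m*n≢0 (agreement f g) (2 ^ 10 * (size * size) ^ suc loss) {{agreement≢0}}}} (by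
            ( log size ∷ log pairs ∷ log (∑ (weight ξ)) ∷ log (Q.coset-mass (c , d)) ∷ log E.S ∷ log E.|H| ∷ log (agreement f g) ∷ log 2 ∷ log 4
            ∷ D ξ ξ ∷ D ξ μ ∷ H ξ ∷ log (E.S * E.S) ∷ log (E.|H| * (4 * agreement f g))
            ∷ log (size * pairs ^ suc loss) ∷ log (agreement f g * (2 ^ 10 * (size * size) ^ suc loss)) ∷ log (size * size) ∷ [])
            (v₁₄ ⊑ v₁₅)
            ((1 , v₁₄ ⊑ v₀ :+ 770 :· v₁) ∷ (1 , v₆ :+ (10 :· v₇ :+ 770 :· v₁₆) ⊑ v₁₅) ∷ (770 , v₀ :+ v₀ ⊑ v₁₆) ∷
             (2 , v₀ ⊑ v₂ :+ tₑ) ∷ (2 , v₂ ⊑ v₃ :+ 2 :· (v₁₀ :+ v₇)) ∷ (2 , v₃ ⊑ v₄) ∷ (1 , v₄ :+ v₄ ⊑ v₁₂) ∷ (1 , v₁₂ ⊑ v₁₃) ∷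
             (1 , v₁₃ ⊑ v₅ :+ (v₈ :+ v₆)) ∷ (1 , v₅ ⊑ v₁₁ :+ 2 :· (v₁₀ :+ v₇) :+ v₈) ∷ (2 , v₈ ⊑ v₇ :+ v₇) ∷ (1 , v₁₁ ⊑ v₀) ∷
             (6 , v₁₀ ⊑ 18 :· v₉) ∷ (108 , v₉ ⊑ tₑ) ∷ []) refl
            ( proj₁ (≈ᵥ-trans (log-* size (pairs ^ suc loss)) (+ᵥ-cong ≈ᵥ-refl (log-^-loss pairs {{pairs≢0}})))
            ∷ proj₂ (≈ᵥ-trans (log-* (agreement f g) (2 ^ 10 * (size * size) ^ suc loss) {{agreement≢0}}) (+ᵥ-cong ≈ᵥ-refl
                (≈ᵥ-trans (log-* (2 ^ 10) ((size * size) ^ suc loss)) (+ᵥ-cong (log-^ 2 10) (log-^-loss (size * size))))))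
            ∷ proj₂ (log-* size size) ∷ large ∷ heavy ∷ log-mono {{mass≢0}} mass≤S ∷ proj₂ (log-* E.S E.S) ∷ log-mono count
            ∷ proj₁ (≈ᵥ-trans (log-* E.|H| (4 * agreement f g) {{H≢0}} {{4a≢0}}) (+ᵥ-cong ≈ᵥ-refl (log-* 4 (agreement f g) {{_}} {{agreement≢0}})))
            ∷ Q.subgroup-size ∷ proj₁ (log-* 2 2) ∷ small ∷ ξμ ∷ close ∷ []))
          where
          tₑ : Linear.Expr 17
          tₑ = 7 :· (2 :· v₀ :- v₁)
          product≢0 : NonZero (E.|H| * (4 * agreement f g))
          product≢0 = NonZero-≤ count
          H≢0 : NonZero E.|H|
          H≢0 = ℕ.m*n≢0⇒m≢0 E.|H| {{product≢0}}
          4a≢0 : NonZero (4 * agreement f g)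
          4a≢0 = ℕ.m*n≢0⇒n≢0 E.|H| {{product≢0}}
          agreement≢0 : NonZero (agreement f g)
          agreement≢0 = ℕ.m*n≢0⇒n≢0 4 {{4a≢0}}

      approximation-from : Approximation
      approximation-from = extract Q.heavy-coset

    near-approximation : Σ[ μ ∈ Dist (Vec 𝔽₂ m × Vec 𝔽₂ n) ] H (μ ⊛ μ) ≤ᵥ H μ +ᵥ κ × D ξ μ ≤ᵥ 18 · D ξ ξ → Approximation
    near-approximation (μ , near , ξμ) = approximation-from μ near ξμ

    conditioned-approximation : Approximation
    conditioned-approximation = near-approximation (Descent.near-idempotent 𝔾 ξ κ κ≥0 steps log2≤)

  homomorphic-approximation : NonZero pairs → Approximation
  homomorphic-approximation pairs≢0 = conclude (graph-part pairs≢0)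
    where
    conclude : Σ[ ξ ∈ Dist (Vec 𝔽₂ m × Vec 𝔽₂ n) ] (∀ xy → weight ξ xy ≤ 𝟙 (onGraph? pairs≢0 xy)) × SumsetEntropy.D 𝔾 ξ ξ ≤ᵥ t pairs≢0 ×
                 log size ≤ᵥ log (∑ (weight ξ)) +ᵥ t pairs≢0 × SumsetEntropy.H 𝔾 ξ ≤ᵥ log size → Approximation
    conclude (ξ , below , close , large , small) = conditioned-approximation pairs≢0 ξ below close large small

-- Rational bounds for real powers

length-filter-∑ : ∀ {A : Set} {P : A → Set} (P? : ∀ a → Dec (P a)) xs →
                length (filter P? xs) ≡ FiniteSum.sumL ℕ.+-0-commutativeMonoid xs (λ a → 𝟙 (P? a))
length-filter-∑ P? []       = refl
length-filter-∑ P? (x ∷ xs) with P? x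
... | yes _ = cong suc (length-filter-∑ P? xs)
... | no  _ = length-filter-∑ P? xs

length-∑ : ∀ {A : Set} (xs : List A) → length xs ≡ FiniteSum.sumL ℕ.+-0-commutativeMonoid xs (λ _ → 1)
length-∑ []       = refl
length-∑ (x ∷ xs) = cong suc (length-∑ xs)

ι : ℕ → ℚ
ι n = ℚ.mkℚ (ℤ.+ n) 0 (Coprime.sym (Coprime.1-coprimeTo n))

ι-* : ∀ m n → ι (m * n) ≡ ι m ℚ.* ι n
ι-* m n = sym (trans (cong (λ i → i ℚ./ 1) (sym (ℤ.pos-* m n))) (ℚ.normalize-coprime (Coprime.sym (Coprime.1-coprimeTo (m * n)))))

ι-mono : ∀ {m n} → m ≤ n → ι m ℚ.≤ ι n
ι-mono m≤n = ℚ.*≤* (ℤ.*-monoʳ-≤-nonNeg (ℤ.+ 1) (ℤ.+≤+ m≤n))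

ι-pos : ∀ n .{{_ : NonZero n}} → ℚ.Positive (ι n)
ι-pos (suc n) = _

ι-^ : ∀ n k → ι (n ^ k) ≡ ι n ^ℚ k
ι-^ n zero    = refl
ι-^ n (suc k) = trans (ι-* n (n ^ k)) (cong (ι n ℚ.*_) (ι-^ n k))

/-* : ∀ k n .{{_ : NonZero n}} → (ℤ.+ k ℚ./ n) ℚ.* ι n ≡ ι k
/-* k n@(suc d) = ℚ.toℚᵘ-injective (ℚᵘ.≃-trans (ℚ.toℚᵘ-homo-* (ℤ.+ k ℚ./ n) (ι n))
  (ℚᵘ.≃-trans (ℚᵘ.*-congʳ {ℚ.toℚᵘ (ι n)} (ℚ.toℚᵘ-fromℚᵘ (ℚᵘ.mkℚᵘ (ℤ.+ k) d))) (ℚᵘ.*≡* eq)))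
  where
  eq : (ℤ.+ k ℤ.* ℤ.+ n) ℤ.* ℤ.+ 1 ≡ ℤ.+ k ℤ.* ℤ.+ (n * 1)
  eq = trans (ℤ.*-identityʳ _) (cong (λ j → ℤ.+ k ℤ.* ℤ.+ j) (sym (ℕ.*-identityʳ n)))

*ℚ-pos : ∀ {p q} → 0ℚ ℚ.< p → 0ℚ ℚ.< q → 0ℚ ℚ.< p ℚ.* q
*ℚ-pos {p} {q} 0<p 0<q = ℚ.positive⁻¹ (p ℚ.* q) {{ℚ.pos*pos⇒pos p {{ℚ.positive 0<p}} q {{ℚ.positive 0<q}}}}

*ℚ-mono : ∀ {p q r s} → 0ℚ ℚ.≤ r → 0ℚ ℚ.≤ q → p ℚ.≤ q → r ℚ.≤ s → p ℚ.* r ℚ.≤ q ℚ.* s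
*ℚ-mono {p} {q} {r} {s} 0≤r 0≤q p≤q r≤s = ℚ.≤-trans (ℚ.*-monoʳ-≤-nonNeg r {{ℚ.nonNegative 0≤r}} p≤q) (ℚ.*-monoˡ-≤-nonNeg q {{ℚ.nonNegative 0≤q}} r≤s)

^ℚ-pos : ∀ {p} n → 0ℚ ℚ.< p → 0ℚ ℚ.< p ^ℚ n
^ℚ-pos zero    0<p = ℚ.positive⁻¹ 1ℚ
^ℚ-pos (suc n) 0<p = *ℚ-pos 0<p (^ℚ-pos n 0<p)

^ℚ-mono : ∀ {p q} n → 0ℚ ℚ.< p → p ℚ.≤ q → p ^ℚ n ℚ.≤ q ^ℚ n
^ℚ-mono zero    0<p p≤q = ℚ.≤-refl
^ℚ-mono (suc n) 0<p p≤q = *ℚ-mono (ℚ.<⇒≤ (^ℚ-pos n 0<p)) (ℚ.≤-trans (ℚ.<⇒≤ 0<p) p≤q) p≤q (^ℚ-mono n 0<p p≤q)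

1^ℚ : ∀ n → 1ℚ ^ℚ n ≡ 1ℚ
1^ℚ zero    = refl
1^ℚ (suc n) = trans (ℚ.*-identityˡ (1ℚ ^ℚ n)) (1^ℚ n)

^ℚ-distrib-* : ∀ p q n → (p ℚ.* q) ^ℚ n ≡ p ^ℚ n ℚ.* q ^ℚ n
^ℚ-distrib-* p q zero    = refl
^ℚ-distrib-* p q (suc n) = trans (cong ((p ℚ.* q) ℚ.*_) (^ℚ-distrib-* p q n)) (interchange p q (p ^ℚ n) (q ^ℚ n))
  where
  open import Algebra.Properties.CommutativeSemigroup (CommutativeMonoid.commutativeSemigroup ℚ.*-1-commutativeMonoid) using (interchange)

reciprocal : ∀ x → 0ℚ ℚ.< x → Σ[ y ∈ ℚ ] 0ℚ ℚ.< y × y ℚ.* x ≡ 1ℚ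
reciprocal x 0<x = ℚ.1/ x , ℚ.positive⁻¹ (ℚ.1/ x) {{ℚ.1/pos⇒pos x}} , ℚ.*-inverseˡ x
  where
  instance
    x⁺ = ℚ.positive 0<x
    x≢0 = ℚ.pos⇒nonZero x

-- Continuity of powers from below without roots: r / x lies below a power of some s < x, and then
-- any s′ < x above both s and r / sⁿ⁺¹ will do.
^ℚ-continuous : ∀ n {x r} → 0ℚ ℚ.< x → 0ℚ ℚ.< r → r ℚ.< x ^ℚ suc n → Σ[ s ∈ ℚ ] 0ℚ ℚ.< s × s ℚ.< x × r ℚ.< s ^ℚ suc n
^ℚ-continuous zero {x} {r} 0<x 0<r r<x with ℚ.<-dense (subst (r ℚ.<_) (ℚ.*-identityʳ x) r<x)
... | s , r<s , s<x = s , ℚ.<-trans 0<r r<s , s<x , subst (r ℚ.<_) (sym (ℚ.*-identityʳ s)) r<s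
^ℚ-continuous (suc n) {x} {r} 0<x 0<r r<xy = first (reciprocal x 0<x)
  where
  y : ℚ
  y = x ^ℚ suc n
  Goal : Set
  Goal = Σ[ s ∈ ℚ ] 0ℚ ℚ.< s × s ℚ.< x × r ℚ.< s ^ℚ suc (suc n)
  cancel : ∀ {i j} a b → a ℚ.* b ≡ 1ℚ → 0ℚ ℚ.< a → i ℚ.< b ℚ.* j → i ℚ.* a ℚ.< j
  cancel {i} {j} a b ab≡1 0<a lt = subst (i ℚ.* a ℚ.<_) (trans (ℚ.*-comm (b ℚ.* j) a) (trans (sym (ℚ.*-assoc a b j)) (trans (cong (ℚ._* j) ab≡1) (ℚ.*-identityˡ j))))
    (ℚ.*-monoˡ-<-pos a {{ℚ.positive 0<a}} lt)
  expand : ∀ i a b → a ℚ.* b ≡ 1ℚ → (i ℚ.* a) ℚ.* b ≡ i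
  expand i a b ab≡1 = trans (ℚ.*-assoc i a b) (trans (cong (i ℚ.*_) ab≡1) (ℚ.*-identityʳ i))
  second : ∀ {s x⁻¹} → x⁻¹ ℚ.* x ≡ 1ℚ → 0ℚ ℚ.< s → s ℚ.< x → r ℚ.* x⁻¹ ℚ.< s ^ℚ suc n → Σ[ z⁻¹ ∈ ℚ ] 0ℚ ℚ.< z⁻¹ × z⁻¹ ℚ.* s ^ℚ suc n ≡ 1ℚ → Goal
  second {s} {x⁻¹} eq 0<s s<x lt (z⁻¹ , 0<z⁻¹ , z-eq) = s′ , ℚ.<-trans 0<s s<s′ , s′<x
    , ℚ.<-≤-trans (subst (ℚ._< s′ ℚ.* z) (expand r z⁻¹ z z-eq) (ℚ.*-monoˡ-<-pos z {{ℚ.positive (^ℚ-pos (suc n) 0<s)}} r/z<s′))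
        (ℚ.*-monoˡ-≤-nonNeg s′ {{ℚ.nonNegative (ℚ.<⇒≤ (ℚ.<-trans 0<s s<s′))}} (^ℚ-mono (suc n) 0<s (ℚ.<⇒≤ s<s′)))
    where
    z : ℚ
    z = s ^ℚ suc n
    r/z<x : r ℚ.* z⁻¹ ℚ.< x
    r/z<x = cancel z⁻¹ z z-eq 0<z⁻¹ (subst (ℚ._< z ℚ.* x) (expand r x⁻¹ x eq) (ℚ.*-monoˡ-<-pos x {{ℚ.positive 0<x}} lt))
    between : Σ[ s′ ∈ ℚ ] (r ℚ.* z⁻¹) ℚ.⊔ s ℚ.< s′ × s′ ℚ.< x
    between = ℚ.<-dense (⊎.[_,_]′ (λ eq → subst (ℚ._< x) (sym eq) r/z<x) (λ eq → subst (ℚ._< x) (sym eq) s<x) (ℚ.⊔-sel (r ℚ.* z⁻¹) s))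
    s′ = proj₁ between
    s′<x = proj₂ (proj₂ between)
    s<s′ : s ℚ.< s′
    s<s′ = ℚ.≤-<-trans (ℚ.p≤q⊔p (r ℚ.* z⁻¹) s) (proj₁ (proj₂ between))
    r/z<s′ : r ℚ.* z⁻¹ ℚ.< s′
    r/z<s′ = ℚ.≤-<-trans (ℚ.p≤p⊔q (r ℚ.* z⁻¹) s) (proj₁ (proj₂ between))
  first : Σ[ x⁻¹ ∈ ℚ ] 0ℚ ℚ.< x⁻¹ × x⁻¹ ℚ.* x ≡ 1ℚ → Goal
  first (x⁻¹ , 0<x⁻¹ , eq) = go (^ℚ-continuous n 0<x (*ℚ-pos 0<r 0<x⁻¹) (cancel x⁻¹ x eq 0<x⁻¹ r<xy))
    where
    go : Σ[ s ∈ ℚ ] 0ℚ ℚ.< s × s ℚ.< x × r ℚ.* x⁻¹ ℚ.< s ^ℚ suc n → Goal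
    go (s , 0<s , s<x , lt) = second eq 0<s s<x lt (reciprocal (s ^ℚ suc n) (^ℚ-pos (suc n) 0<s))

open ℝ⁺

rational : (q : ℚ) → 0ℚ ℚ.< q → ℝ⁺
lower    (rational q 0<q) p = 0ℚ ℚ.< p × p ℚ.< q
positive (rational q 0<q) = proj₁
nonempty (rational q 0<q) = proj₁ (ℚ.<-dense 0<q) , proj₂ (ℚ.<-dense 0<q)
bounded  (rational q 0<q) = q , 0<q , λ (_ , q<q) → ℚ.<-irrefl refl q<q
downward (rational q 0<q) 0<p p≤r (_ , r<q) = 0<p , ℚ.≤-<-trans p≤r r<q
open-top (rational q 0<q) {p} (0<p , p<q) =
  proj₁ (ℚ.<-dense p<q) , proj₁ (proj₂ (ℚ.<-dense p<q)) , ℚ.<-trans 0<p (proj₁ (proj₂ (ℚ.<-dense p<q))) , proj₂ (proj₂ (ℚ.<-dense p<q))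

module _ (e : ℕ) where

  exponent : ℝ⁺
  exponent = rational (ι (suc (suc e))) (ℚ.positive⁻¹ (ι (suc (suc e))))

  -- On bases s ≥ 1 the cut of K ^ y has only the exponents strictly below y, hence y = e + 2 in order to reach s ^ (e + 1).
  power-bound : ∀ K {δ δ⁻¹} → 0ℚ ℚ.< δ → δ ℚ.≤ 1ℚ → 0ℚ ℚ.< δ⁻¹ → δ⁻¹ ℚ.* δ ≡ 1ℚ → 1/ʳ K ≤ʳ δ →
                ∀ r → 0ℚ ℚ.< r → ¬ lower (K ^ʳ exponent) r → δ⁻¹ ^ℚ suc e ℚ.≤ r
  power-bound K {δ} {δ⁻¹} 0<δ δ≤1 0<δ⁻¹ inverse K⁻¹≤δ r 0<r r∉ = ℚ.≮⇒≥ (λ r<power → outside r<power)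
    where
    -- Only a double negation, as K is not assumed to be located: if s were outside the cut, a
    -- rational between δ and 1 / s would lie below 1 / K. This is enough, because the claim is the
    -- negation of a strict inequality.
    below-δ⁻¹ : ∀ s → 0ℚ ℚ.< s → s ℚ.* δ ℚ.< 1ℚ → ¬ ¬ lower K s
    below-δ⁻¹ s 0<s sδ<1 s∉K = from (reciprocal s 0<s)
      where
      from : Σ[ y ∈ ℚ ] 0ℚ ℚ.< y × y ℚ.* s ≡ 1ℚ → ⊥
      from (y , 0<y , ys≡1) = squeeze (ℚ.<-dense δ<y)
        where
        δ<y : δ ℚ.< y
        δ<y = subst₂ ℚ._<_ (trans (sym (ℚ.*-assoc y s δ)) (trans (cong (ℚ._* δ) ys≡1) (ℚ.*-identityˡ δ))) (ℚ.*-identityʳ y)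
          (ℚ.*-monoʳ-<-pos y {{ℚ.positive 0<y}} sδ<1)
        squeeze : (∃[ p ] δ ℚ.< p × p ℚ.< y) → ⊥
        squeeze (p , δ<p , p<y) = ℚ.<-asym δ<p (K⁻¹≤δ (ℚ.<-trans 0<δ δ<p , y , s , p<y , 0<s , s∉K , ℚ.≤-reflexive ys≡1))
    outside : ¬ r ℚ.< δ⁻¹ ^ℚ suc e
    outside r<power with r ℚ.<? 1ℚ
    -- For bases below 1 the exponent e + 2 itself is admissible, and such bases lie below K because
    -- δ ≤ 1.
    ... | yes r<1 = small (^ℚ-continuous (suc e) (ℚ.positive⁻¹ 1ℚ) 0<r (subst (r ℚ.<_) (sym (1^ℚ (suc (suc e)))) r<1))
      where
      small : Σ[ s ∈ ℚ ] 0ℚ ℚ.< s × s ℚ.< 1ℚ × r ℚ.< s ^ℚ suc (suc e) → ⊥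
      small (s , 0<s , s<1 , r<s) = below-δ⁻¹ s 0<s
        (ℚ.≤-<-trans (ℚ.≤-trans (ℚ.*-monoˡ-≤-nonNeg s {{ℚ.nonNegative (ℚ.<⇒≤ 0<s)}} δ≤1) (ℚ.≤-reflexive (ℚ.*-identityʳ s))) s<1)
        (λ s∈K → r∉ (0<r , s ^ℚ suc (suc e) , s , ι (suc (suc e)) , r<s , s∈K , ℚ.positive⁻¹ (ι (suc (suc e))) ,
          inj₂ (ℚ.<⇒≤ s<1 , λ (_ , lt) → ℚ.<-irrefl refl lt) , ℚ.≤-reflexive (ℚ.*-identityʳ (s ^ℚ suc (suc e)))))
    ... | no r≮1 = large (^ℚ-continuous e 0<δ⁻¹ 0<r r<power)
      where
      large : Σ[ s ∈ ℚ ] 0ℚ ℚ.< s × s ℚ.< δ⁻¹ × r ℚ.< s ^ℚ suc e → ⊥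
      large (s , 0<s , s<δ⁻¹ , r<s) = below-δ⁻¹ s 0<s (subst (s ℚ.* δ ℚ.<_) inverse (ℚ.*-monoˡ-<-pos δ {{ℚ.positive 0<δ}} s<δ⁻¹))
        (λ s∈K → r∉ (0<r , s ^ℚ suc e , s , ι (suc e) , r<s , s∈K , ℚ.positive⁻¹ (ι (suc e)) ,
          inj₁ (1≤s , ℚ.positive⁻¹ (ι (suc e)) , ℚ.*<* (ℤ.*-monoʳ-<-pos (ℤ.+ 1) (ℤ.+<+ (ℕ.n<1+n (suc e))))) ,
          ℚ.≤-reflexive (ℚ.*-identityʳ (s ^ℚ suc e))))
        where
        1≤s : 1ℚ ℚ.≤ s
        1≤s = ℚ.≮⇒≥ (λ s<1 → r≮1 (ℚ.<-≤-trans r<s (subst (s ^ℚ suc e ℚ.≤_) (1^ℚ (suc e)) (^ℚ-mono (suc e) 0<s (ℚ.<⇒≤ s<1)))))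

module _ (e : ℕ) {c : ℚ} (0<c : 0ℚ ℚ.< c) where

  constant-times-power-≤ : ∀ K {δ α} → 0ℚ ℚ.< δ → δ ℚ.≤ 1ℚ → 1/ʳ K ≤ʳ δ → c ℚ.* δ ^ℚ suc e ℚ.≤ α →
                           rational c 0<c *ʳ 1/ʳ (K ^ʳ exponent e) ≤ʳ α
  constant-times-power-≤ K {δ} {α} 0<δ δ≤1 K⁻¹≤δ cδ≤α {p} (_ , s , t , (0<s , s<c) , (0<t , q , r , t<q , 0<r , r∉ , qr≤1) , p≤st) =
    from (reciprocal δ 0<δ)
    where
    d : ℚ
    d = δ ^ℚ suc e
    0<d : 0ℚ ℚ.< d
    0<d = ^ℚ-pos (suc e) 0<δ
    from : Σ[ δ⁻¹ ∈ ℚ ] 0ℚ ℚ.< δ⁻¹ × δ⁻¹ ℚ.* δ ≡ 1ℚ → p ℚ.< α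
    from (δ⁻¹ , 0<δ⁻¹ , inverse) = begin-strict
      p        ≤⟨ p≤st ⟩
      s ℚ.* t  <⟨ ℚ.*-monoˡ-<-pos t {{ℚ.positive 0<t}} s<c ⟩
      c ℚ.* t  ≤⟨ ℚ.*-monoˡ-≤-nonNeg c {{ℚ.nonNegative (ℚ.<⇒≤ 0<c)}} (ℚ.≤-trans (ℚ.<⇒≤ t<q) q≤d) ⟩
      c ℚ.* d  ≤⟨ cδ≤α ⟩
      α        ∎
      where
      open ℚ.≤-Reasoning
      d⁻¹ : ℚ
      d⁻¹ = δ⁻¹ ^ℚ suc e
      d⁻¹*d : d⁻¹ ℚ.* d ≡ 1ℚ
      d⁻¹*d = trans (sym (^ℚ-distrib-* δ⁻¹ δ (suc e))) (trans (cong (_^ℚ suc e) inverse) (1^ℚ (suc e)))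
      q≤d : q ℚ.≤ d
      q≤d = begin
        q                  ≡⟨ ℚ.*-identityʳ q ⟨
        q ℚ.* 1ℚ           ≡⟨ cong (q ℚ.*_) d⁻¹*d ⟨
        q ℚ.* (d⁻¹ ℚ.* d)  ≡⟨ ℚ.*-assoc q d⁻¹ d ⟨
        q ℚ.* d⁻¹ ℚ.* d    ≤⟨ ℚ.*-monoʳ-≤-nonNeg d {{ℚ.nonNegative (ℚ.<⇒≤ 0<d)}}
                                (ℚ.*-monoˡ-≤-nonNeg q {{ℚ.nonNegative (ℚ.<⇒≤ (ℚ.<-trans 0<t t<q))}}
                                  (power-bound e K 0<δ δ≤1 0<δ⁻¹ inverse K⁻¹≤δ r 0<r r∉)) ⟩
        q ℚ.* r ℚ.* d      ≤⟨ ℚ.*-monoʳ-≤-nonNeg d {{ℚ.nonNegative (ℚ.<⇒≤ 0<d)}} qr≤1 ⟩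
        1ℚ ℚ.* d           ≡⟨ ℚ.*-identityˡ d ⟩
        d                  ∎

fraction-≤-1 : ∀ {P M} .{{_ : NonZero M}} → P ≤ M → (ℤ.+ P) ℚ./ M ℚ.≤ 1ℚ
fraction-≤-1 {P} {M} P≤M = ℚ.*-cancelʳ-≤-pos (ι M) {{ι-pos M}} (subst₂ ℚ._≤_ (sym (/-* P M)) (sym (ℚ.*-identityˡ (ι M))) (ι-mono P≤M))

-- The cut of 1 / K contains a positive rational, so the probability is positive and some pair is
-- homomorphic.
numerator≢0 : ∀ K {P M} .{{_ : NonZero M}} → 1/ʳ K ≤ʳ (ℤ.+ P) ℚ./ M → NonZero P
numerator≢0 K {suc P} K⁻¹≤δ = _
numerator≢0 K {zero} {M} K⁻¹≤δ = contradiction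
  (ℚ.<-trans (positive (1/ʳ K) (proj₂ (nonempty (1/ʳ K)))) (K⁻¹≤δ (proj₂ (nonempty (1/ʳ K)))))
  (ℚ.<-irrefl (sym (ℚ.0/n≡0 M)))

fraction-power-≤ : ∀ k {a P M A N c} .{{_ : NonZero a}} .{{_ : NonZero M}} .{{_ : NonZero N}} → c ℚ.* ι a ≡ 1ℚ →
                   N * P ^ k ≤ A * (a * M ^ k) → c ℚ.* ((ℤ.+ P) ℚ./ M) ^ℚ k ℚ.≤ (ℤ.+ A) ℚ./ N
fraction-power-≤ k {a} {P} {M} {A} {N} {c} inverse bound = ℚ.*-cancelʳ-≤-pos u {{ℚ.positive 0<u}} (begin
  (c ℚ.* x ^ℚ k) ℚ.* u                                     ≡⟨ ℚ.*-assoc (c ℚ.* x ^ℚ k) (ι a ℚ.* ι M ^ℚ k) (ι N) ⟨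
  (c ℚ.* x ^ℚ k) ℚ.* (ι a ℚ.* ι M ^ℚ k) ℚ.* ι N            ≡⟨ cong (ℚ._* ι N) (interchange c (x ^ℚ k) (ι a) (ι M ^ℚ k)) ⟩
  (c ℚ.* ι a) ℚ.* (x ^ℚ k ℚ.* ι M ^ℚ k) ℚ.* ι N            ≡⟨ cong₂ (λ y z → y ℚ.* z ℚ.* ι N) inverse (sym (^ℚ-distrib-* x (ι M) k)) ⟩
  1ℚ ℚ.* (x ℚ.* ι M) ^ℚ k ℚ.* ι N                          ≡⟨ cong (ℚ._* ι N) (ℚ.*-identityˡ ((x ℚ.* ι M) ^ℚ k)) ⟩
  (x ℚ.* ι M) ^ℚ k ℚ.* ι N                                 ≡⟨ cong (λ y → y ^ℚ k ℚ.* ι N) (/-* P M) ⟩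
  ι P ^ℚ k ℚ.* ι N                                         ≡⟨ cong (ℚ._* ι N) (ι-^ P k) ⟨
  ι (P ^ k) ℚ.* ι N                                        ≡⟨ ℚ.*-comm (ι (P ^ k)) (ι N) ⟩
  ι N ℚ.* ι (P ^ k)                                        ≡⟨ ι-* N (P ^ k) ⟨
  ι (N * P ^ k)                                            ≤⟨ ι-mono bound ⟩
  ι (A * (a * M ^ k))                                      ≡⟨ ι-* A (a * M ^ k) ⟩
  ι A ℚ.* ι (a * M ^ k)                                    ≡⟨ cong₂ ℚ._*_ (sym (/-* A N)) (trans (ι-* a (M ^ k)) (cong (ι a ℚ.*_) (ι-^ M k))) ⟩
  (y ℚ.* ι N) ℚ.* (ι a ℚ.* ι M ^ℚ k)                       ≡⟨ ℚ.*-assoc y (ι N) (ι a ℚ.* ι M ^ℚ k) ⟩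
  y ℚ.* (ι N ℚ.* (ι a ℚ.* ι M ^ℚ k))                       ≡⟨ cong (y ℚ.*_) (ℚ.*-comm (ι N) (ι a ℚ.* ι M ^ℚ k)) ⟩
  y ℚ.* u                                                  ∎)
  where
  open ℚ.≤-Reasoning
  open import Algebra.Properties.CommutativeSemigroup (CommutativeMonoid.commutativeSemigroup ℚ.*-1-commutativeMonoid) using (interchange)
  x y u : ℚ
  x = (ℤ.+ P) ℚ./ M
  y = (ℤ.+ A) ℚ./ N
  u = ι a ℚ.* ι M ^ℚ k ℚ.* ι N
  0<ι : ∀ n .{{_ : NonZero n}} → 0ℚ ℚ.< ι n
  0<ι n = ℚ.positive⁻¹ (ι n) {{ι-pos n}}
  0<u : 0ℚ ℚ.< u
  0<u = *ℚ-pos (*ℚ-pos (0<ι a) (^ℚ-pos k (0<ι M))) (0<ι N)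

-- From counts to probabilities, and the theorem.

module _ {m n : ℕ} {{_ : NonZero m}} (f : Vec 𝔽₂ m → Vec 𝔽₂ n) where

  open Graph (vec-group m) (vec-group n) f using (size; pairs; homomorphic?)

  private
    X  = vectors m
    XX = vectors m ⊗ vectors m
    P M N : ℕ
    P = length (filter homomorphic? (SampleSpace.elements XX))
    M = SampleSpace.size XX
    N = SampleSpace.size X
    agreeing : (Vec 𝔽₂ m → Vec 𝔽₂ n) → ℕ
    agreeing g = length (filter (λ x → f x ≟ᵛ g x) (SampleSpace.elements X))

  count-homomorphic : P ≡ pairs
  count-homomorphic = length-filter-∑ homomorphic? (SampleSpace.elements XX)

  count-vectors : N ≡ size
  count-vectors = length-∑ (SampleSpace.elements X)

  count-pairs : M ≡ size * size
  count-pairs = trans (length-∑ (SampleSpace.elements XX)) (∑-*-∑ {Vec 𝔽₂ m} {Vec 𝔽₂ m} (λ _ → 1) (λ _ → 1))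

  homomorphic-approximation-counts : NonZero P → Σ[ g ∈ (Vec 𝔽₂ m → Vec 𝔽₂ n) ] Additive g × N * P ^ suc loss ≤ agreeing g * (2 ^ 10 * M ^ suc loss)
  homomorphic-approximation-counts P≢0 = from (homomorphic-approximation f (subst NonZero count-homomorphic P≢0))
    where
    from : Approximation f → Σ[ g ∈ (Vec 𝔽₂ m → Vec 𝔽₂ n) ] Additive g × N * P ^ suc loss ≤ agreeing g * (2 ^ 10 * M ^ suc loss)
    from (g , add , bound) = g , add , subst₂ _≤_
      (sym (cong₂ (λ x y → x * y ^ suc loss) count-vectors count-homomorphic))
      (sym (cong₂ (λ x y → x * (2 ^ 10 * y ^ suc loss)) (length-filter-∑ (λ x → f x ≟ᵛ g x) (SampleSpace.elements X)) count-pairs))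
      bound

corollary1p5 :
    Σ[ C₄ ∈ ℝ⁺ ] Σ[ c ∈ ℝ⁺ ]
      (∀ (m n : ℕ) .{{_ : NonZero m}} .{{_ : NonZero n}}
         (K : ℝ⁺) (f : Vec 𝔽₂ m → Vec 𝔽₂ n) →
       1/ʳ K ≤ʳ ℙ[ vectors m ⊗ vectors m ] (λ (x , y) → f (x +ᵛ y) ≟ᵛ f x +ᵛ f y) →
       ∃[ g ]
         IsGroupHomomorphism (AbelianGroup.rawGroup (𝔽₂^ m)) (AbelianGroup.rawGroup (𝔽₂^ n)) g
         × c *ʳ 1/ʳ (K ^ʳ C₄) ≤ʳ ℙ[ vectors m ] (λ x → f x ≟ᵛ g x))
corollary1p5 = exponent loss , rational c 0<c , approximate
  where
  1/2¹⁰ : Σ[ c ∈ ℚ ] 0ℚ ℚ.< c × c ℚ.* ι (2 ^ 10) ≡ 1ℚ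
  1/2¹⁰ = reciprocal (ι (2 ^ 10)) (ℚ.positive⁻¹ (ι (2 ^ 10)) {{ι-pos (2 ^ 10)}})
  c : ℚ
  c = proj₁ 1/2¹⁰
  0<c : 0ℚ ℚ.< c
  0<c = proj₁ (proj₂ 1/2¹⁰)
  approximate : ∀ (m n : ℕ) .{{_ : NonZero m}} .{{_ : NonZero n}} (K : ℝ⁺) (f : Vec 𝔽₂ m → Vec 𝔽₂ n) →
    1/ʳ K ≤ʳ ℙ[ vectors m ⊗ vectors m ] (λ (x , y) → f (x +ᵛ y) ≟ᵛ f x +ᵛ f y) →
    ∃[ g ] IsGroupHomomorphism (AbelianGroup.rawGroup (𝔽₂^ m)) (AbelianGroup.rawGroup (𝔽₂^ n)) g
      × rational c 0<c *ʳ 1/ʳ (K ^ʳ exponent loss) ≤ʳ ℙ[ vectors m ] (λ x → f x ≟ᵛ g x)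
  approximate (suc m) n K f K⁻¹≤δ = conclude (homomorphic-approximation-counts f (numerator≢0 K {P} {M} {{SampleSpace.size≢0 XX}} K⁻¹≤δ))
    where
    X  = vectors (suc m)
    XX = vectors (suc m) ⊗ vectors (suc m)
    homomorphic? : ∀ ((x , y) : Vec 𝔽₂ (suc m) × Vec 𝔽₂ (suc m)) → Dec (f (x +ᵛ y) ≡ f x +ᵛ f y)
    homomorphic? (x , y) = f (x +ᵛ y) ≟ᵛ f x +ᵛ f y
    P M N : ℕ
    P = length (filter homomorphic? (SampleSpace.elements XX))
    M = SampleSpace.size XX
    N = SampleSpace.size X
    agreeing : (Vec 𝔽₂ (suc m) → Vec 𝔽₂ n) → ℕ
    agreeing g = length (filter (λ x → f x ≟ᵛ g x) (SampleSpace.elements X))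
    0<δ : 0ℚ ℚ.< ℙ[ XX ] homomorphic?
    0<δ = ℚ.<-trans (positive (1/ʳ K) (proj₂ (nonempty (1/ʳ K)))) (K⁻¹≤δ (proj₂ (nonempty (1/ʳ K))))
    conclude : Σ[ g ∈ (Vec 𝔽₂ (suc m) → Vec 𝔽₂ n) ] Additive g × N * P ^ suc loss ≤ agreeing g * (2 ^ 10 * M ^ suc loss) →
               ∃[ g ] IsGroupHomomorphism (AbelianGroup.rawGroup (𝔽₂^ (suc m))) (AbelianGroup.rawGroup (𝔽₂^ n)) g
                 × rational c 0<c *ʳ 1/ʳ (K ^ʳ exponent loss) ≤ʳ ℙ[ X ] (λ x → f x ≟ᵛ g x)
    conclude (g , add , bound) = g
      , record
        { isMonoidHomomorphism = record
          { isMagmaHomomorphism = record { isRelHomomorphism = record { cong = cong g } ; homo = add }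
          ; ε-homo = additive-𝟎 add
          }
        ; ⁻¹-homo = λ _ → refl
        }
      , constant-times-power-≤ loss 0<c K 0<δ (fraction-≤-1 {{SampleSpace.size≢0 XX}} (length-filter homomorphic? (SampleSpace.elements XX))) K⁻¹≤δ
          (fraction-power-≤ (suc loss) {2 ^ 10} {P} {M} {agreeing g} {N} {{_}} {{SampleSpace.size≢0 XX}} {{SampleSpace.size≢0 X}} (proj₂ (proj₂ 1/2¹⁰)) bound)
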